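{- For $g\ge 0$ and $n\ge 0$ let $\tilde c_{g,n}$ be the number of rooted maps of genus $g$ with $n$ edges (with $\tilde c_{0,0}=1$ accounting for the one-vertex map with no edges), and let $\tilde C_g(s)=\sum_{n\ge 2g}\tilde c_{g,n}s^n$. Substitute $s=t(1-3t)$, so that $\tilde C_g(t(1-3t))$ is a formal power series in $t$. Then, as formal power series in $t$ (equivalently, as expansions of rational functions at $t=0$), $$\tilde C_0(t(1-3t))=\frac{1-4t}{(1-3t)^2},\qquad \tilde C_1(t(1-3t))=\frac{t^2}{(1-2t)(1-6t)^2},$$ and for every $g\ge 2$ $$\tilde C_g(t(1-3t))=\frac{\tilde P_g(t)}{(1-2t)^{3g-2}(1-6t)^{5g-3}},$$ where $\tilde P_g(t)=\sum_{i=2g}^{8g-6}\tilde p_{g,i}t^i$ is a polynomial with $\tilde p_{g,2g}=\frac{(4g-1)!!}{2g+1}$. Moreover, the $\tilde C_g$ (hence the $\tilde P_g$) can be computed recursively: writing $\tilde C_i$ for $\tilde C_i(t(1-3t))$ and $\dot{\tilde C}_i=\frac{d}{dt}\tilde C_i(t(1-3t))$, for every $g\ge 1$ $$\tilde C_g(t(1-3t))=\frac{1-3t}{t(1-2t)}\int_0^t \tau^2\Big(\tilde D_\tau\tilde C_{g-1}+3\sum_{i=1}^{g-1}\Big(\tilde C_i+\frac{2\tau(1-3\tau)}{1-6\tau}\dot{\tilde C}_i\Big)\Big(\tilde C_{g-i}+\frac{2\tau(1-3\tau)}{1-6\tau}\dot{\tilde C}_{g-i}\Big)\Big)\,d\tau,$$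 where $$\tilde D_t=\frac{4t^3(1-3t)^3}{(1-6t)^3}\frac{d^3}{dt^3}+\frac{24t^2(1-3t)^2(1-9t+27t^2)}{(1-6t)^4}\frac{d^2}{dt^2}+\frac{9t(1-3t)(3-56t+456t^2-1728t^3+2592t^4)}{(1-6t)^5}\frac{d}{dt}+3.$$
   Context: A map is a finite connected graph with a prescribed cyclic order of half-edges at each vertex, equivalently the 1-skeleton of a polygonal decomposition of a closed orientable surface; its genus $g$ satisfies $2-2g=\#\text{vertices}-\#\text{edges}+\#\text{faces}$. A rooted map is a map with a distinguished half-edge, counted up to root-preserving isomorphism. Equivalently, for $n\ge1$, $\tilde c_{g,n}=\frac{1}{(2n-1)!}\#\{(\sigma,\alpha)\in S_{2n}\times S_{2n}:\ \alpha \text{ a fixed-point-free involution},\ \langle\sigma,\alpha\rangle\text{ transitive},\ z(\sigma)-n+z(\sigma\alpha)=2-2g\}$, where $z(\cdot)$ denotes the number of cycles. $(4g-1)!!=1\cdot3\cdot5\cdots(4g-1)$. The integral $\int_0^t$ denotes the formal antiderivative vanishing at $t=0$. -}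

module Defs where

open import Data.Bool using (Bool; true; false; _∧_; _∨_; not; if_then_else_)
open import Data.Nat as ℕ using (ℕ; zero; suc; _≡ᵇ_; _≤ᵇ_; _!)
open import Data.Nat.Properties using (_!≢0)
open import Data.Bool.ListAction using (all; any)
open import Data.Fin using (Fin; toℕ)
open import Data.Vec using (Vec; []; _∷_; lookup)
open import Data.List as List using (List; []; _∷_; length; filterᵇ; allFin; cartesianProduct; concatMap)
open import Data.Product using (_×_; _,_)
open import Data.Integer as ℤ using (ℤ; +_)
open import Data.Rational as ℚ using (ℚ; 0ℚ; 1ℚ; _/_)
open import Relation.Binary.PropositionalEquality using (_≡_)

allᶠ : ∀ {m} → (Fin m → Bool) → Bool
allᶠ {m} p = all p (allFin m)

anyᶠ : ∀ {m} → (Fin m → Bool) → Bool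
anyᶠ {m} p = any p (allFin m)

_==ᶠ_ : ∀ {m} → Fin m → Fin m → Bool
i ==ᶠ j = toℕ i ≡ᵇ toℕ j

allVecs : (k m : ℕ) → List (Vec (Fin m) k)
allVecs zero    m = [] ∷ []
allVecs (suc k) m = concatMap (λ i → List.map (i ∷_) (allVecs k m)) (allFin m)

Fn : ℕ → Set
Fn m = Fin m → Fin m

isPerm : ∀ {m} → Fn m → Bool
isPerm f = allᶠ (λ i → allᶠ (λ j → (i ==ᶠ j) ∨ not (f i ==ᶠ f j)))

isFPFInvolution : ∀ {m} → Fn m → Bool
isFPFInvolution a = allᶠ (λ i → (a (a i) ==ᶠ i) ∧ not (a i ==ᶠ i))

perms : (m : ℕ) → List (Fn m)
perms m = filterᵇ isPerm (List.map lookup (allVecs m m))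

iter : ∀ {m} → Fn m → ℕ → Fn m
iter f zero    i = i
iter f (suc k) i = f (iter f k i)

-- number of cycles z(σ) of a permutation σ of Fin m:
-- each cycle is counted once, through its least element.
z : ∀ {m} → Fn m → ℕ
z {m} σ = length (filterᵇ isCycleMin (allFin m))
  where
  isCycleMin : Fin m → Bool
  isCycleMin i = all (λ k → toℕ i ≤ᵇ toℕ (iter σ k i)) (List.upTo m)

reach : ∀ {m} → Fn m → Fn m → ℕ → Fin m → Fin m → Bool
reach σ α zero    i j = i ==ᶠ j
reach σ α (suc k) i j =
  reach σ α k i j ∨ anyᶠ (λ l → reach σ α k i l ∧ ((σ l ==ᶠ j) ∨ (α l ==ᶠ j)))

-- ⟨σ,α⟩ acts transitively on Fin m
-- (orbits of a finite permutation group = forward-reachability classes;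
--  paths of length < m suffice)
transitive : ∀ {m} → Fn m → Fn m → Bool
transitive {m} σ α = allᶠ (λ i → allᶠ (λ j → reach σ α m i j))

-- the number of pairs (σ,α) ∈ S_{2n} × S_{2n}, α a fixed-point-free involution,
-- ⟨σ,α⟩ transitive, z(σ) - n + z(σα) = 2 - 2g  (written additively in ℕ)
mapCount : ℕ → ℕ → ℕ
mapCount g n = length (filterᵇ ok (cartesianProduct (perms (2 ℕ.* n)) (filterᵇ isFPFInvolution (perms (2 ℕ.* n)))))
  where
  ok : Fn (2 ℕ.* n) × Fn (2 ℕ.* n) → Bool
  ok (σ , α) = transitive σ α ∧ ((z σ ℕ.+ z (λ i → σ (α i)) ℕ.+ 2 ℕ.* g) ≡ᵇ (n ℕ.+ 2))

-- c̃_{g,n}: number of rooted maps of genus g with n edges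
-- (n ≥ 1: the permutation count divided by (2n-1)!;  c̃_{0,0} = 1, c̃_{g,0} = 0 for g ≥ 1)
c̃ : ℕ → ℕ → ℚ
c̃ zero    zero    = 1ℚ
c̃ (suc g) zero    = 0ℚ
c̃ g       (suc n) = (+ mapCount g (suc n) / (suc (2 ℕ.* n)) !) {{suc (2 ℕ.* n) !≢0}}

PS : Set
PS = ℕ → ℚ

_≋_ : PS → PS → Set
f ≋ g = ∀ n → f n ≡ g n
infix 4 _≋_

sumBelow : (ℕ → ℚ) → ℕ → ℚ
sumBelow a zero    = 0ℚ
sumBelow a (suc n) = sumBelow a n ℚ.+ a n

poly : List ℤ → PS
poly []       n       = 0ℚ
poly (a ∷ as) zero    = a / 1
poly (a ∷ as) (suc n) = poly as n

const : ℚ → PS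
const c zero    = c
const c (suc n) = 0ℚ

_⊕_ : PS → PS → PS
(f ⊕ g) n = f n ℚ.+ g n
infixl 6 _⊕_

_⊛_ : PS → PS → PS
(f ⊛ g) n = sumBelow (λ k → f k ℚ.* g (n ℕ.∸ k)) (suc n)
infixl 7 _⊛_

_·_ : ℚ → PS → PS
(c · f) n = c ℚ.* f n
infixr 8 _·_

pow : PS → ℕ → PS
pow f zero    = const 1ℚ
pow f (suc k) = f ⊛ pow f k

-- composition f(h(t)) for h with zero constant term
comp : PS → PS → PS
comp f h m = sumBelow (λ n → f n ℚ.* pow h n m) (suc m)

deriv : PS → PS
deriv f n = (+ suc n / 1) ℚ.* f (suc n)

integ : PS → PS
integ f zero    = 0ℚ
integ f (suc n) = f n ℚ.* (+ 1 / suc n)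

-- division by t, for a series with zero constant term
divT : PS → PS
divT f n = f (suc n)

-- expansion at t = 0 of the rational function 1/(1 - a t): Σ aⁿ tⁿ
geom : ℕ → PS
geom a n = + (a ℕ.^ n) / 1

C̃ : ℕ → PS
C̃ g = c̃ g

Ct : ℕ → PS
Ct g = comp (C̃ g) (poly (+ 0 ∷ + 1 ∷ ℤ.- + 3 ∷ []))

D̃ : PS → PS
D̃ f =
    (poly (+ 0 ∷ + 0 ∷ + 0 ∷ + 4 ∷ []) ⊛ pow (poly (+ 1 ∷ ℤ.- + 3 ∷ [])) 3 ⊛ pow (geom 6) 3
       ⊛ deriv (deriv (deriv f)))
  ⊕ (poly (+ 0 ∷ + 0 ∷ + 24 ∷ []) ⊛ pow (poly (+ 1 ∷ ℤ.- + 3 ∷ [])) 2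
       ⊛ poly (+ 1 ∷ ℤ.- + 9 ∷ + 27 ∷ []) ⊛ pow (geom 6) 4
       ⊛ deriv (deriv f))
  ⊕ (poly (+ 0 ∷ + 9 ∷ []) ⊛ poly (+ 1 ∷ ℤ.- + 3 ∷ [])
       ⊛ poly (+ 3 ∷ ℤ.- + 56 ∷ + 456 ∷ ℤ.- + 1728 ∷ + 2592 ∷ []) ⊛ pow (geom 6) 5
       ⊛ deriv f)
  ⊕ ((+ 3 / 1) · f)

Ã : ℕ → PS
Ã i = Ct i ⊕ (poly (+ 0 ∷ + 2 ∷ ℤ.- + 6 ∷ []) ⊛ geom 6 ⊛ deriv (Ct i))

quadSum : ℕ → ℕ → PS
quadSum g zero    = const 0ℚ
quadSum g (suc k) = quadSum g k ⊕ (Ã (suc k) ⊛ Ã (g ℕ.∸ suc k))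

recursionRHS : ℕ → PS
recursionRHS g =
  poly (+ 1 ∷ ℤ.- + 3 ∷ []) ⊛ geom 2 ⊛
    divT (integ (poly (+ 0 ∷ + 0 ∷ + 1 ∷ []) ⊛
                 (D̃ (Ct (g ℕ.∸ 1)) ⊕ ((+ 3 / 1) · quadSum g (g ℕ.∸ 1)))))

_!! : ℕ → ℕ
zero !!          = 1
suc zero !!      = 1
suc (suc n) !!   = suc (suc n) ℕ.* n !!

{-# OPTIONS --safe #-}
module Submission where

-- Colour the cycles of σ and of σα with N colours, so that a map with v vertices and f faces has weight N^(v+f).
-- Summing over σ first turns the weighted count over all pairs (σ, α) into a functional E of power sums of shift
-- operators, by a recursion on α in which a transposition cuts or joins cycles.  E is, up to a constant, an alternating
-- sum, and hence a determinant of moments, so Plücker's relation yields the KP equation for the generating series;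
-- the evident linear relations between the moments reduce it to an ordinary differential equation, and taking the
-- logarithm (connected maps) gives, with u_n = (2n+1) G_n and w_n = (2n+3)(2n+2) u_n, the recursion
--   2 (n+3) G_{n+2} = w_n + 6 Σ u_i u_{n-i} + 8 N u_{n+1}.
-- It holds for all N ≥ 4, hence for polynomials in N, and Euler's formula turns it into a recursion for the numbers
-- of maps of given genus.  As an equation E = 0 for the series in s and a genus variable h it has the first integral
--   J = (U+G)² - 4 U (1+sU)² - h s² V²,  2 J + ϑJ = -2 V E,  ϑ = 2s d/ds,  U = G + ϑG,  V = 2U + ϑU.
-- After s = t(1-3t), J = 0 gives genus 0 in closed form and expresses every further genus algebraically through the
-- previous ones, from which the shape of the rational functions is read off; E = 0 is the recursion with the integral.

import Defs
open import Level using (0ℓ)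
open import Algebra using (CommutativeRing; IsCommutativeRing; RawRing)
open import Data.Bool as Bool using (Bool; true; false; T; if_then_else_; _∧_; _∨_; not)
import Data.Bool.Properties as Boolₚ
open import Data.Bool.ListAction using (all; any)
open import Data.Empty using (⊥; ⊥-elim)
open import Data.Fin as Fin using (Fin; zero; suc; toℕ; inject₁; fromℕ; fromℕ<; opposite; punchOut)
import Data.Fin.Properties as FP
open import Data.Integer as ℤ using (ℤ; +_; -[1+_])
import Data.Integer.Properties as ℤₚ
open import Data.List as List using (List; []; _∷_; _++_; map; concatMap; length; replicate; cartesianProduct; filterᵇ; allFin; upTo)
open import Data.List.Membership.Propositional using (_∈_)
open import Data.List.Membership.Propositional.Properties
  using (∈-allFin; ∈-upTo⁺; ∈-upTo⁻; ∈-cartesianProduct⁺; ∈-map⁺; ∈-map⁻; ∈-++⁺ˡ; ∈-++⁺ʳ; ∈-∃++)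
open import Data.List.Properties using (++-assoc; ++-identityʳ; map-tabulate; map-∘; map-id)
open import Data.List.Relation.Binary.Pointwise as Pw using (Pointwise; []; _∷_)
open import Data.List.Relation.Unary.All as All using (All; []; _∷_)
import Data.List.Relation.Unary.All.Properties as Allₚ
open import Data.List.Relation.Unary.AllPairs using ([]; _∷_)
open import Data.List.Relation.Unary.Any as Any using (Any; here; there)
import Data.List.Relation.Unary.Any.Properties as Anyₚ
open import Data.List.Relation.Unary.Unique.Propositional using (Unique)
import Data.List.Relation.Unary.Unique.Propositional.Properties as Uniqueₚ
open import Data.Maybe using (Maybe; just; nothing)
open import Data.Nat as N using (ℕ; zero; suc; z≤n; s≤s; _!; _≡ᵇ_; _≤ᵇ_; NonZero)
import Data.Nat.Properties as NP
open import Data.Nat.DivMod using (_%_; m≡m%n+[m/n]*n; m%n<n)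
open import Data.Nat.Induction using (<-rec; <-wellFounded)
open import Data.Nat.ListAction using () renaming (sum to sumL)
open import Data.Nat.Solver using () renaming (module +-*-Solver to ℕ-Solver)
open import Data.Product using (_×_; _,_; proj₁; proj₂; Σ; ∃)
import Data.Product.Properties as Productₚ
open import Data.Rational as ℚ using (ℚ; 0ℚ; 1ℚ; _/_; toℚᵘ)
import Data.Rational.Properties as ℚₚ
open import Data.Rational.Unnormalised as ℚᵘ using (mkℚᵘ; *≡*)
import Data.Rational.Unnormalised.Properties as ℚᵘₚ
open import Data.Sum as Sum using (_⊎_; inj₁; inj₂)
open import Data.Unit using (tt)
open import Data.Vec as Vec using (Vec; []; _∷_; lookup; toList; tabulate; _[_]≔_)
import Data.Vec.Properties as Vecₚ
open import Data.Vec.Properties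
  using (lookup-map; lookup∘update; lookup∘update′; lookup∘tabulate; tabulate∘lookup; tabulate-cong; []≔-idempotent; []≔-lookup)
open import Function using (_∘_; id; flip; Equivalence)
open import Induction.WellFounded using (Acc; acc)
open import Relation.Binary using (IsEquivalence)
open import Relation.Binary.Definitions using (DecidableEquality)
open import Relation.Binary.PropositionalEquality as E using (_≡_; _≢_; cong; cong₂; subst)
open import Relation.Nullary using (¬_; Dec; yes; no; does; ¬?)
open import Relation.Nullary.Decidable using (_×-dec_; _⊎-dec_; _→-dec_; T?; dec-yes; dec-no)

-- The functional behind `E` is the expectation over square complex Wishart matrices W = A A*: the
-- sum over σ of N^(z(σ)+z(σπ)) is the expected product of tr W^k over the cycle lengths k of π. It
-- is handled through the eigenvalue density ∏ (x_i - x_j)² e^(-Σ x_i), whose moments are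
-- factorials, so integration by parts is pure algebra of shift operators. The KP relation involves
-- the four top rows of the moment determinant, whence N ≥ 4. That vertices plus faces agree with
-- the edges modulo 2 and exceed them by at most 2, and that genus g needs 2g edges, is read off
-- from the recursion rather than from topology. In genus 0 the equations J = 0 and E = 0 give U =
-- b² with b = 1 + 3 s b²; the substitution s = t(1-3t) is the one that makes b = 1/(1-3t). They
-- also say that J is stationary in U at genus 0: the part of J linear in the higher-genus U drops
-- out, and so each genus follows algebraically from the previous ones. The exact degrees of the
-- numerators rest on the behaviour at t = ∞, where each of the operators 1 + ϑ and 2 + ϑ cancels a
-- leading term.

infixr 5 _∙_
_∙_ : ∀ {A : Set} {x y z : A} → x ≡ y → y ≡ z → x ≡ z
_∙_ = E.trans

-- Finite enumerations without repetition

record Enum (A : Set) : Set where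
  field
    elems : List A
    unique : Unique elems
    complete : ∀ a → a ∈ elems
    _≟_ : DecidableEquality A
open Enum using (elems)

fins : ∀ n → List (Fin n)
fins zero = []
fins (suc n) = zero ∷ map suc (fins n)

vecs : ∀ {A : Set} → List A → ∀ k → List (Vec A k)
vecs xs zero = [] ∷ []
vecs xs (suc k) = concatMap (λ i → map (i ∷_) (vecs xs k)) xs

finE : ∀ n → Enum (Fin n)
finE n = record { elems = fins n ; unique = uniq n ; complete = comp n ; _≟_ = FP._≟_ }
  where
  comp : ∀ n (a : Fin n) → a ∈ fins n
  comp (suc n) zero = here E.refl
  comp (suc n) (suc a) = there (∈-map⁺ suc (comp n a))
  uniq : ∀ n → Unique (fins n)
  uniq zero = []
  uniq (suc n) = All.tabulate (λ {x} x∈ z≡x → zero∉ x∈ z≡x) ∷ Uniqueₚ.map⁺ FP.suc-injective (uniq n)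
    where
    zero∉ : ∀ {x} → x ∈ map suc (fins n) → zero ≢ x
    zero∉ x∈ z≡x with ∈-map⁻ suc x∈
    zero∉ x∈ () | _ , _ , E.refl

vecE : ∀ {A} → Enum A → ∀ k → Enum (Vec A k)
vecE {A} E k = record { elems = vecs (elems E) k ; unique = uniq k ; complete = comp ; _≟_ = Vecₚ.≡-dec (Enum._≟_ E) }
  where
  as-product : ∀ {B : Set} (xs : List A) (vs : List B) {C : Set} (f : A → B → C) → concatMap (λ i → map (f i) vs) xs ≡ List.cartesianProductWith f xs vs
  as-product [] vs f = E.refl
  as-product (x ∷ xs) vs f = cong (map (f x) vs ++_) (as-product xs vs f)
  uniq : ∀ k → Unique (vecs (elems E) k)
  uniq zero = [] ∷ []
  uniq (suc k) = subst Unique (E.sym (as-product (elems E) (vecs (elems E) k) _∷_)) (Uniqueₚ.cartesianProductWith⁺ _∷_ Vecₚ.∷-injective (Enum.unique E) (uniq k))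
  mem : ∀ {k} a (v : Vec A k) xs vs → a ∈ xs → v ∈ vs → (a ∷ v) ∈ concatMap (λ i → map (i ∷_) vs) xs
  mem a v (x ∷ xs) vs (here E.refl) q = ∈-++⁺ˡ (∈-map⁺ (a ∷_) q)
  mem a v (x ∷ xs) vs (there p) q = ∈-++⁺ʳ (map (x ∷_) vs) (mem a v xs vs p q)
  comp : ∀ {k} (v : Vec A k) → v ∈ vecs (elems E) k
  comp [] = here E.refl
  comp (a ∷ v) = mem a v (elems E) _ (Enum.complete E a) (comp v)

-- Commutative rings: numerals, an equation solver, finite sums, indicators

module Kit (R : CommutativeRing 0ℓ 0ℓ) where

  open CommutativeRing R public
    using (Carrier; _≈_; _+_; _*_; -_; _-_; 0#; 1#; refl; sym; trans; reflexive; setoid; ring; semiring; isEquivalence; +-cong; *-cong; -‿cong; +-comm; +-assoc; *-comm; *-assoc;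
           +-identityˡ; +-identityʳ; *-identityˡ; *-identityʳ; zeroˡ; zeroʳ; distribˡ; distribʳ; -‿inverseʳ; -‿inverseˡ;
           commutativeSemiring)
    renaming (+-congˡ to +ˡ; +-congʳ to +ʳ; *-congˡ to *ˡ; *-congʳ to *ʳ)
  open import Algebra.Properties.Ring ring public
    using (-‿distribˡ-*; -‿distribʳ-*; -‿involutive; -0#≈0#; -‿+-comm)
  open import Relation.Binary.Reasoning.Setoid setoid public

  infixr 5 _»_
  _»_ : ∀ {x y z} → x ≈ y → y ≈ z → x ≈ z
  _»_ = trans

  -- The separate clause for 1 makes `ι 1` the unit by computation, so that constants in solver
  -- goals match the unit of the ring as it stands.
  ι : ℕ → Carrier
  ι zero = 0#
  ι (suc zero) = 1#
  ι (suc (suc n)) = 1# + ι (suc n)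

  ι-suc : ∀ n → ι (suc n) ≈ 1# + ι n
  ι-suc zero = sym (+-identityʳ 1#)
  ι-suc (suc n) = refl

  ι-+ : ∀ m n → ι (m N.+ n) ≈ ι m + ι n
  ι-+ zero n = sym (+-identityˡ _)
  ι-+ (suc m) n = begin
    _ ≈⟨ ι-suc (m N.+ n) ⟩
    _ ≈⟨ +ˡ (ι-+ m n) ⟩
    _ ≈⟨ +-assoc _ _ _ ⟨
    _ ≈⟨ +ʳ (ι-suc m) ⟨
    _ ∎

  ι-* : ∀ m n → ι (m N.* n) ≈ ι m * ι n
  ι-* zero n = sym (zeroˡ _)
  ι-* (suc m) n = begin
    _ ≈⟨ ι-+ n (m N.* n) ⟩
    _ ≈⟨ +-cong (sym (*-identityˡ _)) (ι-* m n) ⟩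
    _ ≈⟨ distribʳ _ _ _ ⟨
    _ ≈⟨ *ʳ (ι-suc m) ⟨
    _ ∎

  private
    ⟦_⟧ℤ : ℤ → Carrier
    ⟦ + n ⟧ℤ = ι n
    ⟦ -[1+ n ] ⟧ℤ = - ι (suc n)

    ⊖-hom : ∀ m n → ⟦ m ℤ.⊖ n ⟧ℤ ≈ ι m - ι n
    ⊖-hom m zero = begin
      _ ≈⟨ +-identityʳ _ ⟨
      _ ≈⟨ +ˡ -0#≈0# ⟨
      _ ∎
    ⊖-hom zero (suc n) = sym (+-identityˡ _)
    ⊖-hom (suc m) (suc n) = begin
      _ ≈⟨ reflexive (cong ⟦_⟧ℤ (ℤₚ.[1+m]⊖[1+n]≡m⊖n m n)) ⟩
      _ ≈⟨ ⊖-hom m n ⟩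
      _ ≈⟨ +ʳ (+-identityʳ _) ⟨
      _ ≈⟨ +ʳ (+ˡ (-‿inverseʳ 1#)) ⟨
      _ ≈⟨ +ʳ (sym (+-assoc _ _ _) » +ʳ (+-comm _ _)) ⟩
      _ ≈⟨ +-assoc _ _ _ ⟩
      _ ≈⟨ +-cong (sym (ι-suc m)) (-‿+-comm _ _ » -‿cong (sym (ι-suc n))) ⟩
      _ ∎

    +-hom : ∀ i j → ⟦ i ℤ.+ j ⟧ℤ ≈ ⟦ i ⟧ℤ + ⟦ j ⟧ℤ
    +-hom (+ m) (+ n) = ι-+ m n
    +-hom (+ m) -[1+ n ] = ⊖-hom m (suc n)
    +-hom -[1+ m ] (+ n) = ⊖-hom n (suc m) » +-comm _ _
    +-hom -[1+ m ] -[1+ n ] = begin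
      _ ≈⟨ -‿cong (reflexive (cong ι (E.sym (NP.+-suc (suc m) n)))) ⟩
      _ ≈⟨ -‿cong (ι-+ (suc m) (suc n)) ⟩
      _ ≈⟨ -‿+-comm _ _ ⟨
      _ ∎

    -‿hom : ∀ i → ⟦ ℤ.- i ⟧ℤ ≈ - ⟦ i ⟧ℤ
    -‿hom (+ zero) = sym -0#≈0#
    -‿hom (+ suc n) = refl
    -‿hom -[1+ n ] = sym (-‿involutive _)

    *-hom⁺ : ∀ m j → ⟦ + m ℤ.* j ⟧ℤ ≈ ι m * ⟦ j ⟧ℤ
    *-hom⁺ m (+ n) = reflexive (cong ⟦_⟧ℤ (E.sym (ℤₚ.pos-* m n))) » ι-* m n
    *-hom⁺ m -[1+ n ] = begin
      _ ≈⟨ reflexive (cong ⟦_⟧ℤ (E.sym (ℤₚ.neg-distribʳ-* (+ m) (+ suc n)))) ⟩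
      _ ≈⟨ -‿hom (+ m ℤ.* + suc n) ⟩
      _ ≈⟨ -‿cong (*-hom⁺ m (+ suc n)) ⟩
      _ ≈⟨ -‿distribʳ-* _ _ ⟩
      _ ∎

    *-hom : ∀ i j → ⟦ i ℤ.* j ⟧ℤ ≈ ⟦ i ⟧ℤ * ⟦ j ⟧ℤ
    *-hom (+ m) j = *-hom⁺ m j
    *-hom -[1+ m ] j = begin
      _ ≈⟨ reflexive (cong ⟦_⟧ℤ (E.sym (ℤₚ.neg-distribˡ-* (+ suc m) j))) ⟩
      _ ≈⟨ -‿hom (+ suc m ℤ.* j) ⟩
      _ ≈⟨ -‿cong (*-hom⁺ (suc m) j) ⟩
      _ ≈⟨ -‿distribˡ-* _ _ ⟩
      _ ∎

    ℤ-raw : RawRing 0ℓ 0ℓ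
    ℤ-raw = record { Carrier = ℤ ; _≈_ = _≡_ ; _+_ = ℤ._+_ ; _*_ = ℤ._*_ ; -_ = ℤ.-_ ; 0# = + 0 ; 1# = + 1 }

  open import Algebra.Solver.Ring.AlmostCommutativeRing using (AlmostCommutativeRing; fromCommutativeRing; _-Raw-AlmostCommutative⟶_)

  private
    -- The solver needs coefficients with decidable equality, which the ring itself may lack;
    -- integers serve, mapped into the ring by `⟦_⟧ℤ`.
    morphism : ℤ-raw -Raw-AlmostCommutative⟶ fromCommutativeRing R
    morphism = record { ⟦_⟧ = ⟦_⟧ℤ ; +-homo = +-hom ; *-homo = *-hom ; -‿homo = -‿hom ; 0-homo = refl ; 1-homo = refl }

    coeff≟ : ∀ i j → Maybe (⟦ i ⟧ℤ ≈ ⟦ j ⟧ℤ)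
    coeff≟ i j with i ℤ.≟ j
    ... | yes i≡j = just (reflexive (cong ⟦_⟧ℤ i≡j))
    ... | no _ = nothing

  open import Algebra.Solver.Ring ℤ-raw (fromCommutativeRing R) morphism coeff≟ public
    using (solve; _:=_; _:+_; _:*_; _:-_; :-_; con; Polynomial)

  :1 :2 :3 :4 : ∀ {n} → Polynomial n
  :1 = con (+ 1)
  :2 = con (+ 2)
  :3 = con (+ 3)
  :4 = con (+ 4)

  +-zero : ∀ {x y} → x ≈ 0# → y ≈ 0# → x + y ≈ 0#
  +-zero p q = +-cong p q » +-identityʳ _

  *-zeroˡ : ∀ {x y} → x ≈ 0# → x * y ≈ 0#
  *-zeroˡ p = *ʳ p » zeroˡ _

  *-zeroʳ : ∀ {x y} → y ≈ 0# → x * y ≈ 0#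
  *-zeroʳ p = *ˡ p » zeroʳ _

  *-comm₃ : ∀ x y z → x * (y * z) ≈ y * (x * z)
  *-comm₃ = solve 3 (λ x y z → x :* (y :* z) := y :* (x :* z)) refl

  move : ∀ {x y z} → x + y ≈ z → x ≈ z - y
  move {x} {y} {z} p = solve 2 (λ x y → x := x :+ y :- y) refl x y » +ʳ p

  ≈-from-- : ∀ {x y} → x - y ≈ 0# → x ≈ y
  ≈-from-- {x} {y} p = solve 2 (λ x y → x := x :- y :+ y) refl x y » +ʳ p » +-identityˡ y

  -- Sums over lists.

  ∑ : ∀ {A : Set} → List A → (A → Carrier) → Carrier
  ∑ [] f = 0#
  ∑ (x ∷ xs) f = f x + ∑ xs f

  ∑-cong∈ : ∀ {A : Set} (xs : List A) {f g : A → Carrier} → (∀ a → a ∈ xs → f a ≈ g a) → ∑ xs f ≈ ∑ xs g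
  ∑-cong∈ [] p = refl
  ∑-cong∈ (x ∷ xs) p = +-cong (p x (here E.refl)) (∑-cong∈ xs (λ a → p a ∘ there))

  ∑-cong : ∀ {A : Set} (xs : List A) {f g : A → Carrier} → (∀ a → f a ≈ g a) → ∑ xs f ≈ ∑ xs g
  ∑-cong xs p = ∑-cong∈ xs (λ a _ → p a)

  ∑-0 : ∀ {A : Set} (xs : List A) {f : A → Carrier} → (∀ a → f a ≈ 0#) → ∑ xs f ≈ 0#
  ∑-0 [] p = refl
  ∑-0 (x ∷ xs) p = +-zero (p x) (∑-0 xs p)

  ∑-+ : ∀ {A : Set} (xs : List A) {f g : A → Carrier} → ∑ xs (λ a → f a + g a) ≈ ∑ xs f + ∑ xs g
  ∑-+ [] = sym (+-identityʳ _)
  ∑-+ (x ∷ xs) {f} {g} = +ˡ (∑-+ xs) » solve 4 (λ a b c d → a :+ b :+ (c :+ d) := a :+ c :+ (b :+ d)) refl (f x) (g x) (∑ xs f) (∑ xs g)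

  ∑-*ˡ : ∀ {A : Set} (xs : List A) c {f : A → Carrier} → ∑ xs (λ a → c * f a) ≈ c * ∑ xs f
  ∑-*ˡ [] c = sym (zeroʳ c)
  ∑-*ˡ (x ∷ xs) c = +ˡ (∑-*ˡ xs c) » sym (distribˡ _ _ _)

  ∑-*ʳ : ∀ {A : Set} (xs : List A) c {f : A → Carrier} → ∑ xs (λ a → f a * c) ≈ ∑ xs f * c
  ∑-*ʳ [] c = sym (zeroˡ c)
  ∑-*ʳ (x ∷ xs) c = +ˡ (∑-*ʳ xs c) » sym (distribʳ _ _ _)

  ∑-neg : ∀ {A : Set} (xs : List A) {f : A → Carrier} → ∑ xs (λ a → - f a) ≈ - ∑ xs f
  ∑-neg [] = sym -0#≈0#
  ∑-neg (x ∷ xs) = +ˡ (∑-neg xs) » -‿+-comm _ _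

  ∑-swap : ∀ {A B : Set} (xs : List A) (ys : List B) {f : A → B → Carrier} → ∑ xs (λ a → ∑ ys (f a)) ≈ ∑ ys (λ b → ∑ xs (λ a → f a b))
  ∑-swap [] ys = sym (∑-0 ys (λ _ → refl))
  ∑-swap (x ∷ xs) ys = +ˡ (∑-swap xs ys) » sym (∑-+ ys)

  ∑-++ : ∀ {A : Set} (xs ys : List A) {f : A → Carrier} → ∑ (xs ++ ys) f ≈ ∑ xs f + ∑ ys f
  ∑-++ [] ys = sym (+-identityˡ _)
  ∑-++ (x ∷ xs) ys = +ˡ (∑-++ xs ys) » sym (+-assoc _ _ _)

  ∑-map : ∀ {A B : Set} (h : A → B) (xs : List A) {f : B → Carrier} → ∑ (map h xs) f ≈ ∑ xs (f ∘ h)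
  ∑-map h [] = refl
  ∑-map h (x ∷ xs) = +ˡ (∑-map h xs)

  ∑-concatMap : ∀ {A B : Set} (h : A → List B) (xs : List A) {f : B → Carrier} → ∑ (concatMap h xs) f ≈ ∑ xs (λ a → ∑ (h a) f)
  ∑-concatMap h [] = refl
  ∑-concatMap h (x ∷ xs) = (∑-++ (h x) (concatMap h xs)) » +ˡ (∑-concatMap h xs)

  ∑-product : ∀ {A B : Set} (xs : List A) (ys : List B) {f : A × B → Carrier} → ∑ (List.cartesianProduct xs ys) f ≈ ∑ xs (λ a → ∑ ys (λ b → f (a , b)))
  ∑-product [] ys = refl
  ∑-product (x ∷ xs) ys = (∑-++ (map (x ,_) ys) _) » +-cong (∑-map (x ,_) ys) (∑-product xs ys)

  ∑-fins : ∀ {n} {f : Fin (suc n) → Carrier} → ∑ (fins (suc n)) f ≈ f zero + ∑ (fins n) (f ∘ suc)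
  ∑-fins {n} = +ˡ (∑-map suc (fins n))

  ∑-vecs : ∀ {A : Set} (xs : List A) k {f : Vec A (suc k) → Carrier} → ∑ (vecs xs (suc k)) f ≈ ∑ xs (λ a → ∑ (vecs xs k) (λ v → f (a ∷ v)))
  ∑-vecs xs k = ∑-concatMap _ xs » ∑-cong xs (λ a → ∑-map (a ∷_) (vecs xs k))

  ∑-const : ∀ {A : Set} (xs : List A) c → ∑ xs (λ _ → c) ≈ ι (length xs) * c
  ∑-const [] c = sym (zeroˡ c)
  ∑-const (x ∷ xs) c = begin
    _ ≈⟨ +-cong (sym (*-identityˡ c)) (∑-const xs c) ⟩
    _ ≈⟨ distribʳ _ _ _ ⟨
    _ ≈⟨ *ʳ (ι-suc (length xs)) ⟨
    _ ∎

  length-fins : ∀ n → length (fins n) ≡ n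
  length-fins zero = E.refl
  length-fins (suc n) = cong suc (length-map' (fins n) ∙ length-fins n)
    where
    length-map' : ∀ {n} (xs : List (Fin n)) → length (map Fin.suc xs) ≡ length xs
    length-map' [] = E.refl
    length-map' (x ∷ xs) = cong suc (length-map' xs)

  ∑-fins-const : ∀ n c → ∑ (fins n) (λ _ → c) ≈ ι n * c
  ∑-fins-const n c = ∑-const (fins n) c » *ʳ (reflexive (cong ι (length-fins n)))

  ∑-unique : ∀ {A : Set} {xs : List A} {f : A → Carrier} {b} → Unique xs → b ∈ xs → (∀ a → a ≢ b → f a ≈ 0#) → ∑ xs f ≈ f b
  ∑-unique {xs = x ∷ xs} {f} (x∉ ∷ u) (here E.refl) p = +ˡ (∑-cong∈ xs (λ a a∈ → p a (λ a≡x → All.lookup x∉ a∈ (E.sym a≡x))) » ∑-0 xs (λ _ → refl)) » +-identityʳ _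
  ∑-unique {xs = x ∷ xs} {f} (x∉ ∷ u) (there b∈) p = +-cong (p x (All.lookup x∉ b∈)) (∑-unique u b∈ p) » +-identityˡ _

  ∑-pick : ∀ {A : Set} (E : Enum A) {f : A → Carrier} b → (∀ a → a ≢ b → f a ≈ 0#) → ∑ (elems E) f ≈ f b
  ∑-pick E b = ∑-unique (Enum.unique E) (Enum.complete E b)

  [_] : ∀ {P : Set} → Dec P → Carrier
  [ d ] = if does d then 1# else 0#

  []-yes : ∀ {P : Set} (d : Dec P) → P → [ d ] ≈ 1#
  []-yes (yes _) p = refl
  []-yes (no ¬p) p = ⊥-elim (¬p p)

  []-no : ∀ {P : Set} (d : Dec P) → ¬ P → [ d ] ≈ 0#
  []-no (yes p) ¬p = ⊥-elim (¬p p)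
  []-no (no _) ¬p = refl

  []-⇔ : ∀ {P Q : Set} (d : Dec P) (e : Dec Q) → (P → Q) → (Q → P) → [ d ] ≈ [ e ]
  []-⇔ d (yes q) f g = []-yes d (g q)
  []-⇔ d (no ¬q) f g = []-no d (¬q ∘ f)

  []-× : ∀ {P Q : Set} (d : Dec P) (e : Dec Q) → [ d ×-dec e ] ≈ [ d ] * [ e ]
  []-× (yes p) (yes q) = sym (*-identityˡ _)
  []-× (yes p) (no ¬q) = sym (zeroʳ _)
  []-× (no ¬p) e = sym (zeroˡ _)

  []-*-cong : ∀ {P : Set} (d : Dec P) {x y} → (P → x ≈ y) → [ d ] * x ≈ [ d ] * y
  []-*-cong (yes p) f = *ˡ (f p)
  []-*-cong (no _) f = zeroˡ _ » sym (zeroˡ _)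

  []-yes* : ∀ {P : Set} (d : Dec P) {x} → P → [ d ] * x ≈ x
  []-yes* d p = *ʳ ([]-yes d p) » *-identityˡ _

  []-no* : ∀ {P : Set} (d : Dec P) {x} → ¬ P → [ d ] * x ≈ 0#
  []-no* d p = *-zeroˡ ([]-no d p)

  ∑-δ : ∀ {A : Set} (E : Enum A) {f : A → Carrier} b {P : A → Set} (P? : ∀ a → Dec (P a)) → P b → (∀ a → P a → a ≡ b) → ∑ (elems E) (λ a → [ P? a ] * f a) ≈ f b
  ∑-δ E {f} b P? Pb uniq = ∑-pick E b (λ a a≢b → []-no* (P? a) (a≢b ∘ uniq a)) » []-yes* (P? b) Pb

  -- Both sides equal the double sum over the graph b = `to` a. The two maps are inverse only
  -- between the subsets cut out by P and Q, so sums over subsets are compared without enumerating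
  -- subtypes.
  ∑-reindex : ∀ {A B : Set} (EA : Enum A) (EB : Enum B) {P : A → Set} {Q : B → Set} (P? : ∀ a → Dec (P a)) (Q? : ∀ b → Dec (Q b)) (to : A → B) (from : B → A) → (∀ a → P a → Q (to a)) → (∀ b → Q b → P (from b)) →
              (∀ a → P a → from (to a) ≡ a) → (∀ b → Q b → to (from b) ≡ b) →
              ∀ {F : A → Carrier} {G : B → Carrier} → (∀ b → Q b → F (from b) ≈ G b) →
              ∑ (elems EA) (λ a → [ P? a ] * F a) ≈ ∑ (elems EB) (λ b → [ Q? b ] * G b)
  ∑-reindex EA EB {P} {Q} P? Q? to from P→Q Q→P from-to to-from {F} {G} F≈G = begin
    _ ≈⟨ ∑-cong (elems EA) (λ a → sym (∑-δ EB (to a) (λ b → Enum._≟_ EB b (to a)) E.refl (λ _ → id))) ⟩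
    _ ≈⟨ ∑-swap (elems EA) (elems EB) ⟩
    _ ≈⟨ ∑-cong (elems EB) inner ⟩
    _ ∎
    where
    term : ∀ b a → ¬ (P a × b ≡ to a) → [ Enum._≟_ EB b (to a) ] * ([ P? a ] * F a) ≈ 0#
    term b a ¬p with Enum._≟_ EB b (to a)
    ... | yes e = *-zeroʳ ([]-no* (P? a) (λ p → ¬p (p , e)))
    ... | no _ = zeroˡ _
    inner : ∀ b → ∑ (elems EA) (λ a → [ Enum._≟_ EB b (to a) ] * ([ P? a ] * F a)) ≈ [ Q? b ] * G b
    inner b with Q? b
    ... | yes q = begin
      _ ≈⟨ ∑-pick EA (from b) (λ a a≢ → term b a (λ { (p , e) → a≢ (E.sym (from-to a p) ∙ cong from (E.sym e)) })) ⟩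
      _ ≈⟨ []-yes* (Enum._≟_ EB b (to (from b))) (E.sym (to-from b q)) ⟩
      _ ≈⟨ []-yes* (P? (from b)) (Q→P b q) ⟩
      _ ≈⟨ F≈G b q ⟩
      _ ≈⟨ *-identityˡ _ ⟨
      _ ∎
    ... | no ¬q = ∑-0 (elems EA) (λ a → term b a (λ { (p , E.refl) → ¬q (P→Q a p) })) » sym (zeroˡ _)

-- Formal power series

module Series (R : CommutativeRing 0ℓ 0ℓ) where

  open Kit R

  Ser : Set
  Ser = ℕ → Carrier

  infix 4 _≋_
  -- A record and not a bare family of equations, so that the two series can be inferred from a
  -- proof.
  record _≋_ (f g : Ser) : Set where
    constructor mk
    field at : ∀ n → f n ≈ g n
  open _≋_ public

  infixl 6 _⊕_
  infixl 7 _⊛_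

  -- The product peels the first factor from degree 0 upwards; the ring laws then follow by
  -- induction on the degree, with that factor shifted.
  _⊕_ _⊛_ : Ser → Ser → Ser
  (f ⊕ g) n = f n + g n
  (f ⊛ g) zero = f 0 * g 0
  (f ⊛ g) (suc n) = f 0 * g (suc n) + (f ∘ suc ⊛ g) n

  ⊖_ : Ser → Ser
  (⊖ f) n = - f n

  𝟎 𝟏 X : Ser
  𝟎 n = 0#
  𝟏 zero = 1#
  𝟏 (suc n) = 0#
  X zero = 0#
  X (suc n) = 𝟏 n

  infixr 8 _·_
  _·_ : Carrier → Ser → Ser
  (c · f) n = c * f n

  shift : Ser → Ser
  shift f n = f (suc n)

  C : Carrier → Ser
  C c zero = c
  C c (suc n) = 0#

  ⊛-at : ∀ n {f f' g g'} → (∀ k → f k ≈ f' k) → (∀ k → g k ≈ g' k) → (f ⊛ g) n ≈ (f' ⊛ g') n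
  ⊛-at zero p q = *-cong (p 0) (q 0)
  ⊛-at (suc n) p q = +-cong (*-cong (p 0) (q (suc n))) (⊛-at n (p ∘ suc) q)

  ⊛-zeroˡ : ∀ n {f g} → (∀ k → f k ≈ 0#) → (f ⊛ g) n ≈ 0#
  ⊛-zeroˡ zero p = *-zeroˡ (p 0)
  ⊛-zeroˡ (suc n) p = +-zero (*-zeroˡ (p 0)) (⊛-zeroˡ n (p ∘ suc))

  ⊛-·ˡ : ∀ n c f g → (c · f ⊛ g) n ≈ c * (f ⊛ g) n
  ⊛-·ˡ zero c f g = *-assoc _ _ _
  ⊛-·ˡ (suc n) c f g = +-cong (*-assoc _ _ _) (⊛-·ˡ n c (shift f) g) » sym (distribˡ _ _ _)

  ⊛-distribʳ : ∀ n f g h → ((f ⊕ g) ⊛ h) n ≈ (f ⊛ h) n + (g ⊛ h) n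
  ⊛-distribʳ zero f g h = distribʳ _ _ _
  ⊛-distribʳ (suc n) f g h = +-cong (distribʳ _ _ _) (⊛-distribʳ n (shift f) (shift g) h) » solve 4 (λ a b c d → a :+ b :+ (c :+ d) := a :+ c :+ (b :+ d)) refl _ _ _ _

  ⊛-sucʳ : ∀ n f g → (f ⊛ g) (suc n) ≈ f (suc n) * g 0 + (f ⊛ shift g) n
  ⊛-sucʳ zero f g = +-comm _ _
  ⊛-sucʳ (suc n) f g = +ˡ (⊛-sucʳ n (shift f) g) » solve 3 (λ a b c → a :+ (b :+ c) := b :+ (a :+ c)) refl _ _ _

  ⊛-comm : ∀ n f g → (f ⊛ g) n ≈ (g ⊛ f) n
  ⊛-comm zero f g = *-comm _ _
  ⊛-comm (suc n) f g = ⊛-sucʳ n f g » +-cong (*-comm _ _) (⊛-comm n f (shift g))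

  ⊛-assoc : ∀ n f g h → ((f ⊛ g) ⊛ h) n ≈ (f ⊛ (g ⊛ h)) n
  ⊛-assoc zero f g h = *-assoc _ _ _
  ⊛-assoc (suc n) f g h = begin
    _ ≈⟨ +ˡ (⊛-distribʳ n (f 0 · shift g) (shift f ⊛ g) h) ⟩
    _ ≈⟨ +ˡ (+-cong (⊛-·ˡ n (f 0) (shift g) h) (⊛-assoc n (shift f) g h)) ⟩
    _ ≈⟨ solve 5 (λ a b c d e → a :* b :* c :+ (a :* d :+ e) := a :* (b :* c :+ d) :+ e) refl _ _ _ _ _ ⟩
    _ ∎

  ⊛-identityˡ : ∀ n f → (𝟏 ⊛ f) n ≈ f n
  ⊛-identityˡ zero f = *-identityˡ _
  ⊛-identityˡ (suc n) f = +-cong (*-identityˡ _) (⊛-zeroˡ n (λ _ → refl)) » +-identityʳ _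

  ≋-isEquivalence : IsEquivalence _≋_
  ≋-isEquivalence = record
    { refl = mk (λ n → refl) ; sym = λ p → mk (λ n → sym (at p n)) ; trans = λ p q → mk (λ n → at p n » at q n) }

  isCommutativeRing : IsCommutativeRing _≋_ _⊕_ _⊛_ ⊖_ 𝟎 𝟏
  isCommutativeRing = record
    { isRing = record
      { +-isAbelianGroup = record
        { isGroup = record
          { isMonoid = record
            { isSemigroup = record
              { isMagma = record { isEquivalence = ≋-isEquivalence ; ∙-cong = λ p q → mk (λ n → +-cong (at p n) (at q n)) }
              ; assoc = λ f g h → mk (λ n → +-assoc _ _ _) }
            ; identity = (λ f → mk (λ n → +-identityˡ _)) , (λ f → mk (λ n → +-identityʳ _)) }
          ; inverse = (λ f → mk (λ n → -‿inverseˡ _)) , (λ f → mk (λ n → -‿inverseʳ _))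
          ; ⁻¹-cong = λ p → mk (λ n → -‿cong (at p n)) }
        ; comm = λ f g → mk (λ n → +-comm _ _) }
      ; *-cong = λ p q → mk (λ n → ⊛-at n (at p) (at q))
      ; *-assoc = λ f g h → mk (λ n → ⊛-assoc n f g h)
      ; *-identity = (λ f → mk (λ n → ⊛-identityˡ n f)) , (λ f → mk (λ n → ⊛-comm n f 𝟏 » ⊛-identityˡ n f))
      ; distrib = (λ f g h → mk (λ n → ⊛-comm n f (g ⊕ h) » ⊛-distribʳ n g h f » +-cong (⊛-comm n g f) (⊛-comm n h f))) , (λ f g h → mk (λ n → ⊛-distribʳ n g h f)) }
    ; *-comm = λ f g → mk (λ n → ⊛-comm n f g) }

  seriesRing : CommutativeRing 0ℓ 0ℓ
  seriesRing = record { isCommutativeRing = isCommutativeRing }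

  X⊛-suc : ∀ f n → (X ⊛ f) (suc n) ≈ f n
  X⊛-suc f n = +-cong (zeroˡ _) (⊛-identityˡ n f) » +-identityˡ _

  X⊛-zero : ∀ f → (X ⊛ f) 0 ≈ 0#
  X⊛-zero f = zeroˡ _

  X-cancel : ∀ {f g} → X ⊛ f ≋ X ⊛ g → f ≋ g
  X-cancel {f} {g} p = mk (λ n → sym (X⊛-suc f n) » at p (suc n) » X⊛-suc g n)

  split-head : ∀ f → f ≋ C (f 0) ⊕ X ⊛ shift f
  split-head f = mk λ { zero → sym (+ˡ (X⊛-zero (shift f)) » +-identityʳ _) ; (suc n) → sym (+-identityˡ _ » X⊛-suc (shift f) n) }

  C⊛ : ∀ c f → C c ⊛ f ≋ c · f
  C⊛ c f = mk λ { zero → refl ; (suc n) → +ˡ (⊛-zeroˡ n (λ _ → refl)) » +-identityʳ _ }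

  shift-⊛ : ∀ f g → f 0 ≈ 0# → shift (f ⊛ g) ≋ shift f ⊛ g
  shift-⊛ f g p = mk (λ n → +ʳ (*-zeroˡ p) » +-identityˡ _)

  ιs : ℕ → Ser
  ιs = Kit.ι seriesRing

  ιs-C : ∀ n → ιs n ≋ C (ι n)
  ιs-C n = mk (go n)
    where
    go : ∀ n m → ιs n m ≈ C (ι n) m
    go zero zero = refl
    go zero (suc m) = refl
    go (suc zero) zero = refl
    go (suc zero) (suc m) = refl
    go (suc (suc n)) zero = +ˡ (go (suc n) zero)
    go (suc (suc n)) (suc m) = +-identityˡ _ » go (suc n) (suc m)

  ιs⊛ : ∀ n f → ιs n ⊛ f ≋ ι n · f
  ιs⊛ n f = mk (λ m → ⊛-at m (at (ιs-C n)) (λ _ → refl) » at (C⊛ (ι n) f) m)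

  θ d : Ser → Ser
  θ f n = ι n * f n
  d f n = ι (suc n) * f (suc n)

  X⊛d : ∀ f → X ⊛ d f ≋ θ f
  X⊛d f = mk λ { zero → trans (X⊛-zero (d f)) (sym (zeroˡ _)) ; (suc n) → X⊛-suc (d f) n }

  θ-cong : ∀ {f g} → f ≋ g → θ f ≋ θ g
  θ-cong p = mk (λ n → *ˡ (at p n))

  d-cong : ∀ {f g} → f ≋ g → d f ≋ d g
  d-cong p = mk (λ n → *ˡ (at p (suc n)))

  d-⊕ : ∀ f g → d (f ⊕ g) ≋ d f ⊕ d g
  d-⊕ f g = mk (λ n → distribˡ _ _ _)

  private
    θ-leibniz-at : ∀ n f g → θ (f ⊛ g) n ≈ (θ f ⊛ g) n + (f ⊛ θ g) n
    θ-leibniz-at zero f g = solve 2 (λ a b → con (Data.Integer.+ 0) :* (a :* b) := con (Data.Integer.+ 0) :* a :* b :+ a :* (con (Data.Integer.+ 0) :* b)) refl _ _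
      where import Data.Integer
    θ-leibniz-at (suc n) f g = begin
      _ ≈⟨ distribˡ _ _ _ ⟩
      _ ≈⟨ +ˡ (*ʳ (ι-suc n)) ⟩
      _ ≈⟨ solve 5 (λ a b c e h → a :* (b :* c) :+ (:1 :+ e) :* h := h :+ e :* h :+ b :* (a :* c)) refl _ _ _ _ _ ⟩
      _ ≈⟨ +ʳ (+ˡ (θ-leibniz-at n (shift f) g)) ⟩
      _ ≈⟨ solve 4 (λ a b c e → a :+ (b :+ c) :+ e := (a :+ b) :+ (e :+ c)) refl _ _ _ _ ⟩
      _ ≈⟨ +ʳ (⊛-distribʳ n (shift f) (θ (shift f)) g) ⟨
      _ ≈⟨ +ʳ (⊛-at n (λ k → solve 2 (λ a b → a :+ b :* a := (:1 :+ b) :* a) refl _ _ » *ʳ (sym (ι-suc k))) (λ _ → refl)) ⟩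
      _ ≈⟨ +ʳ (+ʳ (*-zeroˡ (zeroˡ _)) » +-identityˡ _) ⟨
      _ ∎

  θ-leibniz : ∀ f g → θ (f ⊛ g) ≋ θ f ⊛ g ⊕ f ⊛ θ g
  θ-leibniz f g = mk (λ n → θ-leibniz-at n f g)

  d-leibniz : ∀ f g → d (f ⊛ g) ≋ d f ⊛ g ⊕ f ⊛ d g
  d-leibniz f g = mk λ n → begin
    _ ≈⟨ θ-leibniz-at (suc n) f g ⟩
    _ ≈⟨ +-cong (+ʳ (*-zeroˡ (zeroˡ _)) » +-identityˡ _) (⊛-sucʳ n f (θ g) » +ʳ (*-zeroʳ (zeroˡ _)) » +-identityˡ _) ⟩
    _ ∎

  d-· : ∀ c f → d (c · f) ≋ c · d f
  d-· c f = mk (λ n → *-comm₃ _ _ _)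

  d-C : ∀ c → d (C c) ≋ 𝟎
  d-C c = mk (λ n → zeroʳ _)

  d-X : d X ≋ 𝟏
  d-X = mk λ { zero → *-identityˡ _ ; (suc n) → zeroʳ _ }

  Low : ℕ → Ser → Set
  Low n f = ∀ k → k N.< n → f k ≈ 0#

  ⊛-lowʳ : ∀ n f g → (∀ k → k N.≤ n → g k ≈ 0#) → (f ⊛ g) n ≈ 0#
  ⊛-lowʳ zero f g p = *-zeroʳ (p 0 z≤n)
  ⊛-lowʳ (suc n) f g p = +-zero (*-zeroʳ (p (suc n) NP.≤-refl)) (⊛-lowʳ n (shift f) g (λ k k≤n → p k (NP.m≤n⇒m≤1+n k≤n)))

  ⊛-lead : ∀ n f g → Low n g → (f ⊛ g) n ≈ f 0 * g n
  ⊛-lead zero f g p = refl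
  ⊛-lead (suc n) f g p = +ˡ (⊛-lowʳ n (shift f) g (λ k k≤n → p k (s≤s k≤n))) » +-identityʳ _

  Low-⊛ʳ : ∀ n f g → Low n g → Low n (f ⊛ g)
  Low-⊛ʳ n f g p k k<n = ⊛-lowʳ k f g (λ j j≤k → p j (NP.≤-<-trans j≤k k<n))

  all-low : ∀ {f} → (∀ n → Low n f → f n ≈ 0#) → f ≋ 𝟎
  all-low {f} step = mk (λ n → go (suc n) n NP.≤-refl)
    where
    go : ∀ n → Low n f
    go (suc n) k (s≤s k≤n) = step k (λ j j<k → go n j (NP.<-≤-trans j<k k≤n))

  -- While the lower coefficients of f vanish, the next coefficient of the product is a 0 times that
  -- of f; `all-low` turns this into an induction over all degrees.
  unit-cancel : ∀ {a f} → a 0 ≈ 1# → a ⊛ f ≋ 𝟎 → f ≋ 𝟎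
  unit-cancel {a} {f} a0 p = all-low (λ n low → begin
    _ ≈⟨ *-identityˡ _ ⟨
    _ ≈⟨ *ʳ a0 ⟨
    _ ≈⟨ ⊛-lead n a f low ⟨
    _ ≈⟨ at p n ⟩
    _ ∎)

  unit-cancel-regular : ∀ {a f} → (∀ {x} → a 0 * x ≈ 0# → x ≈ 0#) → a ⊛ f ≋ 𝟎 → f ≋ 𝟎
  unit-cancel-regular {a} {f} a0 p = all-low (λ n low → a0 (sym (⊛-lead n a f low) » at p n))

  module S = Kit seriesRing
  open S public using () renaming (_»_ to infixr 5 _⟫_)

-- Coefficientwise extension of derivations and homomorphisms.

module Lift (R R' : CommutativeRing 0ℓ 0ℓ) where

  private
    module A = Kit R
    module B = Kit R'
    module P = Series R
    module Q = Series R'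

  lift-hom : (φ : A.Carrier → B.Carrier) → (∀ {x y} → x A.≈ y → φ x B.≈ φ y) → (∀ x y → φ (x A.+ y) B.≈ φ x B.+ φ y) → (∀ x y → φ (x A.* y) B.≈ φ x B.* φ y) → ∀ n f g → φ ((f P.⊛ g) n) B.≈ ((φ ∘ f) Q.⊛ (φ ∘ g)) n
  lift-hom φ φ-cong φ-+ φ-* zero f g = φ-* _ _
  lift-hom φ φ-cong φ-+ φ-* (suc n) f g = B.trans (φ-+ _ _) (B.+-cong (φ-* _ _) (lift-hom φ φ-cong φ-+ φ-* n (f ∘ suc) g))

module LiftDerivation (R : CommutativeRing 0ℓ 0ℓ) where

  open Kit R
  open Series R

  lift-leibniz : (δ : Carrier → Carrier) → (∀ x y → δ (x + y) ≈ δ x + δ y) → (∀ x y → δ (x * y) ≈ δ x * y + x * δ y) → ∀ f g → δ ∘ (f ⊛ g) ≋ (δ ∘ f) ⊛ g ⊕ f ⊛ (δ ∘ g)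
  lift-leibniz δ δ-+ δ-* f g = mk (λ n → go n f g)
    where
    go : ∀ n f g → δ ((f ⊛ g) n) ≈ ((δ ∘ f) ⊛ g) n + (f ⊛ (δ ∘ g)) n
    go zero f g = δ-* _ _
    go (suc n) f g = begin
      _ ≈⟨ δ-+ _ _ ⟩
      _ ≈⟨ +-cong (δ-* _ _) (go n (shift f) g) ⟩
      _ ≈⟨ solve 4 (λ a b c e → a :+ b :+ (c :+ e) := a :+ c :+ (b :+ e)) refl _ _ _ _ ⟩
      _ ∎

-- Determinants by alternating expansion, Plücker's relation, Vandermonde

module Determinant (R : CommutativeRing 0ℓ 0ℓ) where

  open Kit R

  -- alt f [b₀,…,bₙ] = Σₖ (-1)ᵏ f bₖ [b₀,…,b̂ₖ,…,bₙ]
  alt : ∀ {B : Set} → (B → List B → Carrier) → List B → Carrier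
  alt f [] = 0#
  alt f (b ∷ bs) = f b bs - alt (λ c cs → f c (b ∷ cs)) bs

  alt-cong∈ : ∀ {B : Set} (bs : List B) {f g : B → List B → Carrier} → (∀ c cs → c ∈ bs → f c cs ≈ g c cs) → alt f bs ≈ alt g bs
  alt-cong∈ [] p = refl
  alt-cong∈ (b ∷ bs) p = +-cong (p b bs (here E.refl)) (-‿cong (alt-cong∈ bs (λ c cs c∈ → p c (b ∷ cs) (there c∈))))

  alt-cong : ∀ {B : Set} (bs : List B) {f g : B → List B → Carrier} → (∀ c cs → f c cs ≈ g c cs) → alt f bs ≈ alt g bs
  alt-cong bs p = alt-cong∈ bs (λ c cs _ → p c cs)

  alt-0 : ∀ {B : Set} (bs : List B) {f : B → List B → Carrier} → (∀ c cs → c ∈ bs → f c cs ≈ 0#) → alt f bs ≈ 0#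
  alt-0 [] p = refl
  alt-0 (b ∷ bs) p = +-zero (p b bs (here E.refl)) (-‿cong (alt-0 bs (λ c cs c∈ → p c (b ∷ cs) (there c∈))) » -0#≈0#)

  alt-+ : ∀ {B : Set} (bs : List B) {f g : B → List B → Carrier} → alt (λ c cs → f c cs + g c cs) bs ≈ alt f bs + alt g bs
  alt-+ [] = sym (+-identityʳ _)
  alt-+ (b ∷ bs) = +ˡ (-‿cong (alt-+ bs)) » solve 4 (λ x y z w → x :+ y :- (z :+ w) := x :- z :+ (y :- w)) refl _ _ _ _

  alt-* : ∀ {B : Set} (bs : List B) x {f : B → List B → Carrier} → alt (λ c cs → x * f c cs) bs ≈ x * alt f bs
  alt-* [] x = sym (zeroʳ x)
  alt-* (b ∷ bs) x = +ˡ (-‿cong (alt-* bs x)) » solve 3 (λ x y z → x :* y :- x :* z := x :* (y :- z)) refl _ _ _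

  alt-neg : ∀ {B : Set} (bs : List B) {f : B → List B → Carrier} → alt (λ c cs → - f c cs) bs ≈ - alt f bs
  alt-neg [] = sym -0#≈0#
  alt-neg (b ∷ bs) = +ˡ (-‿cong (alt-neg bs)) » -‿+-comm _ _

  alt-swap : ∀ {A B : Set} (as : List A) (bs : List B) {g : A → List A → B → List B → Carrier} → alt (λ a as' → alt (g a as') bs) as ≈ alt (λ b bs' → alt (λ a as' → g a as' b bs') as) bs
  alt-swap [] bs = sym (alt-0 bs (λ _ _ _ → refl))
  alt-swap (a ∷ as) bs = +ˡ (-‿cong (alt-swap as bs) » sym (alt-neg bs)) » sym (alt-+ bs)

  private
    alt² : ∀ {B : Set} → (B → B → List B → Carrier) → List B → Carrier
    alt² g = alt (λ c → alt (g c))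

    alt²-∷ : ∀ {B : Set} (g : B → B → List B → Carrier) b bs → alt² g (b ∷ bs) ≈ alt (g b) bs - alt (λ c → g c b) bs + alt² (λ c e es → g c e (b ∷ es)) bs
    alt²-∷ g b bs = +ˡ (-‿cong (alt-+ bs » +ˡ (alt-neg bs))) » solve 3 (λ x y z → x :- (y :- z) := x :- y :+ z) refl _ _ _

    -- Deleting two entries in the opposite order shifts the position of exactly one of them, which
    -- costs one sign.
    alt²-flip : ∀ {B : Set} (g : B → B → List B → Carrier) bs → alt² g bs ≈ - alt² (flip g) bs
    alt²-flip g [] = sym -0#≈0#
    alt²-flip g (b ∷ bs) = begin
      _ ≈⟨ alt²-∷ g b bs ⟩
      _ ≈⟨ +ˡ (alt²-flip _ bs) ⟩
      _ ≈⟨ solve 3 (λ x y z → x :- y :- z := :- (y :- x :+ z)) refl _ _ _ ⟩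
      _ ≈⟨ -‿cong (alt²-∷ (flip g) b bs) ⟨
      _ ∎

    -- Proved by its own induction: `alt²-flip` would only show that twice the sum is 0, and 2 may
    -- be a zero divisor here.
    alt²-sym : ∀ {B : Set} (g : B → B → List B → Carrier) → (∀ c e es → g c e es ≈ g e c es) → ∀ bs → alt² g bs ≈ 0#
    alt²-sym g p [] = refl
    alt²-sym g p (b ∷ bs) = alt²-∷ g b bs » +-zero (+ʳ (alt-cong bs (λ c cs → p b c cs)) » -‿inverseʳ _) (alt²-sym _ (λ c e es → p c e (b ∷ es)) bs)

  -- Rows and columns are labelled by lists and the entries are given by a function of the labels.
  -- Lists of different lengths yield 0, which keeps length hypotheses out of all the expansions.
  det : ∀ {A B : Set} → (A → B → Carrier) → List A → List B → Carrier
  det p [] [] = 1#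
  det p [] (_ ∷ _) = 0#
  det p (a ∷ as) bs = alt (λ c cs → p a c * det p as cs) bs

  private
    pull : ∀ {A B : Set} (p : A → B → Carrier) a a' as bs → det p (a ∷ a' ∷ as) bs ≈ alt² (λ c e es → p a c * (p a' e * det p as es)) bs
    pull p a a' as bs = alt-cong bs (λ c cs → sym (alt-* cs (p a c)))

  det-swap : ∀ {A B : Set} (p : A → B → Carrier) pre a a' as bs → det p (pre ++ a ∷ a' ∷ as) bs ≈ - det p (pre ++ a' ∷ a ∷ as) bs
  det-swap p [] a a' as bs = begin
    _ ≈⟨ pull p a a' as bs ⟩
    _ ≈⟨ alt²-flip _ bs ⟩
    _ ≈⟨ -‿cong (alt-cong bs (λ c cs → alt-cong cs (λ e es → *-comm₃ _ _ _))) ⟩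
    _ ≈⟨ -‿cong (pull p a' a as bs) ⟨
    _ ∎
  det-swap p (h ∷ pre) a a' as bs = alt-cong bs (λ c cs → *ˡ (det-swap p pre a a' as cs) » sym (-‿distribʳ-* _ _)) » alt-neg bs

  det-dup₀ : ∀ {A B : Set} (p : A → B → Carrier) a as bs → det p (a ∷ a ∷ as) bs ≈ 0#
  det-dup₀ p a as bs = pull p a a as bs » alt²-sym _ (λ c e es → *-comm₃ _ _ _) bs

  det-dup : ∀ {A B : Set} (p : A → B → Carrier) a {as} bs → a ∈ as → det p (a ∷ as) bs ≈ 0#
  det-dup p a {_ ∷ as} bs (here E.refl) = det-dup₀ p a as bs
  det-dup p a {h ∷ as} bs (there a∈) = (det-swap p [] a h as bs) » -‿cong (alt-0 bs (λ c cs _ → *-zeroʳ (det-dup p a cs a∈))) » -0#≈0#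

  -- Expanding the rows below by induction produces one deletion among the rows and one among the
  -- columns, and these commute by `alt-swap`.
  det-column : ∀ {A B : Set} (p : A → B → Carrier) as b bs → det p as (b ∷ bs) ≈ alt (λ a as' → p a b * det p as' bs) as
  det-column p [] b bs = refl
  det-column p (a ∷ as) b bs = +ˡ (-‿cong (begin
    _ ≈⟨ alt-cong bs (λ c cs → *ˡ (det-column p as b cs) » sym (alt-* as (p a c))) ⟩
    _ ≈⟨ alt-swap bs as ⟩
    _ ≈⟨ alt-cong as (λ a' as' → alt-cong bs (λ c cs → *-comm₃ _ _ _) » alt-* bs (p a' b)) ⟩
    _ ∎))

  det-transpose : ∀ {A B : Set} (p : A → B → Carrier) as bs → det p as bs ≈ det (flip p) bs as
  det-transpose p [] [] = refl
  det-transpose p (_ ∷ _) [] = refl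
  det-transpose p as (b ∷ bs) = det-column p as b bs » alt-cong as (λ a as' → *ˡ (det-transpose p as' bs))

  -- Expanding the first factor along its first row turns this sum into a combination of determinants with a repeated column.
  exchange : ∀ {A B : Set} (p : A → B → Carrier) (Q ys : List A) (bs : List B) → alt (λ y ys' → det p (y ∷ Q) bs * det p ys' bs) ys ≈ 0#
  exchange p Q ys bs = begin
    _ ≈⟨ alt-cong ys (λ y ys' → *-comm _ _ » sym (alt-* bs _) » alt-cong bs (λ c cs → solve 3 (λ u v w → u :* (v :* w) := w :* (v :* u)) refl _ _ _)) ⟩
    _ ≈⟨ alt-swap ys bs ⟩
    _ ≈⟨ alt-0 bs (λ c cs c∈ → alt-* ys _ » *-zeroʳ (begin
           _ ≈⟨ det-column p ys c bs ⟨
           _ ≈⟨ det-transpose p ys (c ∷ bs) ⟩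
           _ ≈⟨ det-dup (flip p) c ys c∈ ⟩
           0# ∎)) ⟩
    _ ∎

  -- The case of `exchange` with the rows w ∷ R in the first factor and x ∷ y ∷ z ∷ R distributed
  -- over both: a row taken from R would occur twice in the first factor, so only x, y and z
  -- contribute.
  plücker : ∀ {A B : Set} (p : A → B → Carrier) (w x y z : A) (R : List A) (bs : List B) → let D = λ as → det p as bs in
            D (x ∷ w ∷ R) * D (y ∷ z ∷ R) - D (y ∷ w ∷ R) * D (x ∷ z ∷ R) + D (z ∷ w ∷ R) * D (x ∷ y ∷ R) ≈ 0#
  plücker p w x y z R bs = begin
    _ ≈⟨ solve 3 (λ u v t → u :- v :+ t := u :- (v :- (t :- con (ℤ.+ 0)))) refl _ _ _ ⟩
    _ ≈⟨ +ˡ (-‿cong (+ˡ (-‿cong (+ˡ (-‿cong (alt-0 R (λ r rs r∈ → *-zeroˡ ((det-swap p [] r w R bs) »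
             -‿cong (alt-0 bs (λ c cs _ → *-zeroʳ (det-dup p r cs r∈))) » -0#≈0#)))))))) ⟨
    _ ≈⟨ exchange p (w ∷ R) (x ∷ y ∷ z ∷ R) bs ⟩
    _ ∎
    where
    import Data.Integer as ℤ
    D = λ as → det p as bs

  -- Vandermonde determinants for Newton bases: columns 1, x - λ₀, (x - λ₀)(x - λ₁), …

  ∏ : ∀ {A : Set} → List A → (A → Carrier) → Carrier
  ∏ [] f = 1#
  ∏ (x ∷ xs) f = f x * ∏ xs f

  ∏-cong : ∀ {A : Set} (xs : List A) {f g : A → Carrier} → (∀ a → f a ≈ g a) → ∏ xs f ≈ ∏ xs g
  ∏-cong [] p = refl
  ∏-cong (x ∷ xs) p = *-cong (p x) (∏-cong xs p)

  ∏-* : ∀ {A : Set} (xs : List A) {f g : A → Carrier} → ∏ xs (λ a → f a * g a) ≈ ∏ xs f * ∏ xs g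
  ∏-* [] = sym (*-identityˡ _)
  ∏-* (x ∷ xs) = *ˡ (∏-* xs) » solve 4 (λ a b c d → a :* b :* (c :* d) := a :* c :* (b :* d)) refl _ _ _ _

  ∏-map : ∀ {A B : Set} (h : A → B) (xs : List A) {f : B → Carrier} → ∏ (map h xs) f ≈ ∏ xs (f ∘ h)
  ∏-map h [] = refl
  ∏-map h (x ∷ xs) = *ˡ (∏-map h xs)

  ev : ∀ {A : Set} → (A → Carrier) → A → Carrier
  ev c x = c x

  infixr 8 _⊙_
  _⊙_ : ∀ {A : Set} → (A → Carrier) → (A → Carrier) → A → Carrier
  (h ⊙ c) x = h x * c x

  alt-∏ : ∀ {A : Set} (h : A → Carrier) (xs : List A) (f : A → List A → Carrier) → alt (λ x xs' → h x * ∏ xs' h * f x xs') xs ≈ ∏ xs h * alt f xs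
  alt-∏ h [] f = sym (zeroʳ _)
  alt-∏ h (x ∷ xs) f = +ˡ (-‿cong (alt-cong xs (λ c cs → solve 4 (λ a b e k → a :* (b :* e) :* k := a :* e :* (b :* k)) refl _ _ _ _) » alt-∏ h xs (λ c cs → h x * f c (x ∷ cs)) » *ˡ (alt-* xs (h x)))) »
    solve 4 (λ a b u v → a :* b :* u :- b :* (a :* v) := a :* b :* (u :- v)) refl _ _ _ _

  det-scale : ∀ {A : Set} (h : A → Carrier) cs xs → det ev (map (h ⊙_) cs) xs ≈ ∏ xs h * det ev cs xs
  det-scale h [] [] = sym (*-identityˡ _)
  det-scale h [] (_ ∷ _) = sym (zeroʳ _)
  det-scale h (c ∷ cs) xs = alt-cong xs (λ x xs' → *ˡ (det-scale h cs xs') » solve 4 (λ a b e k → a :* b :* (e :* k) := a :* e :* (b :* k)) refl _ _ _ _) » alt-∏ h xs _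

  newton : ∀ {A : Set} → (ℕ → A → Carrier) → (A → Carrier) → ℕ → List (A → Carrier)
  newton f g zero = []
  newton f g (suc n) = g ∷ newton (f ∘ suc) (f 0 ⊙ g) n

  private
    -- Adding l 0 - x₀ times the row g to the next one, after the same has been done further down,
    -- gives all rows but the first the common factor u - x₀. At a point with u = x₀ only the first
    -- entry of the column is then left, which is how `vandermonde` peels off its first point.
    row-reduce : ∀ {A : Set} (u : A → Carrier) (l : ℕ → Carrier) x₀ g n xs → det ev (newton (λ j x → u x - l j) g (suc n)) xs ≈ det ev (g ∷ map ((λ x → u x - x₀) ⊙_) (newton (λ j x → u x - l j) g n)) xs
    row-reduce u l x₀ g zero xs = refl
    row-reduce {A} u l x₀ g (suc n) xs = begin
      _ ≈⟨ alt-cong xs (λ c cs → *ˡ (row-reduce u (l ∘ suc) x₀ g' n cs)) ⟩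
      _ ≈⟨ sym (+-identityʳ _) » +ˡ (sym (*-zeroʳ (det-dup₀ ev g Y xs))) ⟩
      _ ≈⟨ +ˡ (sym (alt-* xs _)) » sym (alt-+ xs) ⟩
      _ ≈⟨ alt-cong xs (λ c cs → solve 4 (λ a b k e → a :* b :+ k :* (a :* e) := a :* (b :+ k :* e)) refl _ _ _ _ »
             *ˡ (+ˡ (sym (alt-* cs _)) » sym (alt-+ cs) » alt-cong cs (λ e es → solve 5 (λ ux l0 x0 ge D → (ux :- l0) :* ge :* D :+ (l0 :- x0) :* (ge :* D) := (ux :- x0) :* ge :* D) refl _ _ _ _ _))) ⟩
      _ ∎
      where
      g' : A → Carrier
      g' = (λ x → u x - l 0) ⊙ g
      Y = map ((λ x → u x - x₀) ⊙_) (newton (λ j x → u x - l (suc j)) g' n)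

  vand : ∀ {A : Set} → (A → Carrier) → List A → Carrier
  vand u [] = 1#
  vand u (x ∷ xs) = ∏ xs (λ y → u y - u x) * vand u xs

  vandermonde : ∀ {A : Set} (u : A → Carrier) (l : ℕ → Carrier) xs → det ev (newton (λ j x → u x - l j) (λ _ → 1#) (length xs)) xs ≈ vand u xs
  vandermonde u l [] = refl
  vandermonde u l (x ∷ xs) = begin
    _ ≈⟨ row-reduce u l (u x) (λ _ → 1#) n (x ∷ xs) ⟩
    _ ≈⟨ det-column ev ((λ _ → 1#) ∷ map (h ⊙_) cs) x xs ⟩
    _
      ≈⟨ +-cong (*-identityˡ _) (-‿cong (alt-0 (map (h ⊙_) cs) {λ c cs' → c x * det ev ((λ _ → 1#) ∷ cs') xs} (λ c cs' c∈ → *-zeroˡ (vanish cs c∈))) » -0#≈0#) ⟩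
    _ ≈⟨ +-identityʳ _ ⟩
    _ ≈⟨ det-scale h cs xs ⟩
    _ ≈⟨ *ˡ (vandermonde u l xs) ⟩
    _ ∎
    where
    n = length xs
    f = λ j y → u y - l j
    h = λ y → u y - u x
    cs = newton f (λ _ → 1#) n
    vanish : ∀ cs {c} → c ∈ map (h ⊙_) cs → c x ≈ 0#
    vanish (e ∷ cs) (here E.refl) = *-zeroˡ (-‿inverseʳ _)
    vanish (e ∷ cs) (there c∈) = vanish cs c∈

-- Products over pairs and the square of the Vandermonde product

pairE : ∀ {A B : Set} → Enum A → Enum B → Enum (A × B)
pairE E F = record
  { elems = cartesianProduct (elems E) (elems F)
  ; unique = Uniqueₚ.cartesianProduct⁺ (Enum.unique E) (Enum.unique F)
  ; complete = λ { (a , b) → ∈-cartesianProduct⁺ (Enum.complete E a) (Enum.complete F b) }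
  ; _≟_ = Productₚ.≡-dec (Enum._≟_ E) (Enum._≟_ F) }

module Products (R : CommutativeRing 0ℓ 0ℓ) where

  open Kit R
  open Determinant R

  module _ {A : Set} (E : Enum A) where

    private _≟_ = Enum._≟_ E

    -- Replacing a factor by 1 stands for dividing the product by that factor, which may not be
    -- invertible.
    except : A → (A → Carrier) → A → Carrier
    except p f a = if does (a ≟ p) then 1# else f a

    except-other : ∀ {p a} f → a ≢ p → except p f a ≈ f a
    except-other {p} {a} f a≢p with a ≟ p
    ... | yes a≡p = ⊥-elim (a≢p a≡p)
    ... | no _ = refl

    except-self : ∀ p f → except p f p ≈ 1#
    except-self p f with p ≟ p
    ... | yes _ = refl
    ... | no q = ⊥-elim (q E.refl)

    except-swap : ∀ p q f a → except p (except q f) a ≈ except q (except p f) a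
    except-swap p q f a with a ≟ p | a ≟ q
    ... | yes _ | yes _ = refl
    ... | yes _ | no _ = refl
    ... | no _ | yes _ = refl
    ... | no _ | no _ = refl

    ∏-except : ∀ {xs : List A} p f → Unique xs → p ∈ xs → ∏ xs f ≈ f p * ∏ xs (except p f)
    ∏-except {x ∷ xs} p f (x∉ ∷ u) (here E.refl) = *ˡ (go xs x∉ » sym (*-identityˡ _) » *ʳ (sym (except-self p f)))
      where
      go : ∀ xs → All (p ≢_) xs → ∏ xs f ≈ ∏ xs (except p f)
      go [] [] = refl
      go (y ∷ ys) (n ∷ ns) = *-cong (sym (except-other f (n ∘ E.sym))) (go ys ns)
    ∏-except {x ∷ xs} p f (x∉ ∷ u) (there p∈) = begin
      _ ≈⟨ *-cong (sym (except-other f (All.lookup x∉ p∈))) (∏-except p f u p∈) ⟩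
      _ ≈⟨ *-comm₃ _ _ _ ⟩
      _ ∎

    ∏-derivation : (δ : Carrier → Carrier) → (∀ x y → δ (x * y) ≈ δ x * y + x * δ y) → δ 1# ≈ 0# → ∀ {xs : List A} f → Unique xs → δ (∏ xs f) ≈ ∑ xs (λ p → δ (f p) * ∏ xs (except p f))
    ∏-derivation δ δ-* δ-1 {[]} f [] = δ-1
    ∏-derivation δ δ-* δ-1 {x ∷ xs} f (x∉ ∷ u) = begin
      _ ≈⟨ δ-* _ _ ⟩
      _ ≈⟨ +-cong (*ˡ (go xs x∉ » sym (*-identityˡ _) » *ʳ (sym (except-self x f)))) (*ˡ (∏-derivation δ δ-* δ-1 f u) » sym (∑-*ˡ xs _) »
               ∑-cong∈ xs (λ p p∈ → *-comm₃ _ _ _ » *ˡ (*ʳ (sym (except-other f (All.lookup x∉ p∈)))))) ⟩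
      _ ∎
      where
      go : ∀ xs → All (x ≢_) xs → ∏ xs f ≈ ∏ xs (except x f)
      go [] [] = refl
      go (y ∷ ys) (n ∷ ns) = *-cong (sym (except-other f (n ∘ E.sym))) (go ys ns)

  -- ∏_{a ≠ b} (u a - u b) as a product over all ordered pairs, and its relation to the Vandermonde product.

  gap : ∀ {N} → (Fin N → Carrier) → Fin N × Fin N → Carrier
  gap u (a , b) = if does (a FP.≟ b) then 1# else u a - u b

  gap-≢ : ∀ {N} (u : Fin N → Carrier) {a b} → a ≢ b → gap u (a , b) ≈ u a - u b
  gap-≢ u {a} {b} a≢b with a FP.≟ b
  ... | yes q = ⊥-elim (a≢b q)
  ... | no _ = refl

  pairs : ∀ N → List (Fin N × Fin N)
  pairs N = elems (pairE (finE N) (finE N))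

  signed : Bool → Carrier → Carrier
  signed true x = x
  signed false x = - x

  ∏-product : ∀ {A B : Set} (xs : List A) (ys : List B) {f : A × B → Carrier} → ∏ (cartesianProduct xs ys) f ≈ ∏ xs (λ a → ∏ ys (λ b → f (a , b)))
  ∏-product [] ys = refl
  ∏-product (x ∷ xs) ys {f} = trans (∏-++ (map (x ,_) ys) _) (*-cong (∏-map (x ,_) ys) (∏-product xs ys))
    where
    ∏-++ : ∀ xs ys → ∏ (xs ++ ys) f ≈ ∏ xs f * ∏ ys f
    ∏-++ [] ys = sym (*-identityˡ _)
    ∏-++ (x ∷ xs) ys = *ˡ (∏-++ xs ys) » sym (*-assoc _ _ _)

  ∏-neg : ∀ {A : Set} (xs : List A) {f : A → Carrier} → Σ Bool λ s → ∏ xs (λ a → - f a) ≈ signed s (∏ xs f)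
  ∏-neg [] = true , refl
  ∏-neg (x ∷ xs) with ∏-neg xs
  ... | true , p = false , *ˡ p » sym (-‿distribˡ-* _ _)
  ... | false , p = true , *ˡ p » solve 2 (λ a b → :- a :* :- b := a :* b) refl _ _

  -- The sign is (-1)^(N(N-1)/2), but its existence is enough: it multiplies all values of the
  -- moment functional alike and cancels from homogeneous relations.
  ∏-gap : ∀ N (u : Fin N → Carrier) → Σ Bool λ s → ∏ (pairs N) (gap u) ≈ signed s (vand u (fins N) * vand u (fins N))
  ∏-gap zero u = true , sym (*-identityˡ _)
  ∏-gap (suc N) u with ∏-gap N (u ∘ suc) | ∏-neg (fins N) {λ b → u (suc b) - u zero}
  ... | s , p | t , q = flips t s , (begin
    _ ≈⟨ ∏-product (fins (suc N)) (fins (suc N)) ⟩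
    (gap u (zero , zero) * ∏ (map suc (fins N)) (λ b → gap u (zero , b)))
      * ∏ (map suc (fins N)) (λ a → gap u (a , zero) * ∏ (map suc (fins N)) (λ b → gap u (a , b)))
      ≈⟨ *-cong (*-identityˡ _ » ∏-map suc (fins N)) (∏-map suc (fins N) » (∏-* (fins N))) ⟩
    ∏ (fins N) (λ b → u zero - u (suc b))
      * (w * ∏ (fins N) (λ a → ∏ (map suc (fins N)) (λ b → gap u (suc a , b))))
      ≈⟨ *-cong (∏-cong (fins N) (λ b → solve 2 (λ x y → x :- y := :- (y :- x)) refl _ _) » q) (*ˡ (∏-cong (fins N) (λ a → ∏-map suc (fins N)) » sym (∏-product (fins N) (fins N)) » ∏-cong (pairs N) shift-gap » p)) ⟩
    _ ≈⟨ combine t s ⟩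
    _ ≈⟨ signed-cong (flips t s) (*-cong (*-cong (sym (∏-map suc (fins N))) vand-suc) (*-cong (sym (∏-map suc (fins N))) vand-suc)) ⟩
    _ ∎)
    where
    flips : Bool → Bool → Bool
    flips true s = s
    flips false s = not s
    w = ∏ (fins N) (λ b → u (suc b) - u zero)
    v = vand (u ∘ suc) (fins N)
    shift-gap : ∀ p → gap u (suc (proj₁ p) , suc (proj₂ p)) ≈ gap (u ∘ suc) p
    shift-gap (a , b) with a FP.≟ b
    ... | yes _ = refl
    ... | no _ = refl
    signed-cong : ∀ s {x y} → x ≈ y → signed s x ≈ signed s y
    signed-cong true p = p
    signed-cong false p = -‿cong p
    combine : ∀ t s → signed t w * (w * signed s (v * v)) ≈ signed (flips t s) ((w * v) * (w * v))
    combine true true = solve 2 (λ w v → w :* (w :* (v :* v)) := w :* v :* (w :* v)) refl w v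
    combine true false = solve 2 (λ w v → w :* (w :* :- (v :* v)) := :- (w :* v :* (w :* v))) refl w v
    combine false true = solve 2 (λ w v → :- w :* (w :* (v :* v)) := :- (w :* v :* (w :* v))) refl w v
    combine false false = solve 2 (λ w v → :- w :* (w :* :- (v :* v)) := w :* v :* (w :* v)) refl w v
    vand-map : ∀ (xs : List (Fin N)) → vand (u ∘ suc) xs ≈ vand u (map suc xs)
    vand-map [] = refl
    vand-map (x ∷ xs) = *-cong (sym (∏-map suc xs)) (vand-map xs)
    vand-suc : v ≈ vand u (map suc (fins N))
    vand-suc = vand-map (fins N)

-- The commutative ring of polynomials in the shift operators (S_i φ)(b) = φ(b + e_i) on functions of b ∈ ℕᴺ.

module Shifts (K : CommutativeRing 0ℓ 0ℓ) (N : ℕ) where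

  open Kit K

  Fun : Set
  Fun = Vec ℕ N → Carrier

  addAt : ∀ {n} → Fin n → ℕ → Vec ℕ n → Vec ℕ n
  addAt zero l (x ∷ b) = l N.+ x ∷ b
  addAt (suc i) l (x ∷ b) = x ∷ addAt i l b

  addAt-comm : ∀ {n} (i j : Fin n) k l b → addAt i k (addAt j l b) ≡ addAt j l (addAt i k b)
  addAt-comm zero zero k l (x ∷ b) = cong (_∷ b) (E.sym (NP.+-assoc k l x) ∙ cong (N._+ x) (NP.+-comm k l) ∙ NP.+-assoc l k x)
  addAt-comm zero (suc j) k l (x ∷ b) = E.refl
  addAt-comm (suc i) zero k l (x ∷ b) = E.refl
  addAt-comm (suc i) (suc j) k l (x ∷ b) = cong (x ∷_) (addAt-comm i j k l b)

  addAt-add : ∀ {n} (i : Fin n) k l b → addAt i k (addAt i l b) ≡ addAt i (k N.+ l) b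
  addAt-add zero k l (x ∷ b) = cong (_∷ b) (E.sym (NP.+-assoc k l x))
  addAt-add (suc i) k l (x ∷ b) = cong (x ∷_) (addAt-add i k l b)

  addAt-0 : ∀ {n} (i : Fin n) b → addAt i 0 b ≡ b
  addAt-0 zero (x ∷ b) = E.refl
  addAt-0 (suc i) (x ∷ b) = cong (x ∷_) (addAt-0 i b)

  lookup-addAt : ∀ {n} (i : Fin n) l b → lookup (addAt i l b) i ≡ l N.+ lookup b i
  lookup-addAt zero l (x ∷ b) = E.refl
  lookup-addAt (suc i) l (x ∷ b) = lookup-addAt i l b

  lookup-addAt-≢ : ∀ {n} {i j : Fin n} l b → i ≢ j → lookup (addAt i l b) j ≡ lookup b j
  lookup-addAt-≢ {i = zero} {zero} l (x ∷ b) i≢j = ⊥-elim (i≢j E.refl)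
  lookup-addAt-≢ {i = zero} {suc j} l (x ∷ b) i≢j = E.refl
  lookup-addAt-≢ {i = suc i} {zero} l (x ∷ b) i≢j = E.refl
  lookup-addAt-≢ {i = suc i} {suc j} l (x ∷ b) i≢j = lookup-addAt-≢ l b (i≢j ∘ cong suc)

  infixl 6 _⊞_
  infixl 7 _⊠_
  infix 8 ⊟_

  -- Expressions compared by their action on functions form a commutative ring without any normal
  -- form, and the partial derivatives can be defined by recursion on expressions.
  data Pol : Set where
    var : Fin N → Pol
    _⊞_ _⊠_ : Pol → Pol → Pol
    ⊟_ : Pol → Pol
    𝟘 𝟙 : Pol

  act : Pol → Fun → Fun
  act (var i) φ b = φ (addAt i 1 b)
  act (p ⊞ q) φ b = act p φ b + act q φ b
  act (p ⊠ q) φ = act p (act q φ)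
  act (⊟ p) φ b = - act p φ b
  act 𝟘 φ b = 0#
  act 𝟙 φ = φ

  act-cong : ∀ p {φ ψ : Fun} → (∀ b → φ b ≈ ψ b) → ∀ b → act p φ b ≈ act p ψ b
  act-cong (var i) e b = e _
  act-cong (p ⊞ q) e b = +-cong (act-cong p e b) (act-cong q e b)
  act-cong (p ⊠ q) e b = act-cong p (act-cong q e) b
  act-cong (⊟ p) e b = -‿cong (act-cong p e b)
  act-cong 𝟘 e b = refl
  act-cong 𝟙 e b = e b

  act-+ : ∀ p (φ ψ : Fun) b → act p (λ b → φ b + ψ b) b ≈ act p φ b + act p ψ b
  act-+ (var i) φ ψ b = refl
  act-+ (p ⊞ q) φ ψ b = +-cong (act-+ p φ ψ b) (act-+ q φ ψ b) » solve 4 (λ a b c d → a :+ b :+ (c :+ d) := a :+ c :+ (b :+ d)) refl _ _ _ _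
  act-+ (p ⊠ q) φ ψ b = act-cong p (act-+ q φ ψ) b » act-+ p _ _ b
  act-+ (⊟ p) φ ψ b = -‿cong (act-+ p φ ψ b) » sym (-‿+-comm _ _)
  act-+ 𝟘 φ ψ b = sym (+-identityʳ _)
  act-+ 𝟙 φ ψ b = refl

  act-* : ∀ p c (φ : Fun) b → act p (λ b → c * φ b) b ≈ c * act p φ b
  act-* (var i) c φ b = refl
  act-* (p ⊞ q) c φ b = +-cong (act-* p c φ b) (act-* q c φ b) » sym (distribˡ _ _ _)
  act-* (p ⊠ q) c φ b = act-cong p (act-* q c φ) b » act-* p c _ b
  act-* (⊟ p) c φ b = -‿cong (act-* p c φ b) » -‿distribʳ-* _ _
  act-* 𝟘 c φ b = sym (zeroʳ c)
  act-* 𝟙 c φ b = refl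

  act-neg : ∀ p (φ : Fun) b → act p (λ b → - φ b) b ≈ - act p φ b
  act-neg p φ b = act-cong p (λ b → solve 1 (λ x → :- x := (:- :1) :* x) refl (φ b)) b » act-* p (- 1#) φ b » solve 1 (λ x → (:- :1) :* x := :- x) refl _

  act-0 : ∀ p b → act p (λ _ → 0#) b ≈ 0#
  act-0 p b = act-cong p (λ b → sym (zeroˡ 0#)) b » act-* p 0# _ b » zeroˡ _

  act-shift : ∀ p i (φ : Fun) b → act p (λ b → φ (addAt i 1 b)) b ≈ act p φ (addAt i 1 b)
  act-shift (var j) i φ b = reflexive (cong φ (addAt-comm i j 1 1 b))
  act-shift (p ⊞ q) i φ b = +-cong (act-shift p i φ b) (act-shift q i φ b)
  act-shift (p ⊠ q) i φ b = act-cong p (act-shift q i φ) b » act-shift p i _ b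
  act-shift (⊟ p) i φ b = -‿cong (act-shift p i φ b)
  act-shift 𝟘 i φ b = refl
  act-shift 𝟙 i φ b = refl

  act-comm : ∀ p q (φ : Fun) b → act p (act q φ) b ≈ act q (act p φ) b
  act-comm (var i) q φ b = sym (act-shift q i φ b)
  act-comm (p ⊞ p') q φ b = +-cong (act-comm p q φ b) (act-comm p' q φ b) » sym (act-+ q _ _ b)
  act-comm (p ⊠ p') q φ b = act-cong p (act-comm p' q φ) b » act-comm p q _ b
  act-comm (⊟ p) q φ b = -‿cong (act-comm p q φ b) » sym (act-neg q _ b)
  act-comm 𝟘 q φ b = sym (act-0 q b)
  act-comm 𝟙 q φ b = refl

  infix 4 _≃_
  record _≃_ (p q : Pol) : Set where
    constructor mk
    field at : ∀ φ b → act p φ b ≈ act q φ b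
  open _≃_ public

  isCommutativeRing : IsCommutativeRing _≃_ _⊞_ _⊠_ ⊟_ 𝟘 𝟙
  isCommutativeRing = record
    { isRing = record
      { +-isAbelianGroup = record
        { isGroup = record
          { isMonoid = record
            { isSemigroup = record
              { isMagma = record
                { isEquivalence = record
                  { refl = mk (λ φ b → refl) ; sym = λ e → mk (λ φ b → sym (at e φ b)) ; trans = λ e f → mk (λ φ b → at e φ b » at f φ b) }
                ; ∙-cong = λ e f → mk (λ φ b → +-cong (at e φ b) (at f φ b)) }
              ; assoc = λ p q r → mk (λ φ b → +-assoc _ _ _) }
            ; identity = (λ p → mk (λ φ b → +-identityˡ _)) , (λ p → mk (λ φ b → +-identityʳ _)) }
          ; inverse = (λ p → mk (λ φ b → -‿inverseˡ _)) , (λ p → mk (λ φ b → -‿inverseʳ _))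
          ; ⁻¹-cong = λ e → mk (λ φ b → -‿cong (at e φ b)) }
        ; comm = λ p q → mk (λ φ b → +-comm _ _) }
      ; *-cong = λ {p} {p'} {q} {q'} e f → mk (λ φ b → at e _ b » act-cong p' (at f φ) b)
      ; *-assoc = λ p q r → mk (λ φ b → refl)
      ; *-identity = (λ p → mk (λ φ b → refl)) , (λ p → mk (λ φ b → refl))
      ; distrib = (λ p q r → mk (λ φ b → act-+ p _ _ b)) , (λ p q r → mk (λ φ b → refl)) }
    ; *-comm = λ p q → mk (act-comm p q) }

  polRing : CommutativeRing 0ℓ 0ℓ
  polRing = record { isCommutativeRing = isCommutativeRing }

  module 𝒫 = Kit polRing
  module 𝒟 = Determinant polRing
  module 𝒬 = Products polRing

  act-∑ : ∀ {A : Set} (xs : List A) (p : A → Pol) φ b → act (𝒫.∑ xs p) φ b ≈ ∑ xs (λ a → act (p a) φ b)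
  act-∑ [] p φ b = refl
  act-∑ (x ∷ xs) p φ b = +ˡ (act-∑ xs p φ b)

  act-∑ʳ : ∀ {A : Set} p (xs : List A) (φ : A → Fun) b → act p (λ b → ∑ xs (λ a → φ a b)) b ≈ ∑ xs (λ a → act p (φ a) b)
  act-∑ʳ p [] φ b = act-0 p b
  act-∑ʳ p (x ∷ xs) φ b = act-+ p _ _ b » +ˡ (act-∑ʳ p xs φ b)

  -- Partial derivatives; they measure the commutator with multiplication by b_i.

  ∂ : Fin N → Pol → Pol
  ∂ i (var j) = 𝒫.[ i FP.≟ j ]
  ∂ i (p ⊞ q) = ∂ i p ⊞ ∂ i q
  ∂ i (p ⊠ q) = (∂ i p ⊠ q) ⊞ (p ⊠ ∂ i q)
  ∂ i (⊟ p) = ⊟ ∂ i p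
  ∂ i 𝟘 = 𝟘
  ∂ i 𝟙 = 𝟘

  times : Fin N → Fun → Fun
  times i φ b = ι (lookup b i) * φ b

  act-times : ∀ p i φ b → act p (times i φ) b ≈ times i (act p φ) b + act (∂ i p) φ (addAt i 1 b)
  act-times (var j) i φ b with i FP.≟ j
  ... | yes E.refl = *ʳ (reflexive (cong ι (lookup-addAt i 1 b)) » ι-suc (lookup b i)) » solve 2 (λ x y → (:1 :+ x) :* y := x :* y :+ y) refl (ι (lookup b i)) (φ (addAt i 1 b))
  ... | no i≢j = *ʳ (reflexive (cong ι (lookup-addAt-≢ 1 b (i≢j ∘ E.sym)))) » sym (+-identityʳ _)
  act-times (p ⊞ q) i φ b = +-cong (act-times p i φ b) (act-times q i φ b) » solve 5 (λ x a b c d → x :* a :+ b :+ (x :* c :+ d) := x :* (a :+ c) :+ (b :+ d)) refl _ _ _ _ _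
  act-times (p ⊠ q) i φ b = begin
    _ ≈⟨ act-cong p (act-times q i φ) b ⟩
    _ ≈⟨ act-+ p _ _ b ⟩
    _ ≈⟨ +-cong (act-times p i (act q φ) b) (act-shift p i _ b) ⟩
    _ ≈⟨ +-assoc _ _ _ ⟩
    _ ∎
  act-times (⊟ p) i φ b = -‿cong (act-times p i φ b) » solve 3 (λ x a b → :- (x :* a :+ b) := x :* (:- a) :+ :- b) refl _ _ _
  act-times 𝟘 i φ b = sym (+-zero (zeroʳ _) refl)
  act-times 𝟙 i φ b = sym (+-identityʳ _)

  -- φ₀ b = ∏ b_i! is the moment functional of e^{-x₁-…-x_N} on (0,∞)ᴺ, so that Φ b is, up to sign, the moment of
  -- x^b against ∏_{i<j}(x_i - x_j)², and Ψ i j b is the same with one factor x_i - x_j removed.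

  facts : ∀ {n} → Vec ℕ n → Carrier
  facts [] = 1#
  facts (x ∷ b) = ι (x !) * facts b

  facts-addAt : ∀ {n} (i : Fin n) b → facts (addAt i 1 b) ≈ ι (suc (lookup b i)) * facts b
  facts-addAt zero (x ∷ b) = *ʳ (ι-* (suc x) (x !)) » *-assoc _ _ _
  facts-addAt (suc i) (x ∷ b) = *ˡ (facts-addAt i b) » *-comm₃ _ _ _

  private
    PE = pairE (finE N) (finE N)
    F = fins N
    g = 𝒬.gap var

  Q : Pol
  Q = 𝒟.∏ (𝒬.pairs N) g

  Q∖ : Fin N × Fin N → Pol
  Q∖ p = 𝒟.∏ (𝒬.pairs N) (𝒬.except PE p g)

  Φ : Fun
  Φ = act Q facts

  Ψ : Fin N → Fin N → Fun
  Ψ i j c = if does (i FP.≟ j) then 0# else act (Q∖ (i , j)) facts c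

  Q≈gap⊠ : ∀ p → Q ≃ g p ⊠ Q∖ p
  Q≈gap⊠ p = 𝒬.∏-except PE p g (Enum.unique PE) (Enum.complete PE p)

  Ψ-self : ∀ i c → Ψ i i c ≈ 0#
  Ψ-self i c with i FP.≟ i
  ... | yes _ = refl
  ... | no q = ⊥-elim (q E.refl)

  Ψ-≢ : ∀ {i j} c → i ≢ j → Ψ i j c ≈ act (Q∖ (i , j)) facts c
  Ψ-≢ {i} {j} c i≢j with i FP.≟ j
  ... | yes q = ⊥-elim (i≢j q)
  ... | no _ = refl

  Ψ-diff : ∀ {i j} c → i ≢ j → Ψ i j (addAt i 1 c) - Ψ i j (addAt j 1 c) ≈ Φ c
  Ψ-diff {i} {j} c i≢j = begin
    _ ≈⟨ +-cong (Ψ-≢ _ i≢j) (-‿cong (Ψ-≢ _ i≢j)) ⟩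
    _ ≈⟨ at (𝒫.*ʳ {Q∖ (i , j)} (𝒬.gap-≢ var i≢j)) facts c ⟨
    _ ≈⟨ at (Q≈gap⊠ (i , j)) facts c ⟨
    _ ∎

  Ψ-anti : ∀ i j c → Ψ j i c ≈ - Ψ i j c
  Ψ-anti i j c with i FP.≟ j
  ... | yes E.refl = Ψ-self i c » sym -0#≈0#
  ... | no i≢j = trans (Ψ-≢ c (i≢j ∘ E.sym)) (at Q∖-anti facts c)
    where
    Q∖∖ : ∀ p q → p ≢ q → Q∖ p ≃ g q ⊠ 𝒟.∏ (𝒬.pairs N) (𝒬.except PE q (𝒬.except PE p g))
    Q∖∖ p q p≢q = 𝒫.trans (𝒬.∏-except PE q (𝒬.except PE p g) (Enum.unique PE) (Enum.complete PE q)) (𝒫.*ʳ (𝒬.except-other PE g (p≢q ∘ E.sym)))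
    ij≢ji : (i , j) ≢ (j , i)
    ij≢ji ij≡ji = i≢j (cong proj₁ ij≡ji)
    Q∖-anti : Q∖ (j , i) ≃ ⊟ Q∖ (i , j)
    Q∖-anti = 𝒫.trans (Q∖∖ (j , i) (i , j) (ij≢ji ∘ E.sym)) (𝒫.trans (𝒫.*-cong (𝒬.gap-≢ var i≢j) (𝒟.∏-cong (𝒬.pairs N) (𝒬.except-swap PE (i , j) (j , i) g)))
      (𝒫.trans (𝒫.solve 3 (λ x y z → (x 𝒫.:- y) 𝒫.:* z 𝒫.:= 𝒫.:- ((y 𝒫.:- x) 𝒫.:* z)) 𝒫.refl (var i) (var j) _)
      (𝒫.trans (𝒫.-‿cong (𝒫.*ʳ (𝒫.sym (𝒬.gap-≢ var (i≢j ∘ E.sym)))))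
      (𝒫.-‿cong (𝒫.sym (Q∖∖ (i , j) (j , i) ij≢ji))))))

  act-[] : ∀ {X : Set} (d : Dec X) φ b → act (𝒫.[ d ]) φ b ≈ [ d ] * φ b
  act-[] (yes _) φ b = sym (*-identityˡ _)
  act-[] (no _) φ b = sym (zeroˡ _)

  -- x_k occurs in the factors (k, j) and (j, k) of `Q`; the two derivatives have opposite signs,
  -- and so do the two cofactors by `Ψ-anti`, hence the factor 2.
  ∂Q : ∀ k b → act (∂ k Q) facts b ≈ ι 2 * ∑ F (λ j → Ψ k j b)
  ∂Q k b = begin
    _ ≈⟨ at (𝒬.∏-derivation PE (∂ k) (λ x y → 𝒫.refl) 𝒫.refl g (Enum.unique PE)) facts b ⟩
    _ ≈⟨ act-∑ (𝒬.pairs N) _ facts b ⟩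
    _ ≈⟨ ∑-cong (𝒬.pairs N) term » ∑-product F F ⟩
    _ ≈⟨ ∑-cong F (λ i → (∑-+ F) » +ˡ (∑-neg F)) » (∑-+ F) » +ˡ (∑-neg F) ⟩
    _ ≈⟨ +-cong (∑-cong F (λ i → ∑-*ˡ F _) » ∑-δ (finE N) k (k FP.≟_) E.refl (λ _ → E.sym))
                (-‿cong (∑-cong F (λ i → ∑-δ (finE N) k (k FP.≟_) E.refl (λ _ → E.sym)))) ⟩
    _ ≈⟨ +ˡ (-‿cong (∑-cong F (λ i → Ψ-anti k i b) » ∑-neg F)) ⟩
    _ ≈⟨ solve 1 (λ x → x :- :- x := :2 :* x) refl _ ⟩
    _ ∎
    where
    term : ∀ p → act (∂ k (g p) ⊠ Q∖ p) facts b ≈ [ k FP.≟ proj₁ p ] * Ψ (proj₁ p) (proj₂ p) b - [ k FP.≟ proj₂ p ] * Ψ (proj₁ p) (proj₂ p) b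
    term (i , j) with i FP.≟ j
    ... | yes E.refl = sym (-‿inverseʳ _)
    ... | no _ = +-cong (act-[] (k FP.≟ i) _ b) (-‿cong (act-[] (k FP.≟ j) _ b))

  -- Integration by parts in x_k: the exponential gives the left side, the monomial x_k^(b_k + 1)
  -- the first term on the right, and the squared Vandermonde product the last.
  Φ-step : ∀ k b → Φ (addAt k 1 b) ≈ (1# + ι (lookup b k)) * Φ b + ι 2 * ∑ F (λ j → Ψ k j (addAt k 1 b))
  Φ-step k b = begin
    _ ≈⟨ act-shift Q k facts b ⟨
    _ ≈⟨ act-cong Q (λ b → facts-addAt k b » *ʳ (ι-suc (lookup b k)) » distribʳ _ _ _ » +ʳ (*-identityˡ _)) b ⟩
    _ ≈⟨ act-+ Q _ _ b ⟩
    _ ≈⟨ +ˡ (act-times Q k facts b) ⟩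
    _ ≈⟨ +ˡ (+ˡ (∂Q k (addAt k 1 b))) ⟩
    _ ≈⟨ solve 3 (λ x y z → x :+ (y :* x :+ z) := (:1 :+ y) :* x :+ z) refl _ _ _ ⟩
    _ ∎

  P : ℕ → Fun → Fun
  P l φ b = ∑ F (λ i → φ (addAt i l b))

  B : Fun → Fun
  B φ b = ∑ F (λ i → ι (lookup b i) * φ (addAt i 1 b))

  private
    -- Symmetrising in i and j turns the `Ψ` terms into divided differences (x_i^l - x_j^l)/(x_i -
    -- x_j), supplied as X; the diagonal has to be taken off because `Ψ` vanishes there while X does
    -- not.
    double : ∀ l b (X : Fin N → Fin N → Carrier) → (∀ i j → i ≢ j → Ψ i j (addAt i l b) - Ψ i j (addAt j l b) ≈ X i j) → (∀ i → ∑ F (λ j → [ ¬? (i FP.≟ j) ] * X i j) ≈ ∑ F (X i) - X i i) →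
             ι 2 * ∑ F (λ i → ∑ F (λ j → Ψ i j (addAt i l b))) ≈ ∑ F (λ i → ∑ F (X i)) - ∑ F (λ i → X i i)
    double l b X diff remove = begin
      _ ≈⟨ solve 1 (λ x → :2 :* x := x :+ x) refl S ⟩
      _ ≈⟨ +ˡ (∑-swap F F) ⟩
      _ ≈⟨ sym (∑-cong F (λ i → ∑-+ F) » (∑-+ F)) ⟩
      _ ≈⟨ ∑-cong F (λ i → ∑-cong F (λ j → term i j)) ⟩
      _ ≈⟨ ∑-cong F remove » (∑-+ F) » +ˡ (∑-neg F) ⟩
      _ ∎
      where
      S = ∑ F (λ i → ∑ F (λ j → Ψ i j (addAt i l b)))
      term : ∀ i j → Ψ i j (addAt i l b) + Ψ j i (addAt j l b) ≈ [ ¬? (i FP.≟ j) ] * X i j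
      term i j = trans (+ˡ (Ψ-anti i j _)) (go (i FP.≟ j))
        where
        go : ∀ (d : Dec (i ≡ j)) → Ψ i j (addAt i l b) - Ψ i j (addAt j l b) ≈ [ ¬? d ] * X i j
        go (yes E.refl) = -‿inverseʳ _ » sym (zeroˡ _)
        go (no i≢j) = diff i j i≢j » sym (*-identityˡ _)

    remove-diagonal : ∀ (X : Fin N → Carrier) i → ∑ F (λ j → [ ¬? (i FP.≟ j) ] * X j) ≈ ∑ F X - X i
    remove-diagonal X i = begin
      _ ≈⟨ ∑-cong F (λ j → go j (i FP.≟ j)) ⟩
      _ ≈⟨ (∑-+ F) » +ˡ (∑-neg F) ⟩
      _ ≈⟨ +ˡ (-‿cong (∑-δ (finE N) i (i FP.≟_) E.refl (λ _ → E.sym))) ⟩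
      _ ∎
      where
      go : ∀ j (d : Dec (i ≡ j)) → [ ¬? d ] * X j ≈ X j - [ d ] * X j
      go j (yes _) = solve 1 (λ x → con (+ 0) :* x := x :- :1 :* x) refl (X j)
        where open import Data.Integer using (+_)
      go j (no _) = solve 1 (λ x → :1 :* x := x :- con (+ 0) :* x) refl (X j)
        where open import Data.Integer using (+_)

  size : ∀ {n} → Vec ℕ n → ℕ
  size = Vec.sum

  ∑-lookup : ∀ {n} (b : Vec ℕ n) → ∑ (fins n) (λ i → ι (lookup b i)) ≈ ι (size b)
  ∑-lookup [] = refl
  ∑-lookup (x ∷ b) = ∑-fins {f = λ i → ι (lookup (x ∷ b) i)} » +ˡ (∑-lookup b) » sym (ι-+ x (size b))

  -- Homogeneity under dilations: the monomial has degree `size b`, the squared Vandermonde product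
  -- N(N-1), and the N differentials add N.
  P₁Φ : ∀ b → P 1 Φ b ≈ (ι N * ι N + ι (size b)) * Φ b
  P₁Φ b = begin
    _ ≈⟨ ∑-cong F (λ i → Φ-step i b) ⟩
    _ ≈⟨ (∑-+ F) » +-cong (∑-*ʳ F (Φ b) » *ʳ ((∑-+ F) » +-cong (∑-fins-const N 1#) (∑-lookup b))) (∑-*ˡ F (ι 2)) ⟩
    _ ≈⟨ +ˡ (double 1 b (λ i j → Φ b) (λ i j → Ψ-diff b) (remove-diagonal (λ _ → Φ b)) »
           +-cong (∑-cong F (λ _ → ∑-fins-const N (Φ b)) » ∑-fins-const N _) (-‿cong (∑-fins-const N (Φ b)))) ⟩
    _ ≈⟨ solve 3 (λ n s f → (n :* :1 :+ s) :* f :+ (n :* (n :* f) :- n :* f) := (n :* n :+ s) :* f) refl (ι N) _ _ ⟩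
    _ ∎

  -- Integration by parts along the field Σ x_i² ∂_i. Its divergence contributes 2 p₁ and the
  -- squared Vandermonde product 2(N-1) p₁, together 2N p₁, and `B` is its action on the monomial.
  P₂Φ : ∀ b → P 2 Φ b ≈ ι 2 * ι N * P 1 Φ b + B Φ b
  P₂Φ b = begin
    _ ≈⟨ ∑-cong F step ⟩
    _ ≈⟨ (∑-+ F) » +-cong ((∑-+ F) » +ʳ (∑-*ˡ F (ι 2))) (∑-*ˡ F (ι 2)) ⟩
    _ ≈⟨ +ˡ (double 2 b (λ i j → Φ (addAt i 1 b) + Φ (addAt j 1 b)) diff (λ i → remove-diagonal (λ j → Φ (addAt i 1 b) + Φ (addAt j 1 b)) i) »
           +-cong (∑-cong F (λ i → (∑-+ F) » +ʳ (∑-fins-const N _)) » (∑-+ F) » +-cong (∑-*ˡ F (ι N)) (∑-fins-const N p)) (-‿cong (∑-+ F))) ⟩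
    _ ≈⟨ solve 3 (λ n p q → :2 :* p :+ q :+ ((n :* p :+ n :* p) :- (p :+ p)) := :2 :* n :* p :+ q) refl (ι N) p (B Φ b) ⟩
    _ ∎
    where
    p = P 1 Φ b
    step : ∀ i → Φ (addAt i 2 b) ≈ ι 2 * Φ (addAt i 1 b) + ι (lookup b i) * Φ (addAt i 1 b) + ι 2 * ∑ F (λ j → Ψ i j (addAt i 2 b))
    step i = begin
      _ ≡⟨ cong Φ (addAt-add i 1 1 b) ⟨
      _ ≈⟨ Φ-step i (addAt i 1 b) ⟩
      _ ≈⟨ +-cong (*ʳ (+ˡ (reflexive (cong ι (lookup-addAt i 1 b)) » ι-suc (lookup b i)))) (*ˡ (∑-cong F (λ j → reflexive (cong (Ψ i j) (addAt-add i 1 1 b))))) ⟩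
      _ ≈⟨ +ʳ (solve 2 (λ x y → (:1 :+ (:1 :+ x)) :* y := :2 :* y :+ x :* y) refl _ _) ⟩
      _ ∎
    diff : ∀ i j → i ≢ j → Ψ i j (addAt i 2 b) - Ψ i j (addAt j 2 b) ≈ Φ (addAt i 1 b) + Φ (addAt j 1 b)
    diff i j i≢j = begin
      _ ≡⟨ cong₂ (λ u v → Ψ i j u - Ψ i j v) (addAt-add i 1 1 b) (addAt-add j 1 1 b) ⟨
      _ ≈⟨ solve 3 (λ x y z → x :- z := x :- y :+ (y :- z)) refl _ (Ψ i j (addAt j 1 (addAt i 1 b))) _ ⟩
      _
        ≈⟨ +-cong (Ψ-diff (addAt i 1 b) i≢j) (+ʳ (reflexive (cong (Ψ i j) (addAt-comm j i 1 1 b))) » Ψ-diff (addAt j 1 b) i≢j) ⟩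
      _ ∎

  P-cong : ∀ l {φ ψ : Fun} → (∀ b → φ b ≈ ψ b) → ∀ b → P l φ b ≈ P l ψ b
  P-cong l e b = ∑-cong F (λ i → e _)

  P-comm : ∀ k l φ b → P k (P l φ) b ≈ P l (P k φ) b
  P-comm k l φ b = ∑-swap F F » ∑-cong F (λ i → ∑-cong F (λ j → reflexive (cong φ (addAt-comm i j l k b))))

  P-* : ∀ l c φ b → P l (λ b → c * φ b) b ≈ c * P l φ b
  P-* l c φ b = ∑-*ˡ F c

  size-addAt : ∀ {n} (i : Fin n) l b → size (addAt i l b) ≡ l N.+ size b
  size-addAt zero l (x ∷ b) = NP.+-assoc l x (size b)
  size-addAt (suc i) l (x ∷ b) = cong (x N.+_) (size-addAt i l b) ∙ E.sym (NP.+-assoc x l _) ∙ cong (N._+ size b) (NP.+-comm x l) ∙ NP.+-assoc l x _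

  P-size : ∀ l c φ b → P l (λ b → (c + ι (size b)) * φ b) b ≈ (c + ι l + ι (size b)) * P l φ b
  P-size l c φ b = ∑-cong F (λ i → *ʳ (+ˡ (reflexive (cong ι (size-addAt i l b)) » ι-+ l (size b)) » sym (+-assoc _ _ _))) » ∑-*ˡ F _

  P-B : ∀ l φ b → P l (B φ) b ≈ B (P l φ) b + ι l * P (suc l) φ b
  P-B l φ b = begin
    _ ≈⟨ ∑-cong F (λ j → ∑-cong F (λ i → term i j) » (∑-+ F) » +ˡ (∑-δ (finE N) j (j FP.≟_) E.refl (λ _ → E.sym))) ⟩
    _ ≈⟨ (∑-+ F) » +-cong (∑-swap F F » ∑-cong F (λ i → ∑-*ˡ F _)) (∑-cong F (λ j → *ˡ (reflexive (cong φ (addAt-add j 1 l b)))) » ∑-*ˡ F _) ⟩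
    _ ∎
    where
    term : ∀ i j → ι (lookup (addAt j l b) i) * φ (addAt i 1 (addAt j l b)) ≈ ι (lookup b i) * φ (addAt j l (addAt i 1 b)) + [ j FP.≟ i ] * (ι l * φ (addAt i 1 (addAt j l b)))
    term i j with j FP.≟ i
    ... | yes E.refl = *-cong (reflexive (cong ι (lookup-addAt i l b)) » ι-+ l _) refl » distribʳ _ _ _ » +-comm _ _ » +-cong (*ˡ (reflexive (cong φ (addAt-comm i i 1 l b)))) (sym (*-identityˡ _))
    ... | no j≢i = *-cong (reflexive (cong ι (lookup-addAt-≢ l b j≢i))) (reflexive (cong φ (addAt-comm i j 1 l b))) » sym (+ˡ (zeroˡ _) » +-identityʳ _)

  Ps : List ℕ → Fun → Fun
  Ps [] φ = φ
  Ps (k ∷ ks) φ = P k (Ps ks φ)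

  Ps-cong : ∀ ks {φ ψ : Fun} → (∀ b → φ b ≈ ψ b) → ∀ b → Ps ks φ b ≈ Ps ks ψ b
  Ps-cong [] e b = e b
  Ps-cong (k ∷ ks) e b = P-cong k (Ps-cong ks e) b

  Ps-+ : ∀ ks (φ ψ : Fun) b → Ps ks (λ b → φ b + ψ b) b ≈ Ps ks φ b + Ps ks ψ b
  Ps-+ [] φ ψ b = refl
  Ps-+ (k ∷ ks) φ ψ b = P-cong k (Ps-+ ks φ ψ) b » (∑-+ F)

  Ps-* : ∀ ks c (φ : Fun) b → Ps ks (λ b → c * φ b) b ≈ c * Ps ks φ b
  Ps-* [] c φ b = refl
  Ps-* (k ∷ ks) c φ b = P-cong k (Ps-* ks c φ) b » P-* k c (Ps ks φ) b

  Ps-P : ∀ ks k φ b → P k (Ps ks φ) b ≈ Ps ks (P k φ) b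
  Ps-P [] k φ b = refl
  Ps-P (l ∷ ks) k φ b = P-comm k l (Ps ks φ) b » P-cong l (Ps-P ks k φ) b

  Ps-size : ∀ ks c φ b → Ps ks (λ b → (c + ι (size b)) * φ b) b ≈ (c + ι (sumL ks) + ι (size b)) * Ps ks φ b
  Ps-size [] c φ b = *ʳ (+ʳ (sym (+-identityʳ c)))
  Ps-size (k ∷ ks) c φ b = P-cong k (Ps-size ks c φ) b » P-size k _ (Ps ks φ) b » *ʳ (+ʳ (+-assoc _ _ _ » +ˡ (+-comm _ _ » sym (ι-+ k (sumL ks)))))

  -- bump e ks = Σ_l l · e (ks with l replaced by l + 1), the effect of Σ x_i² ∂_i on a product of power sums.
  bump : (List ℕ → Carrier) → List ℕ → Carrier
  bump e [] = 0#
  bump e (k ∷ ks) = ι k * e (suc k ∷ ks) + bump (e ∘ (k ∷_)) ks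

  bump-cong : ∀ {e e' : List ℕ → Carrier} ks → (∀ ks → e ks ≈ e' ks) → bump e ks ≈ bump e' ks
  bump-cong [] p = refl
  bump-cong (k ∷ ks) p = +-cong (*ˡ (p _)) (bump-cong ks (p ∘ (k ∷_)))

  private
    bump-∑ : ∀ {A : Set} (xs : List A) (e : A → List ℕ → Carrier) ks → ∑ xs (λ a → bump (e a) ks) ≈ bump (λ ks → ∑ xs (λ a → e a ks)) ks
    bump-∑ xs e [] = ∑-0 xs (λ _ → refl)
    bump-∑ xs e (k ∷ ks) = (∑-+ xs) » +-cong (∑-*ˡ xs _) (bump-∑ xs (λ a → e a ∘ (k ∷_)) ks)

  Ps-B : ∀ ks φ b → Ps ks (B φ) b ≈ B (Ps ks φ) b + bump (λ ks → Ps ks φ b) ks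
  Ps-B [] φ b = sym (+-identityʳ _)
  Ps-B (k ∷ ks) φ b = begin
    _ ≈⟨ P-cong k (Ps-B ks φ) b ⟩
    _ ≈⟨ ∑-+ F ⟩
    _ ≈⟨ +-cong (P-B k (Ps ks φ) b) (bump-∑ F (λ i ks → Ps ks φ (addAt i k b)) ks) ⟩
    _ ≈⟨ +-assoc _ _ _ ⟩
    _ ∎

  𝟎 : ∀ {n} → Vec ℕ n
  𝟎 = Vec.replicate _ 0

  lookup-𝟎 : ∀ {n} (i : Fin n) → lookup 𝟎 i ≡ 0
  lookup-𝟎 zero = E.refl
  lookup-𝟎 (suc i) = lookup-𝟎 i

  size-𝟎 : ∀ n → size (𝟎 {n}) ≡ 0
  size-𝟎 zero = E.refl
  size-𝟎 (suc n) = size-𝟎 n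

  -- The moment, unnormalised and up to the sign in `Q`, of the product of the power sums p_k over k
  -- in the list.
  E : List ℕ → Carrier
  E ks = Ps ks Φ 𝟎

  E-1 : ∀ ks → E (1 ∷ ks) ≈ (ι N * ι N + ι (sumL ks)) * E ks
  E-1 ks = begin
    _ ≈⟨ Ps-P ks 1 Φ 𝟎 ⟩
    _ ≈⟨ Ps-cong ks P₁Φ 𝟎 ⟩
    _ ≈⟨ Ps-size ks _ Φ 𝟎 ⟩
    _ ≈⟨ *ʳ (+ˡ (reflexive (cong ι (size-𝟎 N))) » +-identityʳ _) ⟩
    _ ∎

  -- `P₂Φ` at exponent 0, where the field Σ x_i² ∂_i meets only the power sums. With `E-1` this is
  -- the pair of linear relations, constraints of Virasoro type, that later eliminates the higher
  -- times from KP.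
  E-2 : ∀ ks → E (2 ∷ ks) ≈ ι 2 * ι N * E (1 ∷ ks) + bump E ks
  E-2 ks = begin
    _ ≈⟨ Ps-P ks 2 Φ 𝟎 ⟩
    _ ≈⟨ Ps-cong ks P₂Φ 𝟎 ⟩
    _ ≈⟨ Ps-+ ks _ _ 𝟎 ⟩
    _ ≈⟨ +-cong (Ps-* ks _ _ 𝟎 » *ˡ (sym (Ps-P ks 1 Φ 𝟎))) (Ps-B ks Φ 𝟎) ⟩
    _ ≈⟨ +ˡ (+ʳ (∑-0 F (λ i → *-zeroˡ (reflexive (cong ι (lookup-𝟎 i))))) » +-identityˡ _) ⟩
    _ ∎

  E-move : ∀ pre k ks → E (pre ++ k ∷ ks) ≈ E (k ∷ pre ++ ks)
  E-move [] k ks = refl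
  E-move (l ∷ pre) k ks = trans (P-cong l (λ b → go pre b) 𝟎) (P-comm l k (Ps (pre ++ ks) Φ) 𝟎)
    where
    go : ∀ pre b → Ps (pre ++ k ∷ ks) Φ b ≈ P k (Ps (pre ++ ks) Φ) b
    go [] b = refl
    go (l ∷ pre) b = P-cong l (go pre) b » P-comm l k (Ps (pre ++ ks) Φ) b

-- Alternating functions of lists of exponents.

module Alternants (K : CommutativeRing 0ℓ 0ℓ) where

  open Kit K
  open Determinant K

  LFun : Set
  LFun = List ℕ → Carrier

  Alternating : LFun → Set
  Alternating g = ∀ pre a b as → g (pre ++ a ∷ b ∷ as) ≈ - g (pre ++ b ∷ a ∷ as)

  -- Multiplication by the power sum p_k, carried over from exponent vectors to lists of exponents
  -- of any length.
  PL : ℕ → LFun → LFun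
  PL k g [] = 0#
  PL k g (a ∷ as) = g (k N.+ a ∷ as) + PL k (g ∘ (a ∷_)) as

  PL-cong : ∀ k {g h : LFun} → (∀ as → g as ≈ h as) → ∀ as → PL k g as ≈ PL k h as
  PL-cong k e [] = refl
  PL-cong k e (a ∷ as) = +-cong (e _) (PL-cong k (e ∘ (a ∷_)) as)

  PL-* : ∀ k c (g : LFun) as → PL k (λ as → c * g as) as ≈ c * PL k g as
  PL-* k c g [] = sym (zeroʳ c)
  PL-* k c g (a ∷ as) = +ˡ (PL-* k c (g ∘ (a ∷_)) as) » sym (distribˡ _ _ _)

  PL-+ : ∀ k (g h : LFun) as → PL k (λ as → g as + h as) as ≈ PL k g as + PL k h as
  PL-+ k g h [] = sym (+-identityʳ _)
  PL-+ k g h (a ∷ as) = +ˡ (PL-+ k (g ∘ (a ∷_)) (h ∘ (a ∷_)) as) » solve 4 (λ x y z w → x :+ y :+ (z :+ w) := x :+ z :+ (y :+ w)) refl _ _ _ _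

  PL-neg : ∀ k (g : LFun) as → PL k (λ as → - g as) as ≈ - PL k g as
  PL-neg k g [] = sym -0#≈0#
  PL-neg k g (a ∷ as) = +ˡ (PL-neg k (g ∘ (a ∷_)) as) » -‿+-comm _ _

  PL-0 : ∀ k as → PL k (λ _ → 0#) as ≈ 0#
  PL-0 k [] = refl
  PL-0 k (a ∷ as) = +-zero refl (PL-0 k as)

  PL-alt : ∀ k {B : Set} (bs : List B) (F : B → List B → LFun) as → PL k (λ as → alt (λ c cs → F c cs as) bs) as ≈ alt (λ c cs → PL k (F c cs) as) bs
  PL-alt k [] F as = PL-0 k as
  PL-alt k (b ∷ bs) F as = PL-+ k (F b bs) _ as » +ˡ (PL-neg k _ as » -‿cong (PL-alt k bs (λ c cs → F c (b ∷ cs)) as))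

  PL-alternating : ∀ k g → Alternating g → Alternating (PL k g)
  PL-alternating k g alt-g [] a b as = +-cong (alt-g [] _ _ as) (+-cong (alt-g [] _ _ as) (PL-cong k (alt-g [] a b) as » PL-neg k _ as)) » solve 3 (λ x y z → :- x :+ (:- y :+ :- z) := :- (y :+ (x :+ z))) refl _ _ _
  PL-alternating k g alt-g (h ∷ pre) a b as = +-cong (alt-g (k N.+ h ∷ pre) a b as) (PL-alternating k (g ∘ (h ∷_)) (λ pre → alt-g (h ∷ pre)) pre a b as) » -‿+-comm _ _

  PLs : List ℕ → LFun → LFun
  PLs [] g = g
  PLs (k ∷ ks) g = PL k (PLs ks g)

  PLs-alternating : ∀ ks g → Alternating g → Alternating (PLs ks g)
  PLs-alternating [] g p = p
  PLs-alternating (k ∷ ks) g p = PL-alternating k _ (PLs-alternating ks g p)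

  PLs-cong : ∀ ks {g h : LFun} → (∀ as → g as ≈ h as) → ∀ as → PLs ks g as ≈ PLs ks h as
  PLs-cong [] e as = e as
  PLs-cong (k ∷ ks) e as = PL-cong k (PLs-cong ks e) as

  PLs-* : ∀ ks c (g : LFun) as → PLs ks (λ as → c * g as) as ≈ c * PLs ks g as
  PLs-* [] c g as = refl
  PLs-* (k ∷ ks) c g as = PL-cong k (PLs-* ks c g) as » PL-* k c (PLs ks g) as

  PLs-++ : ∀ ks ls (g : LFun) as → PLs (ks ++ ls) g as ≈ PLs ks (PLs ls g) as
  PLs-++ [] ls g as = refl
  PLs-++ (k ∷ ks) ls g as = PL-cong k (PLs-++ ks ls g) as

  -- The sign with which `alt` extracts an entry is the sign of moving that entry to the front, so
  -- all terms agree.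
  alt-alternating : ∀ g → Alternating g → ∀ js → alt (λ j js' → g (j ∷ js')) js ≈ ι (length js) * g js
  alt-alternating g p [] = sym (zeroˡ _)
  alt-alternating g p (j ∷ js) = begin
    _ ≈⟨ +ˡ (-‿cong (alt-cong js (λ c cs → p [] c j cs) » alt-neg js)) ⟩
    _ ≈⟨ +ˡ (-‿involutive _ » alt-alternating (g ∘ (j ∷_)) (λ pre → p (j ∷ pre)) js) ⟩
    _ ≈⟨ solve 2 (λ x n → x :+ n :* x := (:1 :+ n) :* x) refl _ _ ⟩
    _ ≈⟨ *ʳ (ι-suc (length js)) ⟨
    _ ∎

  -- altG g b js = Σ_w sgn(w) g(b + w(js))
  altG : LFun → ∀ {n} → Vec ℕ n → List ℕ → Carrier
  altG g [] [] = g []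
  altG g [] (_ ∷ _) = 0#
  altG g (x ∷ b) js = alt (λ j js' → altG (g ∘ (j N.+ x ∷_)) b js') js

  altG-𝟎 : ∀ n g → Alternating g → ∀ js → length js ≡ n → altG g (Vec.replicate n 0) js ≈ ι (n !) * g js
  altG-𝟎 zero g p [] e = sym (*-identityˡ _)
  altG-𝟎 (suc n) g p js e = begin
    _ ≈⟨ lengths js _ _ (λ j js' e' → altG-𝟎 n _ (λ pre → p (j N.+ 0 ∷ pre)) js' (NP.suc-injective (e' ∙ e)) » *ˡ (reflexive (cong (λ i → g (i ∷ js')) (NP.+-identityʳ j)))) ⟩
    _ ≈⟨ alt-* js _ ⟩
    _ ≈⟨ *ˡ (alt-alternating g p js) ⟩
    _ ≈⟨ sym (*-assoc _ _ _) » *ʳ (*-comm _ _) ⟩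
    _ ≈⟨ *ʳ (*ʳ (reflexive (cong ι e)) » sym (ι-* (suc n) (n !))) ⟩
    _ ∎
    where
    lengths : ∀ js (f h : ℕ → List ℕ → Carrier) → (∀ j js' → suc (length js') ≡ length js → f j js' ≈ h j js') → alt f js ≈ alt h js
    lengths [] f h p = refl
    lengths (j ∷ js) f h p = +-cong (p j js E.refl) (-‿cong (lengths js _ _ (λ c cs e → p c (j ∷ cs) (cong suc e))))

module ShiftAlternants (K : CommutativeRing 0ℓ 0ℓ) where

  open Kit K
  open Determinant K
  open Alternants K

  module _ (N : ℕ) where

    open Shifts K N

    P-list : ∀ k (g : LFun) b → P k (g ∘ toList) b ≈ PL k g (toList b)
    P-list k g b = go b g
      where
      go : ∀ {n} (b : Vec ℕ n) (g : LFun) → ∑ (fins n) (λ i → g (toList (addAt i k b))) ≈ PL k g (toList b)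
      go [] g = refl
      go (x ∷ b) g = ∑-fins {f = λ i → g (toList (addAt i k (x ∷ b)))} » +ˡ (go b (g ∘ (x ∷_)))

    Ps-list : ∀ ks (g : LFun) b → Ps ks (g ∘ toList) b ≈ PLs ks g (toList b)
    Ps-list [] g b = refl
    Ps-list (k ∷ ks) g b = P-cong k (Ps-list ks g) b » P-list k (PLs ks g) b

    act-P : ∀ p k φ b → act p (P k φ) b ≈ P k (act p φ) b
    act-P p k φ b = trans (act-∑ʳ p (fins N) (λ i b → φ (addAt i k b)) b) (∑-cong (fins N) (λ i → shiftk k i b))
      where
      shiftk : ∀ k i b → act p (λ b → φ (addAt i k b)) b ≈ act p φ (addAt i k b)
      shiftk zero i b = act-cong p (λ b → reflexive (cong φ (addAt-0 i b))) b » reflexive (cong (act p φ) (E.sym (addAt-0 i b)))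
      shiftk (suc k) i b = begin
        _ ≈⟨ act-cong p (λ b → reflexive (cong φ (E.sym (addAt-add i k 1 b ∙ cong (λ l → addAt i l b) (NP.+-comm k 1))))) b ⟩
        _ ≈⟨ act-shift p i _ b ⟩
        _ ≈⟨ shiftk k i (addAt i 1 b) ⟩
        _ ≡⟨ cong (act p φ) (addAt-add i k 1 b ∙ cong (λ l → addAt i l b) (NP.+-comm k 1)) ⟩
        _ ∎

    act-Ps : ∀ p ks φ b → act p (Ps ks φ) b ≈ Ps ks (act p φ) b
    act-Ps p [] φ b = refl
    act-Ps p (k ∷ ks) φ b = act-P p k (Ps ks φ) b » P-cong k (act-Ps p ks φ) b

    act-alt : ∀ {A : Set} (f : A → List A → Pol) (xs : List A) φ b → act (𝒟.alt f xs) φ b ≈ alt (λ x xs' → act (f x xs') φ b) xs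
    act-alt f [] φ b = refl
    act-alt f (x ∷ xs) φ b = +ˡ (-‿cong (act-alt _ xs φ b))

    private
      columns : List (Fin N → Pol)
      columns = 𝒟.newton (λ _ x → var x ⊞ ⊟ 𝟘) (λ _ → 𝟙) N

    from : ℕ → ℕ → List ℕ
    from j zero = []
    from j (suc n) = j ∷ from (suc j) n

    length-from : ∀ j n → length (from j n) ≡ n
    length-from j zero = E.refl
    length-from j (suc n) = cong suc (length-from (suc j) n)

    private
      Raises : (Fin N → Pol) → ℕ → Set
      Raises c j = ∀ x φ b → act (c x) φ b ≈ φ (addAt x j b)

      newton-raises : ∀ n {c j} → Raises c j → Pointwise Raises (𝒟.newton (λ _ x → var x ⊞ ⊟ 𝟘) c n) (from j n)
      newton-raises zero r = []
      newton-raises (suc n) {c} {j} r = r ∷ newton-raises n (λ x φ b → +ˡ -0#≈0# » +-identityʳ _ » r x φ _ » reflexive (cong φ (addAt-add x j 1 b ∙ cong (λ l → addAt x l b) (NP.+-comm j 1))))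

      alt-Pointwise : ∀ {A B : Set} {S : A → B → Set} {xs ys} {f : A → List A → Carrier} {h : B → List B → Carrier} → Pointwise S xs ys → (∀ {x xs y ys} → S x y → Pointwise S xs ys → f x xs ≈ h y ys) → alt f xs ≈ alt h ys
      alt-Pointwise [] e = refl
      alt-Pointwise (r ∷ rs) e = +-cong (e r rs) (-‿cong (alt-Pointwise rs (λ s ss → e s (r ∷ ss))))

      -- Expansion of det (x_i^j) row by row, one row for each variable: the chosen entry x^j raises
      -- the exponent of the first variable by j, that exponent is frozen into `ctx`, and the
      -- remaining rows act on the remaining variables.
      act-det : ∀ n (e : Fin n → Fin N) (ctx : Vec ℕ n → Vec ℕ N) → (∀ i k b → addAt (e i) k (ctx b) ≡ ctx (addAt i k b)) → ∀ φ g → (∀ b → φ (ctx b) ≈ g (toList b)) → ∀ {cs js} → Pointwise Raises cs js → ∀ b →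
                act (𝒟.det (flip 𝒟.ev) (map e (fins n)) cs) φ (ctx b) ≈ altG g b js
      act-det zero e ctx add φ g φ≈g [] [] = φ≈g []
      act-det zero e ctx add φ g φ≈g (r ∷ rs) [] = refl
      act-det (suc n) e ctx add φ g φ≈g {cs} {js} rs (x ∷ b) = act-alt _ cs φ (ctx (x ∷ b)) » alt-Pointwise rs (λ {c} {cs} {j} {js} r rs → begin
          _ ≈⟨ r (e zero) _ _ ⟩
          _ ≡⟨ cong₂ (λ xs v → act (𝒟.det (flip 𝒟.ev) xs cs) φ v) (E.sym (map-∘ (fins n))) (add zero j (x ∷ b)) ⟩
          _ ≈⟨ act-det n (e ∘ suc) (ctx ∘ (j N.+ x ∷_)) (λ i k b → add (suc i) k (j N.+ x ∷ b)) φ _ (λ b → φ≈g (j N.+ x ∷ b)) rs b ⟩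
          _ ∎)

    V : Pol
    V = 𝒟.vand var (fins N)

    act-V : ∀ φ g → (∀ b → φ b ≈ g (toList b)) → ∀ b → act V φ b ≈ altG g b (from 0 N)
    act-V φ g φ≈g b = begin
      _ ≈⟨ at (𝒫.trans (𝒫.sym (𝒟.vandermonde var (λ _ → 𝟘) (fins N))) (𝒟.det-transpose 𝒟.ev _ (fins N))) φ b ⟩
      _ ≡⟨ cong₂ (λ xs n → act (𝒟.det (flip 𝒟.ev) xs (𝒟.newton (λ _ x → var x ⊞ ⊟ 𝟘) (λ _ → 𝟙) n)) φ b) (E.sym (map-id (fins N))) (length-fins N) ⟩
      _ ≈⟨ act-det N id id (λ i k b → E.refl) φ g φ≈g (newton-raises N (λ x φ b → reflexive (cong φ (E.sym (addAt-0 x b))))) b ⟩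
      _ ∎

    -- The matrix entry (j + a)! is the moment of x^(j+a) against e^(-x), so this is the functional
    -- applied to one Vandermonde factor times the monomial with exponents `as`.
    moments : LFun
    moments as = det (λ a j → ι ((j N.+ a) !)) as (from 0 N)

    factL : LFun
    factL [] = 1#
    factL (a ∷ as) = ι (a !) * factL as

    altG-facts : ∀ {n} (b : Vec ℕ n) js → altG factL b js ≈ det (λ a j → ι ((j N.+ a) !)) (toList b) js
    altG-facts [] [] = refl
    altG-facts [] (_ ∷ _) = refl
    altG-facts (x ∷ b) js = alt-cong js (λ j js' → altG-* b (ι ((j N.+ x) !)) factL js' » *ˡ (altG-facts b js'))
      where
      altG-* : ∀ {n} (b : Vec ℕ n) c g js → altG (λ as → c * g as) b js ≈ c * altG g b js
      altG-* [] c g [] = refl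
      altG-* [] c g (_ ∷ _) = sym (zeroʳ c)
      altG-* (x ∷ b) c g js = alt-cong js (λ j js' → altG-* b c _ js') » alt-* js c

    -- The alternating function V φ₀ integrates against the second Vandermonde factor to N! times its value at (0,…,N-1).
    E-moments : Σ Bool λ s → ∀ ks → E ks ≈ Products.signed K s (ι (N !) * PLs ks moments (from 0 N))
    E-moments with 𝒬.∏-gap N var
    ... | s , e = s , λ ks → begin
      _ ≈⟨ Ps-cong ks (λ b → at e facts b » signed-act s (V ⊠ V) facts b) 𝟎 ⟩
      _ ≈⟨ Ps-signed s ks (act V (act V facts)) ⟩
      _ ≈⟨ signed-cong s (begin
        _ ≈⟨ act-Ps V ks (act V facts) 𝟎 ⟨
        _ ≈⟨ act-V _ (PLs ks moments) (λ b → Ps-cong ks V-facts b » Ps-list ks moments b) 𝟎 ⟩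
        _ ≈⟨ altG-𝟎 N (PLs ks moments) (PLs-alternating ks moments (λ pre a b as → det-swap _ pre a b as (from 0 N))) (from 0 N) (length-from 0 N) ⟩
        ι (N !) * PLs ks moments (from 0 N) ∎) ⟩
      _ ∎
      where
      signed-cong : ∀ s {x y} → x ≈ y → Products.signed K s x ≈ Products.signed K s y
      signed-cong true p = p
      signed-cong false p = -‿cong p
      signed-act : ∀ s p φ b → act (𝒬.signed s p) φ b ≈ Products.signed K s (act p φ b)
      signed-act true p φ b = refl
      signed-act false p φ b = refl
      Ps-signed : ∀ s ks φ → Ps ks (λ b → Products.signed K s (φ b)) 𝟎 ≈ Products.signed K s (Ps ks φ 𝟎)
      Ps-signed true ks φ = refl
      Ps-signed false ks φ = Ps-cong ks (λ b → solve 1 (λ x → :- x := (:- :1) :* x) refl (φ b)) 𝟎 » Ps-* ks (- 1#) φ 𝟎 » solve 1 (λ x → (:- :1) :* x := :- x) refl _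
      facts-list : ∀ {n} (b : Vec ℕ n) → facts b ≈ factL (toList b)
      facts-list [] = refl
      facts-list (x ∷ b) = *ˡ (facts-list b)
      V-facts : ∀ b → act V facts b ≈ moments (toList b)
      V-facts b = act-V facts factL facts-list b » altG-facts b (from 0 N)

    -- Takes the place of being nonzero, as the ring is not assumed to be a domain.
    Regular : Carrier → Set
    Regular x = ∀ {y} → x * y ≈ 0# → y ≈ 0#

    Regular-* : ∀ {x y} → Regular x → Regular y → Regular (x * y)
    Regular-* p q e = q (p (sym (*-assoc _ _ _) » e))

    Regular-cong : ∀ {x y} → x ≈ y → Regular x → Regular y
    Regular-cong e p q = p (*ʳ e » q)

    private
      det-Pointwise : ∀ {A A' B : Set} {p : A → B → Carrier} {q : A' → B → Carrier} {as as'} → Pointwise (λ a a' → ∀ b → p a b ≈ q a' b) as as' → ∀ bs → det p as bs ≈ det q as' bs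
      det-Pointwise [] [] = refl
      det-Pointwise [] (_ ∷ _) = refl
      det-Pointwise (r ∷ rs) bs = alt-cong bs (λ c cs → *-cong (r c) (det-Pointwise rs cs))

      rising : ∀ n j (l : ℕ → Carrier) {c} → (∀ i → l i ≈ - ι (suc (j N.+ i))) → (∀ a → ι ((j N.+ a) !) ≈ ι (a !) * c a) → Pointwise (λ i c → ∀ a → ι ((i N.+ a) !) ≈ c a) (from j n) (map ((λ a → ι (a !)) ⊙_) (newton (λ i a → ι a - l i) c n))
      rising zero j l l≈ e = []
      rising (suc n) j l {c} l≈ e = e ∷ rising n (suc j) (l ∘ suc) (λ i → l≈ (suc i) » -‿cong (reflexive (cong (ι ∘ suc) (NP.+-suc j i)))) (λ a → begin
          _ ≈⟨ ι-* (suc (j N.+ a)) ((j N.+ a) !) ⟩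
          _ ≈⟨ *-cong (ι-+ (suc j) a » +ʳ (reflexive (cong (ι ∘ suc) (E.sym (NP.+-identityʳ j))))) (e a) ⟩
          _ ≈⟨ solve 4 (λ s x f c → (s :+ x) :* (f :* c) := f :* ((x :- :- s) :* c)) refl _ _ _ _ ⟩
          _ ≈⟨ *ˡ (*ʳ (+ˡ (-‿cong (sym (l≈ 0))))) ⟩
          _ ∎)

    moments-product : ∀ as → length as ≡ N → moments as ≈ ∏ as (λ a → ι (a !)) * vand ι as
    moments-product as E.refl = begin
      _ ≈⟨ det-transpose _ as _ ⟩
      _ ≈⟨ det-Pointwise (rising (length as) 0 (λ i → - ι (suc i)) (λ i → refl) (λ a → sym (*-identityʳ _))) as ⟩
      _ ≈⟨ det-scale (λ a → ι (a !)) (newton (λ i a → ι a - - ι (suc i)) (λ _ → 1#) (length as)) as ⟩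
      _ ≈⟨ *ˡ (vandermonde ι (λ i → - ι (suc i)) as) ⟩
      _ ∎

-- Permutations as injective maps, transpositions, deletion of a point

Inj : ∀ {m n} → (Fin m → Fin n) → Set
Inj f = ∀ x y → f x ≡ f y → x ≡ y

inj? : ∀ {m n} (f : Fin m → Fin n) → Dec (Inj f)
inj? f = FP.all? (λ x → FP.all? (λ y → (f x FP.≟ f y) →-dec (x FP.≟ y)))

Inv : ∀ {N m} → (Fin m → Fin m) → Vec (Fin N) m → Set
Inv f c = ∀ x → lookup c (f x) ≡ lookup c x

inv? : ∀ {N m} (f : Fin m → Fin m) (c : Vec (Fin N) m) → Dec (Inv f c)
inv? f c = FP.all? (λ x → lookup c (f x) FP.≟ lookup c x)

Inj-cong : ∀ {m n} {f g : Fin m → Fin n} → (∀ x → f x ≡ g x) → Inj f → Inj g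
Inj-cong e i x y p = i x y (e x ∙ p ∙ E.sym (e y))

Inj-∘ : ∀ {l m n} {f : Fin m → Fin n} {g : Fin l → Fin m} → Inj f → Inj g → Inj (f ∘ g)
Inj-∘ i j x y p = j x y (i _ _ p)

Inj⇒surjective : ∀ {m} (f : Fin m → Fin m) → Inj f → ∀ y → ∃ λ x → f x ≡ y
Inj⇒surjective {suc m} f i y with FP.any? (λ x → f x FP.≟ y)
... | yes p = p
... | no ¬p = ⊥-elim (NP.<-irrefl E.refl (FP.injective⇒≤ {f = λ x → punchOut (missed x)} (λ {x} {z} e → i x z (FP.punchOut-injective (missed x) (missed z) e))))
  where
  missed : ∀ x → y ≢ f x
  missed x y≡fx = ¬p (x , E.sym y≡fx)

vec-ext : ∀ {A : Set} {m} {u v : Vec A m} → (∀ x → lookup u x ≡ lookup v x) → u ≡ v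
vec-ext {u = u} {v} e = E.sym (tabulate∘lookup u) ∙ tabulate-cong e ∙ tabulate∘lookup v

-- Transpositions, and deletion of the point 0 from its cycle.

abstract

  tr : ∀ {m} → Fin m → Fin m → Fin m → Fin m
  tr a b x with x FP.≟ a | x FP.≟ b
  ... | yes _ | _ = b
  ... | no _ | yes _ = a
  ... | no _ | no _ = x

  tr-left : ∀ {m} (a b : Fin m) → tr a b a ≡ b
  tr-left a b with a FP.≟ a
  ... | yes _ = E.refl
  ... | no q = ⊥-elim (q E.refl)

  tr-right : ∀ {m} (a b : Fin m) → tr a b b ≡ a
  tr-right a b with b FP.≟ a | b FP.≟ b
  ... | yes e | _ = e
  ... | no _ | yes _ = E.refl
  ... | no _ | no q = ⊥-elim (q E.refl)

  tr-other : ∀ {m} {a b x : Fin m} → x ≢ a → x ≢ b → tr a b x ≡ x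
  tr-other {a = a} {b} {x} p q with x FP.≟ a | x FP.≟ b
  ... | yes e | _ = ⊥-elim (p e)
  ... | no _ | yes e = ⊥-elim (q e)
  ... | no _ | no _ = E.refl

data TrView {m} (a b x : Fin m) : Set where
  left : x ≡ a → tr a b x ≡ b → TrView a b x
  right : x ≢ a → x ≡ b → tr a b x ≡ a → TrView a b x
  other : x ≢ a → x ≢ b → tr a b x ≡ x → TrView a b x

trView : ∀ {m} (a b x : Fin m) → TrView a b x
trView a b x with x FP.≟ a | x FP.≟ b
... | yes E.refl | _ = left E.refl (tr-left a b)
... | no p | yes E.refl = right p E.refl (tr-right a b)
... | no p | no q = other p q (tr-other p q)

tr-involutive : ∀ {m} (a b x : Fin m) → tr a b (tr a b x) ≡ x
tr-involutive a b x with trView a b x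
... | left E.refl e = cong (tr a b) e ∙ tr-right a b
... | right _ E.refl e = cong (tr a b) e ∙ tr-left a b
... | other p q e = cong (tr a b) e ∙ e

Inj-tr : ∀ {m} (a b : Fin m) → Inj (tr a b)
Inj-tr a b x y e = E.sym (tr-involutive a b x) ∙ cong (tr a b) e ∙ tr-involutive a b y

drop : ∀ {m} → Fin (suc m) → Fin m → Fin m
drop zero y = y
drop (suc x) y = x

-- A point sent to 0 is sent on to f 0. The innermost x is a default for the case that f also fixes
-- 0, which injectivity excludes.
rem : ∀ {m} → (Fin (suc m) → Fin (suc m)) → Fin m → Fin m
rem f x = drop (f (suc x)) (drop (f zero) x)

ext : ∀ {m} → (Fin m → Fin m) → Fin (suc m) → Fin (suc m)
ext f zero = zero
ext f (suc x) = suc (f x)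

rem-suc : ∀ {m} (f : Fin (suc m) → Fin (suc m)) {x y} → f (suc x) ≡ suc y → rem f x ≡ y
rem-suc f e rewrite e = E.refl

rem-zero : ∀ {m} (f : Fin (suc m) → Fin (suc m)) {x y} → f (suc x) ≡ zero → f zero ≡ suc y → rem f x ≡ y
rem-zero f e e' rewrite e | e' = E.refl

data RemView {m} (f : Fin (suc m) → Fin (suc m)) (x : Fin m) : Set where
  via : ∀ y → f (suc x) ≡ zero → f zero ≡ suc y → rem f x ≡ y → RemView f x
  dir : ∀ y → f (suc x) ≡ suc y → rem f x ≡ y → RemView f x

remView : ∀ {m} (f : Fin (suc m) → Fin (suc m)) → Inj f → ∀ x → RemView f x
remView f i x with f (suc x) in e | f zero in e'
... | suc y | _ = dir y e (rem-suc f e)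
... | zero | suc y = via y e e' (rem-zero f e e')
... | zero | zero with i _ _ (e ∙ E.sym e')
... | ()

rem-cong : ∀ {m} {f g : Fin (suc m) → Fin (suc m)} → (∀ x → f x ≡ g x) → ∀ x → rem f x ≡ rem g x
rem-cong e x = cong₂ (λ a b → drop a (drop b x)) (e (suc x)) (e zero)

Inj-rem : ∀ {m} (f : Fin (suc m) → Fin (suc m)) → Inj f → Inj (rem f)
Inj-rem f i x y e with remView f i x | remView f i y
... | dir u p r | dir v q s = FP.suc-injective (i _ _ (p ∙ cong suc (E.sym r ∙ e ∙ s) ∙ E.sym q))
... | via u p o r | via v q o' s = FP.suc-injective (i _ _ (p ∙ E.sym q))
... | dir u p r | via v q o s with i _ _ (p ∙ cong suc (E.sym r ∙ e ∙ s) ∙ E.sym o)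
... | ()
Inj-rem f i x y e | via u p o r | dir v q s with i _ _ (q ∙ cong suc (E.sym s ∙ E.sym e ∙ r) ∙ E.sym o)
... | ()

Inj-ext : ∀ {m} {f : Fin m → Fin m} → Inj f → Inj (ext f)
Inj-ext i zero zero e = E.refl
Inj-ext i (suc x) (suc y) e = cong suc (i x y (FP.suc-injective e))

rem-ext∘ : ∀ {m} (σ : Fin m → Fin m) (ρ : Fin (suc m) → Fin (suc m)) → Inj ρ → ∀ x → rem (ext σ ∘ ρ) x ≡ σ (rem ρ x)
rem-ext∘ σ ρ i x with remView ρ i x
... | dir y p r = rem-suc (ext σ ∘ ρ) (cong (ext σ) p) ∙ cong σ (E.sym r)
... | via y p o r = rem-zero (ext σ ∘ ρ) (cong (ext σ) p) (cong (ext σ) o) ∙ cong σ (E.sym r)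

ext-rem : ∀ {m} (f : Fin (suc m) → Fin (suc m)) → Inj f → f zero ≡ zero → ∀ x → ext (rem f) x ≡ f x
ext-rem f i e zero = E.sym e
ext-rem f i e (suc x) with remView f i x
... | dir y p r = cong suc r ∙ E.sym p
... | via y p o r with E.trans (E.sym e) o
... | ()

-- Composing with the transposition (0 j) acts on the deletion of 0 as follows.

rem-tr-self : ∀ {m} (j : Fin (suc m)) x → rem (tr zero j) x ≡ x
rem-tr-self j x with trView zero j (suc x)
... | right _ E.refl e = rem-zero (tr zero j) e (tr-left zero j)
... | other _ _ e = rem-suc (tr zero j) e

rem-tr-fixed : ∀ {m} (π : Fin (suc m) → Fin (suc m)) → Inj π → ∀ j → π zero ≡ zero → ∀ x → rem (tr zero j ∘ π) x ≡ rem π x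
rem-tr-fixed π i j e x with remView π i x
... | via y p o r with E.trans (E.sym e) o
... | ()
rem-tr-fixed π i j e x | dir y p r with trView zero j (suc y)
... | right _ E.refl t = rem-zero (tr zero j ∘ π) (cong (tr zero j) p ∙ t) (cong (tr zero j) e ∙ tr-left zero j) ∙ E.sym r
... | other _ _ t = rem-suc (tr zero j ∘ π) (cong (tr zero j) p ∙ t) ∙ E.sym r

rem-tr-same : ∀ {m} (π : Fin (suc m) → Fin (suc m)) → Inj π → ∀ f → π zero ≡ suc f → ∀ x → rem (tr zero (suc f) ∘ π) x ≡ rem π x
rem-tr-same π i f e x with remView π i x
... | via y p o r = rem-suc (tr zero (suc f) ∘ π) (cong (tr zero (suc f)) p ∙ tr-left zero (suc f)) ∙ FP.suc-injective (E.sym e ∙ o) ∙ E.sym r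
... | dir y p r with trView zero (suc f) (suc y)
... | right _ E.refl t with i _ _ (p ∙ E.sym e)
... | ()
rem-tr-same π i f e x | dir y p r | other _ _ t = rem-suc (tr zero (suc f) ∘ π) (cong (tr zero (suc f)) p ∙ t) ∙ E.sym r

rem-tr-other : ∀ {m} (π : Fin (suc m) → Fin (suc m)) → Inj π → ∀ f → π zero ≡ suc f → ∀ j → j ≢ f → ∀ x → rem (tr zero (suc j) ∘ π) x ≡ tr j f (rem π x)
rem-tr-other π i f e j j≢f x with remView π i x
... | via y p o r with FP.suc-injective (E.sym e ∙ o)
... | E.refl = rem-suc (tr zero (suc j) ∘ π) (cong (tr zero (suc j)) p ∙ tr-left zero (suc j)) ∙ E.sym (cong (tr j f) r ∙ tr-right j f)
rem-tr-other π i f e j j≢f x | dir y p r with trView zero (suc j) (suc y)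
... | right _ E.refl t = rem-zero (tr zero (suc j) ∘ π) (cong (tr zero (suc j)) p ∙ t) (cong (tr zero (suc j)) e ∙ tr-other {a = zero} {suc j} (λ ()) (λ e → j≢f (E.sym (FP.suc-injective e)))) ∙ E.sym (cong (tr j f) r ∙ tr-left j f)
... | other _ q t = E.trans (rem-suc (tr zero (suc j) ∘ π) (cong (tr zero (suc j)) p ∙ t)) (E.sym (cong (tr j f) r ∙ tr-other (q ∘ cong suc) y≢f))
  where
  y≢f : y ≢ f
  y≢f E.refl with i _ _ (p ∙ E.sym e)
  ... | ()

-- Colourings invariant under a permutation.

Inv-fixed : ∀ {N m} (f : Fin (suc m) → Fin (suc m)) → Inj f → f zero ≡ zero → ∀ (i : Fin N) d → (Inv f (i ∷ d) → Inv (rem f) d) × (Inv (rem f) d → Inv f (i ∷ d))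
Inv-fixed f inj e i d = to , from
  where
  to : Inv f (i ∷ d) → Inv (rem f) d
  to inv x with remView f inj x
  ... | dir y p r = cong (lookup d) r ∙ cong (lookup (i ∷ d)) (E.sym p) ∙ inv (suc x)
  ... | via y p o r with E.trans (E.sym e) o
  ... | ()
  from : Inv (rem f) d → Inv f (i ∷ d)
  from inv zero = cong (lookup (i ∷ d)) e
  from inv (suc x) with remView f inj x
  ... | dir y p r = cong (lookup (i ∷ d)) p ∙ cong (lookup d) (E.sym r) ∙ inv x
  ... | via y p o r with E.trans (E.sym e) o
  ... | ()

Inv-moved : ∀ {N m} (f : Fin (suc m) → Fin (suc m)) → Inj f → ∀ y → f zero ≡ suc y → ∀ (i : Fin N) d → (Inv f (i ∷ d) → i ≡ lookup d y × Inv (rem f) d) × (i ≡ lookup d y × Inv (rem f) d → Inv f (i ∷ d))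
Inv-moved f inj y e i d = to , from
  where
  to : Inv f (i ∷ d) → i ≡ lookup d y × Inv (rem f) d
  to inv = i≡ , go
    where
    i≡ : i ≡ lookup d y
    i≡ = E.sym (inv zero) ∙ cong (lookup (i ∷ d)) e
    go : Inv (rem f) d
    go x with remView f inj x
    ... | dir z p r = cong (lookup d) r ∙ cong (lookup (i ∷ d)) (E.sym p) ∙ inv (suc x)
    ... | via z p o r = cong (lookup d) (r ∙ FP.suc-injective (E.sym o ∙ e)) ∙ E.sym i≡ ∙ cong (lookup (i ∷ d)) (E.sym p) ∙ inv (suc x)
  from : i ≡ lookup d y × Inv (rem f) d → Inv f (i ∷ d)
  from (i≡ , inv) zero = cong (lookup (i ∷ d)) e ∙ E.sym i≡
  from (i≡ , inv) (suc x) with remView f inj x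
  ... | dir z p r = cong (lookup (i ∷ d)) p ∙ cong (lookup d) (E.sym r) ∙ inv x
  ... | via z p o r = cong (lookup (i ∷ d)) p ∙ i≡ ∙ cong (lookup d) (FP.suc-injective (E.sym e ∙ o) ∙ E.sym r) ∙ inv x

Inv-cong : ∀ {N m} {f g : Fin m → Fin m} (c : Vec (Fin N) m) → (∀ x → f x ≡ g x) → Inv f c → Inv g c
Inv-cong c e inv x = cong (lookup c) (E.sym (e x)) ∙ inv x

-- Cycle weights and the sum over the first permutation

module Colourings (K : CommutativeRing 0ℓ 0ℓ) (N : ℕ) where

  open Kit K

  colours : ∀ m → List (Vec (Fin N) m)
  colours m = vecs (fins N) m

  ∑inv : ∀ {m} → (Fin m → Fin m) → (Vec (Fin N) m → Carrier) → Carrier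
  ∑inv {m} f G = ∑ (colours m) (λ c → [ inv? f c ] * G c)

  ∑inv-cong : ∀ {m} {f g : Fin m → Fin m} {G H : Vec (Fin N) m → Carrier} → (∀ x → f x ≡ g x) → (∀ c → G c ≈ H c) → ∑inv f G ≈ ∑inv g H
  ∑inv-cong {m} {f} {g} e e' = ∑-cong (colours m) (λ c → *-cong ([]-⇔ (inv? f c) (inv? g c) (Inv-cong c e) (Inv-cong c (λ x → E.sym (e x)))) (e' c))

  ∑inv-fixed : ∀ {m} (f : Fin (suc m) → Fin (suc m)) → Inj f → f zero ≡ zero → ∀ G → ∑inv f G ≈ ∑inv (rem f) (λ d → ∑ (fins N) (λ i → G (i ∷ d)))
  ∑inv-fixed {m} f inj e G = begin
    _ ≈⟨ ∑-vecs (fins N) m ⟩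
    _ ≈⟨ ∑-cong (fins N) (λ i → ∑-cong (colours m) (λ d → *ʳ ([]-⇔ (inv? f (i ∷ d)) (inv? (rem f) d) (proj₁ (Inv-fixed f inj e i d)) (proj₂ (Inv-fixed f inj e i d))))) ⟩
    _ ≈⟨ ∑-swap (fins N) (colours m) ⟩
    _ ≈⟨ ∑-cong (colours m) (λ d → ∑-*ˡ (fins N) _) ⟩
    _ ∎

  ∑inv-moved : ∀ {m} (f : Fin (suc m) → Fin (suc m)) → Inj f → ∀ y → f zero ≡ suc y → ∀ G → ∑inv f G ≈ ∑inv (rem f) (λ d → G (lookup d y ∷ d))
  ∑inv-moved {m} f inj y e G = begin
    _ ≈⟨ ∑-vecs (fins N) m ⟩
    _ ≈⟨ ∑-cong (fins N) (λ i → ∑-cong (colours m) (λ d → *ʳ (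
           ([]-⇔ (inv? f (i ∷ d)) ((i FP.≟ lookup d y) ×-dec inv? (rem f) d) (proj₁ (Inv-moved f inj y e i d)) (proj₂ (Inv-moved f inj y e i d))) »
           ([]-× (i FP.≟ lookup d y) (inv? (rem f) d))) » *-assoc _ _ _)) ⟩
    _ ≈⟨ ∑-swap (fins N) (colours m) ⟩
    _ ≈⟨ ∑-cong (colours m) (λ d → ∑-δ (finE N) (lookup d y) (λ i → i FP.≟ lookup d y) E.refl (λ _ → id)) ⟩
    _ ∎

  -- w f = N^(number of cycles of f)
  w : ∀ {m} → (Fin m → Fin m) → Carrier
  w {m} f = ∑inv f (λ _ → 1#)

  w-cong : ∀ {m} {f g : Fin m → Fin m} → (∀ x → f x ≡ g x) → w f ≈ w g
  w-cong e = ∑inv-cong e (λ _ → refl)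

  w-fixed : ∀ {m} (f : Fin (suc m) → Fin (suc m)) → Inj f → f zero ≡ zero → w f ≈ ι N * w (rem f)
  w-fixed {m} f inj e = ∑inv-fixed f inj e _ » ∑-cong (colours m) (λ d → *ˡ (∑-fins-const N 1#) » *-comm₃ _ _ _) » ∑-*ˡ (colours m) (ι N)

  w-moved : ∀ {m} (f : Fin (suc m) → Fin (suc m)) → Inj f → ∀ y → f zero ≡ suc y → w f ≈ w (rem f)
  w-moved f inj y e = ∑inv-moved f inj y e _

  ∑inj : ∀ m → ((Fin m → Fin m) → Carrier) → Carrier
  ∑inj m G = ∑ (vecs (fins m) m) (λ σ → [ inj? (lookup σ) ] * G (lookup σ))

  ∑inj-cong : ∀ {m} {G H : (Fin m → Fin m) → Carrier} → (∀ f → Inj f → G f ≈ H f) → ∑inj m G ≈ ∑inj m H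
  ∑inj-cong {m} e = ∑-cong (vecs (fins m) m) (λ σ → []-*-cong (inj? (lookup σ)) (e (lookup σ)))

  ∑inj-* : ∀ m c {G : (Fin m → Fin m) → Carrier} → ∑inj m (λ f → c * G f) ≈ c * ∑inj m G
  ∑inj-* m c = ∑-cong (vecs (fins m) m) (λ σ → *-comm₃ _ _ _) » ∑-*ˡ (vecs (fins m) m) c

  -- A permutation of {0,…,m} is uniquely ext σ ∘ (0 j), where j is the preimage of 0.
  ∑inj-suc : ∀ m (G : (Fin (suc m) → Fin (suc m)) → Carrier) → (∀ {f g} → (∀ x → f x ≡ g x) → G f ≈ G g) → ∑inj (suc m) G ≈ ∑ (fins (suc m)) (λ j → ∑inj m (λ σ → G (ext σ ∘ tr zero j)))
  ∑inj-suc m G G-cong = begin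
    _ ≈⟨ ∑-cong V' (λ σ → []-*-cong (inj? (lookup σ)) (λ i → let (j , e) = Inj⇒surjective (lookup σ) i zero in
           sym (∑-δ (finE (suc m)) j (λ k → lookup σ k FP.≟ zero) e (λ k e' → i k j (e' ∙ E.sym e))))) ⟩
    _ ≈⟨ ∑-cong V' (λ σ → sym (∑-*ˡ (fins (suc m)) _)) » ∑-swap V' (fins (suc m)) ⟩
    _ ≈⟨ ∑-cong (fins (suc m)) (λ j → ∑-cong V' (λ σ → sym (*-assoc _ _ _) » *ʳ (sym ([]-× (inj? (lookup σ)) (lookup σ j FP.≟ zero)))) » step j) ⟩
    _ ∎
    where
    V' = vecs (fins (suc m)) (suc m)
    step : ∀ j → ∑ V' (λ σ → [ inj? (lookup σ) ×-dec (lookup σ j FP.≟ zero) ] * G (lookup σ)) ≈ ∑inj m (λ σ → G (ext σ ∘ tr zero j))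
    step j = ∑-reindex (vecE (finE (suc m)) (suc m)) (vecE (finE m) m) (λ σ → inj? (lookup σ) ×-dec (lookup σ j FP.≟ zero)) (λ σ → inj? (lookup σ)) to from
      (λ σ p → Inj-cong (λ x → E.sym (lookup-to σ x)) (Inj-rem (lookup σ ∘ tr zero j) (Inj-∘ (proj₁ p) (Inj-tr zero j))))
      (λ σ i → Inj-cong (λ x → E.sym (lookup-from σ x)) (Inj-∘ {f = ext (lookup σ)} (Inj-ext i) (Inj-tr zero j)) , lookup-from σ j ∙ cong (ext (lookup σ)) (tr-right zero j))
      (λ σ p → vec-ext (λ x → lookup-from (to σ) x ∙ ext-cong (lookup-to σ) (tr zero j x) ∙ ext-rem (lookup σ ∘ tr zero j) (Inj-∘ (proj₁ p) (Inj-tr zero j)) (cong (lookup σ) (tr-left zero j) ∙ proj₂ p) (tr zero j x) ∙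
           cong (lookup σ) (tr-involutive zero j x)))
      (λ σ i → vec-ext (λ x → lookup-to (from σ) x ∙ rem-cong (λ y → lookup-from σ (tr zero j y) ∙ cong (ext (lookup σ)) (tr-involutive zero j y)) x))
      (λ σ i → G-cong (lookup-from σ))
      where
      to : Vec (Fin (suc m)) (suc m) → Vec (Fin m) m
      to σ = tabulate (rem (lookup σ ∘ tr zero j))
      from : Vec (Fin m) m → Vec (Fin (suc m)) (suc m)
      from σ = tabulate (ext (lookup σ) ∘ tr zero j)
      lookup-to : ∀ σ x → lookup (to σ) x ≡ rem (lookup σ ∘ tr zero j) x
      lookup-to σ = lookup∘tabulate (rem (lookup σ ∘ tr zero j))
      lookup-from : ∀ σ x → lookup (from σ) x ≡ ext (lookup σ) (tr zero j x)
      lookup-from σ = lookup∘tabulate (ext (lookup σ) ∘ tr zero j)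
      ext-cong : ∀ {f g : Fin m → Fin m} → (∀ x → f x ≡ g x) → ∀ x → ext f x ≡ ext g x
      ext-cong e zero = E.refl
      ext-cong e (suc x) = cong suc (e x)

  -- The sum of N^(z(σ)+z(σπ)) over σ. Its recursion in π, by deleting the point 0, is the one to be
  -- matched with the moments of power sums.
  M : ∀ {m} → (Fin m → Fin m) → Carrier
  M {m} π = ∑inj m (λ σ → w σ * w (σ ∘ π))

  private
    M-split : ∀ {m} (π : Fin (suc m) → Fin (suc m)) → M π ≈ ∑ (fins (suc m)) (λ j → ∑inj m (λ σ → w (ext σ ∘ tr zero j) * w (ext σ ∘ tr zero j ∘ π)))
    M-split {m} π = ∑inj-suc m (λ σ → w σ * w (σ ∘ π)) (λ {f} {g} e → *-cong (w-cong {f = f} {g} e) (w-cong {f = f ∘ π} {g ∘ π} (λ x → e (π x))))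

    w-ext-fixed : ∀ {m} (σ : Fin m → Fin m) (ρ : Fin (suc m) → Fin (suc m)) {ρ'} → Inj σ → Inj ρ → ρ zero ≡ zero → (∀ x → rem ρ x ≡ ρ' x) → w (ext σ ∘ ρ) ≈ ι N * w (σ ∘ ρ')
    w-ext-fixed σ ρ i j e r = w-fixed (ext σ ∘ ρ) (Inj-∘ (Inj-ext i) j) (cong (ext σ) e) » *ˡ (w-cong (λ x → rem-ext∘ σ ρ j x ∙ cong σ (r x)))

    w-ext-moved : ∀ {m} (σ : Fin m → Fin m) (ρ : Fin (suc m) → Fin (suc m)) {ρ'} {y} → Inj σ → Inj ρ → ρ zero ≡ suc y → (∀ x → rem ρ x ≡ ρ' x) → w (ext σ ∘ ρ) ≈ w (σ ∘ ρ')
    w-ext-moved σ ρ {y = y} i j e r = w-moved (ext σ ∘ ρ) (Inj-∘ (Inj-ext i) j) (σ y) (cong (ext σ) e) » w-cong (λ x → rem-ext∘ σ ρ j x ∙ cong σ (r x))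

  -- Write a permutation as `ext` σ composed with (0 j). For j = 0 the point 0 is fixed by both
  -- permutations and contributes N²; for each of the other m values of j it lies on a longer cycle
  -- of both and can be deleted without changing the numbers of cycles.
  M-fixed : ∀ {m} (π : Fin (suc m) → Fin (suc m)) → Inj π → π zero ≡ zero → M π ≈ (ι N * ι N + ι m) * M (rem π)
  M-fixed {m} π i e = begin
    _ ≈⟨ M-split π » ∑-fins {m} {λ j → ∑inj m (λ σ → w (ext σ ∘ tr zero j) * w (ext σ ∘ tr zero j ∘ π))} ⟩
    ∑inj m (λ σ → w (ext σ ∘ tr zero zero) * w (ext σ ∘ tr zero zero ∘ π))
      + ∑ (fins m) (λ j → ∑inj m (λ σ → w (ext σ ∘ tr zero (suc j)) * w (ext σ ∘ tr zero (suc j) ∘ π)))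
      ≈⟨ +-cong (∑inj-cong {m} {H = λ σ → ι N * ι N * (w σ * w (σ ∘ rem π))} (λ σ s → *-cong (w-ext-fixed σ (tr zero zero) s (Inj-tr zero zero) (tr-left zero zero) (rem-tr-self zero))
               (w-ext-fixed σ (tr zero zero ∘ π) s (Inj-∘ (Inj-tr zero zero) i) (cong (tr zero zero) e ∙ tr-left zero zero) (rem-tr-fixed π i zero e)) »
               solve 3 (λ n a b → n :* a :* (n :* b) := n :* n :* (a :* b)) refl _ _ _) »
             ∑inj-* m (ι N * ι N) {λ σ → w σ * w (σ ∘ rem π)})
           (∑-cong (fins m) (λ j → ∑inj-cong {m} (λ σ s → *-cong (w-ext-moved σ (tr zero (suc j)) s (Inj-tr zero (suc j)) (tr-left zero (suc j)) (rem-tr-self (suc j)))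
               (w-ext-moved σ (tr zero (suc j) ∘ π) s (Inj-∘ (Inj-tr zero (suc j)) i) (cong (tr zero (suc j)) e ∙ tr-left zero (suc j)) (rem-tr-fixed π i (suc j) e)))) »
             ∑-fins-const m _) ⟩
    _ ≈⟨ distribʳ _ _ _ ⟨
    _ ∎

  -- For j = 0 and for j the image of 0 exactly one of the two permutations fixes 0, whence 2N. For
  -- every other j both move 0, and deleting it leaves a transposition composed with `rem π`, by
  -- `rem-tr-other`.
  M-moved : ∀ {m} (π : Fin (suc m) → Fin (suc m)) → Inj π → ∀ f → π zero ≡ suc f → M π ≈ ι 2 * ι N * M (rem π) + ∑ (fins m) (λ j → [ ¬? (j FP.≟ f) ] * M (tr j f ∘ rem π))
  M-moved {m} π i f e = begin
    _ ≈⟨ M-split π » ∑-fins {m} {λ j → ∑inj m (λ σ → w (ext σ ∘ tr zero j) * w (ext σ ∘ tr zero j ∘ π))} ⟩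
    ∑inj m (λ σ → w (ext σ ∘ tr zero zero) * w (ext σ ∘ tr zero zero ∘ π))
      + ∑ (fins m) (λ j → ∑inj m (λ σ → w (ext σ ∘ tr zero (suc j)) * w (ext σ ∘ tr zero (suc j) ∘ π)))
      ≈⟨ +-cong (∑inj-cong {m} {H = λ σ → ι N * (w σ * w (σ ∘ rem π))} (λ σ s → *-cong (w-ext-fixed σ (tr zero zero) s (Inj-tr zero zero) (tr-left zero zero) (rem-tr-self zero))
               (w-ext-moved σ (tr zero zero ∘ π) {y = f} s (Inj-∘ (Inj-tr zero zero) i) (tr00 (π zero) ∙ e) (λ x → rem-cong (λ y → tr00 (π y)) x)) »
               *-assoc _ _ _) »
             ∑inj-* m (ι N) {λ σ → w σ * w (σ ∘ rem π)})
           (∑-cong (fins m) (λ j → step j (j FP.≟ f)) » (∑-+ (fins m)) » +ʳ (∑-δ (finE m) f (λ j → j FP.≟ f) E.refl (λ _ → id))) ⟩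
    _ ≈⟨ solve 3 (λ n a b → n :* a :+ (n :* a :+ b) := :2 :* n :* a :+ b) refl _ _ _ ⟩
    _ ∎
    where
    tr00 : ∀ {m} (x : Fin (suc m)) → tr zero zero x ≡ x
    tr00 zero = tr-left zero zero
    tr00 (suc x) = tr-other {a = zero} {zero} (λ ()) (λ ())
    step : ∀ j (d : Dec (j ≡ f)) → ∑inj m (λ σ → w (ext σ ∘ tr zero (suc j)) * w (ext σ ∘ tr zero (suc j) ∘ π)) ≈ [ d ] * (ι N * M (rem π)) + [ ¬? d ] * M (tr j f ∘ rem π)
    step j (yes E.refl) = ∑inj-cong {m} (λ σ s → *-cong (w-ext-moved σ (tr zero (suc j)) s (Inj-tr zero (suc j)) (tr-left zero (suc j)) (rem-tr-self (suc j)))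
        (w-ext-fixed σ (tr zero (suc j) ∘ π) s (Inj-∘ (Inj-tr zero (suc j)) i) (cong (tr zero (suc j)) e ∙ tr-right zero (suc j)) (rem-tr-same π i j e)) »
        *-comm₃ _ _ _) » ∑inj-* m (ι N) {λ σ → w σ * w (σ ∘ rem π)} » sym (*-identityˡ _) » sym (+-identityʳ _) » +ˡ (sym (zeroˡ _))
    step j (no j≢f) = ∑inj-cong {m} (λ σ s → *-cong (w-ext-moved σ (tr zero (suc j)) s (Inj-tr zero (suc j)) (tr-left zero (suc j)) (rem-tr-self (suc j))) (w-ext-moved σ (tr zero (suc j) ∘ π) {y = f} s (Inj-∘ (Inj-tr zero (suc j)) i)
          (cong (tr zero (suc j)) e ∙ tr-other {a = zero} {suc j} (λ ()) (λ e → j≢f (E.sym (FP.suc-injective e)))) (rem-tr-other π i f e j j≢f))) »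
      sym (*-identityˡ _) » sym (+-identityˡ _) » +ʳ (sym (zeroˡ _))

-- The cut-and-join recursion for moments of power sums

module Tutte (K : CommutativeRing 0ℓ 0ℓ) (N : ℕ) where

  open Kit K
  open Colourings K N
  open Shifts K N

  -- The exponent vector of the monomial obtained by giving each point the variable of its colour.
  ct : ∀ {m} → Vec (Fin N) m → Vec ℕ N
  ct [] = 𝟎
  ct (i ∷ c) = addAt i 1 (ct c)

  ct-lookup : ∀ {m} (c : Vec (Fin N) m) p → ι (lookup (ct c) p) ≈ ∑ (fins m) (λ x → [ lookup c x FP.≟ p ])
  ct-lookup [] p = reflexive (cong ι (lookup-𝟎 p))
  ct-lookup {suc m} (i ∷ c) p = trans (head (i FP.≟ p)) (sym (∑-fins {m} {λ x → [ lookup (i ∷ c) x FP.≟ p ]}))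
    where
    head : (d : Dec (i ≡ p)) → ι (lookup (addAt i 1 (ct c)) p) ≈ [ d ] + ∑ (fins m) (λ x → [ lookup c x FP.≟ p ])
    head (yes E.refl) = reflexive (cong ι (lookup-addAt i 1 (ct c))) » ι-suc (lookup (ct c) p) » +ˡ (ct-lookup c p)
    head (no i≢p) = reflexive (cong ι (lookup-addAt-≢ 1 (ct c) i≢p)) » ct-lookup c p » sym (+-identityˡ _)

  ct-update : ∀ {m} (c : Vec (Fin N) m) j p → addAt (lookup c j) 1 (ct (c [ j ]≔ p)) ≡ addAt p 1 (ct c)
  ct-update (i ∷ c) zero p = addAt-comm i p 1 1 (ct c)
  ct-update (i ∷ c) (suc j) p = addAt-comm (lookup c j) i 1 1 _ ∙ cong (addAt i 1) (ct-update c j p) ∙ addAt-comm i p 1 1 (ct c)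

  ct-size : ∀ {m} (c : Vec (Fin N) m) → size (ct c) ≡ m
  ct-size [] = size-𝟎 N
  ct-size (i ∷ c) = size-addAt i 1 (ct c) ∙ cong suc (ct-size c)

  -- The monomials of the invariant colourings add up to the product of the power sums p_k over the
  -- cycle lengths k of f. Colourings are used in place of cycle types because they can be followed
  -- through the deletion of a point.
  EE : ∀ {m} → (Fin m → Fin m) → Carrier
  EE f = ∑inv f (Φ ∘ ct)

  module _ {m} (ρ : Fin m → Fin m) (ρ-inj : Inj ρ) (f : Fin m) where

    -- 𝒞 p q j: the cycle of f is cut into an arc from f coloured p and an arc from j coloured q.
    -- 𝒜 adds the degenerate case where the whole cycle has colour q, and ℬ the one where it has colour p;
    -- recolouring j from q to p moves the cut from j to ρ j.

    𝒞 𝒜 ℬ : Fin N → Fin N → Fin m → Vec (Fin N) m → Set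
    𝒞 p q j c = j ≢ f × lookup c f ≡ p × lookup c j ≡ q × Inv (tr j f ∘ ρ) c
    𝒜 p q j c = 𝒞 p q j c ⊎ (j ≡ f × lookup c f ≡ q × Inv ρ c)
    ℬ p q j c = 𝒞 p q j c ⊎ (j ≡ f × lookup c f ≡ p × Inv ρ c)

    private
      _≟F_ : ∀ {n} (x y : Fin n) → Dec (x ≡ y)
      _≟F_ = FP._≟_

    𝒞? : ∀ p q j c → Dec (𝒞 p q j c)
    𝒞? p q j c = ¬? (j ≟F f) ×-dec (lookup c f ≟F p) ×-dec (lookup c j ≟F q) ×-dec inv? (tr j f ∘ ρ) c

    𝒟? : ∀ (r : Fin N) j (c : Vec (Fin N) m) → Dec (j ≡ f × lookup c f ≡ r × Inv ρ c)
    𝒟? r j c = (j ≟F f) ×-dec (lookup c f ≟F r) ×-dec inv? ρ c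

    private
      upd : ∀ (c : Vec (Fin N) m) j p → lookup (c [ j ]≔ p) j ≡ p
      upd c j p = lookup∘update j c p

      upd≢ : ∀ (c : Vec (Fin N) m) {j x} p → x ≢ j → lookup (c [ j ]≔ p) x ≡ lookup c x
      upd≢ c p x≢j = lookup∘update′ x≢j c p

      ρ≢ : ∀ {x y z} → ρ y ≡ z → x ≢ y → ρ x ≢ z
      ρ≢ e x≢y e' = x≢y (ρ-inj _ _ (e' ∙ E.sym e))

      through : ∀ {a b x y : Fin m} (c : Vec (Fin N) m) → tr a b x ≡ y → ∀ {z} → lookup c (tr a b x) ≡ z → lookup c y ≡ z
      through c E.refl e = e

    forward : ∀ p q → p ≢ q → ∀ j c → 𝒜 p q j c → lookup c j ≡ q × ℬ p q (ρ j) (c [ j ]≔ p)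
    forward p q p≢q j c (inj₂ (E.refl , cf , inv)) with ρ f ≟F f
    ... | yes e = cf , inj₂ (e , upd c f p , go)
      where
      go : Inv ρ (c [ f ]≔ p)
      go x with x ≟F f
      ... | yes E.refl = cong (lookup (c [ f ]≔ p)) e
      ... | no x≢f = upd≢ c p (ρ≢ e x≢f) ∙ inv x ∙ E.sym (upd≢ c p x≢f)
    ... | no k≢f = cf , inj₁ (k≢f , upd c f p , ck , go)
      where
      k = ρ f
      c' = c [ f ]≔ p
      ck : lookup c' k ≡ q
      ck = upd≢ c p k≢f ∙ inv f ∙ cf
      go : Inv (tr k f ∘ ρ) c'
      go x with x ≟F f
      ... | yes E.refl = cong (lookup c') (tr-left k f)
      ... | no x≢f with ρ x ≟F f
      ... | yes e = cong (lookup c') (cong (tr k f) e ∙ tr-right k f) ∙ ck ∙ E.sym cf ∙ cong (lookup c) (E.sym e) ∙ inv x ∙ E.sym (upd≢ c p x≢f)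
      ... | no e = cong (lookup c') (tr-other (ρ≢ E.refl x≢f) e) ∙ upd≢ c p e ∙ inv x ∙ E.sym (upd≢ c p x≢f)
    forward p q p≢q j c (inj₁ (j≢f , cf , cj , inv)) with ρ j ≟F f
    ... | yes e = cj , inj₂ (e , cf' , go)
      where
      c' = c [ j ]≔ p
      cf' : lookup c' f ≡ p
      cf' = upd≢ c p (j≢f ∘ E.sym) ∙ cf
      go : Inv ρ c'
      go x with x ≟F j
      ... | yes E.refl = cong (lookup c') e ∙ cf' ∙ E.sym (upd c j p)
      ... | no x≢j with ρ x ≟F j
      ... | yes d = cong (lookup c') d ∙ upd c j p ∙ E.sym cf ∙ through c (cong (tr j f) d ∙ tr-left j f) (inv x) ∙ E.sym (upd≢ c p x≢j)
      ... | no d = upd≢ c p d ∙ through c (tr-other d (ρ≢ e x≢j)) (inv x) ∙ E.sym (upd≢ c p x≢j)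
    ... | no k≢f = cj , inj₁ (k≢f , (upd≢ c p (j≢f ∘ E.sym) ∙ cf) , ck , go)
      where
      k = ρ j
      c' = c [ j ]≔ p
      -- If ρ fixed j, invariance under the composite with (j f) would give j the colour of f.
      k≢j : k ≢ j
      k≢j d = p≢q (E.sym cf ∙ through c (cong (tr j f) d ∙ tr-left j f) (inv j) ∙ cj)
      ck : lookup c' k ≡ q
      ck = upd≢ c p k≢j ∙ through c (tr-other k≢j k≢f) (inv j) ∙ cj
      go : Inv (tr k f ∘ ρ) c'
      go x with x ≟F j
      ... | yes E.refl = cong (lookup c') (tr-left k f) ∙ upd≢ c p (j≢f ∘ E.sym) ∙ cf ∙ E.sym (upd c j p)
      ... | no x≢j with ρ x ≟F f
      ... | yes d = cong (lookup c') (cong (tr k f) d ∙ tr-right k f) ∙ ck ∙ E.sym cj ∙ through c (cong (tr j f) d ∙ tr-right j f) (inv x) ∙ E.sym (upd≢ c p x≢j)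
      ... | no d with ρ x ≟F j
      ... | yes h = cong (lookup c') (cong (tr k f) h ∙ tr-other (k≢j ∘ E.sym) j≢f) ∙ upd c j p ∙ E.sym cf ∙ through c (cong (tr j f) h ∙ tr-left j f) (inv x) ∙ E.sym (upd≢ c p x≢j)
      ... | no h = cong (lookup c') (tr-other (ρ≢ E.refl x≢j) d) ∙ upd≢ c p h ∙ through c (tr-other h d) (inv x) ∙ E.sym (upd≢ c p x≢j)

    backward : ∀ p q → p ≢ q → ∀ j c → ℬ p q (ρ j) c → lookup c j ≡ p × 𝒜 p q j (c [ j ]≔ q)
    backward p q p≢q j c (inj₂ (k≡f , cf , inv)) with j ≟F f
    ... | yes E.refl = cf , inj₂ (E.refl , upd c f q , go)
      where
      go : Inv ρ (c [ f ]≔ q)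
      go x with x ≟F f
      ... | yes E.refl = cong (lookup (c [ f ]≔ q)) k≡f
      ... | no x≢f = upd≢ c q (ρ≢ k≡f x≢f) ∙ inv x ∙ E.sym (upd≢ c q x≢f)
    ... | no j≢f = cj , inj₁ (j≢f , cf' , upd c j q , go)
      where
      c' = c [ j ]≔ q
      cj : lookup c j ≡ p
      cj = E.sym (inv j) ∙ cong (lookup c) k≡f ∙ cf
      cf' : lookup c' f ≡ p
      cf' = upd≢ c q (j≢f ∘ E.sym) ∙ cf
      go : Inv (tr j f ∘ ρ) c'
      go x with x ≟F j
      ... | yes E.refl = cong (lookup c') (cong (tr j f) k≡f ∙ tr-right j f)
      ... | no x≢j with ρ x ≟F j
      ... | yes d = cong (lookup c') (cong (tr j f) d ∙ tr-left j f) ∙ cf' ∙ E.sym cj ∙ cong (lookup c) (E.sym d) ∙ inv x ∙ E.sym (upd≢ c q x≢j)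
      ... | no d = cong (lookup c') (tr-other d (ρ≢ k≡f x≢j)) ∙ upd≢ c q d ∙ inv x ∙ E.sym (upd≢ c q x≢j)
    backward p q p≢q j c (inj₁ (k≢f , cf , ck , inv)) with j ≟F f
    ... | yes E.refl = cf , inj₂ (E.refl , upd c f q , go)
      where
      k = ρ f
      go : Inv ρ (c [ f ]≔ q)
      go x with x ≟F f
      ... | yes E.refl = upd≢ c q k≢f ∙ ck ∙ E.sym (upd c f q)
      ... | no x≢f with ρ x ≟F f
      ... | yes d = cong (lookup (c [ f ]≔ q)) d ∙ upd c f q ∙ E.sym ck ∙ through c (cong (tr k f) d ∙ tr-right k f) (inv x) ∙ E.sym (upd≢ c q x≢f)
      ... | no d = upd≢ c q d ∙ through c (tr-other (ρ≢ E.refl x≢f) d) (inv x) ∙ E.sym (upd≢ c q x≢f)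
    ... | no j≢f = cj , inj₁ (j≢f , cf' , upd c j q , go)
      where
      k = ρ j
      c' = c [ j ]≔ q
      cj : lookup c j ≡ p
      cj = E.sym (through c (tr-left k f) (inv j)) ∙ cf
      k≢j : k ≢ j
      k≢j d = p≢q (E.sym cj ∙ cong (lookup c) (E.sym d) ∙ ck)
      cf' : lookup c' f ≡ p
      cf' = upd≢ c q (j≢f ∘ E.sym) ∙ cf
      go : Inv (tr j f ∘ ρ) c'
      go x with x ≟F j
      ... | yes E.refl = cong (lookup c') (tr-other k≢j k≢f) ∙ upd≢ c q k≢j ∙ ck ∙ E.sym (upd c j q)
      ... | no x≢j with ρ x ≟F f
      ... | yes d = cong (lookup c') (cong (tr j f) d ∙ tr-right j f) ∙ upd c j q ∙ E.sym ck ∙ through c (cong (tr k f) d ∙ tr-right k f) (inv x) ∙ E.sym (upd≢ c q x≢j)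
      ... | no d with ρ x ≟F j
      ... | yes h = cong (lookup c') (cong (tr j f) h ∙ tr-left j f) ∙ cf' ∙ E.sym cj ∙ through c (cong (tr k f) h ∙ tr-other (k≢j ∘ E.sym) j≢f) (inv x) ∙ E.sym (upd≢ c q x≢j)
      ... | no h = cong (lookup c') (tr-other h d) ∙ upd≢ c q h ∙ through c (tr-other (ρ≢ E.refl x≢j) d) (inv x) ∙ E.sym (upd≢ c q x≢j)

    private
      Cs = colours m
      F = fins N
      X = fins m

      []-⊎ : ∀ {A B : Set} (d : Dec A) (e : Dec B) → (A → ¬ B) → [ d ⊎-dec e ] ≈ [ d ] + [ e ]
      []-⊎ (yes a) (yes b) n = ⊥-elim (n a b)
      []-⊎ (yes a) (no _) n = sym (+-identityʳ _)
      []-⊎ (no _) e n = sym (+-identityˡ _)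

      S𝒞 : Fin N → Fin N → (Vec (Fin N) m → Carrier) → Carrier
      S𝒞 p q G = ∑ X (λ j → ∑ Cs (λ c → [ 𝒞? p q j c ] * G c))

      S∂ : Fin N → (Vec (Fin N) m → Carrier) → Carrier
      S∂ r G = ∑inv ρ (λ c → [ lookup c f ≟F r ] * G c)

      split : ∀ p q r G → ∑ X (λ j → ∑ Cs (λ c → [ 𝒞? p q j c ⊎-dec 𝒟? r j c ] * G c)) ≈ S𝒞 p q G + S∂ r G
      split p q r G = begin
        _ ≈⟨ ∑-cong X (λ j → ∑-cong Cs (λ c → *ʳ ([]-⊎ (𝒞? p q j c) (𝒟? r j c) (λ a b → proj₁ a (proj₁ b))) » distribʳ _ _ _) » (∑-+ Cs)) ⟩
        _ ≈⟨ (∑-+ X) » +ˡ (∑-swap X Cs) ⟩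
        _
          ≈⟨ +ˡ (∑-cong Cs (λ c → ∑-cong X (λ j → *ʳ (([]-× (j ≟F f) ((lookup c f ≟F r) ×-dec inv? ρ c)) » *ˡ (([]-× (lookup c f ≟F r) (inv? ρ c)) » *-comm _ _)) » *-assoc _ _ _ » *ˡ (*-assoc _ _ _)) »
               ∑-δ (finE m) f (λ j → j ≟F f) E.refl (λ _ → id))) ⟩
        _ ∎

      ∑-perm : ∀ (h : Fin m → Carrier) → ∑ X (h ∘ ρ) ≈ ∑ X h
      ∑-perm h = begin
        _ ≈⟨ ∑-cong X (λ j → sym (∑-δ (finE m) (ρ j) (λ k → k ≟F ρ j) E.refl (λ _ → id))) ⟩
        _ ≈⟨ ∑-swap X X ⟩
        _ ≈⟨ ∑-cong X (λ k → let (j , e) = Inj⇒surjective ρ ρ-inj k in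
               ∑-δ (finE m) {λ _ → h k} j (λ i → k ≟F ρ i) (E.sym e) (λ i e' → ρ-inj i j (E.sym e' ∙ E.sym e))) ⟩
        _ ∎

      -- The recolouring of `forward` and `backward`, summed over all j. A point passes from colour
      -- q to p, so an extra x_p before matches an extra x_q after; the case distinction at j = f
      -- supplies the two boundary terms.
      chain : ∀ p q → p ≢ q → S𝒞 p q (λ c → Ψ p q (addAt p 1 (ct c))) + S∂ q (λ c → Ψ p q (addAt p 1 (ct c))) ≈ S𝒞 p q (λ c → Ψ p q (addAt q 1 (ct c))) + S∂ p (λ c → Ψ p q (addAt q 1 (ct c)))
      chain p q p≢q = begin
        _ ≈⟨ split p q q _ ⟨
        _ ≈⟨ ∑-cong X (λ j → ∑-reindex (vecE (finE N) m) (vecE (finE N) m) (λ c → 𝒞? p q j c ⊎-dec 𝒟? q j c) (λ c → 𝒞? p q (ρ j) c ⊎-dec 𝒟? p (ρ j) c)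
               (λ c → c [ j ]≔ p) (λ c → c [ j ]≔ q)
               (λ c a → proj₂ (forward p q p≢q j c a)) (λ c b → proj₂ (backward p q p≢q j c b))
               (λ c a → []≔-idempotent c j ∙ cong (c [ j ]≔_) (E.sym (proj₁ (forward p q p≢q j c a))) ∙ []≔-lookup c j)
               (λ c b → []≔-idempotent c j ∙ cong (c [ j ]≔_) (E.sym (proj₁ (backward p q p≢q j c b))) ∙ []≔-lookup c j)
               (λ c b → reflexive (cong (Ψ p q) (cong (λ r → addAt r 1 (ct (c [ j ]≔ q))) (E.sym (proj₁ (backward p q p≢q j c b))) ∙ ct-update c j q)))) ⟩
        _ ≈⟨ ∑-perm (λ j → ∑ Cs (λ c → [ 𝒞? p q j c ⊎-dec 𝒟? p j c ] * Ψ p q (addAt q 1 (ct c)))) ⟩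
        _ ≈⟨ split p q p _ ⟩
        _ ∎

      -- For a cycle of length l the coloured cuts give Σ x_p^a x_q^(l-a), and x_p - x_q times this
      -- telescopes to monochromatic cycles. `Φ` contains that factor and `Ψ` is `Φ` without it, so
      -- no division occurs.
      S𝒞-Φ : ∀ p q → p ≢ q → S𝒞 p q (Φ ∘ ct) ≈ S∂ p (λ c → Ψ p q (addAt q 1 (ct c))) + S∂ q (λ c → Ψ q p (addAt p 1 (ct c)))
      S𝒞-Φ p q p≢q = begin
        _ ≈⟨ ∑-cong X (λ j → ∑-cong Cs (λ c → *ˡ (sym (Ψ-diff (ct c) p≢q)) » solve 3 (λ a b c → a :* (b :- c) := a :* b :+ :- (a :* c)) refl _ _ _)) ⟩
        _ ≈⟨ ∑-cong X (λ j → (∑-+ Cs) » +ˡ (∑-neg Cs)) » (∑-+ X) » +ˡ (∑-neg X) ⟩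
        _ ≈⟨ +ʳ (move (chain p q p≢q)) ⟩
        S𝒞 p q (λ c → Ψ p q (addAt q 1 (ct c))) + S∂ p (λ c → Ψ p q (addAt q 1 (ct c))) - S∂ q (λ c → Ψ p q (addAt p 1 (ct c)))
          - S𝒞 p q (λ c → Ψ p q (addAt q 1 (ct c)))
          ≈⟨ solve 3 (λ s a b → s :+ a :- b :- s := a :+ :- b) refl _ _ _ ⟩
        _ ≈⟨ +ˡ (sym (∑-neg Cs) » ∑-cong Cs (λ c → -‿distribʳ-* _ _ » *ˡ (-‿distribʳ-* _ _ » *ˡ (sym (Ψ-anti p q _))))) ⟩
        _ ∎

      Σ𝒞 : ∀ (G : Fin N → Fin N → Carrier) → Carrier
      Σ𝒞 G = ∑ F (λ p → ∑ F (λ q → [ ¬? (p ≟F q) ] * G p q))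

      ΨΣ : Vec (Fin N) m → Carrier
      ΨΣ c = ∑ F (λ q → Ψ (lookup c f) q (addAt (lookup c f) 1 (ct c)))

      cut-sum : Σ𝒞 (λ p q → S𝒞 p q (Φ ∘ ct)) ≈ ι 2 * ∑inv ρ ΨΣ - (ι 2 * ι N - ι 2) * EE ρ
      cut-sum = begin
        _ ≈⟨ ∑-cong F (λ p → ∑-cong F (λ q → case p q (p ≟F q) » distribˡ _ _ _)) ⟩
        _ ≈⟨ ∑-cong F (λ p → ∑-+ F) » (∑-+ F) ⟩
        _ ≈⟨ +ˡ (∑-swap F F » ∑-cong F (λ q → ∑-cong F (λ p → *ʳ ([]-⇔ (¬? (p ≟F q)) (¬? (q ≟F p)) (_∘ E.sym) (_∘ E.sym))))) ⟩
        _ ≈⟨ solve 1 (λ x → x :+ x := :2 :* x) refl _ ⟩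
        _ ≈⟨ *ˡ ΣH ⟩
        _ ≈⟨ solve 3 (λ s n e → :2 :* (s :- (n :* e :- e)) := :2 :* s :- (:2 :* n :- :2) :* e) refl _ _ _ ⟩
        _ ∎
        where
        H : Fin N → Fin N → Carrier
        H p q = S∂ p (λ c → Ψ p q (addAt q 1 (ct c)))
        case : ∀ p q (d : Dec (p ≡ q)) → [ ¬? d ] * S𝒞 p q (Φ ∘ ct) ≈ [ ¬? d ] * (H p q + H q p)
        case p q d = []-*-cong (¬? d) (S𝒞-Φ p q)
        term : ∀ p q c (d : Dec (p ≡ q)) → [ ¬? d ] * Ψ p q (addAt q 1 (ct c)) ≈ Ψ p q (addAt p 1 (ct c)) - (1# - [ d ]) * Φ (ct c)
        term p q c (yes E.refl) = zeroˡ _ » sym (+-cong (Ψ-self p _) (-‿cong (*-zeroˡ (-‿inverseʳ 1#))) » -‿inverseʳ 0#)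
        term p q c (no p≢q) = begin
          _ ≈⟨ solve 2 (λ x y → :1 :* y := x :- (x :- y)) refl (Ψ p q (addAt p 1 (ct c))) _ ⟩
          _ ≈⟨ +ˡ (-‿cong (Ψ-diff (ct c) p≢q » solve 1 (λ x → x := (:1 :- con (+ 0)) :* x) refl _)) ⟩
          _ ∎
          where open import Data.Integer using (+_)
        inner : ∀ c → ∑ F (λ p → ∑ F (λ q → [ ¬? (p ≟F q) ] * ([ lookup c f ≟F p ] * Ψ p q (addAt q 1 (ct c))))) ≈ ΨΣ c - (ι N * Φ (ct c) - Φ (ct c))
        inner c = begin
          _ ≈⟨ ∑-cong F (λ p → ∑-cong F (λ q → *-comm₃ _ _ _) » ∑-*ˡ F _) ⟩
          _ ≈⟨ ∑-δ (finE N) (lookup c f) (lookup c f ≟F_) E.refl (λ _ → E.sym) ⟩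
          _ ≈⟨ ∑-cong F (λ q → term (lookup c f) q c (lookup c f ≟F q)) ⟩
          _ ≈⟨ (∑-+ F) » +ˡ (∑-neg F » -‿cong (∑-*ʳ F _ » *ʳ ((∑-+ F) » +-cong (∑-fins-const N 1#) (∑-neg F »
                 -‿cong (∑-cong F (λ q → sym (*-identityʳ _)) » ∑-δ (finE N) (lookup c f) (lookup c f ≟F_) E.refl (λ _ → E.sym)))) »
                 solve 2 (λ n x → (n :* :1 :- :1) :* x := n :* x :- x) refl _ _)) ⟩
          _ ∎
        ΣH : Σ𝒞 H ≈ ∑inv ρ ΨΣ - (ι N * EE ρ - EE ρ)
        ΣH = begin
          _ ≈⟨ ∑-cong F (λ p → ∑-cong F (λ q → sym (∑-*ˡ Cs _)) » ∑-swap F Cs) ⟩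
          _ ≈⟨ ∑-swap F Cs ⟩
          _ ≈⟨ ∑-cong Cs (λ c → ∑-cong F (λ p → ∑-cong F (λ q → *-comm₃ _ _ _) » ∑-*ˡ F _) » ∑-*ˡ F _ » *ˡ (inner c)) ⟩
          _ ≈⟨ ∑-cong Cs (λ c → solve 4 (λ i s n x → i :* (s :- (n :* x :- x)) := i :* s :+ :- (n :* (i :* x) :+ :- (i :* x))) refl _ _ _ _) ⟩
          _ ≈⟨ (∑-+ Cs) » +ˡ (∑-neg Cs » -‿cong ((∑-+ Cs) » +-cong (∑-*ˡ Cs _) (∑-neg Cs))) ⟩
          _ ∎

      -- If j and f have the same colour, a colouring is invariant under the composite exactly when
      -- it is invariant under ρ; such j are counted by the exponent of that colour, less one for j
      -- = f. If the colours differ, the colouring is one of the coloured cuts `𝒞`.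
      joins : ∑ X (λ j → [ ¬? (j ≟F f) ] * EE (tr j f ∘ ρ)) ≈ ∑inv ρ (λ c → (ι (lookup (ct c) (lookup c f)) - 1#) * Φ (ct c)) + Σ𝒞 (λ p q → S𝒞 p q (Φ ∘ ct))
      joins = begin
        _ ≈⟨ ∑-cong X (λ j → sym (∑-*ˡ Cs _) » ∑-cong Cs (λ c → both j c) » (∑-+ Cs)) ⟩
        _
          ≈⟨ (∑-+ X) » +-cong (∑-swap X Cs » ∑-cong Cs (λ c → ∑-*ˡ X _ » *ˡ (∑-*ʳ X _ » *ʳ (count c)))) regroup ⟩
        _ ∎
        where
        count : ∀ c → ∑ X (λ j → [ lookup c j ≟F lookup c f ] - [ j ≟F f ]) ≈ ι (lookup (ct c) (lookup c f)) - 1#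
        count c = (∑-+ X) » +-cong (sym (ct-lookup c (lookup c f))) (∑-neg X » -‿cong (∑-cong X (λ j → sym (*-identityʳ _)) » ∑-δ (finE m) f (λ j → j ≟F f) E.refl (λ _ → id)))
        regroup : ∑ X (λ j → ∑ Cs (λ c → ∑ F (λ p → ∑ F (λ q → [ ¬? (p ≟F q) ] * ([ 𝒞? p q j c ] * Φ (ct c)))))) ≈ Σ𝒞 (λ p q → S𝒞 p q (Φ ∘ ct))
        regroup = begin
          _ ≈⟨ ∑-cong X (λ j → ∑-swap Cs F » ∑-cong F (λ p → ∑-swap Cs F)) ⟩
          _ ≈⟨ ∑-swap X F » ∑-cong F (λ p → ∑-swap X F) ⟩
          _ ≈⟨ ∑-cong F (λ p → ∑-cong F (λ q → ∑-cong X (λ j → ∑-*ˡ Cs _) » ∑-*ˡ X _)) ⟩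
          _ ∎
        𝒞-sum : ∀ j c x → ∑ F (λ p → ∑ F (λ q → [ ¬? (p ≟F q) ] * ([ 𝒞? p q j c ] * x))) ≈ [ ¬? (lookup c f ≟F lookup c j) ] * ([ 𝒞? (lookup c f) (lookup c j) j c ] * x)
        𝒞-sum j c x = ∑-pick (finE N) (lookup c f) (λ p p≢ → ∑-0 F (λ q → *-zeroʳ ([]-no* (𝒞? p q j c) (λ h → p≢ (E.sym (proj₁ (proj₂ h))))))) »
          ∑-pick (finE N) (lookup c j) (λ q q≢ → *-zeroʳ ([]-no* (𝒞? (lookup c f) q j c) (λ h → q≢ (E.sym (proj₁ (proj₂ (proj₂ h)))))))
        unchanged : ∀ j c → lookup c f ≡ lookup c j → ∀ x → lookup c (tr j f x) ≡ lookup c x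
        unchanged j c e x with trView j f x
        ... | left E.refl t = cong (lookup c) t ∙ e
        ... | right _ E.refl t = cong (lookup c) t ∙ E.sym e
        ... | other _ _ t = cong (lookup c) t
        both : ∀ j c → [ ¬? (j ≟F f) ] * ([ inv? (tr j f ∘ ρ) c ] * Φ (ct c)) ≈ [ inv? ρ c ] * (([ lookup c j ≟F lookup c f ] - [ j ≟F f ]) * Φ (ct c)) + ∑ F (λ p → ∑ F (λ q → [ ¬? (p ≟F q) ] * ([ 𝒞? p q j c ] * Φ (ct c))))
        both j c = trans (cases (j ≟F f) (lookup c f ≟F lookup c j)) (+ˡ (sym (𝒞-sum j c (Φ (ct c)))))
          where
          φ = Φ (ct c)
          cases : (d : Dec (j ≡ f)) (e : Dec (lookup c f ≡ lookup c j)) → [ ¬? d ] * ([ inv? (tr j f ∘ ρ) c ] * φ) ≈ [ inv? ρ c ] * (([ lookup c j ≟F lookup c f ] - [ d ]) * φ) + [ ¬? e ] * ([ 𝒞? (lookup c f) (lookup c j) j c ] * φ)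
          cases (yes E.refl) (no e) = ⊥-elim (e E.refl)
          cases (yes E.refl) (yes e) = zeroˡ _ » sym (+-zero (*-zeroʳ (*-zeroˡ (+ʳ ([]-yes (lookup c f ≟F lookup c f) E.refl) » -‿inverseʳ _))) (zeroˡ _))
          cases (no j≢f) (yes e) = *-identityˡ _ » *ʳ ([]-⇔ (inv? (tr j f ∘ ρ) c) (inv? ρ c) (λ inv x → E.sym (unchanged j c e (ρ x)) ∙ inv x) (λ inv x → unchanged j c e (ρ x) ∙ inv x)) »
            *ˡ (sym (*-identityˡ _) » *ʳ (sym ([]-yes (lookup c j ≟F lookup c f) (E.sym e)) » sym (+-identityʳ _) » +ˡ (sym -0#≈0#))) » sym (+-identityʳ _) » +ˡ (sym (zeroˡ _))
          cases (no j≢f) (no e) = *-identityˡ _ » *ʳ ([]-⇔ (inv? (tr j f ∘ ρ) c) (𝒞? (lookup c f) (lookup c j) j c) (λ inv → j≢f , E.refl , E.refl , inv) (λ h → proj₂ (proj₂ (proj₂ h)))) »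
            sym (*-identityˡ _) » sym (+-identityˡ _) » +ʳ (sym (*-zeroʳ (*-zeroˡ (+-cong ([]-no (lookup c j ≟F lookup c f) (e ∘ E.sym)) -0#≈0# » +-identityʳ _))))

    -- Integration by parts in the variable that colours f: the Vandermonde terms of `Φ-step` become
    -- cuts by `cut-sum`, and the multiplicity of the colour completes them to the sum over
    -- transpositions.
    tutte : ∑inv ρ (λ c → Φ (addAt (lookup c f) 1 (ct c))) ≈ ι 2 * ι N * EE ρ + ∑ X (λ j → [ ¬? (j ≟F f) ] * EE (tr j f ∘ ρ))
    tutte = begin
      _ ≈⟨ ∑-cong Cs (λ c → *ˡ (Φ-step (lookup c f) (ct c)) » solve 4 (λ i k x s → i :* ((:1 :+ k) :* x :+ :2 :* s) := i :* ((k :- :1) :* x) :+ (:2 :* (i :* x) :+ :2 :* (i :* s))) refl _ _ _ _) ⟩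
      _ ≈⟨ (∑-+ Cs) » +ˡ ((∑-+ Cs) » +-cong (∑-*ˡ Cs _) (∑-*ˡ Cs _)) ⟩
      _ ≈⟨ solve 4 (λ a e s n → a :+ (:2 :* e :+ :2 :* s) := :2 :* n :* e :+ (a :+ (:2 :* s :- (:2 :* n :- :2) :* e))) refl _ _ _ (ι N) ⟩
      _ ≈⟨ +ˡ (+ˡ (sym cut-sum) » sym joins) ⟩
      _ ∎

  EE-fixed : ∀ {m} (π : Fin (suc m) → Fin (suc m)) → Inj π → π zero ≡ zero → EE π ≈ (ι N * ι N + ι m) * EE (rem π)
  EE-fixed {m} π i e = begin
    _ ≈⟨ ∑inv-fixed π i e (Φ ∘ ct) ⟩
    _ ≈⟨ ∑-cong (colours m) (λ d → *ˡ (P₁Φ (ct d) » *ʳ (+ˡ (reflexive (cong ι (ct-size d))))) » *-comm₃ _ _ _) ⟩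
    _ ≈⟨ ∑-*ˡ (colours m) _ ⟩
    _ ∎

  EE-moved : ∀ {m} (π : Fin (suc m) → Fin (suc m)) → Inj π → ∀ f → π zero ≡ suc f → EE π ≈ ι 2 * ι N * EE (rem π) + ∑ (fins m) (λ j → [ ¬? (j FP.≟ f) ] * EE (tr j f ∘ rem π))
  EE-moved π i f e = ∑inv-moved π i f e (Φ ∘ ct) » tutte (rem π) (Inj-rem π i) f

  -- Both sides obey the same recursion in the number of points, and on the empty set they agree
  -- with normalisation `Φ 𝟎`.
  M-EE : ∀ m (π : Fin m → Fin m) → Inj π → M π * Φ 𝟎 ≈ EE π
  M-EE zero π i = solve 1 (λ x → (:1 :* ((:1 :* :1 :+ con (+ 0)) :* (:1 :* :1 :+ con (+ 0))) :+ con (+ 0)) :* x := :1 :* x :+ con (+ 0)) refl (Φ 𝟎)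
    where open import Data.Integer using (+_)
  M-EE (suc m) π i = go (π zero) E.refl
    where
    go : ∀ y → π zero ≡ y → M π * Φ 𝟎 ≈ EE π
    go zero e = *ʳ (M-fixed π i e) » *-assoc _ _ _ » *ˡ (M-EE m (rem π) (Inj-rem π i)) » sym (EE-fixed π i e)
    go (suc f) e = begin
      _ ≈⟨ *ʳ (M-moved π i f e) ⟩
      _ ≈⟨ distribʳ _ _ _ » +-cong (*-assoc _ _ _) (sym (∑-*ʳ (fins m) _) » ∑-cong (fins m) (λ j → *-assoc _ _ _)) ⟩
      _ ≈⟨ +-cong (*ˡ (M-EE m (rem π) (Inj-rem π i))) (∑-cong (fins m) (λ j → *ˡ (M-EE m (tr j f ∘ rem π) (Inj-∘ (Inj-tr j f) (Inj-rem π i))))) ⟩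
      _ ≈⟨ EE-moved π i f e ⟨
      _ ∎

-- Split k l m: a k-element subset of Fin m, with its l-element complement.

data Split : ℕ → ℕ → ℕ → Set where
  done : Split 0 0 0
  inl : ∀ {k l m} → Split k l m → Split (suc k) l (suc m)
  inr : ∀ {k l m} → Split k l m → Split k (suc l) (suc m)

el : ∀ {k l m} → Split k l m → Fin k → Fin m
el (inl s) zero = zero
el (inl s) (suc a) = suc (el s a)
el (inr s) a = suc (el s a)

er : ∀ {k l m} → Split k l m → Fin l → Fin m
er (inl s) b = suc (er s b)
er (inr s) zero = zero
er (inr s) (suc b) = suc (er s b)

data View {k l m} (s : Split k l m) : Fin m → Set where
  L : ∀ a → View s (el s a)
  R : ∀ b → View s (er s b)

view : ∀ {k l m} (s : Split k l m) x → View s x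
view (inl s) zero = L zero
view (inl s) (suc x) with view s x
... | L a = L (suc a)
... | R b = R b
view (inr s) zero = R zero
view (inr s) (suc x) with view s x
... | L a = L a
... | R b = R (suc b)

view-el : ∀ {k l m} (s : Split k l m) a → view s (el s a) ≡ L a
view-el (inl s) zero = E.refl
view-el (inl s) (suc a) rewrite view-el s a = E.refl
view-el (inr s) a rewrite view-el s a = E.refl

view-er : ∀ {k l m} (s : Split k l m) b → view s (er s b) ≡ R b
view-er (inl s) b rewrite view-er s b = E.refl
view-er (inr s) zero = E.refl
view-er (inr s) (suc b) rewrite view-er s b = E.refl

isL : ∀ {k l m} → Split k l m → Fin m → Bool
isL (inl s) zero = true
isL (inl s) (suc x) = isL s x
isL (inr s) zero = false
isL (inr s) (suc x) = isL s x

isL-el : ∀ {k l m} (s : Split k l m) a → isL s (el s a) ≡ true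
isL-el (inl s) zero = E.refl
isL-el (inl s) (suc a) = isL-el s a
isL-el (inr s) a = isL-el s a

isL-er : ∀ {k l m} (s : Split k l m) b → isL s (er s b) ≡ false
isL-er (inl s) b = isL-er s b
isL-er (inr s) zero = E.refl
isL-er (inr s) (suc b) = isL-er s b

el-injective : ∀ {k l m} (s : Split k l m) → Inj (el s)
el-injective (inl s) zero zero e = E.refl
el-injective (inl s) (suc a) (suc b) e = cong suc (el-injective s a b (FP.suc-injective e))
el-injective (inr s) a b e = el-injective s a b (FP.suc-injective e)

er-injective : ∀ {k l m} (s : Split k l m) → Inj (er s)
er-injective (inl s) a b e = er-injective s a b (FP.suc-injective e)
er-injective (inr s) zero zero e = E.refl
er-injective (inr s) (suc a) (suc b) e = cong suc (er-injective s a b (FP.suc-injective e))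

el≢er : ∀ {k l m} (s : Split k l m) a b → el s a ≢ er s b
el≢er s a b e with E.trans (E.sym (isL-el s a)) (cong (isL s) e ∙ isL-er s b)
... | ()

merge : ∀ {A : Set} {k l m} → Split k l m → Vec A k → Vec A l → Vec A m
merge done [] [] = []
merge (inl s) (a ∷ u) v = a ∷ merge s u v
merge (inr s) u (b ∷ v) = b ∷ merge s u v

lookup-merge-el : ∀ {A : Set} {k l m} (s : Split k l m) (u : Vec A k) (v : Vec A l) a → lookup (merge s u v) (el s a) ≡ lookup u a
lookup-merge-el (inl s) (x ∷ u) v zero = E.refl
lookup-merge-el (inl s) (x ∷ u) v (suc a) = lookup-merge-el s u v a
lookup-merge-el (inr s) u (x ∷ v) a = lookup-merge-el s u v a

lookup-merge-er : ∀ {A : Set} {k l m} (s : Split k l m) (u : Vec A k) (v : Vec A l) b → lookup (merge s u v) (er s b) ≡ lookup v b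
lookup-merge-er (inl s) (x ∷ u) v b = lookup-merge-er s u v b
lookup-merge-er (inr s) u (x ∷ v) zero = E.refl
lookup-merge-er (inr s) u (x ∷ v) (suc b) = lookup-merge-er s u v b

join' : ∀ {k l m} (s : Split k l m) → (Fin k → Fin k) → (Fin l → Fin l) → ∀ {x} → View s x → Fin m
join' s f g (L a) = el s (f a)
join' s f g (R b) = er s (g b)

join : ∀ {k l m} → Split k l m → (Fin k → Fin k) → (Fin l → Fin l) → Fin m → Fin m
join s f g x = join' s f g (view s x)

join-el : ∀ {k l m} (s : Split k l m) f g a → join s f g (el s a) ≡ el s (f a)
join-el s f g a rewrite view-el s a = E.refl

join-er : ∀ {k l m} (s : Split k l m) f g b → join s f g (er s b) ≡ er s (g b)
join-er s f g b rewrite view-er s b = E.refl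

by-view : ∀ {k l m} (s : Split k l m) (P : Fin m → Set) → (∀ a → P (el s a)) → (∀ b → P (er s b)) → ∀ x → P x
by-view s P p q x with view s x
... | L a = p a
... | R b = q b

join-∘ : ∀ {k l m} (s : Split k l m) f f' g g' x → join s f g (join s f' g' x) ≡ join s (f ∘ f') (g ∘ g') x
join-∘ s f f' g g' = by-view s _ (λ a → cong (join s f g) (join-el s f' g' a) ∙ join-el s f g (f' a) ∙ E.sym (join-el s (f ∘ f') (g ∘ g') a)) (λ b → cong (join s f g) (join-er s f' g' b) ∙ join-er s f g (g' b) ∙ E.sym (join-er s (f ∘ f') (g ∘ g') b))

Inj-join : ∀ {k l m} (s : Split k l m) {f g} → Inj f → Inj g → Inj (join s f g)
Inj-join s {f} {g} i j = by-view s (λ x → ∀ y → join s f g x ≡ join s f g y → x ≡ y) (λ a → by-view s _ (λ a' e → cong (el s) (i a a' (el-injective s _ _ (E.sym (join-el s f g a) ∙ e ∙ join-el s f g a'))))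
                     (λ b e → ⊥-elim (el≢er s _ _ (E.sym (join-el s f g a) ∙ e ∙ join-er s f g b))))
  (λ b → by-view s _ (λ a e → ⊥-elim (el≢er s _ _ (E.sym (E.sym (join-er s f g b) ∙ e ∙ join-el s f g a)))) (λ b' e → cong (er s) (j b b' (er-injective s _ _ (E.sym (join-er s f g b) ∙ e ∙ join-er s f g b')))))

Inj-join-l : ∀ {k l m} (s : Split k l m) {f g} → Inj (join s f g) → Inj f
Inj-join-l s {f} {g} i a a' e = el-injective s _ _ (i _ _ (join-el s f g a ∙ cong (el s) e ∙ E.sym (join-el s f g a')))

Inj-join-r : ∀ {k l m} (s : Split k l m) {f g} → Inj (join s f g) → Inj g
Inj-join-r s {f} {g} i b b' e = er-injective s _ _ (i _ _ (join-er s f g b ∙ cong (er s) e ∙ E.sym (join-er s f g b')))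

-- A least closed set containing 0, as needed for the decomposition by the orbit of 0.

record Orbits : Set₁ where
  field
    orb : ∀ {m} → (Fin (suc m) → Fin (suc m)) → (Fin (suc m) → Fin (suc m)) → Fin (suc m) → Bool
    orb-zero : ∀ {m} (σ α : Fin (suc m) → Fin (suc m)) → orb σ α zero ≡ true
    orb-σ : ∀ {m} (σ α : Fin (suc m) → Fin (suc m)) x → orb σ α x ≡ true → orb σ α (σ x) ≡ true
    orb-α : ∀ {m} (σ α : Fin (suc m) → Fin (suc m)) x → orb σ α x ≡ true → orb σ α (α x) ≡ true
    orb-least : ∀ {m} (σ α : Fin (suc m) → Fin (suc m)) (P : Fin (suc m) → Set) → P zero → (∀ x → P x → P (σ x)) → (∀ x → P x → P (α x)) → ∀ x → orb σ α x ≡ true → P x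

-- The exponential formula for transitive pairs

module Exponential (K : CommutativeRing 0ℓ 0ℓ) where

  open Kit K
  open Series K using (Ser; _⊛_; d; shift; d-leibniz; at)

  -- The sum over all subsets of the m points, each together with its complement.
  𝕊 : ∀ m → (∀ {k l} → Split k l m → Carrier) → Carrier
  𝕊 zero F = F done
  𝕊 (suc m) F = 𝕊 m (λ s → F (inl s)) + 𝕊 m (λ s → F (inr s))

  𝕊-cong : ∀ m {F G : ∀ {k l} → Split k l m → Carrier} → (∀ {k l} (s : Split k l m) → F s ≈ G s) → 𝕊 m F ≈ 𝕊 m G
  𝕊-cong zero e = e done
  𝕊-cong (suc m) e = +-cong (𝕊-cong m (λ s → e (inl s))) (𝕊-cong m (λ s → e (inr s)))

  𝕊-0 : ∀ m {F : ∀ {k l} → Split k l m → Carrier} → (∀ {k l} (s : Split k l m) → F s ≈ 0#) → 𝕊 m F ≈ 0#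
  𝕊-0 zero e = e done
  𝕊-0 (suc m) e = +-zero (𝕊-0 m (λ s → e (inl s))) (𝕊-0 m (λ s → e (inr s)))

  𝕊-* : ∀ m c (F : ∀ {k l} → Split k l m → Carrier) → 𝕊 m (λ s → F s * c) ≈ 𝕊 m F * c
  𝕊-* zero c F = refl
  𝕊-* (suc m) c F = +-cong (𝕊-* m c (λ s → F (inl s))) (𝕊-* m c (λ s → F (inr s))) » sym (distribʳ _ _ _)

  𝕊-∑ : ∀ m {A : Set} (xs : List A) (F : A → ∀ {k l} → Split k l m → Carrier) → 𝕊 m (λ s → ∑ xs (λ a → F a s)) ≈ ∑ xs (λ a → 𝕊 m (F a))
  𝕊-∑ zero xs F = refl
  𝕊-∑ (suc m) xs F = +-cong (𝕊-∑ m xs (λ a s → F a (inl s))) (𝕊-∑ m xs (λ a s → F a (inr s))) » sym (∑-+ xs)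

  all≡? : ∀ {m} (b c : Fin m → Bool) → Dec (∀ x → b x ≡ c x)
  all≡? b c = FP.all? (λ x → b x Boolₚ.≟ c x)

  𝕊-unique : ∀ m (b : Fin m → Bool) → 𝕊 m (λ s → [ all≡? b (isL s) ]) ≈ 1#
  𝕊-unique zero b = refl
  𝕊-unique (suc m) b = go (b zero) E.refl
    where
    tail : ∀ {k l} (s : Split k l m) {k' l'} (s' : Split k' l' (suc m)) → b zero ≡ isL s' zero → (∀ x → isL s' (suc x) ≡ isL s x) → [ all≡? b (isL s') ] ≈ [ all≡? (b ∘ suc) (isL s) ]
    tail s s' e t = []-⇔ (all≡? b (isL s')) (all≡? (b ∘ suc) (isL s)) (λ h x → h (suc x) ∙ t x) (λ { h zero → e ; h (suc x) → h x ∙ E.sym (t x) })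
    clash : ∀ {k' l'} (s' : Split k' l' (suc m)) → b zero ≢ isL s' zero → [ all≡? b (isL s') ] ≈ 0#
    clash s' n = []-no (all≡? b (isL s')) (λ h → n (h zero))
    go : ∀ c → b zero ≡ c → 𝕊 (suc m) (λ s → [ all≡? b (isL s) ]) ≈ 1#
    go true e = +-cong (𝕊-cong m (λ s → tail s (inl s) e (λ _ → E.refl)) » 𝕊-unique m (b ∘ suc)) (𝕊-0 m (λ s → clash (inr s) (λ e' → Boolₚ.not-¬ e e'))) » +-identityʳ _
    go false e = +-cong (𝕊-0 m (λ s → clash (inl s) (λ e' → Boolₚ.not-¬ e e'))) (𝕊-cong m (λ s → tail s (inr s) e (λ _ → E.refl)) » 𝕊-unique m (b ∘ suc)) » +-identityˡ _

  ∑-merge : ∀ {A : Set} (xs : List A) {k l m} (s : Split k l m) (F : Vec A m → Carrier) → ∑ (vecs xs m) F ≈ ∑ (vecs xs k) (λ u → ∑ (vecs xs l) (λ v → F (merge s u v)))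
  ∑-merge xs done F = sym (+-identityʳ _)
  ∑-merge xs {suc k} {l} (inl s) F = ∑-vecs xs _ » ∑-cong xs (λ a → ∑-merge xs s (F ∘ (a ∷_))) » sym (∑-vecs xs k)
  ∑-merge xs {k} {suc l} (inr s) F = ∑-vecs xs _ » ∑-cong xs (λ a → ∑-merge xs s (F ∘ (a ∷_))) » ∑-swap xs (vecs xs k) » ∑-cong (vecs xs k) (λ u → sym (∑-vecs xs l))

  ∑-left : ∀ {k l m} (s : Split k l m) (g : Fin m → Carrier) → ∑ (fins m) (λ x → [ isL s x Boolₚ.≟ true ] * g x) ≈ ∑ (fins k) (g ∘ el s)
  ∑-left done g = refl
  ∑-left {m = suc m} (inl s) g = ∑-fins {m} {λ x → [ isL (inl s) x Boolₚ.≟ true ] * g x} » +-cong (*-identityˡ _) (∑-left s (g ∘ suc)) » sym (∑-fins {f = g ∘ el (inl s)})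
  ∑-left {m = suc m} (inr s) g = ∑-fins {m} {λ x → [ isL (inr s) x Boolₚ.≟ true ] * g x} » +-cong (zeroˡ _) (∑-left s (g ∘ suc)) » +-identityˡ _

  ∑-right : ∀ {k l m} (s : Split k l m) (g : Fin m → Carrier) → ∑ (fins m) (λ x → [ isL s x Boolₚ.≟ false ] * g x) ≈ ∑ (fins l) (g ∘ er s)
  ∑-right done g = refl
  ∑-right {m = suc m} (inl s) g = ∑-fins {m} {λ x → [ isL (inl s) x Boolₚ.≟ false ] * g x} » +-cong (zeroˡ _) (∑-right s (g ∘ suc)) » +-identityˡ _
  ∑-right {m = suc m} (inr s) g = ∑-fins {m} {λ x → [ isL (inr s) x Boolₚ.≟ false ] * g x} » +-cong (*-identityˡ _) (∑-right s (g ∘ suc)) » sym (∑-fins {f = g ∘ er (inr s)})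

  ∑-image : ∀ {A B : Set} (xs : List A) (ys : List B) (e : A → B) {P : B → Set} (P? : ∀ b → Dec (P b)) → (∀ g → ∑ ys (λ b → [ P? b ] * g b) ≈ ∑ xs (g ∘ e)) → ∀ n (F : Vec B n → Carrier) →
            ∑ (vecs ys n) (λ v → [ FP.all? (λ i → P? (lookup v i)) ] * F v) ≈ ∑ (vecs xs n) (λ u → F (Vec.map e u))
  ∑-image xs ys e P? h zero F = +ʳ (*-identityˡ _)
  ∑-image xs ys e {P} P? h (suc n) F = begin
    _ ≈⟨ ∑-vecs ys n ⟩
    _ ≈⟨ ∑-cong ys (λ b → ∑-cong (vecs ys n) (λ v → *ʳ (([]-⇔ (FP.all? (λ i → P? (lookup (b ∷ v) i))) (P? b ×-dec FP.all? (λ i → P? (lookup v i)))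
             (λ p → p zero , p ∘ suc) (λ { (p , q) zero → p ; (p , q) (suc i) → q i })) »
           ([]-× (P? b) (FP.all? (λ i → P? (lookup v i))))) » *-assoc _ _ _) » ∑-*ˡ (vecs ys n) _) ⟩
    _ ≈⟨ h _ ⟩
    _ ≈⟨ ∑-cong xs (λ a → ∑-image xs ys e P? h n (F ∘ (e a ∷_))) ⟩
    _ ≈⟨ ∑-vecs xs n ⟨
    _ ∎

  preserves? : ∀ {k l m} (s : Split k l m) (f : Fin m → Fin m) → Dec (∀ x → isL s (f x) ≡ isL s x)
  preserves? s f = all≡? (isL s ∘ f) (isL s)

  ∑-preserving : ∀ {k l m} (s : Split k l m) (F : (Fin m → Fin m) → Carrier) → (∀ {f g} → (∀ x → f x ≡ g x) → F f ≈ F g) → ∑ (vecs (fins m) m) (λ σ → [ preserves? s (lookup σ) ] * F (lookup σ))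
                 ≈ ∑ (vecs (fins k) k) (λ u → ∑ (vecs (fins l) l) (λ v → F (join s (lookup u) (lookup v))))
  ∑-preserving {k} {l} {m} s F F-cong = begin
    _ ≈⟨ ∑-merge (fins m) s _ ⟩
    _ ≈⟨ ∑-cong (vecs (fins m) k) (λ u → ∑-cong (vecs (fins m) l) (λ v → *ʳ (
           ([]-⇔ (preserves? s (lookup (merge s u v))) (allL u ×-dec allR v) (to u v) (from u v)) » ([]-× (allL u) (allR v))) » *-assoc _ _ _) » ∑-*ˡ (vecs (fins m) l) _) ⟩
    _ ≈⟨ ∑-image (fins k) (fins m) (el s) (λ x → isL s x Boolₚ.≟ true) (∑-left s) k _ ⟩
    _ ≈⟨ ∑-cong (vecs (fins k) k) (λ u → ∑-image (fins l) (fins m) (er s) (λ x → isL s x Boolₚ.≟ false) (∑-right s) l _) ⟩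
    _ ≈⟨ ∑-cong (vecs (fins k) k) (λ u → ∑-cong (vecs (fins l) l) (λ v → F-cong (by-view s _
           (λ a → lookup-merge-el s _ _ a ∙ lookup-map a (el s) u ∙ E.sym (join-el s (lookup u) (lookup v) a))
           (λ b → lookup-merge-er s _ _ b ∙ lookup-map b (er s) v ∙ E.sym (join-er s (lookup u) (lookup v) b))))) ⟩
    _ ∎
    where
    allL : ∀ {n} (u : Vec (Fin m) n) → Dec (∀ i → isL s (lookup u i) ≡ true)
    allL u = FP.all? (λ i → isL s (lookup u i) Boolₚ.≟ true)
    allR : ∀ {n} (u : Vec (Fin m) n) → Dec (∀ i → isL s (lookup u i) ≡ false)
    allR u = FP.all? (λ i → isL s (lookup u i) Boolₚ.≟ false)
    to : ∀ u v → (∀ x → isL s (lookup (merge s u v) x) ≡ isL s x) → (∀ i → isL s (lookup u i) ≡ true) × (∀ i → isL s (lookup v i) ≡ false)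
    to u v h = (λ a → cong (isL s) (E.sym (lookup-merge-el s u v a)) ∙ h (el s a) ∙ isL-el s a) , (λ b → cong (isL s) (E.sym (lookup-merge-er s u v b)) ∙ h (er s b) ∙ isL-er s b)
    from : ∀ u v → (∀ i → isL s (lookup u i) ≡ true) × (∀ i → isL s (lookup v i) ≡ false) → ∀ x → isL s (lookup (merge s u v) x) ≡ isL s x
    from u v (p , q) = by-view s _ (λ a → cong (isL s) (lookup-merge-el s u v a) ∙ p a ∙ E.sym (isL-el s a)) (λ b → cong (isL s) (lookup-merge-er s u v b) ∙ q b ∙ E.sym (isL-er s b))

  module Decomposition (O : Orbits) (u : ∀ m → (Fin m → Fin m) → (Fin m → Fin m) → Carrier) (u-cong : ∀ {m} {σ σ' α α' : Fin m → Fin m} → (∀ x → σ x ≡ σ' x) → (∀ x → α x ≡ α' x) → u m σ α ≈ u m σ' α')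
    (u-join : ∀ {k l m} (s : Split k l m) {σ σ' α α'} → Inj σ → Inj σ' → Inj α → Inj α' → u m (join s σ σ') (join s α α') ≈ u k σ α * u l σ' α') where

    open Orbits O

    V : ∀ m → List (Vec (Fin m) m)
    V m = vecs (fins m) m

    ω : ∀ m → (Fin m → Fin m) → (Fin m → Fin m) → Carrier
    ω m σ α = [ inj? σ ×-dec inj? α ] * u m σ α

    full? : ∀ {m} (σ α : Fin (suc m) → Fin (suc m)) → Dec (∀ x → orb σ α x ≡ true)
    full? σ α = all≡? (orb σ α) (λ _ → true)

    Tot Conn : ℕ → Carrier
    Tot m = ∑ (V m) (λ σ → ∑ (V m) (λ α → ω m (lookup σ) (lookup α)))
    Conn k = ∑ (V (suc k)) (λ σ → ∑ (V (suc k)) (λ α → [ full? (lookup σ) (lookup α) ] * ω (suc k) (lookup σ) (lookup α)))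

    private
      -- An injective map of the left part into itself is onto it, so no point of the right part can
      -- land there.
      Inj⇒preserves : ∀ {k l m} (s : Split k l m) (f : Fin m → Fin m) → Inj f → (∀ x → isL s x ≡ true → isL s (f x) ≡ true) → ∀ x → isL s (f x) ≡ isL s x
      Inj⇒preserves {k} s f i c x with isL s x in e
      ... | true = c x e
      ... | false with isL s (f x) in e'
      ... | false = E.refl
      ... | true = ⊥-elim (bad (preimage (f x) e'))
        where
        g : Fin k → Fin k
        pick : ∀ y → isL s y ≡ true → ∃ λ a → el s a ≡ y
        pick y h with view s y
        ... | L a = a , E.refl
        ... | R b with E.trans (E.sym h) (isL-er s b)
        ... | ()
        g a = proj₁ (pick (f (el s a)) (c (el s a) (isL-el s a)))
        g-el : ∀ a → el s (g a) ≡ f (el s a)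
        g-el a = proj₂ (pick (f (el s a)) (c (el s a) (isL-el s a)))
        g-inj : Inj g
        g-inj a b h = el-injective s a b (i _ _ (E.sym (g-el a) ∙ cong (el s) h ∙ g-el b))
        preimage : ∀ y → isL s y ≡ true → ∃ λ a → f (el s a) ≡ y
        preimage y h = let (a , p) = pick y h ; (b , q) = Inj⇒surjective g g-inj a in b , E.sym (g-el b) ∙ cong (el s) q ∙ p
        bad : ¬ (∃ λ a → f (el s a) ≡ f x)
        bad (a , h) with E.trans (E.sym e) (cong (isL s) (E.sym (i _ _ h)) ∙ isL-el s a)
        ... | ()

      is? : ∀ {k l m} (s : Split k l (suc m)) (σ α : Fin (suc m) → Fin (suc m)) → Dec (∀ x → orb σ α x ≡ isL s x)
      is? s σ α = all≡? (orb σ α) (isL s)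

      orb-cong : ∀ {m} {σ σ' α α' : Fin (suc m) → Fin (suc m)} → (∀ x → σ x ≡ σ' x) → (∀ x → α x ≡ α' x) → ∀ x → orb σ α x ≡ orb σ' α' x
      orb-cong {σ = σ} {σ'} {α} {α'} p q x with orb σ α x in e | orb σ' α' x in e'
      ... | true | true = E.refl
      ... | false | false = E.refl
      ... | true | false = E.trans (E.sym (half p q e)) e'
        where
        half : ∀ {σ σ' α α'} → (∀ x → σ x ≡ σ' x) → (∀ x → α x ≡ α' x) → orb σ α x ≡ true → orb σ' α' x ≡ true
        half {σ} {σ'} {α} {α'} p q = orb-least σ α (λ y → orb σ' α' y ≡ true) (orb-zero σ' α') (λ y h → cong (orb σ' α') (p y) ∙ orb-σ σ' α' y h) (λ y h → cong (orb σ' α') (q y) ∙ orb-α σ' α' y h) x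
      ... | false | true = E.sym e ∙ orb-least σ' α' (λ y → orb σ α y ≡ true) (orb-zero σ α) (λ y h → cong (orb σ α) (E.sym (p y)) ∙ orb-σ σ α y h) (λ y h → cong (orb σ α) (E.sym (q y)) ∙ orb-α σ α y h) x e'

      T-join : ∀ {k l m} (s : Split k l m) (σ : Fin (suc k) → Fin (suc k)) (σ' : Fin l → Fin l) (α : Fin (suc k) → Fin (suc k)) (α' : Fin l → Fin l) → let S = inl s in
               ((∀ x → orb (join S σ σ') (join S α α') x ≡ isL S x) → ∀ a → orb σ α a ≡ true)
               × ((∀ a → orb σ α a ≡ true) → ∀ x → orb (join S σ σ') (join S α α') x ≡ isL S x)
      T-join {m = m} s σ σ' α α' = to , from
        where
        S = inl s
        J = join S σ σ'
        A = join S α α'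
        to : (∀ x → orb J A x ≡ isL S x) → ∀ a → orb σ α a ≡ true
        to h a = lower (orb-least J A (λ x → Σ _ λ b → x ≡ el S b × orb σ α b ≡ true) (zero , E.refl , orb-zero σ α) (λ { _ (b , E.refl , o) → σ b , join-el S σ σ' b , orb-σ σ α b o })
          (λ { _ (b , E.refl , o) → α b , join-el S α α' b , orb-α σ α b o })
          (el S a) (h (el S a) ∙ isL-el S a))
          where
          lower : (Σ _ λ b → el S a ≡ el S b × orb σ α b ≡ true) → orb σ α a ≡ true
          lower (b , e , o) = cong (orb σ α) (el-injective S a b e) ∙ o
        from : (∀ a → orb σ α a ≡ true) → ∀ x → orb J A x ≡ isL S x
        from h = by-view S _ (λ a → orb-least σ α (λ a → orb J A (el S a) ≡ true) (orb-zero J A) (λ b o → cong (orb J A) (E.sym (join-el S σ σ' b)) ∙ orb-σ J A (el S b) o)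
             (λ b o → cong (orb J A) (E.sym (join-el S α α' b)) ∙ orb-α J A (el S b) o) a (h a) ∙ E.sym (isL-el S a))
          (λ b → not-true (λ o → right-out b (orb-least J A (λ x → isL S x ≡ true) E.refl (closed σ σ') (closed α α') (er S b) o)) ∙ E.sym (isL-er S b))
          where
          right-out : ∀ b → isL S (er S b) ≢ true
          right-out b e with E.trans (E.sym e) (isL-er S b)
          ... | ()
          not-true : ∀ {c} → c ≢ true → c ≡ false
          not-true {true} n = ⊥-elim (n E.refl)
          not-true {false} n = E.refl
          closed : ∀ f g x → isL S x ≡ true → isL S (join S f g x) ≡ true
          closed f g = by-view S _ (λ a _ → cong (isL S) (join-el S f g a) ∙ isL-el S (f a)) (λ b e → ⊥-elim (right-out b e))

      -- When the orbit of 0 is the left part, both permutations preserve the two parts: on the left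
      -- they form a transitive pair and on the right an arbitrary one. The splitting `inl s` puts 0
      -- on the left.
      fibre : ∀ {k l m} (s : Split k l m) → ∑ (V (suc m)) (λ σ → ∑ (V (suc m)) (λ α → [ is? (inl s) (lookup σ) (lookup α) ] * ω (suc m) (lookup σ) (lookup α))) ≈ Conn k * Tot l
      fibre {k} {l} {m} s = begin
        _ ≈⟨ ∑-cong (V (suc m)) (λ σ → ∑-cong (V (suc m)) (λ α → keep (lookup σ) (lookup α)) » ∑-*ˡ (V (suc m)) _) ⟩
        _ ≈⟨ ∑-preserving S (λ σ → ∑ (V (suc m)) (λ α → [ preserves? S (lookup α) ] * G σ (lookup α)))
               (λ e → ∑-cong (V (suc m)) (λ α → *ˡ (G-cong e (λ _ → E.refl)))) ⟩
        _
          ≈⟨ ∑-cong (V (suc k)) (λ σ → ∑-cong (V l) (λ σ' → ∑-preserving S (G (join S (lookup σ) (lookup σ'))) (G-cong (λ _ → E.refl)))) ⟩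
        _ ≈⟨ ∑-cong (V (suc k)) (λ σ → ∑-cong (V l) (λ σ' → ∑-cong (V (suc k)) (λ α → ∑-cong (V l) (λ α' →
               G-join (lookup σ) (lookup σ') (lookup α) (lookup α')))) » ∑-swap (V l) (V (suc k))) ⟩
        ∑ (V (suc k)) (λ σ → ∑ (V (suc k)) (λ α → ∑ (V l) (λ σ' → ∑ (V l) (λ α' →
          ([ full? (lookup σ) (lookup α) ] * ω (suc k) (lookup σ) (lookup α)) * ω l (lookup σ') (lookup α')))))
          ≈⟨ ∑-cong (V (suc k)) (λ σ → ∑-cong (V (suc k)) (λ α → ∑-cong (V l) (λ σ' → ∑-*ˡ (V l) _) » ∑-*ˡ (V l) _) » ∑-*ʳ (V (suc k)) _) ⟩
        _ ≈⟨ ∑-*ʳ (V (suc k)) _ ⟩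
        _ ∎
        where
        S = inl s
        G : (Fin (suc m) → Fin (suc m)) → (Fin (suc m) → Fin (suc m)) → Carrier
        G σ α = [ is? S σ α ] * ω (suc m) σ α
        G-cong : ∀ {σ σ' α α'} → (∀ x → σ x ≡ σ' x) → (∀ x → α x ≡ α' x) → G σ α ≈ G σ' α'
        G-cong {σ} {σ'} {α} {α'} p q = *-cong ([]-⇔ (is? S σ α) (is? S σ' α') (λ h x → E.sym (orb-cong p q x) ∙ h x) (λ h x → orb-cong p q x ∙ h x))
          (*-cong ([]-⇔ (inj? σ ×-dec inj? α) (inj? σ' ×-dec inj? α') (λ { (i , j) → Inj-cong p i , Inj-cong q j }) (λ { (i , j) → Inj-cong (λ x → E.sym (p x)) i , Inj-cong (λ x → E.sym (q x)) j })) (u-cong p q))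
        keep : ∀ σ α → G σ α ≈ [ preserves? S σ ] * ([ preserves? S α ] * G σ α)
        keep σ α = []-*-cong (is? S σ α) (λ h → []-*-cong (inj? σ ×-dec inj? α) (λ { (i , j) → sym ([]-yes* (preserves? S σ) (Inj⇒preserves S σ i (λ x e → E.sym (h (σ x)) ∙ orb-σ σ α x (h x ∙ e))) »
                       []-yes* (preserves? S α) (Inj⇒preserves S α j (λ x e → E.sym (h (α x)) ∙ orb-α σ α x (h x ∙ e)))) })) »
          solve 5 (λ a b p q x → a :* (b :* (p :* (q :* x))) := p :* (q :* (a :* (b :* x)))) refl _ _ _ _ _
        G-join : ∀ σ σ' α α' → G (join S σ σ') (join S α α') ≈ ([ full? σ α ] * ω (suc k) σ α) * ω l σ' α'
        G-join σ σ' α α' = *-cong ([]-⇔ (is? S _ _) (full? σ α) (proj₁ (T-join s σ σ' α α')) (proj₂ (T-join s σ σ' α α'))) (*ʳ (([]-⇔ (inj? (join S σ σ') ×-dec inj? (join S α α')) ((inj? σ ×-dec inj? α) ×-dec (inj? σ' ×-dec inj? α'))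
                 (λ { (i , j) → (Inj-join-l S i , Inj-join-l S j) , (Inj-join-r S i , Inj-join-r S j) })
                 (λ { ((i , j) , (i' , j')) → Inj-join S i i' , Inj-join S j j' })) » ([]-× (inj? σ ×-dec inj? α) (inj? σ' ×-dec inj? α'))) »
              *-assoc _ _ _ » []-*-cong (inj? σ ×-dec inj? α) (λ { (i , j) → []-*-cong (inj? σ' ×-dec inj? α') (λ { (i' , j') → u-join S i i' j j' }) })) »
          solve 5 (λ f a b x y → f :* (a :* (b :* (x :* y))) := f :* (a :* x) :* (b :* y)) refl _ _ _ _ _

    -- Pairs are sorted by the orbit of 0, which is given by its intersection with the other m
    -- points; `𝕊-unique` says that each pair is met once.
    decomposition : ∀ m → Tot (suc m) ≈ 𝕊 m (λ {k} {l} _ → Conn k * Tot l)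
    decomposition m = begin
      _ ≈⟨ ∑-cong (V (suc m)) (λ σ → ∑-cong (V (suc m)) (λ α → one (lookup σ) (lookup α))) ⟩
      _
        ≈⟨ ∑-cong (V (suc m)) (λ σ → sym (𝕊-∑ m (V (suc m)) (λ α s → [ is? (inl s) (lookup σ) (lookup α) ] * ω (suc m) (lookup σ) (lookup α)))) ⟩
      _
        ≈⟨ 𝕊-∑ m (V (suc m)) (λ σ s → ∑ (V (suc m)) (λ α → [ is? (inl s) (lookup σ) (lookup α) ] * ω (suc m) (lookup σ) (lookup α))) ⟨
      _ ≈⟨ 𝕊-cong m fibre ⟩
      _ ∎
      where
      one : ∀ σ α → ω (suc m) σ α ≈ 𝕊 m (λ s → [ is? (inl s) σ α ] * ω (suc m) σ α)
      one σ α = sym (𝕊-* m (ω (suc m) σ α) (λ s → [ is? (inl s) σ α ]) » *ʳ (𝕊-cong m (λ s → []-⇔ (is? (inl s) σ α) (all≡? (orb σ α ∘ suc) (isL s)) (λ h x → h (suc x)) (λ { h zero → orb-zero σ α ; h (suc x) → h x })) »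
        𝕊-unique m (orb σ α ∘ suc)) » *-identityˡ _)

  -- Binomial convolution. The first point falls into one part or the other, and these two cases are
  -- the two terms of the Leibniz rule.
  𝕊-factorials : ∀ m (a b : Ser) → 𝕊 m (λ {k} {l} _ → (ι (k !) * a k) * (ι (l !) * b l)) ≈ ι (m !) * (a ⊛ b) m
  𝕊-factorials zero a b = solve 2 (λ a b → (:1 :* a) :* (:1 :* b) := :1 :* (a :* b)) refl _ _
  𝕊-factorials (suc m) a b = begin
    _ ≈⟨ +-cong (𝕊-cong m (λ {k} {l} s → *ʳ (shift-fact k a))) (𝕊-cong m (λ {k} {l} s → *ˡ (shift-fact l b))) ⟩
    _ ≈⟨ +-cong (𝕊-factorials m (d a) b) (𝕊-factorials m a (d b)) ⟩
    _ ≈⟨ distribˡ _ _ _ ⟨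
    _ ≈⟨ *ˡ (at (d-leibniz a b) m) ⟨
    _ ≈⟨ shift-fact m (a ⊛ b) ⟨
    _ ∎
    where
    shift-fact : ∀ k (a : Ser) → ι (suc k !) * a (suc k) ≈ ι (k !) * (ι (suc k) * a (suc k))
    shift-fact k a = *ʳ (ι-* (suc k) (k !) » *-comm _ _) » *-assoc _ _ _

  𝕊-zero-left : ∀ m (F : ℕ → ℕ → Carrier) → (∀ k l → F (suc k) l ≈ 0#) → 𝕊 m (λ {k} {l} _ → F k l) ≈ F 0 m
  𝕊-zero-left zero F z = refl
  𝕊-zero-left (suc m) F z = +-cong (𝕊-0 m (λ {k} {l} s → z k l)) (𝕊-zero-left m (λ k l → F k (suc l)) (λ k l → z k (suc l))) » +-identityˡ _

  𝕊-one-left : ∀ m (F : ℕ → ℕ → Carrier) → (∀ k l → k ≢ 1 → F k l ≈ 0#) → 𝕊 (suc m) (λ {k} {l} _ → F k l) ≈ ι (suc m) * F 1 m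
  𝕊-one-left zero F z = +ˡ (z 0 1 (λ ())) » +-identityʳ _ » sym (*-identityˡ _)
  𝕊-one-left (suc m) F z = begin
    _ ≈⟨ +-cong (𝕊-zero-left (suc m) (λ k l → F (suc k) l) (λ k l → z (suc (suc k)) l (λ ()))) (𝕊-one-left m (λ k l → F k (suc l)) (λ k l → z k (suc l))) ⟩
    _ ≈⟨ solve 2 (λ x n → x :+ n :* x := (:1 :+ n) :* x) refl _ _ ⟩
    _ ∎

-- The Boolean predicates of the map count.

all⇒ : ∀ {A : Set} (p : A → Bool) xs → T (all p xs) → ∀ x → x ∈ xs → T (p x)
all⇒ p xs t x x∈ = All.lookup (Allₚ.all⁺ p xs t) x∈

⇒all : ∀ {A : Set} (p : A → Bool) xs → (∀ x → x ∈ xs → T (p x)) → T (all p xs)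
⇒all p xs h = Allₚ.all⁻ p (All.tabulate (λ {x} → h x))

allᶠ⇒ : ∀ {m} {p : Fin m → Bool} → T (Defs.allᶠ p) → ∀ x → T (p x)
allᶠ⇒ {m} {p} t x = all⇒ p (allFin m) t x (∈-allFin x)

⇒allᶠ : ∀ {m} {p : Fin m → Bool} → (∀ x → T (p x)) → T (Defs.allᶠ p)
⇒allᶠ {m} {p} h = ⇒all p (allFin m) (λ x _ → h x)

anyᶠ⇒ : ∀ {m} {p : Fin m → Bool} → T (Defs.anyᶠ p) → ∃ λ x → T (p x)
anyᶠ⇒ {m} {p} t with Any.satisfied (Anyₚ.any⁻ p (allFin m) t)
... | x , q = x , q

⇒anyᶠ : ∀ {m} {p : Fin m → Bool} x → T (p x) → T (Defs.anyᶠ p)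
⇒anyᶠ {m} {p} x t = Anyₚ.any⁺ p (Any.map (λ { E.refl → t }) (∈-allFin x))

==⇒ : ∀ {m} (i j : Fin m) → T (i Defs.==ᶠ j) → i ≡ j
==⇒ i j t = FP.toℕ-injective (NP.≡ᵇ⇒≡ (toℕ i) (toℕ j) t)

⇒== : ∀ {m} (i : Fin m) {j} → i ≡ j → T (i Defs.==ᶠ j)
⇒== i E.refl = NP.≡⇒≡ᵇ (toℕ i) (toℕ i) E.refl

T∨⇒ : ∀ {a b} → T (a ∨ b) → T a ⊎ T b
T∨⇒ {true} t = inj₁ t
T∨⇒ {false} t = inj₂ t

⇒T∨ : ∀ a {b} → T a ⊎ T b → T (a ∨ b)
⇒T∨ true _ = tt
⇒T∨ false (inj₂ t) = t

T∧⇒ : ∀ {a b} → T (a ∧ b) → T a × T b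
T∧⇒ {true} t = tt , t

⇒T∧ : ∀ {a b} → T a → T b → T (a ∧ b)
⇒T∧ {true} _ t = t

Tnot⇒ : ∀ {a} → T (not a) → ¬ T a
Tnot⇒ {false} _ ()

⇒Tnot : ∀ {a} → ¬ T a → T (not a)
⇒Tnot {true} n = ⊥-elim (n tt)
⇒Tnot {false} n = tt

isPerm⇒Inj : ∀ {m} (f : Fin m → Fin m) → T (Defs.isPerm f) → Inj f
isPerm⇒Inj f t x y e with T∨⇒ {x Defs.==ᶠ y} (allᶠ⇒ (allᶠ⇒ t x) y)
... | inj₁ p = ==⇒ x y p
... | inj₂ n = ⊥-elim (Tnot⇒ n (⇒== (f x) e))

Inj⇒isPerm : ∀ {m} (f : Fin m → Fin m) → Inj f → T (Defs.isPerm f)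
Inj⇒isPerm f i = ⇒allᶠ (λ x → ⇒allᶠ (λ y → ⇒T∨ (x Defs.==ᶠ y) (case x y (f x FP.≟ f y))))
  where
  case : ∀ x y → Dec (f x ≡ f y) → T (x Defs.==ᶠ y) ⊎ T (not (f x Defs.==ᶠ f y))
  case x y (yes e) = inj₁ (⇒== x (i x y e))
  case x y (no n) = inj₂ (⇒Tnot (n ∘ ==⇒ (f x) (f y)))

FPF : ∀ {m} → (Fin m → Fin m) → Set
FPF α = ∀ x → α (α x) ≡ x × α x ≢ x

fpf? : ∀ {m} (α : Fin m → Fin m) → Dec (FPF α)
fpf? α = FP.all? (λ x → (α (α x) FP.≟ x) ×-dec ¬? (α x FP.≟ x))

isFPF⇒ : ∀ {m} (α : Fin m → Fin m) → T (Defs.isFPFInvolution α) → FPF α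
isFPF⇒ α t x = let (p , q) = T∧⇒ {α (α x) Defs.==ᶠ x} (allᶠ⇒ t x) in ==⇒ _ x p , λ e → Tnot⇒ q (⇒== (α x) e)

⇒isFPF : ∀ {m} (α : Fin m → Fin m) → FPF α → T (Defs.isFPFInvolution α)
⇒isFPF α f = ⇒allᶠ (λ x → ⇒T∧ (⇒== (α (α x)) (proj₁ (f x))) (⇒Tnot (proj₂ (f x) ∘ ==⇒ (α x) x)))

FPF⇒Inj : ∀ {m} {α : Fin m → Fin m} → FPF α → Inj α
FPF⇒Inj {α = α} f x y e = E.sym (proj₁ (f x)) ∙ cong α e ∙ proj₁ (f y)

-- Reachability.

data Reach {m} (σ α : Fin m → Fin m) (i : Fin m) : Fin m → Set where
  start : Reach σ α i i
  step-σ : ∀ {l} → Reach σ α i l → Reach σ α i (σ l)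
  step-α : ∀ {l} → Reach σ α i l → Reach σ α i (α l)

Reach-trans : ∀ {m} {σ α : Fin m → Fin m} {i j k} → Reach σ α i j → Reach σ α j k → Reach σ α i k
Reach-trans p start = p
Reach-trans p (step-σ q) = step-σ (Reach-trans p q)
Reach-trans p (step-α q) = step-α (Reach-trans p q)

count : ∀ {m} → (Fin m → Bool) → ℕ
count {zero} p = 0
count {suc m} p = (if p zero then 1 else 0) N.+ count (p ∘ suc)

count-≤ : ∀ {m} (p q : Fin m → Bool) → (∀ x → T (p x) → T (q x)) → count p N.≤ count q
count-≤ {zero} p q h = z≤n
count-≤ {suc m} p q h = NP.+-mono-≤ (bit (p zero) (q zero) (h zero)) (count-≤ (p ∘ suc) (q ∘ suc) (h ∘ suc))
  where
  bit : ∀ a b → (T a → T b) → (if a then 1 else 0) N.≤ (if b then 1 else 0)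
  bit false b h = z≤n
  bit true true h = s≤s z≤n
  bit true false h = ⊥-elim (h tt)

count-< : ∀ {m} (p q : Fin m → Bool) → (∀ x → T (p x) → T (q x)) → ∀ x → T (q x) → ¬ T (p x) → count p N.< count q
count-< {suc m} p q h zero tq np with p zero | q zero
... | true | _ = ⊥-elim (np tt)
... | false | true = s≤s (count-≤ (p ∘ suc) (q ∘ suc) (h ∘ suc))
count-< {suc m} p q h (suc x) tq np = NP.+-mono-≤-< (bit (p zero) (q zero) (h zero)) (count-< (p ∘ suc) (q ∘ suc) (h ∘ suc) x tq np)
  where
  bit : ∀ a b → (T a → T b) → (if a then 1 else 0) N.≤ (if b then 1 else 0)
  bit false b h = z≤n
  bit true true h = s≤s z≤n
  bit true false h = ⊥-elim (h tt)

count-bound : ∀ {m} (p : Fin m → Bool) → count p N.≤ m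
count-bound {zero} p = z≤n
count-bound {suc m} p with p zero
... | true = s≤s (count-bound (p ∘ suc))
... | false = NP.m≤n⇒m≤1+n (count-bound (p ∘ suc))

module _ {m} (σ α : Fin m → Fin m) (i : Fin m) where

  private
    r : ℕ → Fin m → Bool
    r k = Defs.reach σ α k i

    sound : ∀ k j → T (r k j) → Reach σ α i j
    sound zero j t with ==⇒ i j t
    ... | E.refl = start
    sound (suc k) j t with T∨⇒ {r k j} t
    ... | inj₁ p = sound k j p
    ... | inj₂ p with anyᶠ⇒ p
    ... | l , q with T∧⇒ {r k l} q
    ... | a , b with T∨⇒ {σ l Defs.==ᶠ j} b
    ... | inj₁ e = subst (Reach σ α i) (==⇒ (σ l) j e) (step-σ (sound k l a))
    ... | inj₂ e = subst (Reach σ α i) (==⇒ (α l) j e) (step-α (sound k l a))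

    grow : ∀ k j → T (r k j) → T (r (suc k) j)
    grow k j t = ⇒T∨ (r k j) (inj₁ t)

    grow-σ : ∀ k l → T (r k l) → T (r (suc k) (σ l))
    grow-σ k l t = ⇒T∨ (r k (σ l)) (inj₂ (⇒anyᶠ l (⇒T∧ {r k l} t (⇒T∨ (σ l Defs.==ᶠ σ l) (inj₁ (⇒== (σ l) E.refl))))))

    grow-α : ∀ k l → T (r k l) → T (r (suc k) (α l))
    grow-α k l t = ⇒T∨ (r k (α l)) (inj₂ (⇒anyᶠ l (⇒T∧ {r k l} t (⇒T∨ (σ l Defs.==ᶠ α l) (inj₂ (⇒== (α l) E.refl))))))

    begin' : ∀ k → T (r k i)
    begin' zero = ⇒== i E.refl
    begin' (suc k) = grow k i (begin' k)

    Closed : ℕ → Set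
    Closed k = ∀ l → T (r k l) → T (r k (σ l)) × T (r k (α l))

    closed⇒ : ∀ k → Closed k → ∀ {j} → Reach σ α i j → T (r k j)
    closed⇒ k c start = begin' k
    closed⇒ k c (step-σ p) = proj₁ (c _ (closed⇒ k c p))
    closed⇒ k c (step-α p) = proj₂ (c _ (closed⇒ k c p))

    -- Each round of `reach` either adds a point or shows that the set reached is closed. At k = m
    -- the count would exceed the number of points, so m rounds reach everything.
    saturate : ∀ k → (∀ {j} → Reach σ α i j → T (r k j)) ⊎ k N.< count (r k)
    saturate zero = inj₂ (NP.≤-trans (s≤s z≤n) (count-< (λ _ → false) (r 0) (λ _ ()) i (begin' 0) (λ ())))
    saturate (suc k) with saturate k
    ... | inj₁ p = inj₁ (λ q → grow k _ (p q))
    ... | inj₂ p with FP.all? (λ l → T? (r k l) →-dec (T? (r k (σ l)) ×-dec T? (r k (α l))))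
    ... | yes c = inj₁ (λ q → grow k _ (closed⇒ k c q))
    ... | no nc with FP.¬∀⟶∃¬ m _ (λ l → T? (r k l) →-dec (T? (r k (σ l)) ×-dec T? (r k (α l)))) nc
    ... | l , n with T? (r k l)
    ... | no nl = ⊥-elim (n (λ t → ⊥-elim (nl t)))
    ... | yes tl with T? (r k (σ l))
    ... | no nσ = inj₂ (NP.≤-<-trans p (count-< (r k) (r (suc k)) (grow k) (σ l) (grow-σ k l tl) nσ))
    ... | yes tσ = inj₂ (NP.≤-<-trans p (count-< (r k) (r (suc k)) (grow k) (α l) (grow-α k l tl) (λ tα → n (λ _ → tσ , tα))))

  reach⇒ : ∀ k j → T (Defs.reach σ α k i j) → Reach σ α i j
  reach⇒ = sound

  ⇒reach : ∀ {j} → Reach σ α i j → T (Defs.reach σ α m i j)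
  ⇒reach q with saturate m
  ... | inj₁ p = p q
  ... | inj₂ p = ⊥-elim (NP.<-irrefl E.refl (NP.<-≤-trans p (count-bound (r m))))

T⇒≡ : ∀ {b} → T b → b ≡ true
T⇒≡ {true} _ = E.refl

≡⇒T : ∀ {b} → b ≡ true → T b
≡⇒T E.refl = tt

reachOrbits : Orbits
reachOrbits = record
  { orb = λ {m} σ α x → Defs.reach σ α (suc m) zero x
  ; orb-zero = λ σ α → T⇒≡ (⇒reach σ α zero start)
  ; orb-σ = λ {m} σ α x e → T⇒≡ (⇒reach σ α zero (step-σ (reach⇒ σ α zero (suc m) x (≡⇒T e))))
  ; orb-α = λ {m} σ α x e → T⇒≡ (⇒reach σ α zero (step-α (reach⇒ σ α zero (suc m) x (≡⇒T e))))
  ; orb-least = λ {m} σ α P p pσ pα x e → least P p pσ pα (reach⇒ σ α zero (suc m) x (≡⇒T e)) }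
  where
  least : ∀ {m} {σ α : Fin m → Fin m} {i} (P : Fin m → Set) → P i → (∀ x → P x → P (σ x)) → (∀ x → P x → P (α x)) → ∀ {x} → Reach σ α i x → P x
  least P p pσ pα start = p
  least P p pσ pα (step-σ q) = pσ _ (least P p pσ pα q)
  least P p pσ pα (step-α q) = pα _ (least P p pσ pα q)

-- Iterates of a permutation.

module Iterates {m} (σ : Fin m → Fin m) (σ-inj : Inj σ) where

  it : ℕ → Fin m → Fin m
  it = Defs.iter σ

  it-+ : ∀ a b x → it (a N.+ b) x ≡ it a (it b x)
  it-+ zero b x = E.refl
  it-+ (suc a) b x = cong σ (it-+ a b x)

  it-inj : ∀ k → Inj (it k)
  it-inj zero x y e = e
  it-inj (suc k) x y e = it-inj k x y (σ-inj _ _ e)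

  period : ∀ x → ∃ λ p → suc p N.≤ m × it (suc p) x ≡ x
  period x with FP.pigeonhole (NP.n<1+n m) (λ (k : Fin (suc m)) → it (toℕ k) x)
  ... | a , b , a<b , e = p , ≤m , it-inj (toℕ a) _ _ (E.sym (it-+ (toℕ a) (suc p) x) ∙ cong (λ k → it k x) a+p≡b ∙ E.sym e)
    where
    p = toℕ b N.∸ suc (toℕ a)
    a+p≡b : toℕ a N.+ suc p ≡ toℕ b
    a+p≡b = NP.+-suc (toℕ a) p ∙ NP.m+[n∸m]≡n a<b
    ≤m : suc p N.≤ m
    ≤m = NP.≤-trans (NP.≤-trans (NP.m≤n+m (suc p) (toℕ a)) (NP.≤-reflexive a+p≡b)) (NP.≤-pred (FP.toℕ<n b))

  it-multiple : ∀ p x → it (suc p) x ≡ x → ∀ q → it (q N.* suc p) x ≡ x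
  it-multiple p x e zero = E.refl
  it-multiple p x e (suc q) = it-+ (suc p) (q N.* suc p) x ∙ cong (it (suc p)) (it-multiple p x e q) ∙ e

  it-reduce : ∀ x j → ∃ λ k → k N.< m × it j x ≡ it k x
  it-reduce x j with period x
  ... | p , p<m , e = j % suc p , NP.<-≤-trans (m%n<n j (suc p)) p<m , cong (λ k → it k x) (m≡m%n+[m/n]*n j (suc p)) ∙ it-+ (j % suc p) (j N./ suc p N.* suc p) x ∙ cong (it (j % suc p)) (it-multiple p x e (j N./ suc p))

  it-back : ∀ x k → ∃ λ j → it j (it k x) ≡ x
  it-back x k with period x
  ... | p , _ , e = k N.* p , E.trans (E.sym (it-+ (k N.* p) k x)) (cong (λ j → it j x) arith ∙ it-multiple p x e k)
    where
    arith : k N.* p N.+ k ≡ k N.* suc p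
    arith = NP.+-comm (k N.* p) k ∙ E.sym (NP.*-suc k p)

  Smaller : Fin m → Set
  Smaller x = ∃ λ (k : Fin m) → toℕ (it (toℕ k) x) N.< toℕ x

  smaller? : ∀ x → Dec (Smaller x)
  smaller? x = FP.any? (λ k → toℕ (it (toℕ k) x) N.<? toℕ x)

  least-iterate : ∀ x → ¬ Smaller x → ∀ j → toℕ x N.≤ toℕ (it j x)
  least-iterate x n j with it-reduce x j
  ... | k , k<m , e = NP.≮⇒≥ (λ lt → n (fromℕ< k<m , subst (λ i → toℕ (it i x) N.< toℕ x) (E.sym (FP.toℕ-fromℕ< k<m)) (subst (λ y → toℕ y N.< toℕ x) e lt)))

  -- A pointer to a smaller iterate, or to x itself if x is least on its cycle. Invariance of a
  -- colouring amounts to being constant along these pointers, which leaves the colours free exactly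
  -- at the least elements.
  ref : ∀ x → Dec (Smaller x) → Fin m
  ref x (yes (k , _)) = it (toℕ k) x
  ref x (no _) = x

  Inv-it : ∀ {N} (d : Vec (Fin N) m) → Inv σ d → ∀ k x → lookup d (it k x) ≡ lookup d x
  Inv-it d inv zero x = E.refl
  Inv-it d inv (suc k) x = inv (it k x) ∙ Inv-it d inv k x

  Compatible : ∀ {N} → Vec (Fin N) m → Set
  Compatible d = ∀ x → lookup d x ≡ lookup d (ref x (smaller? x))

  Inv⇒Compatible : ∀ {N} (d : Vec (Fin N) m) → Inv σ d → Compatible d
  Inv⇒Compatible d inv x with smaller? x
  ... | yes (k , _) = E.sym (Inv-it d inv (toℕ k) x)
  ... | no _ = E.refl

  private
    descend : ∀ {N} (d : Vec (Fin N) m) → Compatible d → ∀ x → Acc N._<_ (toℕ x) → ∃ λ k → ¬ Smaller (it k x) × lookup d x ≡ lookup d (it k x)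
    descend d c x (acc rec) with smaller? x | c x
    ... | no n | _ = 0 , n , E.refl
    ... | yes (k , lt) | e with descend d c (it (toℕ k) x) (rec lt)
    ... | j , n , e' = j N.+ toℕ k , subst (λ y → ¬ Smaller y) (E.sym (it-+ j (toℕ k) x)) n , e ∙ e' ∙ cong (lookup d) (E.sym (it-+ j (toℕ k) x))

  -- Following the pointers from x and from σ x ends at least elements of one and the same cycle,
  -- hence at the same point.
  Compatible⇒Inv : ∀ {N} (d : Vec (Fin N) m) → Compatible d → Inv σ d
  Compatible⇒Inv d c x with descend d c x (<-wellFounded _) | descend d c (σ x) (<-wellFounded _)
  ... | k , n , e | k' , n' , e' = E.trans e' (cong (lookup d) same ∙ E.sym e)
    where
    y = it k x
    y' = it k' (σ x)
    to : ∃ λ j → it j y ≡ y'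
    to with it-back x k
    ... | b , h = k' N.+ (1 N.+ b) , it-+ k' (1 N.+ b) y ∙ cong (it k') (cong σ h)
    from : ∃ λ j → it j y' ≡ y
    from with it-back (σ x) k' | it-back x 1
    ... | b , h | b' , h' = k N.+ (b' N.+ b) , it-+ k (b' N.+ b) y' ∙ cong (it k) (it-+ b' b y' ∙ cong (it b') h ∙ h')
    same : y' ≡ y
    same = FP.toℕ-injective (NP.≤-antisym (subst (λ w → toℕ y' N.≤ toℕ w) (proj₂ from) (least-iterate y' n' (proj₁ from))) (subst (λ w → toℕ y N.≤ toℕ w) (proj₂ to) (least-iterate y n (proj₁ to))))

  ref-< : ∀ x → Smaller x → toℕ (ref x (smaller? x)) N.< toℕ x
  ref-< x s with smaller? x
  ... | yes (k , lt) = lt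
  ... | no n = ⊥-elim (n s)

  ref-self : ∀ x → ¬ Smaller x → ref x (smaller? x) ≡ x
  ref-self x n with smaller? x
  ... | yes s = ⊥-elim (n s)
  ... | no _ = E.refl

Reach-it : ∀ {m} {σ α : Fin m → Fin m} {i j} k → Reach σ α i j → Reach σ α i (Defs.iter σ k j)
Reach-it zero p = p
Reach-it (suc k) p = step-σ (Reach-it k p)

Reach-it' : ∀ {m} {σ α : Fin m → Fin m} {i j} k → Reach σ α i j → Reach σ α i (Defs.iter α k j)
Reach-it' zero p = p
Reach-it' (suc k) p = step-α (Reach-it' k p)

-- A step along a permutation is undone by an iterate of that permutation, so forward reachability
-- already gives the orbits of the generated group.
Reach-sym : ∀ {m} {σ α : Fin m → Fin m} → Inj σ → Inj α → ∀ {i j} → Reach σ α i j → Reach σ α j i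
Reach-sym i₁ i₂ start = start
Reach-sym {σ = σ} {α} i₁ i₂ (step-σ {l} p) with Iterates.it-back σ i₁ l 1
... | b , e = Reach-trans (subst (Reach σ α (σ l)) e (Reach-it b start)) (Reach-sym i₁ i₂ p)
Reach-sym {σ = σ} {α} i₁ i₂ (step-α {l} p) with Iterates.it-back α i₂ l 1
... | b , e = Reach-trans (subst (Reach σ α (α l)) e (Reach-it' b start)) (Reach-sym i₁ i₂ p)

transitive⇒ : ∀ {m} (σ α : Fin (suc m) → Fin (suc m)) → T (Defs.transitive σ α) → ∀ x → Orbits.orb reachOrbits σ α x ≡ true
transitive⇒ {m} σ α t x = T⇒≡ (allᶠ⇒ {p = Defs.reach σ α (suc m) zero} (allᶠ⇒ {p = λ i → Defs.allᶠ (Defs.reach σ α (suc m) i)} t zero) x)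

⇒transitive : ∀ {m} (σ α : Fin (suc m) → Fin (suc m)) → Inj σ → Inj α → (∀ x → Orbits.orb reachOrbits σ α x ≡ true) → T (Defs.transitive σ α)
⇒transitive {m} σ α i₁ i₂ h = ⇒allᶠ {p = λ i → Defs.allᶠ (Defs.reach σ α (suc m) i)} (λ i → ⇒allᶠ {p = Defs.reach σ α (suc m) i} (λ j → ⇒reach σ α i
  (Reach-trans (Reach-sym i₁ i₂ (reach⇒ σ α zero (suc m) i (≡⇒T (h i)))) (reach⇒ σ α zero (suc m) j (≡⇒T (h j))))))

-- Counting colourings: an invariant colouring is free exactly at the least elements of the cycles.

count-snoc : ∀ m (p : Fin (suc m) → Bool) → count p ≡ (if p (fromℕ m) then 1 else 0) N.+ count (p ∘ inject₁)
count-snoc zero p = E.refl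
count-snoc (suc m) p = E.trans (cong (x N.+_) (count-snoc m (p ∘ suc))) (E.sym (NP.+-assoc x y c) ∙ cong (N._+ c) (NP.+-comm x y) ∙ NP.+-assoc y x c)
  where
  x = if p zero then 1 else 0
  y = if p (fromℕ (suc m)) then 1 else 0
  c = count (p ∘ suc ∘ inject₁)

count-opposite : ∀ {m} (p : Fin m → Bool) → count (p ∘ opposite) ≡ count p
count-opposite {zero} p = E.refl
count-opposite {suc m} p = cong ((if p (fromℕ m) then 1 else 0) N.+_) (count-opposite (p ∘ inject₁)) ∙ E.sym (count-snoc m p)

length-filter : ∀ {m n} (f : Fin m → Fin n) (p : Fin n → Bool) → length (filterᵇ p (List.tabulate f)) ≡ count (p ∘ f)
length-filter {zero} f p = E.refl
length-filter {suc m} f p with p (f zero)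
... | true = cong suc (length-filter (f ∘ suc) p)
... | false = length-filter (f ∘ suc) p

module CycleCount (K : CommutativeRing 0ℓ 0ℓ) (N : ℕ) where

  open Kit K
  open Colourings K N

  private
    -- Constraints point to larger indices only. Choosing colours from the last point down to the
    -- first, a free point offers N colours and a bound one exactly one.
    free : ∀ {m} (r : Fin m → Fin m) (b : Fin m → Bool) → (∀ x → b x ≡ true → r x ≡ x) → (∀ x → b x ≡ false → toℕ x N.< toℕ (r x)) → ∑ (colours m) (λ d → [ FP.all? (λ x → lookup d x FP.≟ lookup d (r x)) ] * 1#) ≈ ι (N N.^ count b)
    free {zero} r b h< h = +-identityʳ _ » *-identityˡ _
    free {suc m} r b h= h< = trans (∑-vecs (fins N) m) (go (b zero) E.refl)
      where
      r' : Fin m → Fin m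
      r' x = drop (r (suc x)) x
      r-suc : ∀ x → r (suc x) ≡ suc (r' x)
      r-suc x with b (suc x) in e | r (suc x) in e'
      ... | true | suc y = E.refl
      ... | false | suc y = E.refl
      ... | true | zero with E.trans (E.sym e') (h= (suc x) e)
      ... | ()
      r-suc x | false | zero with subst (λ y → suc (toℕ x) N.< toℕ y) e' (h< (suc x) e)
      ... | ()
      ok? : ∀ (d : Vec (Fin N) m) → Dec (∀ x → lookup d x ≡ lookup d (r' x))
      ok? d = FP.all? (λ x → lookup d x FP.≟ lookup d (r' x))
      okk? : ∀ (d : Vec (Fin N) (suc m)) → Dec (∀ x → lookup d x ≡ lookup d (r x))
      okk? d = FP.all? (λ x → lookup d x FP.≟ lookup d (r x))
      rest : ∀ i (d : Vec (Fin N) m) → (∀ x → lookup d x ≡ lookup d (r' x)) → ∀ x → lookup (i ∷ d) (suc x) ≡ lookup (i ∷ d) (r (suc x))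
      rest i d h x = h x ∙ cong (lookup (i ∷ d)) (E.sym (r-suc x))
      rest⁻ : ∀ i (d : Vec (Fin N) m) → (∀ x → lookup (i ∷ d) x ≡ lookup (i ∷ d) (r x)) → ∀ x → lookup d x ≡ lookup d (r' x)
      rest⁻ i d h x = h (suc x) ∙ cong (lookup (i ∷ d)) (r-suc x)
      tailfree : ∑ (colours m) (λ d → [ ok? d ] * 1#) ≈ ι (N N.^ count (b ∘ suc))
      tailfree = free r' (b ∘ suc) (λ x e → FP.suc-injective (E.sym (r-suc x) ∙ h= (suc x) e)) (λ x e → NP.≤-pred (subst (λ y → suc (toℕ x) N.< toℕ y) (r-suc x) (h< (suc x) e)))
      go : ∀ c → b zero ≡ c → ∑ (fins N) (λ i → ∑ (colours m) (λ d → [ okk? (i ∷ d) ] * 1#)) ≈ ι (N N.^ ((if b zero then 1 else 0) N.+ count (b ∘ suc)))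
      go true e = begin
        _ ≈⟨ ∑-cong (fins N) (λ i → ∑-cong (colours m) (λ d → *ʳ ([]-⇔ (okk? (i ∷ d)) (ok? d) (rest⁻ i d) (λ { h zero → cong (lookup (i ∷ d)) (E.sym (h= zero e)) ; h (suc x) → rest i d h x })))) ⟩
        _ ≈⟨ ∑-fins-const N _ » *ˡ tailfree ⟩
        _ ≈⟨ ι-* N _ ⟨
        _ ≡⟨ cong (λ c → ι (N N.^ ((if c then 1 else 0) N.+ count (b ∘ suc)))) e ⟨
        _ ∎
      go false e = tied (r zero) E.refl
        where
        tied : ∀ z → r zero ≡ z → ∑ (fins N) (λ i → ∑ (colours m) (λ d → [ okk? (i ∷ d) ] * 1#)) ≈ ι (N N.^ ((if b zero then 1 else 0) N.+ count (b ∘ suc)))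
        tied zero e' with subst (λ y → 0 N.< toℕ y) e' (h< zero e)
        ... | ()
        tied (suc y) e' = begin
          _ ≈⟨ ∑-cong (fins N) (λ i → ∑-cong (colours m) (λ d → *ʳ (([]-⇔ (okk? (i ∷ d)) ((i FP.≟ lookup d y) ×-dec ok? d) (λ h → h zero ∙ cong (lookup (i ∷ d)) e' , rest⁻ i d h)
                 (λ { (p , h) zero → E.trans p (cong (lookup (i ∷ d)) (E.sym e')) ; (p , h) (suc x) → rest i d h x })) »
                 ([]-× (i FP.≟ lookup d y) (ok? d))) » *-assoc _ _ _)) ⟩
          _ ≈⟨ ∑-swap (fins N) (colours m) » ∑-cong (colours m) (λ d → ∑-δ (finE N) (lookup d y) (λ i → i FP.≟ lookup d y) E.refl (λ _ → id)) ⟩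
          _ ≈⟨ tailfree ⟩
          _ ≡⟨ cong (λ c → ι (N N.^ ((if c then 1 else 0) N.+ count (b ∘ suc)))) e ⟨
          _ ∎

  -- The pointers of `ref` lead to smaller points but `free` wants larger ones, so the points are
  -- reflected by `opposite`.
  w-z : ∀ {m} (σ : Fin m → Fin m) → Inj σ → w σ ≈ ι (N N.^ Defs.z σ)
  w-z {m} σ i = begin
    _ ≈⟨ ∑-reindex (vecE (finE N) m) (vecE (finE N) m) (inv? σ) (λ d → FP.all? (λ x → lookup d x FP.≟ lookup d (r x))) mirror mirror
           (λ d h x → lookup-flip d x ∙ Inv⇒Compatible d h (opposite x) ∙ cong (lookup d) (E.sym (FP.opposite-involutive _)) ∙ E.sym (lookup-flip d (r x)))
           (λ d h → Compatible⇒Inv (mirror d) (λ x → lookup-flip d x ∙ h (opposite x) ∙ cong (λ y → lookup d (opposite (ref y (smaller? y)))) (FP.opposite-involutive x) ∙ E.sym (lookup-flip d _)))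
           (λ d _ → flip-flip d) (λ d _ → flip-flip d) (λ _ _ → refl) ⟩
    _ ≈⟨ free r (b ∘ opposite) (λ x e → cong opposite (ref-self (opposite x) (b-true (opposite x) e)) ∙ FP.opposite-involutive x)
           (λ x e → flip-< x _ (ref-< (opposite x) (b-false (opposite x) e))) ⟩
    _ ≡⟨ cong (λ k → ι (N N.^ k)) (count-opposite b ∙ E.sym (length-filter id b)) ⟩
    _ ∎
    where
    open Iterates σ i
    b : Fin m → Bool
    b x = all (λ k → toℕ x ≤ᵇ toℕ (Defs.iter σ k x)) (upTo m)
    r : Fin m → Fin m
    r x = opposite (ref (opposite x) (smaller? (opposite x)))
    mirror : Vec (Fin N) m → Vec (Fin N) m
    mirror d = tabulate (lookup d ∘ opposite)
    lookup-flip : ∀ d x → lookup (mirror d) x ≡ lookup d (opposite x)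
    lookup-flip d = lookup∘tabulate (lookup d ∘ opposite)
    flip-flip : ∀ d → mirror (mirror d) ≡ d
    flip-flip d = vec-ext (λ x → lookup-flip (mirror d) x ∙ lookup-flip d (opposite x) ∙ cong (lookup d) (FP.opposite-involutive x))
    b-true : ∀ x → b x ≡ true → ¬ Smaller x
    b-true x e (k , lt) = NP.<⇒≱ lt (NP.≤ᵇ⇒≤ _ _ (all⇒ (λ k → toℕ x ≤ᵇ toℕ (it k x)) (upTo m) (≡⇒T e) (toℕ k) (∈-upTo⁺ (FP.toℕ<n k))))
    b-false : ∀ x → b x ≡ false → Smaller x
    b-false x e with smaller? x
    ... | yes s = s
    ... | no n = ⊥-elim (subst T e (⇒all (λ k → toℕ x ≤ᵇ toℕ (it k x)) (upTo m) (λ k _ → NP.≤⇒≤ᵇ (least-iterate x n k))))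
    flip-< : ∀ x y → toℕ y N.< toℕ (opposite x) → toℕ x N.< toℕ (opposite y)
    flip-< x y lt = subst (toℕ x N.<_) (E.sym (FP.opposite-prop y)) (NP.m+n≤o⇒m≤o∸n (suc (toℕ x)) (E.subst₂ N._≤_ (E.sym (NP.+-suc (suc (toℕ x)) (toℕ y))) (NP.m+[n∸m]≡n (FP.toℕ<n x))
        (NP.≤-trans (NP.≤-reflexive (cong suc (E.sym (NP.+-suc (toℕ x) (toℕ y))))) (NP.+-monoʳ-≤ (suc (toℕ x)) (subst (suc (toℕ y) N.≤_) (FP.opposite-prop x) lt)))))

  ∑-filterᵇ : ∀ {A : Set} (p : A → Bool) (xs : List A) {f : A → Carrier} → ∑ (filterᵇ p xs) f ≈ ∑ xs (λ x → [ T? (p x) ] * f x)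
  ∑-filterᵇ p [] = refl
  ∑-filterᵇ p (x ∷ xs) with p x
  ... | true = +-cong (sym (*-identityˡ _)) (∑-filterᵇ p xs)
  ... | false = ∑-filterᵇ p xs » sym (+-identityˡ _) » +ʳ (sym (zeroˡ _))

allFin≡fins : ∀ n → allFin n ≡ fins n
allFin≡fins zero = E.refl
allFin≡fins (suc n) = cong (zero ∷_) (E.sym (map-tabulate id suc) ∙ cong (map suc) (allFin≡fins n))

allVecs≡vecs : ∀ k m → Defs.allVecs k m ≡ vecs (fins m) k
allVecs≡vecs zero m = E.refl
allVecs≡vecs (suc k) m = cong₂ (λ vs xs → List.concatMap (λ i → map (i ∷_) vs) xs) (allVecs≡vecs k m) (allFin≡fins m)

-- Gains two successors when n gains one, which 2 * n does not by computation.
dbl : ℕ → ℕ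
dbl zero = zero
dbl (suc n) = suc (suc (dbl n))

module Doubling (K : CommutativeRing 0ℓ 0ℓ) where

  open Kit K

  ι-dbl : ∀ n → ι (dbl n) ≈ ι 2 * ι n
  ι-dbl zero = sym (zeroʳ _)
  ι-dbl (suc n) = begin
    _ ≈⟨ ι-suc (suc (dbl n)) » +ˡ (ι-suc (dbl n)) ⟩
    _ ≈⟨ +ˡ (+ˡ (ι-dbl n)) ⟩
    _ ≈⟨ solve 1 (λ x → :1 :+ (:1 :+ :2 :* x) := :2 :* (:1 :+ x)) refl (ι n) ⟩
    _ ≈⟨ *ˡ (ι-suc n) ⟨
    _ ∎

-- oddfact n = (2n - 1)!!
oddfact : ℕ → ℕ
oddfact zero = 1
oddfact (suc n) = suc (dbl n) N.* oddfact n

FPF-join : ∀ {k l m} (s : Split k l m) {f g} → FPF f → FPF g → FPF (join s f g)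
FPF-join s {f} {g} p q = by-view s _ (λ a → cong (join s f g) (join-el s f g a) ∙ join-el s f g (f a) ∙ cong (el s) (proj₁ (p a)) , λ e → proj₂ (p a) (el-injective s _ _ (E.sym (join-el s f g a) ∙ e)))
  (λ b → cong (join s f g) (join-er s f g b) ∙ join-er s f g (g b) ∙ cong (er s) (proj₁ (q b)) , λ e → proj₂ (q b) (er-injective s _ _ (E.sym (join-er s f g b) ∙ e)))

FPF-join-l : ∀ {k l m} (s : Split k l m) {f g} → FPF (join s f g) → FPF f
FPF-join-l s {f} {g} h a = el-injective s _ _ (E.sym (join-el s f g (f a)) ∙ cong (join s f g) (E.sym (join-el s f g a)) ∙ proj₁ (h (el s a))) , λ e → proj₂ (h (el s a)) (join-el s f g a ∙ cong (el s) e)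

FPF-join-r : ∀ {k l m} (s : Split k l m) {f g} → FPF (join s f g) → FPF g
FPF-join-r s {f} {g} h b = er-injective s _ _ (E.sym (join-er s f g (g b)) ∙ cong (join s f g) (E.sym (join-er s f g b)) ∙ proj₁ (h (er s b))) , λ e → proj₂ (h (er s b)) (join-er s f g b ∙ cong (er s) e)

FPF-cong : ∀ {m} {α β : Fin m → Fin m} → (∀ x → α x ≡ β x) → FPF α → FPF β
FPF-cong {α = α} {β} e h x = cong β (E.sym (e x)) ∙ E.sym (e (α x)) ∙ proj₁ (h x) , λ q → proj₂ (h x) (e x ∙ q)

-- Multiplicativity over components and the sum over matchings

module Multiplicative (K : CommutativeRing 0ℓ 0ℓ) (N : ℕ) where

  open Kit K
  open Colourings K N
  open Exponential K using (∑-merge)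

  ∑inv-join : ∀ {k l m} (s : Split k l m) f g {G : Vec (Fin N) m → Carrier} {G₁ G₂} → (∀ c d → G (merge s c d) ≈ G₁ c * G₂ d) → ∑inv (join s f g) G ≈ ∑inv f G₁ * ∑inv g G₂
  ∑inv-join {k} {l} {m} s f g {G} {G₁} {G₂} mult = begin
    _ ≈⟨ ∑-merge (fins N) s _ ⟩
    _ ≈⟨ ∑-cong (colours k) (λ c → ∑-cong (colours l) (λ d → *-cong
           (([]-⇔ (inv? (join s f g) (merge s c d)) (inv? f c ×-dec inv? g d) (to c d) (from c d)) » ([]-× (inv? f c) (inv? g d))) (mult c d) »
           solve 4 (λ a b x y → a :* b :* (x :* y) := a :* x :* (b :* y)) refl _ _ _ _) » ∑-*ˡ (colours l) _) ⟩
    _ ≈⟨ ∑-*ʳ (colours k) _ ⟩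
    _ ∎
    where
    to : ∀ c d → Inv (join s f g) (merge s c d) → Inv f c × Inv g d
    to c d h = (λ a → E.sym (lookup-merge-el s c d (f a)) ∙ cong (lookup (merge s c d)) (E.sym (join-el s f g a)) ∙ h (el s a) ∙ lookup-merge-el s c d a)
             , (λ b → E.sym (lookup-merge-er s c d (g b)) ∙ cong (lookup (merge s c d)) (E.sym (join-er s f g b)) ∙ h (er s b) ∙ lookup-merge-er s c d b)
    from : ∀ c d → Inv f c × Inv g d → Inv (join s f g) (merge s c d)
    from c d (p , q) = by-view s _ (λ a → cong (lookup (merge s c d)) (join-el s f g a) ∙ lookup-merge-el s c d (f a) ∙ p a ∙ E.sym (lookup-merge-el s c d a))
      (λ b → cong (lookup (merge s c d)) (join-er s f g b) ∙ lookup-merge-er s c d (g b) ∙ q b ∙ E.sym (lookup-merge-er s c d b))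

module Matchings (K : CommutativeRing 0ℓ 0ℓ) (N : ℕ) where

  private
    module 𝕂 = Kit K
    module 𝕊h = Shifts K N
    module 𝕋 = Tutte K N
    module ℂ = Colourings K N
  open 𝕊h using (Pol; polRing; var; act; 𝟎; Φ; P; Ps; addAt)
  open Kit polRing
  open Colourings polRing N
  open Exponential polRing
  open Multiplicative polRing N

  mono : ∀ {m} → Vec (Fin N) m → Pol
  mono [] = 1#
  mono (i ∷ c) = var i * mono c

  mono-merge : ∀ {k l m} (s : Split k l m) c d → mono (merge s c d) ≈ mono c * mono d
  mono-merge done [] [] = sym (*-identityˡ 1#)
  mono-merge (inl s) (i ∷ c) d = *ˡ {var i} (mono-merge s c d) » sym (*-assoc (var i) (mono c) (mono d))
  mono-merge (inr s) c (i ∷ d) = *ˡ {var i} (mono-merge s c d) » *-comm₃ (var i) (mono c) (mono d)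

  act-mono : ∀ {m} (c : Vec (Fin N) m) φ → act (mono c) φ 𝟎 𝕂.≈ φ (𝕋.ct c)
  act-mono [] φ = 𝕂.refl
  act-mono (i ∷ c) φ = 𝕂.trans (𝕂.sym (𝕊h.act-shift (mono c) i φ 𝟎)) (act-mono c (λ b → φ (addAt i 1 b)))

  act-∑inv : ∀ {m} (α : Fin m → Fin m) φ → act (∑inv α mono) φ 𝟎 𝕂.≈ ℂ.∑inv α (φ ∘ 𝕋.ct)
  act-∑inv {m} α φ = 𝕂.trans (𝕊h.act-∑ (colours m) _ φ 𝟎) (𝕂.∑-cong (colours m) (λ c → 𝕂.trans (𝕊h.act-[] (inv? α c) (act (mono c) φ) 𝟎) (𝕂.*ˡ (act-mono c φ))))

  private
    id? : ∀ {m} (σ : Fin m → Fin m) → Dec (∀ x → σ x ≡ x)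
    id? σ = FP.all? (λ x → σ x FP.≟ x)

    -- Forcing the first permutation to be the identity lets `Decomposition` split off the orbits of
    -- α alone.
    u : ∀ m → (Fin m → Fin m) → (Fin m → Fin m) → Pol
    u m σ α = [ id? σ ×-dec fpf? α ] * ∑inv α mono

    u-cong : ∀ {m} {σ σ' α α' : Fin m → Fin m} → (∀ x → σ x ≡ σ' x) → (∀ x → α x ≡ α' x) → u m σ α ≈ u m σ' α'
    u-cong {m} {σ} {σ'} {α} {α'} p q = *-cong ([]-⇔ (id? σ ×-dec fpf? α) (id? σ' ×-dec fpf? α') (λ { (i , f) → (λ x → E.sym (p x) ∙ i x) , FPF-cong q f }) (λ { (i , f) → (λ x → p x ∙ i x) , FPF-cong (λ x → E.sym (q x)) f }))
      (∑inv-cong {f = α} {α'} {mono} {mono} q (λ _ → refl))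

    u-join : ∀ {k l m} (s : Split k l m) {σ σ' α α'} → Inj σ → Inj σ' → Inj α → Inj α' → u m (join s σ σ') (join s α α') ≈ u k σ α * u l σ' α'
    u-join s {σ} {σ'} {α} {α'} _ _ _ _ = *-cong (([]-⇔ (id? (join s σ σ') ×-dec fpf? (join s α α')) ((id? σ ×-dec fpf? α) ×-dec (id? σ' ×-dec fpf? α'))
          (λ { (i , f) → ((λ a → el-injective s _ _ (E.sym (join-el s σ σ' a) ∙ i (el s a))) , FPF-join-l s f) , ((λ b → er-injective s _ _ (E.sym (join-er s σ σ' b) ∙ i (er s b))) , FPF-join-r s f) })
          (λ { ((i , f) , (i' , f')) → by-view s _ (λ a → join-el s σ σ' a ∙ cong (el s) (i a)) (λ b → join-er s σ σ' b ∙ cong (er s) (i' b)) , FPF-join s f f' })) »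
          ([]-× (id? σ ×-dec fpf? α) (id? σ' ×-dec fpf? α')))
        (∑inv-join s α α' (mono-merge s)) »
      (solve 4 (λ a b x y → a :* b :* (x :* y) := a :* x :* (b :* y)) refl [ id? σ ×-dec fpf? α ] [ id? σ' ×-dec fpf? α' ] (∑inv α mono) (∑inv α' mono))

    module D = Decomposition reachOrbits u u-cong u-join
    open D using (V; Tot; Conn; ω; full?)
    open Orbits reachOrbits

    idv : ∀ m → Vec (Fin m) m
    idv m = tabulate id

  -- The power-sum products of all perfect matchings on m points. All cycles have length 2, so this
  -- is (2n-1)!! p₂ⁿ for m = 2n and 0 for odd m.
  X : ℕ → Pol
  X m = ∑ (vecs (fins m) m) (λ α → [ fpf? (lookup α) ] * ∑inv (lookup α) mono)

  private
    pick-id : ∀ m (F : Vec (Fin m) m → Vec (Fin m) m → Pol) → (∀ σ α → σ ≢ idv m → F σ α ≈ 0#) → ∑ (V m) (λ σ → ∑ (V m) (F σ)) ≈ ∑ (V m) (F (idv m))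
    pick-id m F z = ∑-pick (vecE (finE m) m) (idv m) (λ σ n → ∑-0 (V m) (λ α → z σ α n))

    u-off : ∀ m (σ α : Vec (Fin m) m) → σ ≢ idv m → u m (lookup σ) (lookup α) ≈ 0#
    u-off m σ α n = []-no* (id? (lookup σ) ×-dec fpf? (lookup α)) {∑inv (lookup α) mono} (λ h → n (vec-ext (λ x → proj₁ h x ∙ E.sym (lookup∘tabulate id x))))

    ω-id : ∀ m α → ω m (lookup (idv m)) (lookup α) ≈ [ fpf? (lookup α) ] * ∑inv (lookup α) mono
    ω-id m α = sym (*-assoc [ inj? (lookup (idv m)) ×-dec inj? (lookup α) ] _ (∑inv (lookup α) mono)) » *ʳ {∑inv (lookup α) mono} (sym ([]-× (inj? (lookup (idv m)) ×-dec inj? (lookup α)) (id? (lookup (idv m)) ×-dec fpf? (lookup α))) »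
        ([]-⇔ ((inj? (lookup (idv m)) ×-dec inj? (lookup α)) ×-dec (id? (lookup (idv m)) ×-dec fpf? (lookup α))) (fpf? (lookup α)) (λ h → proj₂ (proj₂ h))
          (λ f → (Inj-cong {f = id} (λ x → E.sym (lookup∘tabulate id x)) (λ x y e → e) , FPF⇒Inj f) , lookup∘tabulate id , f)))

    Tot≈X : ∀ m → Tot m ≈ X m
    Tot≈X m = pick-id m (λ σ α → ω m (lookup σ) (lookup α)) (λ σ α n → *ˡ {[ inj? (lookup σ) ×-dec inj? (lookup α) ]} (u-off m σ α n) » (zeroʳ [ inj? (lookup σ) ×-dec inj? (lookup α) ])) » ∑-cong (V m) (ω-id m)

    Conn≈ : ∀ k → Conn k ≈ ∑ (V (suc k)) (λ α → [ full? (lookup (idv (suc k))) (lookup α) ] * ([ fpf? (lookup α) ] * ∑inv (lookup α) mono))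
    Conn≈ k = pick-id (suc k) (λ σ α → [ full? (lookup σ) (lookup α) ] * ω (suc k) (lookup σ) (lookup α)) (λ σ α n →
        *ˡ {[ full? (lookup σ) (lookup α) ]} (*ˡ {[ inj? (lookup σ) ×-dec inj? (lookup α) ]} (u-off (suc k) σ α n) » (zeroʳ [ inj? (lookup σ) ×-dec inj? (lookup α) ])) » (zeroʳ [ full? (lookup σ) (lookup α) ])) »
      ∑-cong (V (suc k)) (λ α → *ˡ {[ full? (lookup (idv (suc k))) (lookup α) ]} (ω-id (suc k) α))

    -- The orbit of 0 under a fixed-point-free involution is {0, α 0}.
    Conn-off : ∀ k → k ≢ 1 → Conn k ≈ 0#
    Conn-off k k≢1 = trans (Conn≈ k) (∑-0 (V (suc k)) (λ α → go k k≢1 α))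
      where
      orbit : ∀ {k} (α : Fin (suc k) → Fin (suc k)) → FPF α → (∀ x → orb (lookup (idv (suc k))) α x ≡ true) → ∀ x → (x ≢ zero) → x ≡ α zero
      orbit {k} α f h x x≢0 with orb-least (lookup (idv (suc k))) α (λ y → y ≢ zero → y ≡ α zero) (λ n → ⊥-elim (n E.refl)) (λ y p n → lookup∘tabulate id y ∙ p (λ e → n (lookup∘tabulate id y ∙ e))) (λ y p n → step y p n (y FP.≟ zero)) x (h x) x≢0
        where
        step : ∀ y → (y ≢ zero → y ≡ α zero) → α y ≢ zero → Dec (y ≡ zero) → α y ≡ α zero
        step y p n (yes e) = cong α e
        step y p n (no y≢) = ⊥-elim (n (cong α (p y≢) ∙ proj₁ (f zero)))
      ... | e = e
      go : ∀ k → k ≢ 1 → ∀ α → [ full? (lookup (idv (suc k))) (lookup α) ] * ([ fpf? (lookup α) ] * ∑inv (lookup α) mono) ≈ 0#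
      go zero k≢1 α = trans (*ˡ {[ full? (lookup (idv 1)) (lookup α) ]} ([]-no* (fpf? (lookup α)) {∑inv (lookup α) mono} (λ f → proj₂ (f zero) (one (lookup α zero))))) (zeroʳ [ full? (lookup (idv 1)) (lookup α) ])
        where
        one : ∀ (x : Fin 1) → x ≡ zero
        one zero = E.refl
      go (suc zero) k≢1 α = ⊥-elim (k≢1 E.refl)
      go (suc (suc k)) k≢1 α = trans (sym (*-assoc [ full? (lookup (idv (suc (suc (suc k))))) (lookup α) ] [ fpf? (lookup α) ] (∑inv (lookup α) mono))) (*-zeroˡ (sym ([]-× (full? (lookup (idv (suc (suc (suc k))))) (lookup α)) (fpf? (lookup α))) »
          []-no (full? (lookup (idv (suc (suc (suc k))))) (lookup α) ×-dec fpf? (lookup α)) (λ { (h , f) → one≢two (orbit (lookup α) f h (suc zero) (λ ()) ∙ E.sym (orbit (lookup α) f h (suc (suc zero)) (λ ()))) })))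
        where
        one≢two : ∀ {k} → _≢_ {A = Fin (suc (suc (suc k)))} (suc zero) (suc (suc zero))
        one≢two ()

    p₂ : Pol
    p₂ = ∑ (fins N) (λ i → mono (i ∷ i ∷ []))

    Conn-1 : Conn 1 ≈ p₂
    Conn-1 = trans (Conn≈ 1) (∑-pick (vecE (finE 2) 2) {λ α → [ full? (lookup (idv 2)) (lookup α) ] * ([ fpf? (lookup α) ] * ∑inv (lookup α) mono)} swap off » on)
      where
      swap : Vec (Fin 2) 2
      swap = suc zero ∷ zero ∷ []
      f : FPF (lookup swap)
      f zero = E.refl , λ ()
      f (suc zero) = E.refl , λ ()
      only : ∀ α → FPF (lookup α) → α ≡ swap
      only (zero ∷ _ ∷ []) h = ⊥-elim (proj₂ (h zero) E.refl)
      only (suc zero ∷ zero ∷ []) h = E.refl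
      only (suc zero ∷ suc zero ∷ []) h = ⊥-elim (proj₂ (h (suc zero)) E.refl)
      off : ∀ α → α ≢ swap → [ full? (lookup (idv 2)) (lookup α) ] * ([ fpf? (lookup α) ] * ∑inv (lookup α) mono) ≈ 0#
      off α n = *ˡ {[ full? (lookup (idv 2)) (lookup α) ]} ([]-no* (fpf? (lookup α)) {∑inv (lookup α) mono} (n ∘ only α)) » (zeroʳ [ full? (lookup (idv 2)) (lookup α) ])
      on : [ full? (lookup (idv 2)) (lookup swap) ] * ([ fpf? (lookup swap) ] * ∑inv (lookup swap) mono) ≈ p₂
      on = []-yes* (full? (lookup (idv 2)) (lookup swap)) (λ { zero → orb-zero (lookup (idv 2)) (lookup swap) ; (suc zero) → orb-α (lookup (idv 2)) (lookup swap) zero (orb-zero (lookup (idv 2)) (lookup swap)) }) » []-yes* (fpf? (lookup swap)) f »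
        ∑inv-moved (lookup swap) (FPF⇒Inj f) zero E.refl mono »
        ∑inv-fixed (rem (lookup swap)) (Inj-rem (lookup swap) (FPF⇒Inj f)) E.refl (λ d → mono (lookup d zero ∷ d)) »
        +-identityʳ _ » *-identityˡ p₂

    -- The partner of 0 is chosen among m + 1 points, and this pair of points contributes p₂.
    X-step : ∀ m → X (suc (suc m)) ≈ ι (suc m) * (p₂ * X m)
    X-step m = sym (Tot≈X (suc (suc m))) » D.decomposition (suc m) » 𝕊-one-left m (λ k l → Conn k * Tot l) (λ k l k≢1 → *-zeroˡ (Conn-off k k≢1)) » *ˡ {ι (suc m)} (*-cong Conn-1 (Tot≈X m))

    X-0 : X 0 ≈ 1#
    X-0 = solve 0 (:1 :* (:1 :* :1 :+ con (+ 0)) :+ con (+ 0) := :1) refl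
      where open import Data.Integer using (+_)

    X-1 : X 1 ≈ 0#
    X-1 = sym (Tot≈X 1) » D.decomposition 0 » *-zeroˡ (Conn-off 0 (λ ()))

    act-ι : ∀ n φ b → act (ι n) φ b 𝕂.≈ 𝕂.ι n 𝕂.* φ b
    act-ι zero φ b = 𝕂.sym (𝕂.zeroˡ (φ b))
    act-ι (suc zero) φ b = 𝕂.sym (𝕂.*-identityˡ (φ b))
    act-ι (suc (suc n)) φ b = 𝕂.trans (𝕂.+-cong (𝕂.sym (𝕂.*-identityˡ (φ b))) (act-ι (suc n) φ b)) (𝕂.sym (𝕂.distribʳ (φ b) 𝕂.1# (𝕂.ι (suc n))))

    act-p₂ : ∀ φ b → act p₂ φ b 𝕂.≈ P 2 φ b
    act-p₂ φ b = 𝕂.trans (𝕊h.act-∑ (fins N) _ φ b) (𝕂.∑-cong (fins N) (λ i → 𝕂.reflexive (cong φ (𝕊h.addAt-add i 1 1 b))))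

  act-X-even : ∀ n φ b → act (X (dbl n)) φ b 𝕂.≈ 𝕂.ι (oddfact n) 𝕂.* Ps (replicate n 2) φ b
  act-X-even zero φ b = 𝕂.trans (𝕊h.at X-0 φ b) (𝕂.sym (𝕂.*-identityˡ (φ b)))
  act-X-even (suc n) φ b = 𝕂.begin _
      𝕂.≈⟨ 𝕊h.at (X-step (dbl n)) φ b ⟩
    act (ι (suc (dbl n))) (act p₂ (act (X (dbl n)) φ)) b
      𝕂.≈⟨ 𝕂.trans (act-ι (suc (dbl n)) _ b) (𝕂.*ˡ (𝕂.trans (act-p₂ _ b) (𝕊h.P-cong 2 (act-X-even n φ) b))) ⟩
    𝕂.ι (suc (dbl n)) 𝕂.* P 2 (λ b → 𝕂.ι (oddfact n) 𝕂.* Ps (replicate n 2) φ b) b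
      𝕂.≈⟨ 𝕂.*ˡ (𝕊h.P-* 2 _ (Ps (replicate n 2) φ) b) ⟩
    𝕂.ι (suc (dbl n)) 𝕂.* (𝕂.ι (oddfact n) 𝕂.* P 2 (Ps (replicate n 2) φ) b)
      𝕂.≈⟨ 𝕂.trans (𝕂.sym (𝕂.*-assoc _ _ _)) (𝕂.*ʳ (𝕂.sym (𝕂.ι-* (suc (dbl n)) (oddfact n)))) ⟩
    𝕂.ι (oddfact (suc n)) 𝕂.* Ps (replicate (suc n) 2) φ b 𝕂.∎

  act-X-odd : ∀ n φ b → act (X (suc (dbl n))) φ b 𝕂.≈ 𝕂.0#
  act-X-odd zero φ b = 𝕊h.at X-1 φ b
  act-X-odd (suc n) φ b = 𝕂.trans (𝕊h.at (X-step (suc (dbl n))) φ b) (𝕂.trans (act-ι (suc (suc (dbl n))) _ b) (𝕂.*-zeroʳ (𝕂.trans (𝕊h.act-cong p₂ (act-X-odd n φ) b) (𝕊h.act-0 p₂ b))))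

-- All pairs (σ, α) as a moment of p₂

module MapSeries (K : CommutativeRing 0ℓ 0ℓ) (N : ℕ) where

  open Kit K
  open Colourings K N
  open Multiplicative K N
  open Exponential K
  open Shifts K N using (Φ; 𝟎; E; Ps; act)
  open Tutte K N using (EE; M-EE)
  open Matchings K N using (X; act-X-even; act-X-odd; act-∑inv; mono)

  u : ∀ m → (Fin m → Fin m) → (Fin m → Fin m) → Carrier
  u m σ α = [ fpf? α ] * (w σ * w (σ ∘ α))

  private
    u-cong : ∀ {m} {σ σ' α α' : Fin m → Fin m} → (∀ x → σ x ≡ σ' x) → (∀ x → α x ≡ α' x) → u m σ α ≈ u m σ' α'
    u-cong {m} {σ} {σ'} {α} {α'} p q = *-cong ([]-⇔ (fpf? α) (fpf? α') (FPF-cong q) (FPF-cong (λ x → E.sym (q x)))) (*-cong (w-cong p) (w-cong (λ x → p (α x) ∙ cong σ' (q x))))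

    w-join : ∀ {k l m} (s : Split k l m) f g → w (join s f g) ≈ w f * w g
    w-join s f g = ∑inv-join s f g (λ _ _ → sym (*-identityˡ _))

    u-join : ∀ {k l m} (s : Split k l m) {σ σ' α α'} → Inj σ → Inj σ' → Inj α → Inj α' → u m (join s σ σ') (join s α α') ≈ u k σ α * u l σ' α'
    u-join s {σ} {σ'} {α} {α'} _ _ _ _ = *-cong (([]-⇔ (fpf? (join s α α')) (fpf? α ×-dec fpf? α') (λ f → FPF-join-l s f , FPF-join-r s f) (λ { (f , g) → FPF-join s f g })) » ([]-× (fpf? α) (fpf? α')))
        (*-cong (w-join s σ σ') (w-cong (join-∘ s σ α σ' α') » w-join s (σ ∘ α) (σ' ∘ α'))) »
      solve 6 (λ a b x y z t → a :* b :* (x :* y :* (z :* t)) := a :* (x :* z) :* (b :* (y :* t))) refl _ _ _ _ _ _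

  open Decomposition reachOrbits u u-cong u-join public using (V; ω; full?; Tot; Conn; decomposition)

  private
    Tot≈M : ∀ m → Tot m ≈ ∑ (V m) (λ α → [ fpf? (lookup α) ] * M (lookup α))
    Tot≈M m = trans (∑-swap (V m) (V m)) (∑-cong (V m) (λ α → ∑-cong (V m) (λ σ → term (lookup σ) (lookup α)) » ∑-*ˡ (V m) _))
      where
      term : ∀ σ α → ω m σ α ≈ [ fpf? α ] * ([ inj? σ ] * (w σ * w (σ ∘ α)))
      term σ α = sym (*-assoc _ _ _) » *ʳ (sym ([]-× (inj? σ ×-dec inj? α) (fpf? α)) » ([]-⇔ ((inj? σ ×-dec inj? α) ×-dec fpf? α) (fpf? α ×-dec inj? σ) (λ { ((i , _) , f) → f , i }) (λ { (f , i) → (i , FPF⇒Inj f) , f })) »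
          ([]-× (fpf? α) (inj? σ))) » *-assoc _ _ _

    Tot*Φ : ∀ m → Tot m * Φ 𝟎 ≈ act (X m) Φ 𝟎
    Tot*Φ m = begin
      _ ≈⟨ *ʳ (Tot≈M m) » sym (∑-*ʳ (V m) _) ⟩
      _ ≈⟨ ∑-cong (V m) (λ α → *-assoc _ _ _ » []-*-cong (fpf? (lookup α)) (λ f → M-EE m (lookup α) (FPF⇒Inj f) » sym (act-∑inv (lookup α) Φ))) ⟩
      _ ≈⟨ Shifts.act-∑ K N (V m) _ Φ 𝟎 » ∑-cong (V m) (λ α → Shifts.act-[] K N (fpf? (lookup α)) _ 𝟎) ⟨
      _ ∎

  Tot-even : ∀ n → Tot (dbl n) * Φ 𝟎 ≈ ι (oddfact n) * E (replicate n 2)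
  Tot-even n = Tot*Φ (dbl n) » act-X-even n Φ 𝟎

  Tot-odd : ∀ n → Tot (suc (dbl n)) * Φ 𝟎 ≈ 0#
  Tot-odd n = Tot*Φ (suc (dbl n)) » act-X-odd n Φ 𝟎

-- The KP relation for alternants

desc : ℕ → List ℕ
desc zero = []
desc (suc n) = n ∷ desc n

module KP (R : CommutativeRing 0ℓ 0ℓ) (half : ∀ {x} → CommutativeRing._≈_ R (CommutativeRing._+_ R x x) (CommutativeRing.0# R) → CommutativeRing._≈_ R x (CommutativeRing.0# R)) where

  open Kit R
  open Determinant R
  open Alternants R
  open Products R using (signed)

  adjacent : ∀ g → Alternating g → ∀ pre a as → g (pre ++ a ∷ a ∷ as) ≈ 0#
  adjacent g p pre a as = half (+ˡ (p pre a a as) » -‿inverseʳ _)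

  collide : ∀ g → Alternating g → ∀ pre a mid as → g (pre ++ a ∷ mid ++ a ∷ as) ≈ 0#
  collide g p pre a [] as = adjacent g p pre a as
  collide g p pre a (b ∷ mid) as = p pre a b (mid ++ a ∷ as) » -‿cong (reflexive (cong g (E.sym (++-assoc pre (b ∷ []) (a ∷ mid ++ a ∷ as)))) » collide g p (pre ++ b ∷ []) a mid as) » -0#≈0#

  collide-before : ∀ g → Alternating g → ∀ {pre a} as → a ∈ pre → g (pre ++ a ∷ as) ≈ 0#
  collide-before g p {a = a} as a∈ with ∈-∃++ a∈
  ... | l , r , E.refl = reflexive (cong g (++-assoc l (a ∷ r) (a ∷ as))) » collide g p l a r as

  Occupied : ℕ → ℕ → List ℕ → Set
  Occupied k n top = ∀ j → j N.< k → j N.+ n ∈ top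

  -- Raising an entry of the staircase by k + 1 moves it onto another entry of the staircase or onto
  -- one of the k + 1 places just above it, all of them taken; a repeated entry kills the
  -- alternating function.
  PL-desc : ∀ g → Alternating g → ∀ k n top → Occupied (suc k) n top → PL (suc k) (λ as → g (top ++ as)) (desc n) ≈ 0#
  PL-desc g p k zero top occ = refl
  PL-desc g p k (suc n) top occ = +-zero (collide-before g p (desc n) (subst (_∈ top) (NP.+-suc k n) (occ k NP.≤-refl))) (PL-cong (suc k) (λ as → reflexive (cong g (E.sym (++-assoc top (n ∷ []) as)))) (desc n) » PL-desc g p k n (top ++ n ∷ []) occ')
    where
    occ' : Occupied (suc k) n (top ++ n ∷ [])
    occ' zero j<k = ∈-++⁺ʳ top (here E.refl)
    occ' (suc j) j<k = ∈-++⁺ˡ (subst (_∈ top) (NP.+-suc j n) (occ j (NP.<-trans (NP.n<1+n j) j<k)))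

  -- The sign relating the increasing and the decreasing order of the rows.
  signed-cong : ∀ s {x y} → x ≈ y → signed s x ≈ signed s y
  signed-cong true p = p
  signed-cong false p = -‿cong p

  move-front : ∀ as → Σ Bool λ s → ∀ g → Alternating g → ∀ a → g (as ++ a ∷ []) ≈ signed s (g (a ∷ as))
  move-front [] = true , λ g p a → refl
  move-front (b ∷ as) with move-front as
  ... | true , e = false , λ g p a → e (g ∘ (b ∷_)) (λ pre → p (b ∷ pre)) a » (p [] b a as)
  ... | false , e = true , λ g p a → e (g ∘ (b ∷_)) (λ pre → p (b ∷ pre)) a » -‿cong (p [] b a as) » -‿involutive _

  upto : ℕ → List ℕ
  upto zero = []
  upto (suc n) = upto n ++ n ∷ []

  reverse-sign : ∀ n → Σ Bool λ s → ∀ g → Alternating g → g (upto n) ≈ signed s (g (desc n))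
  reverse-sign zero = true , λ g p → refl
  reverse-sign (suc n) with move-front (upto n) | reverse-sign n
  ... | true , e | s , f = s , λ g p → e g p n » f (g ∘ (n ∷_)) (λ pre → p (n ∷ pre))
  ... | false , e | true , f = false , λ g p → e g p n » -‿cong (f (g ∘ (n ∷_)) (λ pre → p (n ∷ pre)))
  ... | false , e | false , f = true , λ g p → e g p n » -‿cong (f (g ∘ (n ∷_)) (λ pre → p (n ∷ pre))) » -‿involutive _

  module _ (r : ℕ) where

    -- The partition (a-3, b-2, c-1, e) placed on a staircase of r further rows, so ⟨3,2,1,0⟩ is the
    -- empty one. A suffix such as 21 names the partition that p_k multiplies; the lemmas below are
    -- the Murnaghan-Nakayama rules needed up to degree 4.
    _⟨_,_,_,_⟩ : LFun → ℕ → ℕ → ℕ → ℕ → Carrier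
    g ⟨ a , b , c , e ⟩ = g (a N.+ r ∷ b N.+ r ∷ c N.+ r ∷ e N.+ r ∷ desc r)

    private
      step : ∀ g → Alternating g → ∀ k a b c e → Occupied (suc k) r (a N.+ r ∷ b N.+ r ∷ c N.+ r ∷ e N.+ r ∷ []) →
             PL (suc k) g ⟨ a , b , c , e ⟩ ≈ g ⟨ suc k N.+ a , b , c , e ⟩ + (g ⟨ a , suc k N.+ b , c , e ⟩ + (g ⟨ a , b , suc k N.+ c , e ⟩ + g ⟨ a , b , c , suc k N.+ e ⟩))
      step g p k a b c e occ = +-cong (assoc a (λ as → as) _) (+-cong (assoc b (a N.+ r ∷_) _) (+-cong (assoc c (λ as → a N.+ r ∷ b N.+ r ∷ as) _)
        (+-cong (assoc e (λ as → a N.+ r ∷ b N.+ r ∷ c N.+ r ∷ as) _) (PL-desc g p k r (a N.+ r ∷ b N.+ r ∷ c N.+ r ∷ e N.+ r ∷ []) occ) » +-identityʳ _)))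
        where
        assoc : ∀ x (f : List ℕ → List ℕ) as → g (f (suc k N.+ (x N.+ r) ∷ as)) ≈ g (f (suc k N.+ x N.+ r ∷ as))
        assoc x f as = reflexive (cong (λ v → g (f (v ∷ as))) (E.sym (NP.+-assoc (suc k) x r)))

    module _ (g : LFun) (p : Alternating g) where

      private
        occ₁ : ∀ {a b c} → Occupied 1 r (a ∷ b ∷ c ∷ r ∷ [])
        occ₁ zero _ = there (there (there (here E.refl)))
        occ₁ (suc _) (s≤s ())

        occ₂ : ∀ {a b} → Occupied 2 r (a ∷ b ∷ suc r ∷ r ∷ [])
        occ₂ zero _ = there (there (there (here E.refl)))
        occ₂ (suc zero) _ = there (there (here E.refl))
        occ₂ (suc (suc _)) (s≤s (s≤s ()))

        occ₃ : ∀ {a} → Occupied 3 r (a ∷ suc (suc r) ∷ suc r ∷ r ∷ [])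
        occ₃ zero _ = there (there (there (here E.refl)))
        occ₃ (suc zero) _ = there (there (here E.refl))
        occ₃ (suc (suc zero)) _ = there (here E.refl)
        occ₃ (suc (suc (suc _))) (s≤s (s≤s (s≤s ())))

        ≡₁₂ : ∀ a c e → g ⟨ a , a , c , e ⟩ ≈ 0#
        ≡₁₂ a c e = adjacent g p [] _ _
        ≡₂₃ : ∀ a b e → g ⟨ a , b , b , e ⟩ ≈ 0#
        ≡₂₃ a b e = adjacent g p (a N.+ r ∷ []) _ _
        ≡₃₄ : ∀ a b c → g ⟨ a , b , c , c ⟩ ≈ 0#
        ≡₃₄ a b c = adjacent g p (a N.+ r ∷ b N.+ r ∷ []) _ _
        ≡₂₄ : ∀ a b c → g ⟨ a , b , c , b ⟩ ≈ 0#
        ≡₂₄ a b c = collide g p (a N.+ r ∷ []) _ (c N.+ r ∷ []) _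
        ≡₁₃ : ∀ a b e → g ⟨ a , b , a , e ⟩ ≈ 0#
        ≡₁₃ a b e = collide g p [] _ (b N.+ r ∷ []) _
        ≡₁₄ : ∀ a b c → g ⟨ a , b , c , a ⟩ ≈ 0#
        ≡₁₄ a b c = collide g p [] _ (b N.+ r ∷ c N.+ r ∷ []) _
        flip₁₂ : ∀ a b c e → g ⟨ a , b , c , e ⟩ ≈ - g ⟨ b , a , c , e ⟩
        flip₁₂ a b c e = p [] _ _ _
        flip₂₃ : ∀ a b c e → g ⟨ a , b , c , e ⟩ ≈ - g ⟨ a , c , b , e ⟩
        flip₂₃ a b c e = p (a N.+ r ∷ []) _ _ _
        flip₃₄ : ∀ a b c e → g ⟨ a , b , c , e ⟩ ≈ - g ⟨ a , b , e , c ⟩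
        flip₃₄ a b c e = p (a N.+ r ∷ b N.+ r ∷ []) _ _ _

        z₄ : ∀ {x y z w} → w ≈ 0# → x + (y + (z + w)) ≈ x + (y + z)
        z₄ e = +ˡ (+ˡ (+ˡ e » +-identityʳ _))
        z₃ : ∀ {x y z} → z ≈ 0# → x + (y + z) ≈ x + y
        z₃ e = +ˡ (+ˡ e » +-identityʳ _)
        z₂ : ∀ {x y} → y ≈ 0# → x + y ≈ x
        z₂ e = +ˡ e » +-identityʳ _
        m₂ : ∀ {x y z} → y ≈ 0# → x + (y + z) ≈ x + z
        m₂ e = +ˡ (+ʳ e » +-identityˡ _)

      P₁-∅ : PL 1 g ⟨ 3 , 2 , 1 , 0 ⟩ ≈ g ⟨ 4 , 2 , 1 , 0 ⟩
      P₁-∅ = step g p 0 3 2 1 0 occ₁ » z₂ (+-zero (≡₁₂ 3 1 0) (+-zero (≡₂₃ 3 2 0) (≡₃₄ 3 2 1)))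

      P₁-1 : PL 1 g ⟨ 4 , 2 , 1 , 0 ⟩ ≈ g ⟨ 5 , 2 , 1 , 0 ⟩ + g ⟨ 4 , 3 , 1 , 0 ⟩
      P₁-1 = step g p 0 4 2 1 0 occ₁ » z₃ (+-zero (≡₂₃ 4 2 0) (≡₃₄ 4 2 1))

      P₁-2 : PL 1 g ⟨ 5 , 2 , 1 , 0 ⟩ ≈ g ⟨ 6 , 2 , 1 , 0 ⟩ + g ⟨ 5 , 3 , 1 , 0 ⟩
      P₁-2 = step g p 0 5 2 1 0 occ₁ » z₃ (+-zero (≡₂₃ 5 2 0) (≡₃₄ 5 2 1))

      P₁-3 : PL 1 g ⟨ 6 , 2 , 1 , 0 ⟩ ≈ g ⟨ 7 , 2 , 1 , 0 ⟩ + g ⟨ 6 , 3 , 1 , 0 ⟩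
      P₁-3 = step g p 0 6 2 1 0 occ₁ » z₃ (+-zero (≡₂₃ 6 2 0) (≡₃₄ 6 2 1))

      P₁-11 : PL 1 g ⟨ 4 , 3 , 1 , 0 ⟩ ≈ g ⟨ 5 , 3 , 1 , 0 ⟩ + g ⟨ 4 , 3 , 2 , 0 ⟩
      P₁-11 = step g p 0 4 3 1 0 occ₁ » z₄ (≡₃₄ 4 3 1) » m₂ (≡₁₂ 4 1 0)

      P₁-21 : PL 1 g ⟨ 5 , 3 , 1 , 0 ⟩ ≈ g ⟨ 6 , 3 , 1 , 0 ⟩ + (g ⟨ 5 , 4 , 1 , 0 ⟩ + g ⟨ 5 , 3 , 2 , 0 ⟩)
      P₁-21 = step g p 0 5 3 1 0 occ₁ » z₄ (≡₃₄ 5 3 1)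

      P₁-111 : PL 1 g ⟨ 4 , 3 , 2 , 0 ⟩ ≈ g ⟨ 5 , 3 , 2 , 0 ⟩ + g ⟨ 4 , 3 , 2 , 1 ⟩
      P₁-111 = step g p 0 4 3 2 0 occ₁ » m₂ (≡₁₂ 4 2 0) » m₂ (≡₂₃ 4 3 0)

      P₂-∅ : PL 2 g ⟨ 3 , 2 , 1 , 0 ⟩ ≈ g ⟨ 5 , 2 , 1 , 0 ⟩ - g ⟨ 4 , 3 , 1 , 0 ⟩
      P₂-∅ = step g p 1 3 2 1 0 occ₂ » z₃ (+-zero (≡₁₃ 3 2 0) (≡₂₄ 3 2 1)) » +ˡ (flip₁₂ 3 4 1 0)

      P₂-2 : PL 2 g ⟨ 5 , 2 , 1 , 0 ⟩ ≈ g ⟨ 7 , 2 , 1 , 0 ⟩ + (g ⟨ 5 , 4 , 1 , 0 ⟩ - g ⟨ 5 , 3 , 2 , 0 ⟩)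
      P₂-2 = step g p 1 5 2 1 0 occ₂ » z₄ (≡₂₄ 5 2 1) » +ˡ (+ˡ (flip₂₃ 5 2 3 0))

      P₂-11 : PL 2 g ⟨ 4 , 3 , 1 , 0 ⟩ ≈ g ⟨ 6 , 3 , 1 , 0 ⟩ + (- g ⟨ 5 , 4 , 1 , 0 ⟩ - g ⟨ 4 , 3 , 2 , 1 ⟩)
      P₂-11 = step g p 1 4 3 1 0 occ₂ » +ˡ (+-cong (flip₁₂ 4 5 1 0) (+-cong (≡₂₃ 4 3 0) (flip₃₄ 4 3 1 2) » +-identityˡ _))

      P₃-∅ : PL 3 g ⟨ 3 , 2 , 1 , 0 ⟩ ≈ g ⟨ 6 , 2 , 1 , 0 ⟩ + (- g ⟨ 5 , 3 , 1 , 0 ⟩ + g ⟨ 4 , 3 , 2 , 0 ⟩)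
      P₃-∅ = step g p 2 3 2 1 0 occ₃ » z₄ (≡₁₄ 3 2 1) » +ˡ (+-cong (flip₁₂ 3 5 1 0) (flip₂₃ 3 2 4 0 » -‿cong (flip₁₂ 3 4 2 0) » -‿involutive _))

    -- Half of Hirota's bilinear form (D₁⁴ + 3 D₂² - 4 D₁ D₃) τ·τ, where t ks stands for the
    -- derivative of τ in the times dual to the power sums p_k, k in ks.
    kp : (List ℕ → Carrier) → Carrier
    kp t = t (1 ∷ 1 ∷ 1 ∷ 1 ∷ []) * t [] - ι 4 * (t (1 ∷ 1 ∷ 1 ∷ []) * t (1 ∷ [])) + ι 3 * (t (1 ∷ 1 ∷ []) * t (1 ∷ 1 ∷ [])) + ι 3 * (t (2 ∷ 2 ∷ []) * t [] - t (2 ∷ []) * t (2 ∷ [])) - ι 4 * (t (3 ∷ 1 ∷ []) * t [] - t (3 ∷ []) * t (1 ∷ []))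

    -- Expanded in determinants s_λ indexed by partitions, the form collapses to 12 (s_∅ s_22 - s_1
    -- s_21 + s_2 s_11), a single Plücker relation.
    kp-det : ∀ (q : ℕ → ℕ → Carrier) bs → kp (λ ks → PLs ks (λ as → det q as bs) ⟨ 3 , 2 , 1 , 0 ⟩) ≈ 0#
    kp-det q bs = begin
      _ ≈⟨ +-cong (+-cong (+-cong (+-cong (*ʳ e₁₁₁₁) (-‿cong (*ˡ (*-cong e₁₁₁ e₁)))) (*ˡ (*-cong e₁₁ e₁₁))) (*ˡ (+-cong (*ʳ e₂₂) (-‿cong (*-cong e₂ e₂))))) (-‿cong (*ˡ (+-cong (*ʳ e₃₁) (-‿cong (*-cong e₃ e₁))))) ⟩
      _ ≈⟨ solve 12 (λ s0 s1 s2 s11 s3 s21 s111 s4 s31 s22 s211 s1111 → ((s4 :+ s31) :+ (s31 :+ (s22 :+ s211)) :+ ((s31 :+ (s22 :+ s211)) :+ (s211 :+ s1111))) :* s0 :- :4 :* ((s3 :+ s21 :+ (s21 :+ s111)) :* s1) :+ :3 :* ((s2 :+ s11) :* (s2 :+ s11))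
               :+ :3 :* ((s4 :+ (s22 :- s211) :- (s31 :+ (:- s22 :- s1111))) :* s0 :- (s2 :- s11) :* (s2 :- s11))
               :- :4 :* ((s4 :+ s31 :+ (:- (s31 :+ (s22 :+ s211)) :+ (s211 :+ s1111))) :* s0 :- (s3 :+ (:- s21 :+ s111)) :* s1)
             := con (+ 12) :* (s0 :* s22 :- s2 :* (:- s11) :+ s1 :* (:- s21)))
             refl (D ⟨ 3 , 2 , 1 , 0 ⟩) (D ⟨ 4 , 2 , 1 , 0 ⟩) (D ⟨ 5 , 2 , 1 , 0 ⟩) (D ⟨ 4 , 3 , 1 , 0 ⟩) (D ⟨ 6 , 2 , 1 , 0 ⟩) (D ⟨ 5 , 3 , 1 , 0 ⟩)
             (D ⟨ 4 , 3 , 2 , 0 ⟩) (D ⟨ 7 , 2 , 1 , 0 ⟩) (D ⟨ 6 , 3 , 1 , 0 ⟩) (D ⟨ 5 , 4 , 1 , 0 ⟩) (D ⟨ 5 , 3 , 2 , 0 ⟩) (D ⟨ 4 , 3 , 2 , 1 ⟩) ⟩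
      _
        ≈⟨ *ˡ (+-cong (+ˡ (-‿cong (*ˡ (alt₀ [] (3 N.+ r) (4 N.+ r) (1 N.+ r ∷ r ∷ desc r))))) (*ˡ (alt₀ [] (3 N.+ r) (5 N.+ r) (1 N.+ r ∷ r ∷ desc r)))) ⟨
      -- The rows w, x, y, z are at heights 2, 3, 5, 4; the unsorted pairs (3,4) and (3,5) account
      -- for the signs in front of s_11 and s_21.
      _ ≈⟨ *ˡ (plücker q (2 N.+ r) (3 N.+ r) (5 N.+ r) (4 N.+ r) (1 N.+ r ∷ r ∷ desc r) bs) ⟩
      _ ≈⟨ zeroʳ _ ⟩
      _ ∎
      where
      open import Data.Integer using (+_)
      D : LFun
      D as = det q as bs
      alt₀ : Alternating D
      alt₀ pre a b as = det-swap q pre a b as bs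
      alt₁ : Alternating (PL 1 D)
      alt₁ = PL-alternating 1 D alt₀
      alt₁₁ : Alternating (PL 1 (PL 1 D))
      alt₁₁ = PL-alternating 1 _ alt₁
      alt₁₁₁ : Alternating (PL 1 (PL 1 (PL 1 D)))
      alt₁₁₁ = PL-alternating 1 _ alt₁₁
      alt₂ : Alternating (PL 2 D)
      alt₂ = PL-alternating 2 D alt₀
      e₁ = P₁-∅ D alt₀
      e₁₁ = P₁-∅ (PL 1 D) alt₁ » P₁-1 D alt₀
      e₁₁₁ = P₁-∅ (PL 1 (PL 1 D)) alt₁₁ » P₁-1 (PL 1 D) alt₁ » +-cong (P₁-2 D alt₀) (P₁-11 D alt₀)
      e₁₁₁₁ = P₁-∅ (PL 1 (PL 1 (PL 1 D))) alt₁₁₁ » P₁-1 (PL 1 (PL 1 D)) alt₁₁ » +-cong (P₁-2 (PL 1 D) alt₁ » +-cong (P₁-3 D alt₀) (P₁-21 D alt₀)) (P₁-11 (PL 1 D) alt₁ » +-cong (P₁-21 D alt₀) (P₁-111 D alt₀))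
      e₂ = P₂-∅ D alt₀
      e₂₂ = P₂-∅ (PL 2 D) alt₂ » +-cong (P₂-2 D alt₀) (-‿cong (P₂-11 D alt₀))
      e₃ = P₃-∅ D alt₀
      e₃₁ = P₃-∅ (PL 1 D) alt₁ » +-cong (P₁-3 D alt₀) (+-cong (-‿cong (P₁-21 D alt₀)) (P₁-111 D alt₀))

    kp-scale : ∀ c (t t' : List ℕ → Carrier) → (∀ ks → t ks ≈ c * t' ks) → kp t' ≈ 0# → kp t ≈ 0#
    kp-scale c t t' e z = begin
      _ ≈⟨ +-cong (+-cong (+-cong (+-cong (*-cong (e (1 ∷ 1 ∷ 1 ∷ 1 ∷ [])) (e [])) (-‿cong (*ˡ (*-cong (e (1 ∷ 1 ∷ 1 ∷ [])) (e (1 ∷ []))))))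
             (*ˡ (*-cong (e (1 ∷ 1 ∷ [])) (e (1 ∷ 1 ∷ []))))) (*ˡ (+-cong (*-cong (e (2 ∷ 2 ∷ [])) (e [])) (-‿cong (*-cong (e (2 ∷ [])) (e (2 ∷ [])))))))
             (-‿cong (*ˡ (+-cong (*-cong (e (3 ∷ 1 ∷ [])) (e [])) (-‿cong (*-cong (e (3 ∷ [])) (e (1 ∷ []))))))) ⟩
      _ ≈⟨ solve 10 (λ c t0 t1 t11 t111 t1111 t2 t22 t3 t31 → (c :* t1111) :* (c :* t0) :- :4 :* ((c :* t111) :* (c :* t1)) :+ :3 :* ((c :* t11) :* (c :* t11))
             :+ :3 :* ((c :* t22) :* (c :* t0) :- (c :* t2) :* (c :* t2)) :- :4 :* ((c :* t31) :* (c :* t0) :- (c :* t3) :* (c :* t1))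
             := c :* c :* (t1111 :* t0 :- :4 :* (t111 :* t1) :+ :3 :* (t11 :* t11)
             :+ :3 :* (t22 :* t0 :- t2 :* t2) :- :4 :* (t31 :* t0 :- t3 :* t1))) refl
             c (t' []) (t' (1 ∷ [])) (t' (1 ∷ 1 ∷ [])) (t' (1 ∷ 1 ∷ 1 ∷ [])) (t' (1 ∷ 1 ∷ 1 ∷ 1 ∷ [])) (t' (2 ∷ [])) (t' (2 ∷ 2 ∷ [])) (t' (3 ∷ [])) (t' (3 ∷ 1 ∷ [])) ⟩
      _ ≈⟨ *-zeroʳ z ⟩
      _ ∎

-- The tau function of maps: KP and the linear constraints

module MapEquation (K : CommutativeRing 0ℓ 0ℓ) (inv : ℕ → CommutativeRing.Carrier K) (inv-l : ∀ n → CommutativeRing._≈_ K (CommutativeRing._*_ K (Kit.ι K (suc n)) (inv n)) (CommutativeRing.1# K)) (N r : ℕ) (N≡4+r : N ≡ 4 N.+ r) where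

  open Kit K
  open Series K
  open Determinant K using () renaming (det to detᴷ; alt to altᴷ)
  private
    module A = Alternants K
    module 𝒜 = Alternants seriesRing
    module 𝒟 = Determinant seriesRing

  open Shifts K N using (E; E-1; E-2; E-move; bump; bump-cong)
  open ShiftAlternants K using (from; moments; E-moments)
  open Products K using (signed)

  regular-suc : ∀ n {x} → ι (suc n) * x ≈ 0# → x ≈ 0#
  regular-suc n {x} p = begin
    _ ≈⟨ *-identityˡ x ⟨
    _ ≈⟨ *ʳ (*-comm _ _ » inv-l n) ⟨
    _ ≈⟨ *-assoc _ _ _ ⟩
    _ ≈⟨ *-zeroʳ p ⟩
    _ ∎

  half : ∀ {x} → x + x ≈ 0# → x ≈ 0#
  half {x} p = regular-suc 1 (solve 1 (λ x → :2 :* x := x :+ x) refl x » p)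

  -- κ n = 1 / (2ⁿ n!)
  κ : ℕ → Carrier
  κ zero = 1#
  κ (suc n) = inv 1 * (inv n * κ n)

  κ-suc : ∀ n → ι 2 * (ι (suc n) * κ (suc n)) ≈ κ n
  κ-suc n = solve 5 (λ t i a b k → t :* (i :* (a :* (b :* k))) := t :* a :* (i :* b :* k)) refl _ _ _ _ _ » *-cong (inv-l 1) (*ʳ (inv-l n) » *-identityˡ _) » *-identityˡ _

  ϑ δ : Ser → Ser
  ϑ f n = ι (dbl n) * f n
  δ f = ι 2 · d f

  private
    -- The moments (j + a)! deformed by the weight e^(s x²/2). The time of p₂ thereby enters each
    -- matrix entry, and the deformed functional is again a determinant.
    pS : ℕ → ℕ → Ser
    pS a j n = κ n * ι ((j N.+ (dbl n N.+ a)) !)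

    js : List ℕ
    js = from N 0 N

    DS : 𝒜.LFun
    DS as = 𝒟.det pS as js

    δ-pS : ∀ a j → δ (pS a j) ≋ pS (2 N.+ a) j
    δ-pS a j = mk (λ n → solve 4 (λ t i k x → t :* (i :* (k :* x)) := t :* (i :* k) :* x) refl _ _ _ _ » *-cong (κ-suc n) (reflexive (cong (λ x → ι ((j N.+ x) !)) (cong suc (E.sym (NP.+-suc (dbl n) a)) ∙ E.sym (NP.+-suc (dbl n) (suc a))))))

    δ-⊕ : ∀ f g → δ (f ⊕ g) ≋ δ f ⊕ δ g
    δ-⊕ f g = mk (λ n → solve 4 (λ t i x y → t :* (i :* (x :+ y)) := t :* (i :* x) :+ t :* (i :* y)) refl _ _ _ _)

    δ-⊖ : ∀ f → δ (⊖ f) ≋ ⊖ δ f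
    δ-⊖ f = mk (λ n → solve 3 (λ t i x → t :* (i :* :- x) := :- (t :* (i :* x))) refl _ _ _)

    δ-⊛ : ∀ f g → δ (f ⊛ g) ≋ δ f ⊛ g ⊕ f ⊛ δ g
    δ-⊛ f g = mk (λ n → *ˡ (at (d-leibniz f g) n) » distribˡ _ _ _ » +-cong (sym (⊛-·ˡ n (ι 2) (d f) g)) (*ˡ (⊛-comm n f (d g)) » sym (⊛-·ˡ n (ι 2) (d g) f) » ⊛-comm n (δ g) f))

    δ-alt : ∀ {B : Set} (bs : List B) (f : B → List B → Ser) → δ (𝒟.alt f bs) ≋ 𝒟.alt (λ c cs → δ (f c cs)) bs
    δ-alt [] f = mk (λ n → *ˡ (zeroʳ _) » zeroʳ _)
    δ-alt (b ∷ bs) f = δ-⊕ (f b bs) (⊖ 𝒟.alt (λ c cs → f c (b ∷ cs)) bs) ⟫ S.+ˡ (δ-⊖ (𝒟.alt (λ c cs → f c (b ∷ cs)) bs) ⟫ S.-‿cong (δ-alt bs (λ c cs → f c (b ∷ cs))))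

    δ-det : ∀ as bs → δ (𝒟.det pS as bs) ≋ 𝒜.PL 2 (λ as → 𝒟.det pS as bs) as
    δ-det [] [] = mk (λ n → *ˡ (zeroʳ _) » zeroʳ _)
    δ-det [] (_ ∷ _) = mk (λ n → *ˡ (zeroʳ _) » zeroʳ _)
    δ-det (a ∷ as) bs = δ-alt bs _ ⟫ 𝒟.alt-cong bs (λ c cs → δ-⊛ (pS a c) (𝒟.det pS as cs) ⟫ S.+-cong (S.*ʳ (δ-pS a c)) (S.*ˡ (δ-det as cs))) ⟫ 𝒟.alt-+ bs ⟫ S.+ˡ (𝒟.alt-cong bs (λ c cs → S.sym (𝒜.PL-* 2 (pS a c) (λ as → 𝒟.det pS as cs) as)) ⟫
        S.sym (𝒜.PL-alt 2 bs (λ c cs as → pS a c ⊛ 𝒟.det pS as cs) as))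

    PL-at : ∀ k (G : 𝒜.LFun) as n → 𝒜.PL k G as n ≈ A.PL k (λ as → G as n) as
    PL-at k G [] n = refl
    PL-at k G (a ∷ as) n = +ˡ (PL-at k (G ∘ (a ∷_)) as n)

    PLs-at : ∀ ks (G : 𝒜.LFun) as n → 𝒜.PLs ks G as n ≈ A.PLs ks (λ as → G as n) as
    PLs-at [] G as n = refl
    PLs-at (k ∷ ks) G as n = PL-at k (𝒜.PLs ks G) as n » A.PL-cong k (λ as → PLs-at ks G as n) as

    alt-at-0 : ∀ {B : Set} (bs : List B) (f : B → List B → Ser) → 𝒟.alt f bs 0 ≈ altᴷ (λ c cs → f c cs 0) bs
    alt-at-0 [] f = refl
    alt-at-0 (b ∷ bs) f = +ˡ (-‿cong (alt-at-0 bs (λ c cs → f c (b ∷ cs))))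

    det-at-0 : ∀ as bs → 𝒟.det pS as bs 0 ≈ detᴷ (λ a j → ι ((j N.+ a) !)) as bs
    det-at-0 [] [] = refl
    det-at-0 [] (_ ∷ _) = refl
    det-at-0 (a ∷ as) bs = alt-at-0 bs _ » Determinant.alt-cong K bs (λ c cs → *-cong (*-identityˡ _) (det-at-0 as cs))

    -- Twice d/ds raises an exponent by 2 in one row at a time, that is, multiplies by p₂; iterating
    -- it gives p₂ⁿ with the coefficient 1/(2ⁿ n!).
    DS-coefficient : ∀ n as → DS as n ≈ κ n * A.PLs (replicate n 2) (moments N) as
    DS-coefficient zero as = det-at-0 as js » sym (*-identityˡ _)
    DS-coefficient (suc n) as = begin
      _ ≈⟨ unscale (DS as (suc n)) ⟨
      _ ≈⟨ *ˡ (*ˡ (begin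
             _ ≈⟨ at (δ-det as js) n ⟩
             _ ≈⟨ PL-at 2 DS as n ⟩
             _ ≈⟨ A.PL-cong 2 (DS-coefficient n) as ⟩
             _ ≈⟨ A.PL-* 2 (κ n) _ as ⟩
             κ n * A.PLs (replicate (suc n) 2) (moments N) as ∎)) ⟩
      inv 1 * (inv n * (κ n * A.PLs (replicate (suc n) 2) (moments N) as)) ≈⟨ *ˡ (sym (*-assoc _ _ _)) » sym (*-assoc _ _ _) ⟩
      _ ∎
      where
      unscale : ∀ x → inv 1 * (inv n * (ι 2 * (ι (suc n) * x))) ≈ x
      unscale x = solve 5 (λ a b t i x → a :* (b :* (t :* (i :* x))) := t :* a :* (i :* b :* x)) refl _ _ _ _ _ » *-cong (inv-l 1) (*ʳ (inv-l n) » *-identityˡ x) » *-identityˡ x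

  -- The moment of e^(s p₂/2) times the product of the p_k over k in ks: the tau function and its
  -- derivatives, restricted to the line of the second time.
  τ : List ℕ → Ser
  τ ks n = κ n * E (ks ++ replicate n 2)

  private
    sgn = proj₁ (E-moments N)
    c₀ : Carrier
    c₀ = signed sgn (ι (N !))

    signed-* : ∀ s x y → signed s (x * y) ≈ signed s x * y
    signed-* true x y = refl
    signed-* false x y = -‿distribˡ-* x y

    τ≈ : ∀ ks → τ ks ≋ c₀ · 𝒜.PLs ks DS js
    τ≈ ks = mk λ n → begin
      _ ≈⟨ *ˡ (proj₂ (E-moments N) (ks ++ replicate n 2) » signed-* sgn (ι (N !)) _) ⟩
      _ ≈⟨ *-comm₃ _ _ _ ⟩
      _ ≈⟨ *ˡ (*ˡ (A.PLs-++ ks (replicate n 2) (moments N) js) » sym (A.PLs-* ks (κ n) _ js)) ⟩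
      _ ≈⟨ *ˡ (PLs-at ks DS js n » A.PLs-cong ks (DS-coefficient n) js) ⟨
      _ ∎

    halfS : ∀ {f} → f ⊕ f ≋ 𝟎 → f ≋ 𝟎
    halfS p = mk (λ n → half (at p n))

    module 𝒦 = KP seriesRing halfS

    from≡upto : ∀ n → from N 0 n ≡ 𝒦.upto n
    from≡upto n = snoc n 0
      where
      from-suc : ∀ j n → from N j (suc n) ≡ from N j n ++ (j N.+ n ∷ [])
      from-suc j zero = cong (_∷ []) (E.sym (NP.+-identityʳ j))
      from-suc j (suc n) = cong (j ∷_) (from-suc (suc j) n ∙ cong (λ i → from N (suc j) n ++ (i ∷ [])) (E.sym (NP.+-suc j n)))
      snoc : ∀ n (_ : ℕ) → from N 0 n ≡ 𝒦.upto n
      snoc zero _ = E.refl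
      snoc (suc n) _ = from-suc 0 n ∙ cong (_++ (n ∷ [])) (snoc n 0)

    t : List ℕ → Ser
    t ks = 𝒜.PLs ks DS (desc N)

    rows : ∀ s → (∀ g → 𝒜.Alternating g → g (𝒦.upto N) ≋ Products.signed seriesRing s (g (desc N))) → ∀ ks → 𝒜.PLs ks DS js ≋ Products.signed seriesRing s (t ks)
    rows s e ks = S.reflexive (cong (𝒜.PLs ks DS) (from≡upto N)) ⟫ e (𝒜.PLs ks DS) (𝒜.PLs-alternating ks DS (λ pre a b as → 𝒟.det-swap pS pre a b as js))

    scaled : ∀ s → (∀ ks → 𝒜.PLs ks DS js ≋ Products.signed seriesRing s (t ks)) → Σ Ser λ c → ∀ ks → τ ks ≋ c ⊛ t ks
    scaled true e = C c₀ , λ ks → τ≈ ks ⟫ S.sym (C⊛ c₀ (𝒜.PLs ks DS js)) ⟫ S.*ˡ {C c₀} (e ks)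
    scaled false e = ⊖ C c₀ , λ ks → τ≈ ks ⟫ S.sym (C⊛ c₀ (𝒜.PLs ks DS js)) ⟫ S.*ˡ {C c₀} (e ks) ⟫ S.sym (S.-‿distribʳ-* (C c₀) (t ks)) ⟫ S.-‿distribˡ-* (C c₀) (t ks)

    τ≈t : Σ Ser λ c → ∀ ks → τ ks ≋ c ⊛ t ks
    τ≈t = scaled (proj₁ (𝒦.reverse-sign N)) (rows (proj₁ (𝒦.reverse-sign N)) (proj₂ (𝒦.reverse-sign N)))

    t-kp : 𝒦.kp r t ≋ 𝟎
    t-kp = S.reflexive (cong (λ n → 𝒦.kp r (λ ks → 𝒜.PLs ks DS (desc n))) N≡4+r) ⟫ 𝒦.kp-det r pS js

  τ-kp : 𝒦.kp r τ ≋ 𝟎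
  τ-kp = 𝒦.kp-scale r (proj₁ τ≈t) τ t (proj₂ τ≈t) t-kp

  ν : Ser
  ν = S.ι N ⊛ S.ι N

  ν-at : ∀ f n → (ν ⊛ f) n ≈ ι N * ι N * f n
  ν-at f n = ⊛-assoc n (S.ι N) (S.ι N) f » at (ιs⊛ N (S.ι N ⊛ f)) n » *ˡ (at (ιs⊛ N f) n) » sym (*-assoc _ _ _)

  sum-twos : ∀ ks n → sumL (ks ++ replicate n 2) ≡ sumL ks N.+ dbl n
  sum-twos [] zero = E.refl
  sum-twos [] (suc n) = cong (λ m → suc (suc m)) (sum-twos [] n)
  sum-twos (k ∷ ks) n = cong (k N.+_) (sum-twos ks n) ∙ E.sym (NP.+-assoc k (sumL ks) (dbl n))

  -- `E-1` with n additional parts equal to 2, whose total 2n becomes the operator `ϑ`.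
  τ-1 : ∀ ks → τ (1 ∷ ks) ≋ (ν ⊕ S.ι (sumL ks)) ⊛ τ ks ⊕ ϑ (τ ks)
  τ-1 ks = mk λ n → begin
    _ ≈⟨ *ˡ (E-1 (ks ++ replicate n 2) » *ʳ (+ˡ (reflexive (cong ι (sum-twos ks n)) » ι-+ (sumL ks) (dbl n)))) ⟩
    _ ≈⟨ solve 5 (λ k a b c e → k :* ((a :+ (b :+ c)) :* e) := a :* (k :* e) :+ b :* (k :* e) :+ c :* (k :* e)) refl _ _ _ _ _ ⟩
    _ ≈⟨ +ʳ (⊛-distribʳ n ν (S.ι (sumL ks)) (τ ks) » +-cong (ν-at (τ ks) n) (at (ιs⊛ (sumL ks) (τ ks)) n)) ⟨
    _ ∎

  -- Here ϑ comes from Σₙ sⁿ/(2ⁿ n!) 2n (…) = s Σₙ sⁿ/(2ⁿ n!) (… with n replaced by n + 1).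
  τ-2 : ∀ ks → X ⊛ τ (2 ∷ ks) ≋ ϑ (τ ks)
  τ-2 ks = mk λ { zero → trans (X⊛-zero (τ (2 ∷ ks))) (sym (zeroˡ _)) ; (suc n) → begin
    _ ≈⟨ X⊛-suc (τ (2 ∷ ks)) n ⟩
    _ ≈⟨ *-cong (sym (κ-suc n)) (sym (E-move ks 2 (replicate n 2))) ⟩
    _ ≈⟨ solve 4 (λ t i k e → t :* (i :* k) :* e := t :* i :* (k :* e)) refl _ _ _ _ ⟩
    _ ≈⟨ *ʳ (ι-dbl (suc n)) ⟨
    ι (dbl (suc n)) * τ ks (suc n) ∎ }
    where
    ι-dbl : ∀ n → ι (dbl n) ≈ ι 2 * ι n
    ι-dbl n = trans (reflexive (cong ι (dbl≡ n))) (ι-* 2 n)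
      where
      dbl≡ : ∀ n → dbl n ≡ 2 N.* n
      dbl≡ zero = E.refl
      dbl≡ (suc n) = cong suc (cong suc (dbl≡ n) ∙ E.sym (NP.+-suc n (n N.+ 0)))

  bump-++ : ∀ (e : List ℕ → Carrier) ks ls → bump e (ks ++ ls) ≈ bump (λ ks → e (ks ++ ls)) ks + bump (λ ls → e (ks ++ ls)) ls
  bump-++ e [] ls = sym (+-identityˡ _)
  bump-++ e (k ∷ ks) ls = +ˡ (bump-++ (e ∘ (k ∷_)) ks ls) » sym (+-assoc _ _ _)

  bump-twos : ∀ ks n → bump (λ ls → E (ks ++ ls)) (replicate (suc n) 2) ≈ ι (dbl (suc n)) * E (3 ∷ ks ++ replicate n 2)
  bump-twos ks zero = +ˡ refl » +-identityʳ _ » *ˡ (E-move ks 3 [])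
  bump-twos ks (suc n) = begin
    _ ≈⟨ +-cong (*ˡ (E-move ks 3 (replicate (suc n) 2))) (bump-cong (replicate (suc n) 2) (λ ls → E-move ks 2 ls) » bump-twos (2 ∷ ks) n) ⟩
    _ ≈⟨ +ˡ (*ˡ (sym (E-move (3 ∷ ks) 2 (replicate n 2) ⟪ E-move (3 ∷ []) 2 (ks ++ replicate n 2) ⟫))) ⟩
    _ ≈⟨ sym (distribʳ _ _ _) » *ʳ (sym (ι-+ 2 (dbl (suc n)))) ⟩
    _ ∎
    where
    _⟪_⟫ : ∀ {x y z} → x ≈ y → z ≈ y → x ≈ z
    p ⟪ q ⟫ = p » sym q

  -- In `E-2` each of the n factors p₂ is turned into 2 p₃; the resulting factor 2n cancels against
  -- 1/(2ⁿ n!) and lowers n by one, which produces the term with `X`.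
  τ-3 : ∀ ks (b : Ser) → (∀ n → b n ≈ bump (λ ks → τ ks n) ks) → τ (2 ∷ ks) ≋ S.ι 2 ⊛ S.ι N ⊛ τ (1 ∷ ks) ⊕ b ⊕ X ⊛ τ (3 ∷ ks)
  τ-3 ks b e = mk λ n → begin
    _ ≈⟨ *ˡ (E-2 (ks ++ replicate n 2) » +ˡ (bump-++ E ks (replicate n 2))) ⟩
    _
      ≈⟨ solve 6 (λ k t n e b c → k :* (t :* n :* e :+ (b :+ c)) := t :* (n :* (k :* e)) :+ k :* b :+ k :* c) refl _ _ _ _ _ _ ⟩
    _
      ≈⟨ +-cong (+-cong (sym (⊛-assoc n (S.ι 2) (S.ι N) (τ (1 ∷ ks)) » at (ιs⊛ 2 (S.ι N ⊛ τ (1 ∷ ks))) n » *ˡ (at (ιs⊛ N (τ (1 ∷ ks))) n))) (scale-bump (κ n) _ ks » sym (e n))) (last n) ⟩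
    _ ∎
    where
    scale-bump : ∀ c (e : List ℕ → Carrier) ks → c * bump e ks ≈ bump (λ ks → c * e ks) ks
    scale-bump c e [] = zeroʳ c
    scale-bump c e (k ∷ ks) = distribˡ _ _ _ » +-cong (*-comm₃ _ _ _) (scale-bump c (e ∘ (k ∷_)) ks)
    last : ∀ n → κ n * bump (λ ls → E (ks ++ ls)) (replicate n 2) ≈ (X ⊛ τ (3 ∷ ks)) n
    last zero = zeroʳ _ » sym (X⊛-zero (τ (3 ∷ ks)))
    last (suc n) = begin
      _ ≈⟨ *ˡ (bump-twos ks n » *ʳ (ι-dbl' n)) ⟩
      _ ≈⟨ solve 4 (λ k t i e → k :* (t :* i :* e) := t :* (i :* k) :* e) refl _ _ _ _ ⟩
      _ ≈⟨ *ʳ (κ-suc n) ⟩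
      _ ≈⟨ X⊛-suc (τ (3 ∷ ks)) n ⟨
      _ ∎
      where
      ι-dbl' : ∀ n → ι (dbl (suc n)) ≈ ι 2 * ι (suc n)
      ι-dbl' n = trans (reflexive (cong ι (dbl≡ (suc n)))) (ι-* 2 (suc n))
        where
        dbl≡ : ∀ n → dbl n ≡ 2 N.* n
        dbl≡ zero = E.refl
        dbl≡ (suc n) = cong suc (cong suc (dbl≡ n) ∙ E.sym (NP.+-suc n (n N.+ 0)))

-- Elimination of the higher times between the KP equation and the Virasoro constraints.

module Elimination (R : CommutativeRing 0ℓ 0ℓ) where

  open Kit R

  module Derivation (D : Carrier → Carrier) (D-cong : ∀ {x y} → x ≈ y → D x ≈ D y) (D-+ : ∀ x y → D (x + y) ≈ D x + D y) (D-* : ∀ x y → D (x * y) ≈ D x * y + x * D y)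
    (N X T G : Carrier) (DX : D X ≈ ι 2 * X) (DN : D (N * N) ≈ 0#) (DT : D T ≈ (G - N * N) * T) where

    -- T G, T A₂, T A₃, T A₄ are the moments of p₁ up to order 4, and G, U, V, W the corresponding
    -- cumulants.
    U V W Z : Carrier
    U = G + D G
    V = ι 2 * U + D U
    W = ι 3 * V + D V
    Z = X * X * (W + ι 6 * (U * U)) + ι 8 * N * X * U - (U + G) + ι 2 * (N * N)

    private
      DG : D G ≈ U - G
      DG = solve 2 (λ g d → d := g :+ d :- g) refl G (D G)
      DU : D U ≈ V - ι 2 * U
      DU = solve 2 (λ u d → d := :2 :* u :+ d :- :2 :* u) refl U (D U)
      DV : D V ≈ W - ι 3 * V
      DV = solve 2 (λ u d → d := :3 :* u :+ d :- :3 :* u) refl V (D V)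

      DGG : D (G * G) ≈ (U - G) * G + G * (U - G)
      DGG = D-* G G » +-cong (*ʳ DG) (*ˡ DG)
      DGU : D (G * U) ≈ (U - G) * U + G * (V - ι 2 * U)
      DGU = D-* G U » +-cong (*ʳ DG) (*ˡ DU)

      A₂ A₃ A₄ : Carrier
      A₂ = G * G + U
      A₃ = G * (G * G) + (G * U + (G * U + G * U)) + V
      A₄ = G * G * (G * G) + ι 6 * (G * G * U) + ι 3 * (U * U) + ι 4 * (G * V) + W

      DA₂ : D A₂ ≈ (U - G) * G + G * (U - G) + (V - ι 2 * U)
      DA₂ = D-+ _ _ » +-cong DGG DU
      DA₃ : D A₃ ≈ (U - G) * (G * G) + G * ((U - G) * G + G * (U - G)) + (((U - G) * U + G * (V - ι 2 * U)) + (((U - G) * U + G * (V - ι 2 * U)) + ((U - G) * U + G * (V - ι 2 * U)))) + (W - ι 3 * V)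
      DA₃ = D-+ _ _ » +-cong (D-+ _ _ » +-cong (D-* _ _ » +-cong (*ʳ DG) (*ˡ DGG)) (D-+ _ _ » +-cong DGU (D-+ _ _ » +-cong DGU DGU))) DV

      next : ∀ {x a} k {b c} → x ≈ a * T → D a ≈ b → (N * N + k) * a + b + a * (G - N * N) ≈ c → (N * N + k) * x + D x ≈ c * T
      next {x} {a} k {b} {c} e d f = begin
        _ ≈⟨ +-cong (*ˡ e) (D-cong e » D-* a T » +-cong (*ʳ d) (*ˡ DT)) ⟩
        _ ≈⟨ solve 6 (λ m a b t g n → m :* (a :* t) :+ (b :* t :+ a :* ((g :- n :* n) :* t)) := (m :* a :+ b :+ a :* (g :- n :* n)) :* t) refl _ _ _ T G N ⟩
        _ ≈⟨ *ʳ f ⟩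
        _ ∎

    -- The derivatives in the second and third times are known only after multiplication by X or X²,
    -- so the KP relation is multiplied by X². Its part in the first time depends on cumulants
    -- alone: A₄ - 4 A₃ G + 3 A₂² = W + 6 U².
    eliminate : ∀ {τ₁ τ₁₁ τ₁₁₁ τ₁₁₁₁ τ₂ τ₂₂ τ₂₁ τ₃ τ₃₁} → τ₁ ≈ (N * N + ι 0) * T + D T → τ₁₁ ≈ (N * N + ι 1) * τ₁ + D τ₁ → τ₁₁₁ ≈ (N * N + ι 2) * τ₁₁ + D τ₁₁ → τ₁₁₁₁ ≈ (N * N + ι 3) * τ₁₁₁ + D τ₁₁₁ → X * τ₂ ≈ D T → X * τ₂₁ ≈ D τ₁ → X * τ₂₂ ≈ D τ₂ →
      τ₂ ≈ ι 2 * N * τ₁ + 0# + X * τ₃ → τ₂₁ ≈ ι 2 * N * τ₁₁ + τ₂ + X * τ₃₁ →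
      τ₁₁₁₁ * T - ι 4 * (τ₁₁₁ * τ₁) + ι 3 * (τ₁₁ * τ₁₁) + ι 3 * (τ₂₂ * T - τ₂ * τ₂) - ι 4 * (τ₃₁ * T - τ₃ * τ₁) ≈ 0# →
      T * T * Z ≈ 0#
    eliminate {τ₁} {τ₁₁} {τ₁₁₁} {τ₁₁₁₁} {τ₂} {τ₂₂} {τ₂₁} {τ₃} {τ₃₁} h₁ h₁₁ h₁₁₁ h₁₁₁₁ h₂ h₂₁ h₂₂ h₃ h₃₁ kp = begin
      _ ≈⟨ solve 7 (λ t x n g u v w → t :* t :* (x :* x :* (w :+ con (+ 6) :* (u :* u)) :+ con (+ 8) :* n :* x :* u :- (u :+ g) :+ :2 :* (n :* n))
             := x :* x :* ((g :* g :* (g :* g) :+ con (+ 6) :* (g :* g :* u) :+ :3 :* (u :* u) :+ :4 :* (g :* v) :+ w) :* t :* t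
                  :- :4 :* ((g :* (g :* g) :+ (g :* u :+ (g :* u :+ g :* u)) :+ v) :* t :* (g :* t)) :+ :3 :* ((g :* g :+ u) :* t :* ((g :* g :+ u) :* t)))
                :+ :3 :* (((u :- g) :+ (g :- n :* n) :* (g :- n :* n) :- :2 :* (g :- n :* n)) :* t :* t :- (g :- n :* n) :* t :* ((g :- n :* n) :* t))
                :- :4 :* (((u :- g) :+ g :* (g :- n :* n) :- :2 :* n :* x :* (g :* g :+ u) :- (g :- n :* n)) :* t :* t :- ((g :- n :* n) :* t :- :2 :* n :* x :* (g :* t)) :* (g :* t)))
             refl T X N G U V W ⟩
      X * X * (A₄ * T * T - ι 4 * (A₃ * T * (G * T)) + ι 3 * (A₂ * T * (A₂ * T))) + ι 3 * (((U - G) + (G - N * N) * (G - N * N) - ι 2 * (G - N * N)) * T * T - (G - N * N) * T * ((G - N * N) * T))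
        - ι 4 * (((U - G) + G * (G - N * N) - ι 2 * N * X * A₂ - (G - N * N)) * T * T - ((G - N * N) * T - ι 2 * N * X * (G * T)) * (G * T))
        ≈⟨ +-cong (+-cong (*ˡ (+-cong (+-cong (*ʳ e₁₁₁₁) (-‿cong (*ˡ (*-cong e₁₁₁ e₁)))) (*ˡ (*-cong e₁₁ e₁₁)))) (*ˡ (+-cong (*ʳ e₂₂) (-‿cong (*-cong e₂ e₂))))) (-‿cong (*ˡ (+-cong (*ʳ e₃₁) (-‿cong (*-cong e₃ e₁))))) ⟨
      _
        ≈⟨ solve 10 (λ x t a b c e f g h i → x :* x :* (a :* t :- :4 :* (b :* c) :+ :3 :* (e :* e)) :+ :3 :* (x :* (x :* f) :* t :- x :* g :* (x :* g)) :- :4 :* (x :* (x :* h) :* t :- x :* (x :* i) :* c)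
             := x :* x :* (a :* t :- :4 :* (b :* c) :+ :3 :* (e :* e) :+ :3 :* (f :* t :- g :* g) :- :4 :* (h :* t :- i :* c))) refl X T τ₁₁₁₁ τ₁₁₁ τ₁ τ₁₁ τ₂₂ τ₂ τ₃₁ τ₃ ⟩
      _ ≈⟨ *-zeroʳ kp ⟩
      _ ∎
      where
      open import Data.Integer using (+_)
      e₁ : τ₁ ≈ G * T
      e₁ = h₁ » +ˡ DT » solve 3 (λ n t g → (n :* n :+ con (+ 0)) :* t :+ (g :- n :* n) :* t := g :* t) refl N T G
      e₁₁ : τ₁₁ ≈ A₂ * T
      e₁₁ = h₁₁ » next (ι 1) e₁ DG (solve 3 (λ n g u → (n :* n :+ :1) :* g :+ (u :- g) :+ g :* (g :- n :* n) := g :* g :+ u) refl N G U)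
      e₁₁₁ : τ₁₁₁ ≈ A₃ * T
      e₁₁₁ = h₁₁₁ » next (ι 2) e₁₁ DA₂ (solve 4 (λ n g u v → (n :* n :+ :2) :* (g :* g :+ u) :+ ((u :- g) :* g :+ g :* (u :- g) :+ (v :- :2 :* u)) :+ (g :* g :+ u) :* (g :- n :* n)
        := g :* (g :* g) :+ (g :* u :+ (g :* u :+ g :* u)) :+ v) refl N G U V)
      e₁₁₁₁ : τ₁₁₁₁ ≈ A₄ * T
      e₁₁₁₁ = h₁₁₁₁ » next (ι 3) e₁₁₁ DA₃ (solve 5 (λ n g u v w → let gu = (u :- g) :* u :+ g :* (v :- :2 :* u) ; a = g :* (g :* g) :+ (g :* u :+ (g :* u :+ g :* u)) :+ v in
        (n :* n :+ :3) :* a :+ ((u :- g) :* (g :* g) :+ g :* ((u :- g) :* g :+ g :* (u :- g)) :+ (gu :+ (gu :+ gu)) :+ (w :- :3 :* v)) :+ a :* (g :- n :* n)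
        := g :* g :* (g :* g) :+ con (+ 6) :* (g :* g :* u) :+ :3 :* (u :* u) :+ :4 :* (g :* v) :+ w) refl N G U V W)
      e₂ : X * τ₂ ≈ (G - N * N) * T
      e₂ = h₂ » DT
      e₂₁ : X * τ₂₁ ≈ (U - G + G * (G - N * N)) * T
      e₂₁ = h₂₁ » D-cong e₁ » D-* G T » +-cong (*ʳ DG) (*ˡ DT) » solve 4 (λ n t g u → (u :- g) :* t :+ g :* ((g :- n :* n) :* t) := (u :- g :+ g :* (g :- n :* n)) :* t) refl N T G U
      e₂₂ : X * (X * τ₂₂) ≈ ((U - G) + (G - N * N) * (G - N * N) - ι 2 * (G - N * N)) * T
      e₂₂ = begin
        _ ≈⟨ *ˡ h₂₂ ⟩
        _ ≈⟨ solve 3 (λ x a b → x :* b := (:2 :* x :* a :+ x :* b) :- :2 :* (x :* a)) refl X τ₂ (D τ₂) ⟩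
        _ ≈⟨ +ʳ (+ʳ (*ʳ (sym DX)) » sym (D-* X τ₂)) ⟩
        _ ≈⟨ +-cong (D-cong h₂ » DDT) (-‿cong (*ˡ e₂)) ⟩
        _ ≈⟨ solve 4 (λ n t g u → (u :- g :+ g :* (g :- n :* n)) :* t :- n :* n :* ((g :- n :* n) :* t) :- :2 :* ((g :- n :* n) :* t)
               := ((u :- g) :+ (g :- n :* n) :* (g :- n :* n) :- :2 :* (g :- n :* n)) :* t) refl N T G U ⟩
        _ ∎
        where
        DDT : D (D T) ≈ (U - G + G * (G - N * N)) * T - N * N * ((G - N * N) * T)
        DDT = begin
          -- The zero stands for D (N * N) times T, which completes the Leibniz rule for N² T; then
          -- N² T + D T is τ₁ by h₁.
          _ ≈⟨ solve 4 (λ a b c t → a := con (+ 0) :* t :+ c :* b :+ a :- c :* b) refl (D (D T)) (D T) (N * N) T ⟩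
          _ ≈⟨ +-cong (+ʳ (+ʳ (*ʳ (sym DN)) » sym (D-* (N * N) T)) » sym (D-+ (N * N * T) (D T)) » D-cong (+ʳ (*ʳ (sym (+-identityʳ _))) » sym h₁) » sym h₂₁ » e₂₁) (-‿cong (*ˡ DT)) ⟩
          _ ∎
      e₃ : X * (X * τ₃) ≈ (G - N * N) * T - ι 2 * N * X * (G * T)
      e₃ = begin
        _ ≈⟨ solve 4 (λ x n a b → x :* b := x :* (:2 :* n :* a :+ con (+ 0) :+ b) :- :2 :* n :* x :* a) refl X N τ₁ (X * τ₃) ⟩
        _ ≈⟨ +-cong (*ˡ (sym h₃) » e₂) (-‿cong (*ˡ e₁)) ⟩
        _ ∎
      e₃₁ : X * (X * τ₃₁) ≈ ((U - G) + G * (G - N * N) - ι 2 * N * X * A₂ - (G - N * N)) * T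
      e₃₁ = begin
        _ ≈⟨ solve 5 (λ x n a b c → x :* b := x :* (:2 :* n :* a :+ c :+ b) :- :2 :* n :* x :* a :- x :* c) refl X N τ₁₁ (X * τ₃₁) τ₂ ⟩
        _ ≈⟨ +-cong (+-cong (*ˡ (sym h₃₁) » e₂₁) (-‿cong (*ˡ e₁₁))) (-‿cong e₂) ⟩
        _ ≈⟨ solve 6 (λ x n t g u a → (u :- g :+ g :* (g :- n :* n)) :* t :- :2 :* n :* x :* (a :* t) :- (g :- n :* n) :* t
               := ((u :- g) :+ g :* (g :- n :* n) :- :2 :* n :* x :* a :- (g :- n :* n)) :* t) refl X N T G U A₂ ⟩
        _ ∎

-- Connected maps and the recursion at fixed N

module MapRecursion (K : CommutativeRing 0ℓ 0ℓ) (inv : ℕ → CommutativeRing.Carrier K) (inv-l : ∀ n → CommutativeRing._≈_ K (CommutativeRing._*_ K (Kit.ι K (suc n)) (inv n)) (CommutativeRing.1# K)) (N r : ℕ) (N≡4+r : N ≡ 4 N.+ r) where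

  open Kit K
  open Series K
  open Doubling K
  open MapEquation K inv inv-l N r N≡4+r
  open MapSeries K N using (Tot; Conn; decomposition; Tot-even; Tot-odd)
  open Shifts K N using (E; Φ) renaming (𝟎 to 𝟎ᵥ)
  open ShiftAlternants K using (Regular; Regular-*; Regular-cong; moments; moments-product; from; length-from; E-moments)
  open Exponential K using (𝕊; 𝕊-cong; 𝕊-factorials)
  open Determinant K using (∏; vand)

  inv! : ℕ → Carrier
  inv! zero = 1#
  inv! (suc n) = inv n * inv! n

  inv!-l : ∀ n → ι (n !) * inv! n ≈ 1#
  inv!-l zero = *-identityˡ _
  inv!-l (suc n) = *ʳ (ι-* (suc n) (n !)) » solve 4 (λ s f i j → s :* f :* (i :* j) := s :* i :* (f :* j)) refl _ _ _ _ » *-cong (inv-l n) (inv!-l n) » *-identityˡ _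

  unique-inverse : ∀ {x y z} → x * y ≈ 1# → x * z ≈ 1# → y ≈ z
  unique-inverse {x} {y} {z} p q = begin
    _ ≈⟨ *-identityˡ y ⟨
    _ ≈⟨ *ʳ q ⟨
    _ ≈⟨ solve 3 (λ x y z → x :* z :* y := x :* y :* z) refl x y z ⟩
    _ ≈⟨ *ʳ p » *-identityˡ z ⟩
    _ ∎

  private
    Regular-suc : ∀ n → Regular N (ι (suc n))
    Regular-suc = regular-suc

    Regular-fact : ∀ n → Regular N (ι (n !))
    Regular-fact n {y} p = sym (*-identityˡ y) » *ʳ (sym (inv!-l n) » *-comm _ _) » *-assoc _ _ _ » *-zeroʳ p

    Regular-1 : Regular N 1#
    Regular-1 p = sym (*-identityˡ _) » p

    Regular-gaps : ∀ n j i → Regular N (∏ (from N (suc (i N.+ j)) n) (λ y → ι y - ι j))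
    Regular-gaps zero j i = Regular-1
    Regular-gaps (suc n) j i = Regular-* N (Regular-cong N (sym (+ʳ (ι-+ (suc i) j) » solve 2 (λ a b → a :+ b :- b := a) refl _ _)) (Regular-suc i)) (Regular-gaps n j (suc i))

    Regular-vand : ∀ n j → Regular N (vand ι (from N j n))
    Regular-vand zero j = Regular-1
    Regular-vand (suc n) j = Regular-* N (Regular-gaps n j 0) (Regular-vand n (suc j))

    Regular-facts : ∀ as → Regular N (∏ as (λ a → ι (a !)))
    Regular-facts [] = Regular-1
    Regular-facts (a ∷ as) = Regular-* N (Regular-fact a) (Regular-facts as)

    Regular-signed : ∀ s {x} → Regular N x → Regular N (Products.signed K s x)
    Regular-signed true p = p
    Regular-signed false p {y} e = p (sym (-‿involutive _) » -‿cong (-‿distribˡ-* _ y) » -‿cong e » -0#≈0#)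

    -- Up to sign, `Φ 𝟎ᵥ` is N! times the factorials of 0, ..., N-1 times their Vandermonde product,
    -- all of them positive integers.
    Regular-Φ : Regular N (Φ 𝟎ᵥ)
    Regular-Φ = Regular-cong N (sym (proj₂ (E-moments N) [])) (Regular-signed (proj₁ (E-moments N)) (Regular-* N (Regular-fact N)
      (Regular-cong N (sym (moments-product N (from N 0 N) (length-from N 0 N))) (Regular-* N (Regular-facts (from N 0 N)) (Regular-vand N 0)))))

    a b : Ser
    a k = inv! k * Conn k
    b l = inv! l * Tot l

    uninv : ∀ n x → x ≈ ι (n !) * (inv! n * x)
    uninv n x = sym (sym (*-assoc _ _ _) » *ʳ (inv!-l n) » *-identityˡ x)

    -- `decomposition` read in exponential generating series: the connected series a is the
    -- logarithmic derivative of the series b of all pairs.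
    exponential : ∀ m → d b m ≈ (a ⊛ b) m
    exponential m = begin
      _ ≈⟨ solve 4 (λ s i j t → s :* (i :* j :* t) := s :* i :* (j :* t)) refl _ _ _ _ » *ʳ (inv-l m) » *-identityˡ _ ⟩
      _ ≈⟨ *ˡ (decomposition m » 𝕊-cong m (λ {k} {l} _ → *-cong (uninv k (Conn k)) (uninv l (Tot l))) » 𝕊-factorials m a b) ⟩
      _ ≈⟨ sym (*-assoc _ _ _) » *ʳ (*-comm _ _ » inv!-l m) » *-identityˡ _ ⟩
      _ ∎

    b-odd : ∀ n → b (suc (dbl n)) ≈ 0#
    b-odd n = *-zeroʳ (Regular-Φ (*-comm _ _ » Tot-odd n))

    κ-inv! : ∀ n → inv! (dbl n) * ι (oddfact n) ≈ κ n
    κ-inv! zero = *-identityˡ _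
    κ-inv! (suc n) = begin
      _ ≈⟨ *ˡ (ι-* (suc (dbl n)) (oddfact n)) ⟩
      _ ≈⟨ solve 5 (λ i j k s o → i :* (j :* k) :* (s :* o) := i :* ((s :* j) :* (k :* o))) refl _ _ _ _ _ ⟩
      _ ≈⟨ *-cong inv-dbl (*-cong (inv-l (dbl n)) (κ-inv! n) » *-identityˡ _) ⟩
      _ ≈⟨ *-assoc _ _ _ ⟩
      _ ∎
      where
      dbl≡ : ∀ n → dbl n ≡ 2 N.* n
      dbl≡ zero = E.refl
      dbl≡ (suc n) = cong suc (cong suc (dbl≡ n) ∙ E.sym (NP.+-suc n (n N.+ 0)))
      inv-dbl : inv (suc (dbl n)) ≈ inv 1 * inv n
      inv-dbl = unique-inverse (inv-l (suc (dbl n))) (*ʳ (reflexive (cong ι (dbl≡ (suc n))) » ι-* 2 (suc n)) » solve 4 (λ t s i j → t :* s :* (i :* j) := t :* i :* (s :* j)) refl _ _ _ _ » *-cong (inv-l 1) (inv-l n) » *-identityˡ _)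

    T₀ : Ser
    T₀ = τ []

    b-even : ∀ n → b (dbl n) * Φ 𝟎ᵥ ≈ T₀ n
    b-even n = begin
      _ ≈⟨ *-assoc _ _ _ » *ˡ (Tot-even n) ⟩
      _ ≈⟨ sym (*-assoc _ _ _) » *ʳ (κ-inv! n) ⟩
      _ ∎

    even-⊛ : ∀ n (f g : Ser) → (∀ n → g (suc (dbl n)) ≈ 0#) → (f ⊛ g) (suc (dbl n)) ≈ ((λ j → f (suc (dbl j))) ⊛ (λ j → g (dbl j))) n
    even-⊛ zero f g z = +ʳ (*-zeroʳ (z 0)) » +-identityˡ _
    even-⊛ (suc n) f g z = +ʳ (*-zeroʳ (z (suc n))) » +-identityˡ _ » +ˡ (even-⊛ n (λ j → f (suc (suc j))) g z)

    ⊛-scale : ∀ n (f g : Ser) c → (f ⊛ g) n * c ≈ (f ⊛ (λ j → g j * c)) n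
    ⊛-scale n f g c = *-comm _ _ » *ˡ (⊛-comm n f g) » sym (⊛-·ˡ n c g f) » ⊛-comm n (c · g) f » ⊛-at n (λ _ → refl) (λ _ → *-comm _ _)

  -- Conn (2n-1)/(2n-1)! counts the rooted maps with n edges by N^(vertices + faces); the term `ν`
  -- of `G` is the map without edges, with one vertex and one face.
  H G : Ser
  H zero = 0#
  H (suc n) = inv! (suc (dbl n)) * Conn (suc (dbl n))
  G = ν ⊕ H

  private
    -- The odd degrees of `exponential`. Since b has even terms only, edges replace half-edges as
    -- the variable, and d/dx becomes 2s d/ds.
    logarithmic : ϑ T₀ ≋ H ⊛ T₀
    logarithmic = mk go
      where
      go : ∀ n → ϑ T₀ n ≈ (H ⊛ T₀) n
      go zero = zeroˡ _ » sym (zeroˡ _)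
      go (suc n) = begin
        _ ≈⟨ *ˡ (b-even (suc n)) ⟨
        _ ≈⟨ *-assoc _ _ _ ⟨
        _ ≈⟨ *ʳ (exponential (suc (dbl n)) » even-⊛ n a b b-odd) ⟩
        _ ≈⟨ ⊛-scale n (H ∘ suc) (λ j → b (dbl j)) (Φ 𝟎ᵥ) ⟩
        _ ≈⟨ ⊛-at n (λ _ → refl) b-even ⟩
        _ ≈⟨ at (shift-⊛ H T₀ refl) n ⟨
        _ ∎

    ϑ-⊛ : ∀ f g → ϑ (f ⊛ g) ≋ ϑ f ⊛ g ⊕ f ⊛ ϑ g
    ϑ-⊛ f g = mk λ n → begin
      _ ≈⟨ *ʳ (ι-dbl n) » *-assoc _ _ _ ⟩
      _ ≈⟨ *ˡ (at (θ-leibniz f g) n) » distribˡ _ _ _ ⟩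
      _ ≈⟨ +-cong (sym (⊛-·ˡ n (ι 2) (θ f) g) » ⊛-at n (λ k → two f k) (λ _ → refl)) (*-comm _ _ » ⊛-scale n f (θ g) (ι 2) » ⊛-at n (λ _ → refl) (λ k → *-comm _ _ » two g k)) ⟩
      _ ∎
      where
      two : ∀ f k → ι 2 * θ f k ≈ ϑ f k
      two f k = sym (*-assoc _ _ _) » *ʳ (sym (ι-dbl k))

    module El = Elimination seriesRing
    Nˢ : Ser
    Nˢ = S.ι N

    ν-C : ν ≋ C (ι N * ι N)
    ν-C = ιs⊛ N (S.ι N) ⟫ (mk λ { zero → *ˡ (at (ιs-C N) 0) ; (suc n) → *ˡ (at (ιs-C N) (suc n)) » zeroʳ _ })

    ϑν : ϑ ν ≋ 𝟎
    ϑν = mk λ { zero → zeroˡ _ ; (suc n) → *-zeroʳ (at ν-C (suc n)) }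

    ϑX : ϑ X ≋ S.ι 2 ⊛ X
    ϑX = (mk λ { zero → trans (zeroʳ _) (sym (zeroʳ _)) ; (suc zero) → refl ; (suc (suc n)) → zeroʳ _ » sym (zeroʳ _) }) ⟫ S.sym (ιs⊛ 2 X)

    ϑT : ϑ T₀ ≋ (G ⊕ ⊖ ν) ⊛ T₀
    ϑT = logarithmic ⟫ S.*ʳ {T₀} (S.solve 2 (λ n h → h S.:= n S.:+ h S.:- n) S.refl ν H)

    ϑ-cong : ∀ {f g} → f ≋ g → ϑ f ≋ ϑ g
    ϑ-cong e = mk (λ n → *ˡ (at e n))

    ϑ-⊕ : ∀ f g → ϑ (f ⊕ g) ≋ ϑ f ⊕ ϑ g
    ϑ-⊕ f g = mk (λ n → distribˡ _ _ _)

    open El.Derivation ϑ ϑ-cong ϑ-⊕ ϑ-⊛ Nˢ X T₀ G ϑX ϑν ϑT using (U; V; W; Z; eliminate)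

    TTZ : T₀ ⊛ T₀ ⊛ Z ≋ 𝟎
    TTZ = eliminate {τ (1 ∷ [])} {τ (1 ∷ 1 ∷ [])} {τ (1 ∷ 1 ∷ 1 ∷ [])} {τ (1 ∷ 1 ∷ 1 ∷ 1 ∷ [])} {τ (2 ∷ [])} {τ (2 ∷ 2 ∷ [])} {τ (2 ∷ 1 ∷ [])} {τ (3 ∷ [])} {τ (3 ∷ 1 ∷ [])}
      (τ-1 []) (τ-1 (1 ∷ [])) (τ-1 (1 ∷ 1 ∷ [])) (τ-1 (1 ∷ 1 ∷ 1 ∷ [])) (τ-2 []) (τ-2 (1 ∷ [])) (τ-2 (2 ∷ []))
      (τ-3 [] 𝟎 (λ n → refl)) (τ-3 (1 ∷ []) (τ (2 ∷ [])) (λ n → sym (+-identityʳ _ » *-identityˡ _))) τ-kp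

    Regular-T0 : ∀ {x} → T₀ 0 * x ≈ 0# → x ≈ 0#
    Regular-T0 p = Regular-Φ (*ʳ (sym (*-identityˡ _)) » p)

    Z≋𝟎 : Z ≋ 𝟎
    Z≋𝟎 = unit-cancel-regular Regular-T0 (unit-cancel-regular {T₀} {T₀ ⊛ Z} Regular-T0 (S.sym (S.*-assoc T₀ T₀ Z) ⟫ TTZ))

    U-at : ∀ n → U n ≈ ι (suc (dbl n)) * G n
    U-at n = solve 2 (λ g x → g :+ x :* g := (:1 :+ x) :* g) refl (G n) (ι (dbl n)) » *ʳ (sym (ι-suc (dbl n)))

    V-at : ∀ n → V n ≈ ι (suc (suc (dbl n))) * U n
    V-at n = +ʳ (at (ιs⊛ 2 U) n) » sym (distribʳ _ _ _) » *ʳ (sym (ι-+ 2 (dbl n)))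

    W-at : ∀ n → W n ≈ ι (suc (suc (suc (dbl n)))) * V n
    W-at n = +ʳ (at (ιs⊛ 3 V) n) » sym (distribʳ _ _ _) » *ʳ (sym (ι-+ 3 (dbl n)))

  u w : Ser
  u n = ι (suc (dbl n)) * G n
  w n = ι (suc (suc (suc (dbl n)))) * (ι (suc (suc (dbl n))) * u n)

  G-0 : G 0 ≈ ι N * ι N
  G-0 = +-identityʳ _ » at ν-C 0

  G-suc : ∀ n → G (suc n) ≈ inv! (suc (dbl n)) * Conn (suc (dbl n))
  G-suc n = +ʳ (at ν-C (suc n)) » +-identityˡ _

  private
    sum-at : ∀ n → (U ⊕ G) n ≈ ι (suc (suc (dbl n))) * G n
    sum-at n = +ʳ (U-at n) » solve 2 (λ s g → s :* g :+ g := (:1 :+ s) :* g) refl _ _ » *ʳ (sym (ι-suc (suc (dbl n))))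

    linear-at : ∀ n → (S.ι 8 ⊛ Nˢ ⊛ X ⊛ U) (suc n) ≈ ι 8 * (ι N * u n)
    linear-at n = at (S.*-assoc (S.ι 8 ⊛ Nˢ) X U ⟫ S.*-assoc (S.ι 8) Nˢ (X ⊛ U) ⟫ ιs⊛ 8 (Nˢ ⊛ (X ⊛ U))) (suc n) » *ˡ (at (ιs⊛ N (X ⊛ U)) (suc n) » *ˡ (X⊛-suc U n » U-at n))

    νs-at : ∀ n → (S.ι 2 ⊛ (Nˢ ⊛ Nˢ)) (suc n) ≈ 0#
    νs-at n = at (ιs⊛ 2 (Nˢ ⊛ Nˢ)) (suc n) » *-zeroʳ (at ν-C (suc n))

    Q : Ser
    Q = W ⊕ S.ι 6 ⊛ (U ⊛ U)

    XXQ : ∀ n → (X ⊛ X ⊛ Q) (suc n) ≈ (X ⊛ Q) n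
    XXQ n = at (S.*-assoc X X Q) (suc n) » X⊛-suc (X ⊛ Q) n

    isolate : ∀ {q l s v} → q + l - s + v ≈ 0# → v ≈ 0# → s ≈ q + l
    isolate {q} {l} {s} {v} e z = solve 4 (λ q l s v → s := q :+ l :+ v :- (q :+ l :- s :+ v)) refl q l s v » +-cong (+ˡ z » +-identityʳ _) (-‿cong e » -0#≈0#) » +-identityʳ _

  G-recursion₁ : ι 4 * G 1 ≈ ι 8 * (ι N * u 0)
  G-recursion₁ = sym (sum-at 1) » isolate (at Z≋𝟎 1) (νs-at 0) » +-cong (XXQ 0 » X⊛-zero Q) (linear-at 0) » +-identityˡ _

  -- The coefficient of degree n + 2 in `Z≋𝟎`; the constant 2N² has left the scene and `ϑ`
  -- multiplies the degree-n coefficient by 2n.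
  G-recursion : ∀ n → ι (dbl (3 N.+ n)) * G (2 N.+ n) ≈ w n + ι 6 * (u ⊛ u) n + ι 8 * (ι N * u (suc n))
  G-recursion n = sym (sum-at (2 N.+ n)) » isolate (at Z≋𝟎 (2 N.+ n)) (νs-at (suc n)) » +-cong (XXQ (suc n) » X⊛-suc Q n » +-cong (W-at n » *ˡ (V-at n » *ˡ (U-at n))) (at (ιs⊛ 6 (U ⊛ U)) n » *ˡ (⊛-at n U-at U-at))) (linear-at (suc n))

-- Series with finitely many terms, and their values.

module Polynomials (K : CommutativeRing 0ℓ 0ℓ) where

  open Kit K
  open Series K
  private module SS = Series seriesRing

  Poly : ℕ → Ser → Set
  Poly zero f = ∀ k → f k ≈ 0#
  Poly (suc B) f = Poly B (shift f)

  ev : ℕ → Ser → Carrier → Carrier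
  ev zero f x = 0#
  ev (suc B) f x = f 0 + x * ev B (shift f) x

  ev-cong : ∀ B {f g} x → f ≋ g → ev B f x ≈ ev B g x
  ev-cong zero x e = refl
  ev-cong (suc B) x e = +-cong (at e 0) (*ˡ (ev-cong B x (mk (λ n → at e (suc n)))))

  ev-+ : ∀ B f g x → ev B (f ⊕ g) x ≈ ev B f x + ev B g x
  ev-+ zero f g x = sym (+-identityʳ _)
  ev-+ (suc B) f g x = +ˡ (*ˡ (ev-+ B (shift f) (shift g) x)) » solve 5 (λ a b x u v → a :+ b :+ x :* (u :+ v) := a :+ x :* u :+ (b :+ x :* v)) refl _ _ _ _ _

  ev-· : ∀ B c f x → ev B (c · f) x ≈ c * ev B f x
  ev-· zero c f x = sym (zeroʳ c)
  ev-· (suc B) c f x = +ˡ (*ˡ (ev-· B c (shift f) x)) » solve 4 (λ c a x u → c :* a :+ x :* (c :* u) := c :* (a :+ x :* u)) refl _ _ _ _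

  ev-⊖ : ∀ B f x → ev B (⊖ f) x ≈ - ev B f x
  ev-⊖ zero f x = sym -0#≈0#
  ev-⊖ (suc B) f x = +ˡ (*ˡ (ev-⊖ B (shift f) x)) » solve 3 (λ a x u → :- a :+ x :* :- u := :- (a :+ x :* u)) refl _ _ _

  ev-0 : ∀ B f x → (∀ k → f k ≈ 0#) → ev B f x ≈ 0#
  ev-0 zero f x e = refl
  ev-0 (suc B) f x e = +-zero (e 0) (*-zeroʳ (ev-0 B (shift f) x (e ∘ suc)))

  ev-∑ : ∀ B {A : Set} (xs : List A) (F : A → Ser) x → ev B (λ k → ∑ xs (λ a → F a k)) x ≈ ∑ xs (λ a → ev B (F a) x)
  ev-∑ zero xs F x = sym (∑-0 xs (λ _ → refl))
  ev-∑ (suc B) xs F x = +ˡ (*ˡ (ev-∑ B xs (λ a → shift (F a)) x) » sym (∑-*ˡ xs x)) » sym (∑-+ xs)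

  Poly-cong : ∀ B {f g} → f ≋ g → Poly B f → Poly B g
  Poly-cong zero e p k = sym (at e k) » p k
  Poly-cong (suc B) e p = Poly-cong B (mk (λ n → at e (suc n))) p

  Poly-0 : ∀ B {f} → (∀ k → f k ≈ 0#) → Poly B f
  Poly-0 zero e = e
  Poly-0 (suc B) e = Poly-0 B (e ∘ suc)

  Poly-+ : ∀ B {f g} → Poly B f → Poly B g → Poly B (f ⊕ g)
  Poly-+ zero p q k = +-zero (p k) (q k)
  Poly-+ (suc B) p q = Poly-+ B p q

  Poly-· : ∀ B c {f} → Poly B f → Poly B (c · f)
  Poly-· zero c p k = *-zeroʳ (p k)
  Poly-· (suc B) c p = Poly-· B c p

  Poly-⊖ : ∀ B {f} → Poly B f → Poly B (⊖ f)
  Poly-⊖ zero p k = -‿cong (p k) » -0#≈0#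
  Poly-⊖ (suc B) p = Poly-⊖ B p

  Poly-≤ : ∀ {B D} f → B N.≤ D → Poly B f → Poly D f
  Poly-≤ {D = D} f z≤n p = Poly-0 D p
  Poly-≤ f (s≤s h) p = Poly-≤ (shift f) h p

  ev-≤ : ∀ {B D} f x → B N.≤ D → Poly B f → ev D f x ≈ ev B f x
  ev-≤ {D = D} f x z≤n p = ev-0 D f x p
  ev-≤ f x (s≤s h) p = +ˡ (*ˡ (ev-≤ (shift f) x h p))

  shift-conv : ∀ f g → shift (f ⊛ g) ≋ f 0 · shift g ⊕ shift f ⊛ g
  shift-conv f g = mk (λ n → refl)

  Poly-⊛ : ∀ B D {f g} → Poly B f → Poly D g → Poly (B N.+ D) (f ⊛ g)
  Poly-⊛ zero D p q = Poly-0 D (λ k → ⊛-zeroˡ k p)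
  Poly-⊛ (suc B) D {f} {g} p q = Poly-+ (B N.+ D) (Poly-· (B N.+ D) (f 0) (Poly-≤ (shift g) (NP.≤-refl {B N.+ D}) (Poly-≤ {D} {suc (B N.+ D)} g (NP.m≤n⇒m≤1+n (NP.m≤n+m D B)) q))) (Poly-⊛ B D p q)

  ev-⊛ : ∀ B D f g x → Poly B f → Poly D g → ev (B N.+ D) (f ⊛ g) x ≈ ev B f x * ev D g x
  ev-⊛ zero D f g x p q = ev-0 D (f ⊛ g) x (λ k → ⊛-zeroˡ k p) » sym (zeroˡ _)
  ev-⊛ (suc B) D f g x p q = begin
    _ ≈⟨ +ˡ (*ˡ (ev-+ (B N.+ D) (f 0 · shift g) (shift f ⊛ g) x » +-cong (ev-· (B N.+ D) (f 0) (shift g) x) (ev-⊛ B D (shift f) g x p q))) ⟩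
    _ ≈⟨ solve 6 (λ f0 g0 x u v w → f0 :* g0 :+ x :* (f0 :* u :+ v :* w) := f0 :* (g0 :+ x :* u) :+ x :* v :* w) refl _ _ _ _ _ _ ⟩
    _ ≈⟨ +ʳ (*ˡ (ev-≤ g x (NP.m≤n⇒m≤1+n (NP.m≤n+m D B)) q)) ⟩
    _ ≈⟨ distribʳ _ _ _ ⟨
    _ ∎

  ev-conv : ∀ B n (F G : ℕ → Ser) x → (∀ k → k N.≤ n → Poly B (F k)) → (∀ k → k N.≤ n → Poly B (G k)) → ev (B N.+ B) ((F SS.⊛ G) n) x ≈ ((λ k → ev B (F k) x) ⊛ (λ k → ev B (G k) x)) n
  ev-conv B zero F G x p q = ev-⊛ B B (F 0) (G 0) x (p 0 z≤n) (q 0 z≤n)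
  ev-conv B (suc n) F G x p q = ev-+ (B N.+ B) (F 0 ⊛ G (suc n)) ((F ∘ suc SS.⊛ G) n) x » +-cong (ev-⊛ B B (F 0) (G (suc n)) x (p 0 z≤n) (q (suc n) NP.≤-refl)) (ev-conv B n (F ∘ suc) G x (λ k h → p (suc k) (s≤s h)) (λ k h → q k (NP.m≤n⇒m≤1+n h)))

  Poly-conv : ∀ B n (F G : ℕ → Ser) → (∀ k → k N.≤ n → Poly B (F k)) → (∀ k → k N.≤ n → Poly B (G k)) → Poly (B N.+ B) ((F SS.⊛ G) n)
  Poly-conv B zero F G p q = Poly-⊛ B B (p 0 z≤n) (q 0 z≤n)
  Poly-conv B (suc n) F G p q = Poly-+ (B N.+ B) (Poly-⊛ B B (p 0 z≤n) (q (suc n) NP.≤-refl)) (Poly-conv B n (F ∘ suc) G (λ k h → p (suc k) (s≤s h)) (λ k h → q k (NP.m≤n⇒m≤1+n h)))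

  -- Synthetic division by x - a: the coefficients of the quotient are the Horner values at a.
  quotient : ℕ → Carrier → Ser → Ser
  quotient zero a f = 𝟎
  quotient (suc B) a f zero = ev B (shift f) a
  quotient (suc B) a f (suc k) = quotient B a (shift f) k

  quotient-Poly : ∀ B a f → Poly B (quotient (suc B) a f)
  quotient-Poly zero a f zero = refl
  quotient-Poly zero a f (suc k) = refl
  quotient-Poly (suc B) a f = quotient-Poly B a (shift f)

  ev-quotient : ∀ B a f x → ev (suc B) f x - ev (suc B) f a ≈ (x - a) * ev B (quotient (suc B) a f) x
  ev-quotient zero a f x = solve 3 (λ c x a → c :+ x :* con (+ 0) :- (c :+ a :* con (+ 0)) := (x :- a) :* con (+ 0)) refl _ _ _
    where open import Data.Integer using (+_)
  ev-quotient (suc B) a f x = begin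
    _ ≈⟨ solve 5 (λ c x a p q → (c :+ x :* p) :- (c :+ a :* q) := (x :- a) :* q :+ x :* (p :- q)) refl _ _ _ _ _ ⟩
    _ ≈⟨ +ˡ (*ˡ (ev-quotient B a (shift f) x)) ⟩
    _ ≈⟨ solve 4 (λ d q x r → d :* q :+ x :* (d :* r) := d :* (q :+ x :* r)) refl _ _ _ _ ⟩
    _ ∎
    where
    u = ev (suc B) (shift f)

  quotient-0 : ∀ B a f → Poly B f → (∀ k → quotient B a f k ≈ 0#) → ev B f a ≈ 0# → ∀ k → f k ≈ 0#
  quotient-0 zero a f p q e k = p k
  quotient-0 (suc B) a f p q e = λ { zero → trans (sym (+ˡ (*-zeroʳ (q 0)) » +-identityʳ _)) e ; (suc k) → rest k }
    where
    rest = quotient-0 B a (shift f) p (q ∘ suc) (q 0)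

  module _ (regular : ∀ n {x} → ι (suc n) * x ≈ 0# → x ≈ 0#) where

    -- Dividing by x - m lowers the bound and keeps the roots m + 1, m + 2, ..., because their
    -- distances from m are regular.
    many-roots : ∀ B f m → Poly B f → (∀ i → ev B f (ι (i N.+ m)) ≈ 0#) → ∀ k → f k ≈ 0#
    many-roots zero f m p r = p
    many-roots (suc B) f m p r = quotient-0 (suc B) (ι m) f p (many-roots B (quotient (suc B) (ι m) f) (suc m) (quotient-Poly B (ι m) f) (λ i → regular i (begin
          _ ≈⟨ *ʳ (solve 2 (λ s m → s := s :+ m :- m) refl (ι (suc i)) (ι m) » +ʳ (sym (ι-+ (suc i) m) » reflexive (cong ι (E.sym (NP.+-suc i m))))) ⟩
          _ ≈⟨ ev-quotient B (ι m) f (ι (i N.+ suc m)) ⟨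
          _ ≈⟨ +-cong (reflexive (cong (λ j → ev (suc B) f (ι j)) (NP.+-suc i m)) » r (suc i)) (-‿cong (r 0)) ⟩
          _ ≈⟨ -‿inverseʳ _ ⟩
          _ ∎)))
      (r 0)

  -- rep w a = Σ_g a_g X^{w-2g}, for a with a_g = 0 when 2g > w.

  up : ℕ → Ser → Ser
  up zero f = f
  up (suc k) f = X ⊛ up k f

  up-cong : ∀ k {f g} → f ≋ g → up k f ≋ up k g
  up-cong zero e = e
  up-cong (suc k) e = S.*ˡ {X} (up-cong k e)

  up-⊕ : ∀ k f g → up k (f ⊕ g) ≋ up k f ⊕ up k g
  up-⊕ zero f g = S.refl
  up-⊕ (suc k) f g = S.*ˡ {X} (up-⊕ k f g) ⟫ S.distribˡ X (up k f) (up k g)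

  up-⊛ : ∀ k f g → up k f ⊛ g ≋ up k (f ⊛ g)
  up-⊛ zero f g = S.refl
  up-⊛ (suc k) f g = S.*-assoc X (up k f) g ⟫ S.*ˡ {X} (up-⊛ k f g)

  up-up : ∀ k l f → up k (up l f) ≋ up (k N.+ l) f
  up-up zero l f = S.refl
  up-up (suc k) l f = S.*ˡ {X} (up-up k l f)

  up-· : ∀ k c f → up k (c · f) ≋ c · up k f
  up-· k c f = up-cong k (S.sym (C⊛ c f) ⟫ S.*-comm (C c) f) ⟫ S.sym (up-⊛ k f (C c)) ⟫ S.*-comm (up k f) (C c) ⟫ C⊛ c (up k f)

  up-0 : ∀ k → up k 𝟎 ≋ 𝟎
  up-0 zero = S.refl
  up-0 (suc k) = S.*-zeroʳ {X} (up-0 k)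

  up-at : ∀ k f n → up k f (k N.+ n) ≈ f n
  up-at zero f n = refl
  up-at (suc k) f n = X⊛-suc (up k f) (k N.+ n) » up-at k f n

  rep : ℕ → Ser → Ser
  rep zero a = C (a 0)
  rep (suc zero) a = up 1 (C (a 0))
  rep (suc (suc w)) a = up (2 N.+ w) (C (a 0)) ⊕ rep w (shift a)

  Supp : ℕ → Ser → Set
  Supp zero a = shift a ≋ 𝟎
  Supp (suc zero) a = shift a ≋ 𝟎
  Supp (suc (suc w)) a = Supp w (shift a)

  C-cong : ∀ {x y} → x ≈ y → C x ≋ C y
  C-cong e = mk λ { zero → e ; (suc n) → refl }

  C-0 : C 0# ≋ 𝟎
  C-0 = mk λ { zero → refl ; (suc n) → refl }

  C-+ : ∀ x y → C (x + y) ≋ C x ⊕ C y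
  C-+ x y = mk λ { zero → refl ; (suc n) → sym (+-identityʳ _) }

  C-· : ∀ c x → C (c * x) ≋ c · C x
  C-· c x = mk λ { zero → refl ; (suc n) → sym (zeroʳ c) }

  shift-cong : ∀ {a b} → a ≋ b → shift a ≋ shift b
  shift-cong e = mk (λ n → at e (suc n))

  rep-cong : ∀ w {a b} → a ≋ b → rep w a ≋ rep w b
  rep-cong zero e = C-cong (at e 0)
  rep-cong (suc zero) e = up-cong 1 (C-cong (at e 0))
  rep-cong (suc (suc w)) e = S.+-cong (up-cong (2 N.+ w) (C-cong (at e 0))) (rep-cong w (shift-cong e))

  rep-⊕ : ∀ w a b → rep w (a ⊕ b) ≋ rep w a ⊕ rep w b
  rep-⊕ zero a b = C-+ _ _
  rep-⊕ (suc zero) a b = up-cong 1 (C-+ _ _) ⟫ up-⊕ 1 _ _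
  rep-⊕ (suc (suc w)) a b = S.+-cong (up-cong (2 N.+ w) (C-+ _ _) ⟫ up-⊕ (2 N.+ w) (C (a 0)) (C (b 0))) (rep-⊕ w (shift a) (shift b)) ⟫ S.solve 4 (λ x y z t → x S.:+ y S.:+ (z S.:+ t) S.:= x S.:+ z S.:+ (y S.:+ t)) S.refl _ _ _ _

  rep-· : ∀ w c a → rep w (c · a) ≋ c · rep w a
  rep-· zero c a = C-· _ _
  rep-· (suc zero) c a = up-cong 1 (C-· _ _) ⟫ up-· 1 c _
  rep-· (suc (suc w)) c a = S.+-cong (up-cong (2 N.+ w) (C-· _ _) ⟫ up-· (2 N.+ w) c _) (rep-· w c (shift a)) ⟫ mk (λ n → sym (distribˡ _ _ _))

  rep-0 : ∀ w {a} → a ≋ 𝟎 → rep w a ≋ 𝟎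
  rep-0 zero e = C-cong (at e 0) ⟫ C-0
  rep-0 (suc zero) e = up-cong 1 (C-cong (at e 0) ⟫ C-0) ⟫ up-0 1
  rep-0 (suc (suc w)) e = S.+-zero (up-cong (2 N.+ w) (C-cong (at e 0) ⟫ C-0) ⟫ up-0 (2 N.+ w)) (rep-0 w (shift-cong e))

  rep-constant : ∀ w {a} → shift a ≋ 𝟎 → rep w a ≋ up w (C (a 0))
  rep-constant zero e = S.refl
  rep-constant (suc zero) e = S.refl
  rep-constant (suc (suc w)) e = S.+ˡ (rep-0 w e) ⟫ S.+-identityʳ _

  rep-up : ∀ k v {b} → Supp v b → rep (k N.+ v) b ≋ up k (rep v b)
  rep-up k zero {b} s = S.reflexive (cong (λ w → rep w b) (NP.+-identityʳ k)) ⟫ rep-constant k s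
  rep-up k (suc zero) {b} s = rep-constant (k N.+ 1) s ⟫ S.sym (up-up k 1 (C (b 0)))
  rep-up k (suc (suc v)) {b} s = S.reflexive (cong (λ w → rep w b) (NP.+-suc k (suc v) ∙ cong suc (NP.+-suc k v))) ⟫
    S.+-cong (S.reflexive (cong (λ w → up w (C (b 0))) (E.sym (NP.+-suc k (suc v) ∙ cong suc (NP.+-suc k v)))) ⟫ S.sym (up-up k (2 N.+ v) (C (b 0)))) (rep-up k v s) ⟫ S.sym (up-⊕ k (up (2 N.+ v) (C (b 0))) (rep v (shift b)))

  rep-X : ∀ w a → rep (2 N.+ w) (X ⊛ a) ≋ rep w a
  rep-X w a = S.+-cong (up-cong (2 N.+ w) (C-cong (X⊛-zero a) ⟫ C-0) ⟫ up-0 (2 N.+ w)) (rep-cong w (mk (X⊛-suc a))) ⟫ S.+-identityˡ _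

  rep-⊛ : ∀ w v {a b} → Supp w a → Supp v b → rep w a ⊛ rep v b ≋ rep (w N.+ v) (a ⊛ b)
  rep-⊛ zero v {a} {b} s t = S.trans (C⊛ (a 0) (rep v b)) (S.sym (rep-· v (a 0) b) ⟫ rep-cong v (constant s))
    where
    constant : ∀ {a b} → shift a ≋ 𝟎 → a 0 · b ≋ a ⊛ b
    constant e = mk λ { zero → refl ; (suc n) → sym (+ˡ (⊛-zeroˡ n (at e)) » +-identityʳ _) }
  rep-⊛ (suc zero) v {a} {b} s t = S.trans (up-⊛ 1 (C (a 0)) (rep v b)) (up-cong 1 (rep-⊛ zero v {a} {b} s t) ⟫ up-cong 1 (rep-cong v (S.sym (constant s))) ⟫ up-cong 1 (rep-· v (a 0) b) ⟫ up-· 1 (a 0) (rep v b) ⟫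
      mk (λ n → *ˡ (at (S.sym (rep-up 1 v t)) n)) ⟫ S.sym (rep-· (1 N.+ v) (a 0) b) ⟫ rep-cong (1 N.+ v) (constant s))
    where
    constant : ∀ {a b} → shift a ≋ 𝟎 → a 0 · b ≋ a ⊛ b
    constant e = mk λ { zero → refl ; (suc n) → sym (+ˡ (⊛-zeroˡ n (at e)) » +-identityʳ _) }
  rep-⊛ (suc (suc w)) v {a} {b} s t = S.distribʳ (rep v b) (up (2 N.+ w) (C (a 0))) (rep w (shift a)) ⟫ S.+-cong (up-⊛ (2 N.+ w) (C (a 0)) (rep v b) ⟫ up-cong (2 N.+ w) (C⊛ (a 0) (rep v b)) ⟫ up-· (2 N.+ w) (a 0) (rep v b) ⟫
        mk (λ n → *ˡ (at (S.sym (rep-up (2 N.+ w) v t)) n))) (rep-⊛ w v s t) ⟫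
    S.+ʳ (S.sym (rep-· (2 N.+ w N.+ v) (a 0) b)) ⟫
    S.+-assoc (up (2 N.+ (w N.+ v)) (C (a 0 * b 0))) (rep (w N.+ v) (a 0 · shift b)) (rep (w N.+ v) (shift a ⊛ b)) ⟫ S.+ˡ (S.sym (rep-⊕ (w N.+ v) (a 0 · shift b) (shift a ⊛ b)) ⟫ rep-cong (w N.+ v) (S.sym (shift-conv a b)))

  rep-high : ∀ w a n → rep w a (suc (w N.+ n)) ≈ 0#
  rep-high zero a n = refl
  rep-high (suc zero) a n = X⊛-suc (C (a 0)) (suc n) » refl
  rep-high (suc (suc w)) a n = +-zero (reflexive (cong (up (2 N.+ w) (C (a 0))) (E.sym (NP.+-suc (2 N.+ w) n))) » up-at (2 N.+ w) (C (a 0)) (suc n))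
    (reflexive (cong (rep w (shift a)) (cong suc (E.sym (NP.+-suc w (suc n) ∙ cong suc (NP.+-suc w n))))) » rep-high w (shift a) (suc (suc n)))

  up-low : ∀ k f n → n N.< k → up k f n ≈ 0#
  up-low (suc k) f zero h = X⊛-zero (up k f)
  up-low (suc k) f (suc n) (s≤s h) = X⊛-suc (up k f) n » up-low k f n h

  rep-at : ∀ w a g k → k N.+ (g N.+ g) ≡ w → rep w a k ≈ a g
  rep-at zero a zero zero e = refl
  rep-at (suc zero) a zero (suc zero) e = X⊛-suc (C (a 0)) 0
  rep-at (suc zero) a (suc g) zero e with E.trans (E.sym (NP.+-suc g g)) (NP.suc-injective e)
  ... | ()
  rep-at (suc zero) a (suc g) (suc k) e with E.trans (E.sym (NP.+-suc k (g N.+ suc g))) (NP.suc-injective e)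
  ... | ()
  rep-at (suc (suc w)) a zero k e with E.trans (E.sym (NP.+-identityʳ k)) e
  ... | E.refl = +-cong (reflexive (cong (up (2 N.+ w) (C (a 0))) (E.sym (NP.+-identityʳ (2 N.+ w)))) » up-at (2 N.+ w) (C (a 0)) 0) (reflexive (cong (λ n → rep w (shift a) (suc n)) (NP.+-comm 1 w)) » rep-high w (shift a) 1) » +-identityʳ _
  rep-at (suc (suc w)) a (suc g) k e = trans (+-cong (up-low (2 N.+ w) (C (a 0)) k k<) (rep-at w (shift a) g k e')) (+-identityˡ _)
    where
    e″ : suc (suc (k N.+ (g N.+ g))) ≡ suc (suc w)
    e″ = cong suc (E.sym (NP.+-suc k (g N.+ g))) ∙ E.sym (NP.+-suc k (suc (g N.+ g))) ∙ cong (λ i → k N.+ suc i) (E.sym (NP.+-suc g g)) ∙ e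
    e' : k N.+ (g N.+ g) ≡ w
    e' = NP.suc-injective (NP.suc-injective e″)
    k< : k N.< 2 N.+ w
    k< = s≤s (NP.≤-trans (NP.m≤m+n k (g N.+ g)) (NP.≤-trans (NP.≤-reflexive e') (NP.n≤1+n w)))

  Supp-at : ∀ w a g → Supp w a → w N.< g N.+ g → a g ≈ 0#
  Supp-at zero a (suc g) s h = at s g
  Supp-at (suc zero) a (suc g) s h = at s g
  Supp-at (suc (suc w)) a (suc g) s (s≤s h) = Supp-at w (shift a) g s (NP.≤-pred (NP.≤-trans h (NP.≤-reflexive (NP.+-suc g g))))

  Supp-⊕ : ∀ w {a b} → Supp w a → Supp w b → Supp w (a ⊕ b)
  Supp-⊕ zero s t = S.+-zero s t
  Supp-⊕ (suc zero) s t = S.+-zero s t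
  Supp-⊕ (suc (suc w)) s t = Supp-⊕ w s t

  Supp-· : ∀ w c {a} → Supp w a → Supp w (c · a)
  Supp-· zero c s = mk (λ n → *-zeroʳ (at s n))
  Supp-· (suc zero) c s = mk (λ n → *-zeroʳ (at s n))
  Supp-· (suc (suc w)) c s = Supp-· w c s

  Supp-cong : ∀ w {a b} → a ≋ b → Supp w a → Supp w b
  Supp-cong zero e s = S.sym (shift-cong e) ⟫ s
  Supp-cong (suc zero) e s = S.sym (shift-cong e) ⟫ s
  Supp-cong (suc (suc w)) e s = Supp-cong w (shift-cong e) s

  Supp-suc : ∀ w {a} → Supp w a → Supp (suc w) a
  Supp-suc zero s = s
  Supp-suc (suc zero) s = mk (λ n → at s (suc n))
  Supp-suc (suc (suc w)) s = Supp-suc w s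

  Supp-+ : ∀ k w {a} → Supp w a → Supp (k N.+ w) a
  Supp-+ zero w s = s
  Supp-+ (suc k) w s = Supp-suc (k N.+ w) (Supp-+ k w s)

  Supp-X : ∀ w {a} → Supp w a → Supp (2 N.+ w) (X ⊛ a)
  Supp-X w {a} s = Supp-cong w (S.sym (mk (X⊛-suc a))) s

  Supp-⊛ : ∀ w v {a b} → Supp w a → Supp v b → Supp (w N.+ v) (a ⊛ b)
  Supp-⊛ zero v {a} {b} s t = Supp-cong v (mk λ { zero → refl ; (suc n) → sym (+ˡ (⊛-zeroˡ n (at s)) » +-identityʳ _) }) (Supp-· v (a 0) t)
  Supp-⊛ (suc zero) v {a} {b} s t = Supp-suc v (Supp-⊛ zero v {a} {b} s t)
  Supp-⊛ (suc (suc w)) v {a} {b} s t = Supp-cong (w N.+ v) (S.sym (shift-conv a b)) (Supp-⊕ (w N.+ v) (Supp-· (w N.+ v) (a 0) (Supp-+ (2 N.+ w) v t)) (Supp-⊛ w v s t))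

  -- The weights k + w and n - k + v of paired factors always add up to n + (w + v), so the
  -- convolution is again homogeneous.
  rep-conv : ∀ n w v (F G F̂ Ĝ : ℕ → Ser) → (∀ k → k N.≤ n → Supp (k N.+ w) (F̂ k) × F k ≋ rep (k N.+ w) (F̂ k)) → (∀ k → k N.≤ n → Supp (k N.+ v) (Ĝ k) × G k ≋ rep (k N.+ v) (Ĝ k)) →
             Supp (n N.+ (w N.+ v)) ((F̂ SS.⊛ Ĝ) n) × (F SS.⊛ G) n ≋ rep (n N.+ (w N.+ v)) ((F̂ SS.⊛ Ĝ) n)
  rep-conv zero w v F G F̂ Ĝ p q = Supp-⊛ w v (proj₁ (p 0 z≤n)) (proj₁ (q 0 z≤n)) , S.*-cong (proj₂ (p 0 z≤n)) (proj₂ (q 0 z≤n)) ⟫ rep-⊛ w v (proj₁ (p 0 z≤n)) (proj₁ (q 0 z≤n))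
  rep-conv (suc n) w v F G F̂ Ĝ p q = Supp-⊕ W (subst (λ i → Supp i (F̂ 0 ⊛ Ĝ (suc n))) e₁ (Supp-⊛ w (suc n N.+ v) (proj₁ (p 0 z≤n)) (proj₁ q'))) (subst (λ i → Supp i ((F̂ ∘ suc SS.⊛ Ĝ) n)) e₂ (proj₁ ih))
    , S.trans (S.+-cong (S.*-cong (proj₂ (p 0 z≤n)) (proj₂ q') ⟫ rep-⊛ w (suc n N.+ v) (proj₁ (p 0 z≤n)) (proj₁ q') ⟫ S.reflexive (cong (λ i → rep i (F̂ 0 ⊛ Ĝ (suc n))) e₁))
        (proj₂ ih ⟫ S.reflexive (cong (λ i → rep i ((F̂ ∘ suc SS.⊛ Ĝ) n)) e₂))) (S.sym (rep-⊕ W _ _))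
    where
    W = suc n N.+ (w N.+ v)
    q' = q (suc n) NP.≤-refl
    e₁ : w N.+ (suc n N.+ v) ≡ W
    e₁ = E.sym (NP.+-assoc w (suc n) v) ∙ cong (N._+ v) (NP.+-comm w (suc n)) ∙ NP.+-assoc (suc n) w v
    e₂ : n N.+ (suc w N.+ v) ≡ W
    e₂ = NP.+-suc n (w N.+ v)
    ih = rep-conv n (suc w) v (F ∘ suc) G (F̂ ∘ suc) Ĝ (λ k h → subst (λ i → Supp i (F̂ (suc k)) × F (suc k) ≋ rep i (F̂ (suc k))) (E.sym (NP.+-suc k w)) (p (suc k) (s≤s h))) (λ k h → q k (NP.m≤n⇒m≤1+n h))

z-bound : ∀ {m} (σ : Fin m → Fin m) → Defs.z σ N.≤ m
z-bound {m} σ = NP.≤-trans (NP.≤-reflexive (length-filter id b)) (count-bound b)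
  where
  b : Fin m → Bool
  b x = all (λ k → toℕ x ≤ᵇ toℕ (Defs.iter σ k x)) (upTo m)

-- From fixed N to polynomials in N and to fixed genus

module GenusRecursion (K : CommutativeRing 0ℓ 0ℓ) (inv : ℕ → CommutativeRing.Carrier K) (inv-l : ∀ n → CommutativeRing._≈_ K (CommutativeRing._*_ K (Kit.ι K (suc n)) (inv n)) (CommutativeRing.1# K)) where

  open Kit K
  open Series K
  open Polynomials K
  open Doubling K
  private module SS = Series seriesRing
  open MapSeries K 0 using (V; full?)

  inv! : ℕ → Carrier
  inv! zero = 1#
  inv! (suc n) = inv n * inv! n

  weight : ∀ {m} → (Fin (suc m) → Fin (suc m)) → (Fin (suc m) → Fin (suc m)) → Carrier
  weight σ α = [ full? σ α ] * ([ inj? σ ×-dec inj? α ] * [ fpf? α ])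

  faces : ∀ {m} → (Fin m → Fin m) → (Fin m → Fin m) → ℕ
  faces σ α = Defs.z σ N.+ Defs.z (σ ∘ α)

  maps : ∀ k → Ser
  maps k j = ∑ (V (suc k)) (λ σ → ∑ (V (suc k)) (λ α → weight (lookup σ) (lookup α) * [ faces (lookup σ) (lookup α) N.≟ j ]))

  -- The polynomial in N whose value at every N ≥ 4 is the coefficient `G n`.
  p : ℕ → Ser
  p zero = up 2 (C 1#)
  p (suc n) = inv! (suc (dbl n)) · maps (suc (dbl n))

  private
    ι-^ : ∀ N s → ι (N N.^ suc s) ≈ ι N * ι (N N.^ s)
    ι-^ N s = ι-* N (N N.^ s)

    ev-δ : ∀ B s N → s N.< B → ev B (λ j → [ s N.≟ j ]) (ι N) ≈ ι (N N.^ s)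
    ev-δ (suc B) zero N h = +ˡ (*-zeroʳ (ev-0 B _ (ι N) (λ _ → refl))) » +-identityʳ _
    ev-δ (suc B) (suc s) N (s≤s h) = +-identityˡ _ » *ˡ (ev-δ B s N h) » sym (ι-^ N s)

    Poly-δ : ∀ B s → s N.< B → Poly B (λ j → [ s N.≟ j ])
    Poly-δ (suc B) zero h = Poly-0 B (λ _ → refl)
    Poly-δ (suc B) (suc s) (s≤s h) = Poly-δ B s h

    faces-bound : ∀ {m} (σ α : Fin m → Fin m) → faces σ α N.≤ m N.+ m
    faces-bound σ α = NP.+-mono-≤ (z-bound σ) (z-bound (σ ∘ α))

    Poly-∑ : ∀ B {A : Set} xs {F : A → Ser} → (∀ a → Poly B (F a)) → Poly B (λ k → ∑ xs (λ a → F a k))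
    Poly-∑ B [] q = Poly-0 B (λ _ → refl)
    Poly-∑ B (x ∷ xs) {F} q = Poly-+ B {F x} (q x) (Poly-∑ B xs q)

    Poly-maps : ∀ k B → suc k N.+ suc k N.< B → Poly B (maps k)
    Poly-maps k B h = Poly-∑ B (V (suc k)) (λ σ → Poly-∑ B (V (suc k)) (λ α → Poly-· B (weight (lookup σ) (lookup α)) (Poly-δ B (faces (lookup σ) (lookup α)) (NP.≤-<-trans (faces-bound (lookup σ) (lookup α)) h))))

    module _ (N : ℕ) where
      open CycleCount K N using (w-z)
      open MapSeries K N using (Conn)

      ev-maps : ∀ k B → suc k N.+ suc k N.< B → ev B (maps k) (ι N) ≈ Conn k
      ev-maps k B h = trans (ev-∑ B (V (suc k)) _ (ι N)) (∑-cong (V (suc k)) (λ σ → ev-∑ B (V (suc k)) _ (ι N) » ∑-cong (V (suc k)) (λ α → term (lookup σ) (lookup α))))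
        where
        term : ∀ σ α → ev B (λ j → weight {k} σ α * [ faces σ α N.≟ j ]) (ι N) ≈ [ full? σ α ] * MapSeries.ω K N (suc k) σ α
        term σ α = begin
          _ ≈⟨ ev-· B (weight σ α) _ (ι N) » *ˡ (ev-δ B (faces σ α) N (NP.≤-<-trans (faces-bound σ α) h)) ⟩
          _ ≈⟨ *ˡ (reflexive (cong ι (NP.^-distribˡ-+-* N (Defs.z σ) (Defs.z (σ ∘ α)))) » ι-* (N N.^ Defs.z σ) (N N.^ Defs.z (σ ∘ α))) ⟩
          _ ≈⟨ solve 4 (λ a b c x → a :* (b :* c) :* x := a :* (b :* (c :* x))) refl _ _ _ _ ⟩
          _ ≈⟨ *ˡ ([]-*-cong (inj? σ ×-dec inj? α) (λ { (i , j) → *ˡ (sym (*-cong (w-z σ i) (w-z (σ ∘ α) (Inj-∘ {f = σ} {g = α} i j)))) })) ⟩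
          _ ∎

    -- Two permutations of 2n points have at most 4n cycles in total; the added 2 makes room for p 0
    -- = N².
    bound : ℕ → ℕ
    bound n = suc (dbl n N.+ dbl n) N.+ 2

    module _ (N r : ℕ) (N≡ : N ≡ 4 N.+ r) where
      private module M = MapRecursion K inv inv-l N r N≡

      M-inv! : ∀ n → M.inv! n ≈ inv! n
      M-inv! zero = refl
      M-inv! (suc n) = *ˡ (M-inv! n)

      ev-X : ∀ B f → ev (suc B) (X ⊛ f) (ι N) ≈ ι N * ev B f (ι N)
      ev-X B f = +-cong (X⊛-zero f) (*ˡ (ev-cong B (ι N) (mk (X⊛-suc f)))) » +-identityˡ _

      ev-p : ∀ n B → bound n N.≤ B → ev B (p n) (ι N) ≈ M.G n
      ev-p zero (suc zero) (s≤s ())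
      ev-p zero (suc (suc zero)) (s≤s (s≤s ()))
      ev-p zero (suc (suc (suc B))) h = ev-X (suc (suc B)) (X ⊛ C 1#) » *ˡ (ev-X (suc B) (C 1#) » *ˡ (+ˡ (*-zeroʳ (ev-0 B _ (ι N) (λ _ → refl))) » +-identityʳ _) » *-identityʳ _) » sym M.G-0
      ev-p (suc n) B h = ev-· B (inv! (suc (dbl n))) (maps (suc (dbl n))) (ι N) » *-cong (sym (M-inv! (suc (dbl n)))) (ev-maps N (suc (dbl n)) B (NP.≤-trans (NP.m≤m+n _ 2) h)) » sym (M.G-suc n)

  u w : ℕ → Ser
  u n = ι (suc (dbl n)) · p n
  w n = ι (suc (suc (suc (dbl n)))) · ι (suc (suc (dbl n))) · u n

  private
    Poly-p : ∀ n B → bound n N.≤ B → Poly B (p n)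
    Poly-p zero (suc zero) (s≤s ())
    Poly-p zero (suc (suc zero)) (s≤s (s≤s ()))
    Poly-p zero (suc (suc (suc B))) h = Poly-0 B (λ k → X⊛-suc (X ⊛ C 1#) (suc (suc k)) » X⊛-suc (C 1#) (suc k))
    Poly-p (suc n) B h = Poly-· B (inv! (suc (dbl n))) (Poly-maps (suc (dbl n)) B (NP.≤-trans (NP.m≤m+n _ 2) h))

    dbl-mono : ∀ {m n} → m N.≤ n → dbl m N.≤ dbl n
    dbl-mono z≤n = z≤n
    dbl-mono (s≤s h) = s≤s (s≤s (dbl-mono h))

    bound-mono : ∀ {m n} → m N.≤ n → bound m N.≤ bound n
    bound-mono h = NP.+-monoˡ-≤ 2 (s≤s (NP.+-mono-≤ (dbl-mono h) (dbl-mono h)))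

    regular : ∀ n {x} → ι (suc n) * x ≈ 0# → x ≈ 0#
    regular n {x} e = begin
      _ ≈⟨ sym (*-identityˡ x) » *ʳ (sym (inv-l n)) ⟩
      _ ≈⟨ solve 3 (λ a b x → a :* b :* x := b :* (a :* x)) refl _ _ _ ⟩
      _ ≈⟨ *-zeroʳ e ⟩
      _ ∎

    -- Removes N ≥ 4: agreement at 4, 5, 6, ... leaves infinitely many roots for the difference.
    identical : ∀ B {f g} → Poly B f → Poly B g → (∀ i → ev B f (ι (i N.+ 4)) ≈ ev B g (ι (i N.+ 4))) → f ≋ g
    identical B {f} {g} a b e = S.≈-from-- (mk (many-roots regular B (f ⊕ ⊖ g) 4 (Poly-+ B {f} a (Poly-⊖ B b)) (λ i → ev-+ B f (⊖ g) (ι (i N.+ 4)) » +-cong (e i) (ev-⊖ B g (ι (i N.+ 4))) » -‿inverseʳ _)))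

    Poly-X : ∀ B {f} → Poly B f → Poly (suc B) (X ⊛ f)
    Poly-X B {f} q = Poly-cong B {f} {shift (X ⊛ f)} (S.sym (mk (X⊛-suc f))) q

    scale : ∀ B c f N G → ev B f N ≈ G → ev B (c · f) N ≈ c * G
    scale B c f N G e = ev-· B c f N » *ˡ e

  p-recursion₁ : ι 4 · p 1 ≋ ι 8 · (X ⊛ u 0)
  p-recursion₁ = identical B (Poly-· B (ι 4) {p 1} (Poly-p 1 B NP.≤-refl)) (Poly-· B (ι 8) {X ⊛ u 0} (Poly-X (N.pred B) {u 0} (Poly-· (N.pred B) (ι 1) {p 0} (Poly-p 0 (N.pred B) b₀)))) (λ i → go (i N.+ 4) i (NP.+-comm i 4))
    where
    B = bound 1
    b₀ : bound 0 N.≤ N.pred B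
    b₀ = s≤s (s≤s (s≤s z≤n))
    go : ∀ N r → N ≡ 4 N.+ r → ev B (ι 4 · p 1) (ι N) ≈ ev B (ι 8 · (X ⊛ u 0)) (ι N)
    go N r N≡ = trans (scale B (ι 4) (p 1) (ι N) _ (ev-p N r N≡ 1 B NP.≤-refl)) (M.G-recursion₁ » sym (scale B (ι 8) (X ⊛ u 0) (ι N) _ (ev-X N r N≡ (N.pred B) (u 0) » *ˡ (scale (N.pred B) (ι 1) (p 0) (ι N) _ (ev-p N r N≡ 0 (N.pred B) b₀)))))
      where
      module M = MapRecursion K inv inv-l N r N≡

  p-recursion : ∀ n → ι (dbl (3 N.+ n)) · p (2 N.+ n) ≋ w n ⊕ ι 6 · (u SS.⊛ u) n ⊕ ι 8 · (X ⊛ u (suc n))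
  p-recursion n = identical E (Poly-· E (ι (dbl (3 N.+ n))) {p (2 N.+ n)} (Poly-p (2 N.+ n) E ≤E))
      (Poly-+ E {w n ⊕ ι 6 · (u SS.⊛ u) n} {ι 8 · (X ⊛ u (suc n))} (Poly-+ E {w n} {ι 6 · (u SS.⊛ u) n} (Poly-· E _ {ι (2 N.+ dbl n) · u n} (Poly-· E _ {u n} (Poly-u n E (NP.≤-trans (b≤ n (NP.m≤n+m n 2)) ≤E))))
          (Poly-· E (ι 6) {(u SS.⊛ u) n} (Poly-conv B n u u (λ k h → Poly-u k B (bn k h)) (λ k h → Poly-u k B (bn k h)))))
        (Poly-· E (ι 8) {X ⊛ u (suc n)} (Poly-X (N.pred E) {u (suc n)} (Poly-u (suc n) (N.pred E) (NP.≤-trans (b≤ (suc n) (NP.n≤1+n _)) ≤E')))))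
      (λ i → go (i N.+ 4) i (NP.+-comm i 4))
    where
    B E : ℕ
    B = bound (2 N.+ n)
    E = B N.+ B
    ≤E : B N.≤ E
    ≤E = NP.m≤m+n B B
    ≤E' : B N.≤ N.pred E
    ≤E' = NP.m≤n+m B (N.pred B)
    b≤ : ∀ k → k N.≤ 2 N.+ n → bound k N.≤ B
    b≤ k = bound-mono
    bn : ∀ k → k N.≤ n → bound k N.≤ B
    bn k h = b≤ k (NP.≤-trans h (NP.m≤n+m n 2))
    Poly-u : ∀ k D → bound k N.≤ D → Poly D (u k)
    Poly-u k D h = Poly-· D (ι (suc (dbl k))) {p k} (Poly-p k D h)
    go : ∀ N r → N ≡ 4 N.+ r → ev E (ι (dbl (3 N.+ n)) · p (2 N.+ n)) (ι N) ≈ ev E (w n ⊕ ι 6 · (u SS.⊛ u) n ⊕ ι 8 · (X ⊛ u (suc n))) (ι N)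
    go N r N≡ = trans (scale E _ (p (2 N.+ n)) (ι N) _ (ev-p N r N≡ (2 N.+ n) E ≤E)) (M.G-recursion n » sym (ev-+ E (w n ⊕ ι 6 · (u SS.⊛ u) n) (ι 8 · (X ⊛ u (suc n))) (ι N) » +-cong (ev-+ E (w n) (ι 6 · (u SS.⊛ u) n) (ι N) » +-cong
            (scale E (ι (3 N.+ dbl n)) (ι (2 N.+ dbl n) · u n) (ι N) _ (scale E (ι (2 N.+ dbl n)) (u n) (ι N) _ (ev-u n E (NP.≤-trans (b≤ n (NP.m≤n+m n 2)) ≤E))))
            (scale E (ι 6) ((u SS.⊛ u) n) (ι N) _ (ev-conv B n u u (ι N) (λ k h → Poly-u k B (bn k h)) (λ k h → Poly-u k B (bn k h)) » ⊛-at≤ n (λ k h → ev-u k B (bn k h)) (λ k h → ev-u k B (bn k h)))))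
          (scale E (ι 8) (X ⊛ u (suc n)) (ι N) _ (ev-X N r N≡ (N.pred E) (u (suc n)) » *ˡ (ev-u (suc n) (N.pred E) (NP.≤-trans (b≤ (suc n) (NP.n≤1+n _)) ≤E'))))))
      where
      module M = MapRecursion K inv inv-l N r N≡
      ev-u : ∀ k D → bound k N.≤ D → ev D (u k) (ι N) ≈ M.u k
      ev-u k D h = scale D (ι (suc (dbl k))) (p k) (ι N) _ (ev-p N r N≡ k D h)
      ⊛-at≤ : ∀ n {f f' g g' : Ser} → (∀ k → k N.≤ n → f k ≈ f' k) → (∀ k → k N.≤ n → g k ≈ g' k) → (f ⊛ g) n ≈ (f' ⊛ g') n
      ⊛-at≤ zero a b = *-cong (a 0 z≤n) (b 0 z≤n)
      ⊛-at≤ (suc n) a b = +-cong (*-cong (a 0 z≤n) (b (suc n) NP.≤-refl)) (⊛-at≤ n (λ k h → a (suc k) (s≤s h)) (λ k h → b k (NP.m≤n⇒m≤1+n h)))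

  record Rep (w : ℕ) (f f̂ : Ser) : Set where
    constructor _▹_
    field
      support : Supp w f̂
      value : f ≋ rep w f̂
  open Rep

  private
    Rep-· : ∀ {w} c {f f̂} → Rep w f f̂ → Rep w (c · f) (c · f̂)
    Rep-· {w} c {f} {f̂} (s ▹ e) = Supp-· w c {f̂} s ▹ S.trans (mk (λ n → *ˡ (at e n))) (S.sym (rep-· w c f̂))

    Rep-⊕ : ∀ {w f g f̂ ĝ} → Rep w f f̂ → Rep w g ĝ → Rep w (f ⊕ g) (f̂ ⊕ ĝ)
    Rep-⊕ {w} {f} {g} {f̂} {ĝ} (s ▹ e) (s' ▹ e') = Supp-⊕ w {f̂} {ĝ} s s' ▹ S.trans (S.+-cong e e') (S.sym (rep-⊕ w f̂ ĝ))

    -- A handle more costs two powers of N, so delaying the genus series by one step raises the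
    -- weight by 2 and leaves the polynomial alone.
    Rep-X : ∀ {w f f̂} → Rep w f f̂ → Rep (2 N.+ w) f (X ⊛ f̂)
    Rep-X {w} {f} {f̂} (s ▹ e) = Supp-X w {f̂} s ▹ S.trans e (S.sym (rep-X w f̂))

    Rep-X⊛ : ∀ {w f f̂} → Rep w f f̂ → Rep (suc w) (X ⊛ f) f̂
    Rep-X⊛ {w} {f} {f̂} (s ▹ e) = Supp-suc w {f̂} s ▹ S.trans (S.*ˡ {X} e) (S.sym (rep-up 1 w {f̂} s))

    Rep-≋ : ∀ {w f g f̂} → f ≋ g → Rep w g f̂ → Rep w f f̂
    Rep-≋ e (s ▹ e') = s ▹ S.trans e e'

    Rep-≋̂ : ∀ {w f f̂ ĝ} → f̂ ≋ ĝ → Rep w f ĝ → Rep w f f̂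
    Rep-≋̂ {w} {f} {f̂} {ĝ} e (s ▹ e') = Supp-cong w {ĝ} {f̂} (S.sym e) s ▹ S.trans e' (rep-cong w (S.sym e))

    Rep-conv : ∀ n (F F̂ : ℕ → Ser) → (∀ k → k N.≤ n → Rep (k N.+ 2) (F k) (F̂ k)) → Rep (n N.+ 4) ((F SS.⊛ F) n) ((F̂ SS.⊛ F̂) n)
    Rep-conv n F F̂ h with rep-conv n 2 2 F F F̂ F̂ h' h'
      where
      h' : ∀ k → k N.≤ n → Supp (k N.+ 2) (F̂ k) × F k ≋ rep (k N.+ 2) (F̂ k)
      h' k q = support (h k q) , value (h k q)
    ... | s , e = s ▹ e

  -- p n = Σ_g ĉ_{n,g} X^{n+2-2g} by Euler's formula, so that the recursion for p yields one for ĉ.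
  module _ (ĉ : ℕ → Ser) (ĉ-0 : ĉ 0 ≋ 𝟏) (ĉ-euler : ∀ n g k → k N.+ (g N.+ g) ≡ suc n N.+ 2 → ĉ (suc n) g ≈ p (suc n) k) (ĉ-high : ∀ n g → suc n N.+ 2 N.< g N.+ g → ĉ (suc n) g ≈ 0#) where

    û ŵ : ℕ → Ser
    û n = ι (suc (dbl n)) · ĉ n
    ŵ n = ι (suc (suc (suc (dbl n)))) · ι (suc (suc (dbl n))) · û n

    private
      Good : ℕ → Set
      Good n = Rep (n N.+ 2) (p n) (ĉ n)

      good-0 : Good 0
      good-0 = Rep-≋̂ ĉ-0 (mk (λ _ → refl) ▹ S.sym (S.+ˡ C-0 ⟫ S.+-identityʳ _))

      -- Euler's formula reads the genus-g count off p at one power of N, and any genus expansion of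
      -- p is read off at the same power; beyond the support both vanish.
      settle : ∀ n a → Rep (suc n N.+ 2) (p (suc n)) a → ĉ (suc n) ≋ a
      settle n a (s ▹ e) = mk go
        where
        go : ∀ g → ĉ (suc n) g ≈ a g
        go g with (g N.+ g) N.≤? (suc n N.+ 2)
        ... | yes h = ĉ-euler n g (suc n N.+ 2 N.∸ (g N.+ g)) (NP.m∸n+n≡m h) » at e _ » rep-at _ a g (suc n N.+ 2 N.∸ (g N.+ g)) (NP.m∸n+n≡m h)
        ... | no ¬h = ĉ-high n g (NP.≰⇒> ¬h) » sym (Supp-at _ a g s (NP.≰⇒> ¬h))

      good : ∀ n a → Rep (suc n N.+ 2) (p (suc n)) a → Good (suc n)
      good n a r = Rep-≋̂ (settle n a r) r

      unscale : ∀ k {f g} → ι (suc k) · f ≋ g → f ≋ inv k · g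
      unscale k {f} {g} e = mk λ n → sym (*-identityˡ _) » *ʳ (sym (*-comm _ _ » inv-l k)) » *-assoc _ _ _ » *ˡ (at e n)

      rescale : ∀ k {f g} → f ≋ inv k · g → ι (suc k) · f ≋ g
      rescale k {f} {g} e = mk λ n → *ˡ (at e n) » sym (*-assoc _ _ _) » *ʳ (inv-l k) » *-identityˡ _

      a₁ : Ser
      a₁ = inv 3 · ι 8 · û 0

      rep₁ : Rep 3 (p 1) a₁
      rep₁ = Rep-≋ (unscale 3 p-recursion₁) (Rep-· (inv 3) (Rep-· (ι 8) (Rep-X⊛ (Rep-· (ι 1) good-0))))

      a : ℕ → Ser
      a n = inv (5 N.+ dbl n) · (X ⊛ ŵ n ⊕ ι 6 · (û SS.⊛ û) n ⊕ ι 8 · û (suc n))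

      rep-a : ∀ n → (∀ k → k N.≤ suc n → Good k) → Rep (suc (suc n) N.+ 2) (p (2 N.+ n)) (a n)
      rep-a n G = Rep-≋ (unscale (5 N.+ dbl n) (p-recursion n)) (Rep-· (inv (5 N.+ dbl n)) (Rep-⊕ (Rep-⊕ w-rep (Rep-· (ι 6) conv-rep)) (Rep-· (ι 8) (Rep-X⊛ (u-rep (suc n) NP.≤-refl)))))
        where
        u-rep : ∀ k → k N.≤ suc n → Rep (k N.+ 2) (u k) (û k)
        u-rep k h = Rep-· (ι (suc (dbl k))) (G k h)
        w-rep : Rep (suc (suc n) N.+ 2) (w n) (X ⊛ ŵ n)
        w-rep = Rep-X (Rep-· (ι (3 N.+ dbl n)) (Rep-· (ι (2 N.+ dbl n)) (u-rep n (NP.n≤1+n n))))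
        conv-rep : Rep (suc (suc n) N.+ 2) ((u SS.⊛ u) n) ((û SS.⊛ û) n)
        conv-rep = subst (λ i → Rep i ((u SS.⊛ u) n) ((û SS.⊛ û) n)) (NP.+-comm n 4 ∙ cong (2 N.+_) (NP.+-comm 2 n)) (Rep-conv n u û (λ k h → u-rep k (NP.m≤n⇒m≤1+n h)))

      -- Strong induction along the recursion, whose terms all have the same weight. This is where
      -- it is seen that only the powers N^(n+2-2g) with g ≥ 0 occur.
      goods : ∀ n → Good n
      goods = <-rec Good step
        where
        step : ∀ n → (∀ {k} → k N.< n → Good k) → Good n
        step zero _ = good-0
        step (suc zero) _ = good 0 a₁ rep₁
        step (suc (suc n)) ih = good (suc n) (a n) (rep-a n (λ k h → ih (s≤s h)))

    genus-recursion₁ : ι 4 · ĉ 1 ≋ ι 8 · û 0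
    genus-recursion₁ = rescale 3 (settle 0 a₁ rep₁)

    genus-recursion : ∀ n → ι (dbl (3 N.+ n)) · ĉ (2 N.+ n) ≋ X ⊛ ŵ n ⊕ ι 6 · (û SS.⊛ û) n ⊕ ι 8 · û (suc n)
    genus-recursion n = rescale (5 N.+ dbl n) (settle (suc n) (a n) (rep-a n (λ k _ → goods k)))

    private
      Supp-conv : ∀ n (F : ℕ → Ser) → (∀ k → k N.≤ n → Supp k (F k)) → Supp n ((F SS.⊛ F) n)
      Supp-conv n F h = subst (λ i → Supp i ((F SS.⊛ F) n)) (NP.+-identityʳ n) (proj₁ (rep-conv n 0 0 F' F' F F h' h'))
        where
        F' : ℕ → Ser
        F' k = rep (k N.+ 0) (F k)
        h' : ∀ k → k N.≤ n → Supp (k N.+ 0) (F k) × F' k ≋ rep (k N.+ 0) (F k)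
        h' k q = subst (λ i → Supp i (F k)) (E.sym (NP.+-identityʳ k)) (h k q) , S.refl

    -- The sharper bound 2g ≤ n, by induction: the genus rises by one only in the term that goes
    -- back two edges.
    ĉ-support : ∀ n → Supp n (ĉ n)
    ĉ-support = <-rec (λ n → Supp n (ĉ n)) step
      where
      step : ∀ n → (∀ {k} → k N.< n → Supp k (ĉ k)) → Supp n (ĉ n)
      step zero _ = Supp-cong 0 {𝟏} {ĉ 0} (S.sym ĉ-0) (mk (λ _ → refl))
      step (suc zero) ih = Supp-cong 1 {a₁} {ĉ 1} (S.sym (unscale 3 genus-recursion₁)) (Supp-· 1 (inv 3) {ι 8 · û 0} (Supp-· 1 (ι 8) {û 0} (Supp-suc 0 {û 0} (Supp-· 0 (ι 1) {ĉ 0} (ih (s≤s z≤n))))))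
      step (suc (suc n)) ih = Supp-cong (2 N.+ n) {a n} {ĉ (2 N.+ n)} (S.sym (unscale (5 N.+ dbl n) (genus-recursion n)))
          (Supp-· (2 N.+ n) (inv (5 N.+ dbl n)) {X ⊛ ŵ n ⊕ ι 6 · (û SS.⊛ û) n ⊕ ι 8 · û (suc n)} (Supp-⊕ (2 N.+ n) {X ⊛ ŵ n ⊕ ι 6 · (û SS.⊛ û) n} {ι 8 · û (suc n)}
            (Supp-⊕ (2 N.+ n) {X ⊛ ŵ n} {ι 6 · (û SS.⊛ û) n} (Supp-X n {ŵ n} (Supp-· n (ι (3 N.+ dbl n)) {ι (2 N.+ dbl n) · û n} (Supp-· n (ι (2 N.+ dbl n)) {û n} (û-support n (NP.n≤1+n n)))))
              (Supp-· (2 N.+ n) (ι 6) {(û SS.⊛ û) n} (Supp-+ 2 n {(û SS.⊛ û) n} (Supp-conv n û (λ k h → û-support k (NP.m≤n⇒m≤1+n h))))))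
            (Supp-· (2 N.+ n) (ι 8) {û (suc n)} (Supp-suc (suc n) {û (suc n)} (û-support (suc n) NP.≤-refl)))))
        where
        û-support : ∀ k → k N.≤ suc n → Supp k (û k)
        û-support k h = Supp-· k (ι (suc (dbl k))) {ĉ k} (ih (s≤s h))

    ĉ-vanish : ∀ n g → n N.< g N.+ g → ĉ n g ≈ 0#
    ĉ-vanish n g = Supp-at n (ĉ n) g (ĉ-support n)

    dbl≡ : ∀ n → dbl n ≡ n N.+ n
    dbl≡ zero = E.refl
    dbl≡ (suc n) = cong suc (cong suc (dbl≡ n) ∙ E.sym (NP.+-suc n n))

    -- At two edges per handle the support kills the quadratic and the linear term, and what is left
    -- is a two-term recursion with factor (2m+3)(2m+2)(2m+1), where m = 2k.
    leading : ∀ k → ι (suc (dbl k)) * ĉ (dbl k) k ≈ ι (oddfact (dbl k))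
    leading zero = *-identityˡ _ » at ĉ-0 0
    leading (suc k) = begin
      _ ≈⟨ sym (*-identityˡ _) » *ʳ (sym (*-comm _ _ » inv-l 1)) » *-assoc _ _ _ ⟩
      _ ≈⟨ *ˡ (sym (*-assoc _ _ _) » *ʳ (sym (ι-dbl (3 N.+ m))) » at (genus-recursion m) (suc k)) ⟩
      _ ≈⟨ *ˡ (+-cong (+-cong (X⊛-suc (ŵ m) k) (*-zeroʳ (Supp-at m ((û SS.⊛ û) m) (suc k) (Supp-conv m û (λ j _ → Supp-· j (ι (suc (dbl j))) {ĉ j} (ĉ-support j)))
             (NP.≤-trans m< (NP.n≤1+n _)))) » +-identityʳ _) (*-zeroʳ (*-zeroʳ (ĉ-vanish (suc m) (suc k) (s≤s m<)))) » +-identityʳ _) ⟩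
      _ ≈⟨ *ˡ (*ˡ (*ʳ (ι-dbl (suc m)))) ⟩
      _ ≈⟨ solve 6 (λ i a t b c l → i :* (a :* (t :* b :* (c :* l))) := t :* i :* (a :* (c :* (b :* l)))) refl _ _ _ _ _ _ ⟩
      _ ≈⟨ *-cong (inv-l 1) (*ˡ (*ˡ (leading k))) » *-identityˡ _ ⟩
      _ ≈⟨ ι-* (3 N.+ dbl m) (suc (dbl m) N.* oddfact m) » *ˡ (ι-* (suc (dbl m)) (oddfact m)) ⟨
      _ ∎
      where
      m = dbl k
      m< : m N.< k N.+ suc k
      m< = NP.≤-reflexive (cong suc (dbl≡ k) ∙ E.sym (NP.+-suc k k))

-- The map numbers over the rationals

module Counting where

  ℚring : CommutativeRing 0ℓ 0ℓ
  ℚring = ℚₚ.+-*-commutativeRing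

  open Kit ℚring

  /-homo : ∀ a b → toℚᵘ (a / suc b) ℚᵘ.≃ mkℚᵘ a b
  /-homo a b = ℚₚ.toℚᵘ-fromℚᵘ (mkℚᵘ a b)

  /1-+ : ∀ a b → (a ℤ.+ b) / 1 ≡ a / 1 + b / 1
  /1-+ a b = ℚₚ.toℚᵘ-injective (ℚᵘₚ.≃-trans (/-homo (a ℤ.+ b) 0) (ℚᵘₚ.≃-sym (ℚᵘₚ.≃-trans (ℚₚ.toℚᵘ-homo-+ (a / 1) (b / 1))
    (ℚᵘₚ.≃-trans (ℚᵘₚ.+-cong (/-homo a 0) (/-homo b 0)) (*≡* (cong (ℤ._* + 1) (cong₂ ℤ._+_ (ℤₚ.*-identityʳ a) (ℤₚ.*-identityʳ b))))))))

  ι≡/ : ∀ n → ι n ≡ + n / 1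
  ι≡/ zero = E.refl
  ι≡/ (suc zero) = E.refl
  ι≡/ (suc (suc n)) = cong (λ x → 1ℚ + x) (ι≡/ (suc n)) ∙ E.sym (/1-+ (+ 1) (+ suc n))

  ι*/ : ∀ a b → ι (suc b) * (+ a / suc b) ≡ ι a
  ι*/ a b = cong (_* (+ a / suc b)) (ι≡/ (suc b)) ∙ ℚₚ.toℚᵘ-injective (ℚᵘₚ.≃-trans (ℚₚ.toℚᵘ-homo-* (+ suc b / 1) (+ a / suc b))
    (ℚᵘₚ.≃-trans (ℚᵘₚ.*-cong (/-homo (+ suc b) 0) (/-homo (+ a) b)) (ℚᵘₚ.≃-trans (*≡* (ℤₚ.*-identityʳ _ ∙ ℤₚ.*-comm (+ suc b) (+ a) ∙ cong (λ k → + a ℤ.* + k) (E.sym (NP.+-identityʳ (suc b))))) (ℚᵘₚ.≃-sym (/-homo (+ a) 0))))) ∙ E.sym (ι≡/ a)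

  inv : ℕ → ℚ
  inv n = + 1 / suc n

  inv-l : ∀ n → ι (suc n) * inv n ≡ 1#
  inv-l = ι*/ 1

  open GenusRecursion ℚring inv inv-l
  open MapSeries ℚring 0 using (V; full?)

  inv!-l : ∀ n → ι (n !) * inv! n ≡ 1#
  inv!-l zero = *-identityˡ 1#
  inv!-l (suc n) = *ʳ (ι-* (suc n) (n !)) » solve 4 (λ s f i j → s :* f :* (i :* j) := s :* i :* (f :* j)) refl (ι (suc n)) (ι (n !)) (inv n) (inv! n) » *-cong (inv-l n) (inv!-l n) » *-identityˡ _

  quotient-! : ∀ a n → (+ a / (n !)) {{n NP.!≢0}} ≡ inv! n * ι a
  quotient-! a n = go (n !) {{n NP.!≢0}} (inv!-l n)
    where
    go : ∀ d .{{_ : N.NonZero d}} → ι d * inv! n ≡ 1# → + a / d ≡ inv! n * ι a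
    go (suc b) e = sym (*-identityˡ _) » *ʳ (sym e) » solve 3 (λ d i q → d :* i :* q := i :* (d :* q)) refl (ι (suc b)) (inv! n) (+ a / suc b) » *ˡ {inv! n} (ι*/ a b)

  private
    Pr : ℕ → Set
    Pr m = Defs.Fn m × Defs.Fn m

    pairs : ∀ m → List (Pr m)
    pairs m = List.cartesianProduct (Defs.perms m) (filterᵇ Defs.isFPFInvolution (Defs.perms m))

    ∑-perms : ∀ m (f : Defs.Fn m → ℚ) → ∑ (Defs.perms m) f ≡ ∑ (V m) (λ σ → [ T? (Defs.isPerm (lookup σ)) ] * f (lookup σ))
    ∑-perms m f = CycleCount.∑-filterᵇ ℚring 0 Defs.isPerm (List.map lookup (Defs.allVecs m m)) » ∑-map lookup (Defs.allVecs m m) » reflexive (cong (λ vs → ∑ vs (λ σ → [ T? (Defs.isPerm (lookup σ)) ] * f (lookup σ))) (allVecs≡vecs m m))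

    ι-length : ∀ {A : Set} (xs : List A) → ι (length xs) ≡ ∑ xs (λ _ → 1#)
    ι-length xs = sym (∑-const xs 1# » *-identityʳ _)

    ι-count : ∀ m (q : Pr m → Bool) → ι (length (filterᵇ q (pairs m))) ≡
      ∑ (V m) (λ σ → [ T? (Defs.isPerm (lookup σ)) ] * ∑ (V m) (λ α → [ T? (Defs.isPerm (lookup α)) ] * ([ T? (Defs.isFPFInvolution (lookup α)) ] * ([ T? (q (lookup σ , lookup α)) ] * 1#))))
    ι-count m q = begin
      _ ≈⟨ ι-length (filterᵇ q (pairs m)) » CycleCount.∑-filterᵇ ℚring 0 q (pairs m) ⟩
      _ ≈⟨ ∑-product (Defs.perms m) (filterᵇ Defs.isFPFInvolution (Defs.perms m)) ⟩
      _ ≈⟨ ∑-cong (Defs.perms m) (λ σ → CycleCount.∑-filterᵇ ℚring 0 Defs.isFPFInvolution (Defs.perms m) »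
             ∑-perms m (λ α → [ T? (Defs.isFPFInvolution α) ] * ([ T? (q (σ , α)) ] * 1#))) ⟩
      _ ≈⟨ ∑-perms m _ ⟩
      _ ∎

    term : ∀ k (σ α : Defs.Fn (suc k)) {P Q : Set} (P? : Dec P) (Q? : Dec Q) → (T (Defs.transitive σ α) × Q → P) → (Inj σ → Inj α → P → T (Defs.transitive σ α) × Q) →
           [ T? (Defs.isPerm σ) ] * ([ T? (Defs.isPerm α) ] * ([ T? (Defs.isFPFInvolution α) ] * ([ P? ] * 1#))) ≡ weight σ α * [ Q? ]
    term k σ α P? Q? f g = *-cong ([]-⇔ (T? (Defs.isPerm σ)) (inj? σ) (isPerm⇒Inj σ) (Inj⇒isPerm σ)) (*-cong ([]-⇔ (T? (Defs.isPerm α)) (inj? α) (isPerm⇒Inj α) (Inj⇒isPerm α))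
            (*-cong ([]-⇔ (T? (Defs.isFPFInvolution α)) (fpf? α) (isFPF⇒ α) (⇒isFPF α)) (*-identityʳ [ P? ]))) »
          (solve 4 (λ a b c x → a :* (b :* (c :* x)) := a :* b :* c :* x) refl [ inj? σ ] [ inj? α ] [ fpf? α ] [ P? ]) »
      *ʳ {[ P? ]} (*ʳ (sym ([]-× (inj? σ) (inj? α)))) »
      (*-assoc [ inj? σ ×-dec inj? α ] [ fpf? α ] [ P? ]) » []-*-cong (inj? σ ×-dec inj? α) (λ { (i , j) → *ˡ {[ fpf? α ]} (
          ([]-⇔ P? (full? σ α ×-dec Q?) (λ p → let (t , q) = g i j p in transitive⇒ σ α t , q) (λ { (h , q) → f (⇒transitive σ α i j h , q) })) » ([]-× (full? σ α) Q?)) }) »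
        refl »
        (solve 4 (λ i a h q → i :* (a :* (h :* q)) := h :* (i :* a) :* q) refl [ inj? σ ×-dec inj? α ] [ fpf? α ] [ full? σ α ] [ Q? ])

    ι-maps : ∀ k (q : Pr (suc k) → Bool) {Q : ∀ σ α → Set} (Q? : ∀ σ α → Dec (Q σ α)) → (∀ σ α → T (q (σ , α)) → T (Defs.transitive σ α) × Q σ α) → (∀ σ α → T (Defs.transitive σ α) × Q σ α → T (q (σ , α))) →
             ι (length (filterᵇ q (pairs (suc k)))) ≡ ∑ (V (suc k)) (λ σ → ∑ (V (suc k)) (λ α → weight (lookup σ) (lookup α) * [ Q? (lookup σ) (lookup α) ]))
    ι-maps k q Q? f g = ι-count (suc k) q » ∑-cong (V (suc k)) (λ σ → sym (∑-*ˡ (V (suc k)) [ T? (Defs.isPerm (lookup σ)) ]) » ∑-cong (V (suc k)) (λ α →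
      term k (lookup σ) (lookup α) (T? (q (lookup σ , lookup α))) (Q? (lookup σ) (lookup α)) (g (lookup σ) (lookup α)) (λ _ _ → f (lookup σ) (lookup α))))

    mapsOf : ∀ g n k → ℚ
    mapsOf g n k = ∑ (V (suc k)) (λ σ → ∑ (V (suc k)) (λ α → weight (lookup σ) (lookup α) * [ faces (lookup σ) (lookup α) N.+ 2 N.* g N.≟ suc n N.+ 2 ]))

    -- The size is written as the predecessor of what 2 * suc n computes to; `resize` brings it into
    -- the doubled form afterwards.
    mapCount≡ : ∀ g n → ι (Defs.mapCount g (suc n)) ≡ mapsOf g n (n N.+ suc (n N.+ 0))
    mapCount≡ g n = ι-maps (n N.+ suc (n N.+ 0)) _ (λ σ α → faces σ α N.+ 2 N.* g N.≟ suc n N.+ 2) (λ σ α t → proj₁ (T∧⇒ t) , NP.≡ᵇ⇒≡ _ _ (proj₂ (T∧⇒ {Defs.transitive σ α} t))) (λ { σ α (t , e) → ⇒T∧ t (NP.≡⇒≡ᵇ _ _ e) })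

    half : ∀ n → 2 N.* n ≡ dbl n
    half zero = E.refl
    half (suc n) = cong suc (NP.+-suc n (n N.+ 0) ∙ cong suc (half n))

  ĉ : ℕ → ℕ → ℚ
  ĉ n g = Defs.c̃ g n

  private
    resize : ∀ g n {k l} → suc k ≡ suc l → mapsOf g n k ≡ mapsOf g n l
    resize g n E.refl = E.refl

    ĉ-suc : ∀ n g → ĉ (suc n) g ≡ inv! (suc (dbl n)) * mapsOf g n (suc (dbl n))
    ĉ-suc n g = trans (unfold g) (quotient-! (Defs.mapCount g (suc n)) (suc (2 N.* n)) » *-cong (reflexive (cong (inv! ∘ suc) (half n))) (mapCount≡ g n » resize g n (half (suc n))))
      where
      unfold : ∀ g → ĉ (suc n) g ≡ (+ Defs.mapCount g (suc n) / (suc (2 N.* n)) !) {{suc (2 N.* n) NP.!≢0}}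
      unfold zero = E.refl
      unfold (suc g) = E.refl

    twice : ∀ g → 2 N.* g ≡ g N.+ g
    twice g = cong (g N.+_) (NP.+-identityʳ g)

    ĉ-0 : Series._≋_ ℚring (ĉ 0) (Series.𝟏 ℚring)
    ĉ-0 = Series.mk λ { zero → E.refl ; (suc g) → E.refl }

    ĉ-euler : ∀ n g k → k N.+ (g N.+ g) ≡ suc n N.+ 2 → ĉ (suc n) g ≡ p (suc n) k
    ĉ-euler n g k e = trans (ĉ-suc n g) (*ˡ {inv! (suc (dbl n))} (∑-cong (V m) (λ σ → ∑-cong (V m) (λ α → *ˡ {weight (lookup σ) (lookup α)} (same (faces (lookup σ) (lookup α)))))))
      where
      m = suc (suc (dbl n))
      same : ∀ f → [ f N.+ 2 N.* g N.≟ suc n N.+ 2 ] ≡ [ f N.≟ k ]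
      same f = []-⇔ (f N.+ 2 N.* g N.≟ suc n N.+ 2) (f N.≟ k) (λ h → NP.+-cancelʳ-≡ (g N.+ g) f k (cong (f N.+_) (E.sym (twice g)) ∙ h ∙ E.sym e)) (λ { E.refl → cong (f N.+_) (twice g) ∙ e })

    ĉ-high : ∀ n g → suc n N.+ 2 N.< g N.+ g → ĉ (suc n) g ≡ 0#
    ĉ-high n g h = trans (ĉ-suc n g) (*-zeroʳ {inv! (suc (dbl n))} (∑-0 (V m) (λ σ → ∑-0 (V m) (λ α → *-zeroʳ {weight (lookup σ) (lookup α)} ([]-no (faces (lookup σ) (lookup α) N.+ 2 N.* g N.≟ suc n N.+ 2) (λ e → NP.<-irrefl (E.sym e)
          (NP.<-≤-trans h (NP.≤-trans (NP.≤-reflexive (E.sym (twice g))) (NP.m≤n+m (2 N.* g) (faces (lookup σ) (lookup α)))))))))))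
      where
      m = suc (suc (dbl n))

  open Series ℚring

  Û Ŵ : ℕ → Ser
  Û n = ι (suc (dbl n)) · ĉ n
  Ŵ n = ι (suc (suc (suc (dbl n)))) · ι (suc (suc (dbl n))) · Û n

  count-0 : ĉ 0 ≋ 𝟏
  count-0 = ĉ-0

  count-recursion₁ : ι 4 · ĉ 1 ≋ ι 8 · Û 0
  count-recursion₁ = genus-recursion₁ ĉ ĉ-0 ĉ-euler ĉ-high

  count-recursion : ∀ n → ι (dbl (3 N.+ n)) · ĉ (2 N.+ n) ≋ X ⊛ Ŵ n ⊕ ι 6 · Series._⊛_ seriesRing Û Û n ⊕ ι 8 · Û (suc n)
  count-recursion = genus-recursion ĉ ĉ-0 ĉ-euler ĉ-high

  count-vanish : ∀ n g → n N.< g N.+ g → ĉ n g ≡ 0#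
  count-vanish = ĉ-vanish ĉ ĉ-0 ĉ-euler ĉ-high

  count-leading : ∀ k → ι (suc (dbl k)) * ĉ (dbl k) k ≡ ι (oddfact (dbl k))
  count-leading = leading ĉ ĉ-0 ĉ-euler ĉ-high

-- The substitution s = t(1-3t)

module Substitution (K : CommutativeRing 0ℓ 0ℓ) where

  open Kit K
  open Series K

  s : Ser
  s = X ⊛ (𝟏 ⊕ ⊖ (S.ι 3 ⊛ X))

  -- multiplication by s = X(1 - 3X), in a form that makes sub structurally recursive
  s* : Ser → Ser
  s* f zero = 0#
  s* f (suc zero) = f 0
  s* f (suc (suc n)) = f (suc n) - ι 3 * f n

  -- sub f = f(X(1 - 3X))
  sub : Ser → Ser
  sub f zero = f 0
  sub f (suc zero) = sub (shift f) 0
  sub f (suc (suc n)) = sub (shift f) (suc n) - ι 3 * sub (shift f) n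

  s*-⊛ : ∀ f → s* f ≋ s ⊛ f
  s*-⊛ f = S.trans (mk go) (S.solve 2 (λ x f → x S.:* (f S.:- S.:3 S.:* (x S.:* f)) S.:= x S.:* (S.:1 S.:- S.:3 S.:* x) S.:* f) S.refl X f)
    where
    tail = f ⊕ ⊖ (S.ι 3 ⊛ (X ⊛ f))
    inner : ∀ n {y} → (X ⊛ f) n ≈ y → tail n ≈ f n - ι 3 * y
    inner n e = +ˡ (-‿cong (at (ιs⊛ 3 (X ⊛ f)) n » *ˡ e))
    go : ∀ n → s* f n ≈ (X ⊛ tail) n
    go zero = sym (X⊛-zero tail)
    go (suc zero) = sym (X⊛-suc tail 0 » inner 0 (X⊛-zero f) » +ˡ (-‿cong (zeroʳ _) » -0#≈0#) » +-identityʳ _)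
    go (suc (suc n)) = sym (X⊛-suc tail (suc n) » inner (suc n) (X⊛-suc f n))

  sub-horner : ∀ f → sub f ≋ C (f 0) ⊕ s ⊛ sub (shift f)
  sub-horner f = S.trans (mk go) (S.+ˡ {C (f 0)} (s*-⊛ (sub (shift f))))
    where
    go : ∀ n → sub f n ≈ C (f 0) n + s* (sub (shift f)) n
    go zero = sym (+-identityʳ _)
    go (suc zero) = sym (+-identityˡ _)
    go (suc (suc n)) = sym (+-identityˡ _)

  -- Each use of the hypothesis gains a factor s, which has no constant term. `sub-⊛` and `sub-d`
  -- apply this to the difference of their two sides, where a Horner step yields the factor.
  vanish : (Δ : Ser → Ser) → (∀ f → Δ f ≋ s ⊛ Δ (shift f)) → ∀ f → Δ f ≋ 𝟎
  vanish Δ step f = mk (go f)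
    where
    step' : ∀ f → Δ f ≋ s* (Δ (shift f))
    step' f = step f ⟫ S.sym (s*-⊛ (Δ (shift f)))
    go : ∀ f n → Δ f n ≈ 0#
    go f zero = at (step' f) 0
    go f (suc zero) = at (step' f) 1 » go (shift f) 0
    go f (suc (suc n)) = at (step' f) (suc (suc n)) » +-zero (go (shift f) (suc n)) (-‿cong (*-zeroʳ (go (shift f) n)) » -0#≈0#)

  sub-cong : ∀ {f g} → f ≋ g → sub f ≋ sub g
  sub-cong e = mk (λ n → go n e)
    where
    go : ∀ n {f g} → f ≋ g → sub f n ≈ sub g n
    tail : ∀ {f g} → f ≋ g → shift f ≋ shift g
    tail e = mk (λ n → at e (suc n))
    go zero e = at e 0
    go (suc zero) e = go 0 (tail e)
    go (suc (suc n)) e = +-cong (go (suc n) (tail e)) (-‿cong (*ˡ (go n (tail e))))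

  sub-⊕ : ∀ f g → sub (f ⊕ g) ≋ sub f ⊕ sub g
  sub-⊕ f g = mk (λ n → go n f g)
    where
    go : ∀ n f g → sub (f ⊕ g) n ≈ sub f n + sub g n
    go zero f g = refl
    go (suc zero) f g = refl
    go (suc (suc n)) f g = +-cong (go (suc n) (shift f) (shift g)) (-‿cong (*ˡ (go n (shift f) (shift g)))) » solve 5 (λ a b t u v → a :+ b :- t :* (u :+ v) := a :- t :* u :+ (b :- t :* v)) refl _ _ _ _ _

  sub-· : ∀ c f → sub (c · f) ≋ c · sub f
  sub-· c f = mk (λ n → go n f)
    where
    go : ∀ n f → sub (c · f) n ≈ c * sub f n
    go zero f = refl
    go (suc zero) f = refl
    go (suc (suc n)) f = +-cong (go (suc n) (shift f)) (-‿cong (*ˡ (go n (shift f)))) » solve 4 (λ c a t u → c :* a :- t :* (c :* u) := c :* (a :- t :* u)) refl _ _ _ _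

  sub-𝟎 : sub 𝟎 ≋ 𝟎
  sub-𝟎 = sub-cong {𝟎} {0# · 𝟎} (mk (λ n → sym (zeroˡ _))) ⟫ sub-· 0# 𝟎 ⟫ mk (λ n → zeroˡ _)

  sub-C : ∀ c → sub (C c) ≋ C c
  sub-C c = sub-horner (C c) ⟫ S.+ˡ (S.*-zeroʳ {s} sub-𝟎) ⟫ S.+-identityʳ (C c)

  sub-⊛ : ∀ f g → sub (f ⊛ g) ≋ sub f ⊛ sub g
  sub-⊛ f g = S.≈-from-- (vanish (λ f → sub (f ⊛ g) ⊕ ⊖ (sub f ⊛ sub g)) step f)
    where
    step : ∀ f → sub (f ⊛ g) ⊕ ⊖ (sub f ⊛ sub g) ≋ s ⊛ (sub (shift f ⊛ g) ⊕ ⊖ (sub (shift f) ⊛ sub g))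
    step f = S.trans (S.+-cong (sub-horner (f ⊛ g) ⟫ S.+-cong product (S.*ˡ {s} (sub-⊕ (f 0 · shift g) (shift f ⊛ g) ⟫ S.+ʳ (sub-· (f 0) (shift g) ⟫ S.sym (C⊛ (f 0) (sub (shift g))))))) (S.-‿cong (S.*ʳ {sub g} (sub-horner f))))
      (S.+ˡ (S.-‿cong (S.*ˡ {C (f 0) ⊕ s ⊛ sub (shift f)} (sub-horner g))) ⟫
      S.solve 6 (λ x y s p r t → (x S.:* y S.:+ s S.:* (x S.:* r S.:+ p)) S.:- (x S.:+ s S.:* t) S.:* (y S.:+ s S.:* r) S.:= s S.:* (p S.:- t S.:* (y S.:+ s S.:* r))) S.refl (C (f 0)) (C (g 0)) s (sub (shift f ⊛ g)) (sub (shift g)) (sub (shift f)) ⟫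
        S.*ˡ {s} (S.+ˡ (S.-‿cong (S.*ˡ {sub (shift f)} (S.sym (sub-horner g))))))
      where
      product : C (f 0 * g 0) ≋ C (f 0) ⊛ C (g 0)
      product = S.sym (C⊛ (f 0) (C (g 0)) ⟫ (mk λ { zero → refl ; (suc n) → zeroʳ _ }))

  private
    shift-X : shift X ≋ C 1#
    shift-X = mk λ { zero → refl ; (suc n) → refl }

    C1 : C 1# ≋ 𝟏
    C1 = mk λ { zero → refl ; (suc n) → refl }

  sub-X : sub X ≋ s
  sub-X = S.trans (sub-horner X) (S.+-cong C0 (S.*ˡ {s} (sub-cong shift-X ⟫ sub-C 1# ⟫ C1)) ⟫ S.+-identityˡ _ ⟫ S.*-identityʳ s)
    where
    C0 : C 0# ≋ 𝟎
    C0 = mk λ { zero → refl ; (suc n) → refl }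

  d-s : d s ≋ 𝟏 ⊕ ⊖ (S.ι 6 ⊛ X)
  d-s = S.trans (d-cong {s} {X ⊕ ⊖ (S.ι 3 ⊛ (X ⊛ X))} (S.solve 1 (λ x → x S.:* (S.:1 S.:- S.:3 S.:* x) S.:= x S.:- S.:3 S.:* (x S.:* x)) S.refl X)) (mk go)
    where
    go : ∀ n → d (X ⊕ ⊖ (S.ι 3 ⊛ (X ⊛ X))) n ≈ (𝟏 ⊕ ⊖ (S.ι 6 ⊛ X)) n
    XX : ∀ n → (X ⊛ X) (suc n) ≈ X n
    XX n = X⊛-suc X n
    inner : ∀ n → (S.ι 3 ⊛ (X ⊛ X)) (suc n) ≈ ι 3 * X n
    inner n = at (ιs⊛ 3 (X ⊛ X)) (suc n) » *ˡ (XX n)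
    go zero = trans (*ˡ (+ˡ (-‿cong (inner 0)))) (solve 0 (:1 :* (:1 :- :3 :* con (+ 0)) := :1 :- con (+ 6) :* con (+ 0)) refl » +ˡ (-‿cong (sym (at (ιs⊛ 6 X) 0))))
      where open import Data.Integer using (+_)
    go (suc zero) = trans (*ˡ (+ˡ (-‿cong (inner 1)))) (solve 0 (:2 :* (con (+ 0) :- :3 :* :1) := con (+ 0) :- con (+ 6) :* :1) refl » +ˡ (-‿cong (sym (at (ιs⊛ 6 X) 1))))
      where open import Data.Integer using (+_)
    go (suc (suc n)) = *ˡ (+ˡ (-‿cong (inner (2 N.+ n)))) » *-zeroʳ (+-identityˡ _ » -‿cong (zeroʳ _) » -0#≈0#) » sym (+-identityˡ _ » -‿cong (at (ιs⊛ 6 X) (2 N.+ n) » zeroʳ _) » -0#≈0#)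

  d-C⊕ : ∀ c f → d (C c ⊕ f) ≋ d f
  d-C⊕ c f = d-⊕ (C c) f ⟫ S.+ʳ (d-C c) ⟫ S.+-identityˡ (d f)

  d-shift : ∀ f → d f ≋ shift f ⊕ X ⊛ d (shift f)
  d-shift f = d-cong (split-head f) ⟫ d-C⊕ (f 0) (X ⊛ shift f) ⟫ d-leibniz X (shift f) ⟫ S.+ʳ (S.*ʳ {shift f} d-X ⟫ S.*-identityˡ (shift f))

  sub-d : ∀ f → d (sub f) ≋ (𝟏 ⊕ ⊖ (S.ι 6 ⊛ X)) ⊛ sub (d f)
  sub-d f = S.≈-from-- (vanish (λ f → d (sub f) ⊕ ⊖ (m ⊛ sub (d f))) step f)
    where
    m = 𝟏 ⊕ ⊖ (S.ι 6 ⊛ X)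
    step : ∀ f → d (sub f) ⊕ ⊖ (m ⊛ sub (d f)) ≋ s ⊛ (d (sub (shift f)) ⊕ ⊖ (m ⊛ sub (d (shift f))))
    step f = S.+-cong (d-cong (sub-horner f) ⟫ d-C⊕ (f 0) (s ⊛ sub (shift f)) ⟫ d-leibniz s (sub (shift f)) ⟫ S.+ʳ (S.*ʳ {sub (shift f)} d-s))
        (S.-‿cong (S.*ˡ {m} (sub-cong (d-shift f) ⟫ sub-⊕ (shift f) (X ⊛ d (shift f)) ⟫ S.+ˡ (sub-⊛ X (d (shift f)) ⟫ S.*ʳ {sub (d (shift f))} sub-X)))) ⟫
      S.solve 5 (λ m a s b c → (m S.:* a S.:+ s S.:* b) S.:- m S.:* (a S.:+ s S.:* c) S.:= s S.:* (b S.:- m S.:* c)) S.refl m (sub (shift f)) s (d (sub (shift f))) (sub (d (shift f)))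

  sub-low : ∀ m f → Low m f → Low m (sub f)
  sub-low (suc m) f l zero h = l 0 h
  sub-low (suc m) f l (suc zero) (s≤s h) = sub-low m (shift f) (λ k q → l (suc k) (s≤s q)) 0 h
  sub-low (suc m) f l (suc (suc n)) (s≤s h) = +-zero (sub-low m (shift f) l' (suc n) h) (-‿cong (*-zeroʳ (sub-low m (shift f) l' n (NP.≤-trans (NP.n≤1+n _) h))) » -0#≈0#)
    where
    l' : Low m (shift f)
    l' k q = l (suc k) (s≤s q)

  sub-lead : ∀ m f → Low m f → sub f m ≈ f m
  sub-lead zero f l = refl
  sub-lead (suc zero) f l = refl
  sub-lead (suc (suc m)) f l = trans (+-cong (sub-lead (suc m) (shift f) l') (-‿cong (*-zeroʳ (sub-low (suc m) (shift f) l' m NP.≤-refl)) » -0#≈0#)) (+-identityʳ _)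
    where
    l' : Low (suc m) (shift f)
    l' k q = l (suc k) (s≤s q)

  geo : ℕ → Ser
  geo a n = ι (a N.^ n)

  geo-inverse : ∀ a → (𝟏 ⊕ ⊖ (S.ι a ⊛ X)) ⊛ geo a ≋ 𝟏
  geo-inverse a = S.trans (S.solve 3 (λ a x g → (S.:1 S.:- a S.:* x) S.:* g S.:= g S.:- a S.:* (x S.:* g)) S.refl (S.ι a) X (geo a)) (mk go)
    where
    go : ∀ n → (geo a ⊕ ⊖ (S.ι a ⊛ (X ⊛ geo a))) n ≈ 𝟏 n
    go zero = +ˡ (-‿cong (at (ιs⊛ a (X ⊛ geo a)) 0 » *-zeroʳ (X⊛-zero (geo a)))) » +ˡ -0#≈0# » +-identityʳ _
    go (suc n) = +-cong (ι-* a (a N.^ n)) (-‿cong (at (ιs⊛ a (X ⊛ geo a)) (suc n) » *ˡ (X⊛-suc (geo a) n))) » -‿inverseʳ _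

  d-ι⊛X : ∀ a → d (S.ι a ⊛ X) ≋ S.ι a
  d-ι⊛X a = d-cong (ιs⊛ a X) ⟫ d-· (ι a) X ⟫ mk (λ n → *ˡ (at d-X n)) ⟫ S.sym (ιs⊛ a 𝟏) ⟫ S.*-identityʳ (S.ι a)

  d-⊖ : ∀ f → d (⊖ f) ≋ ⊖ d f
  d-⊖ f = mk (λ n → sym (-‿distribʳ-* _ _))

  d-𝟏 : d 𝟏 ≋ 𝟎
  d-𝟏 = mk (λ n → zeroʳ _)

  d-1-aX : ∀ a → d (𝟏 ⊕ ⊖ (S.ι a ⊛ X)) ≋ ⊖ S.ι a
  d-1-aX a = d-⊕ 𝟏 (⊖ (S.ι a ⊛ X)) ⟫ S.+-cong d-𝟏 (d-⊖ (S.ι a ⊛ X) ⟫ S.-‿cong (d-ι⊛X a)) ⟫ S.+-identityˡ _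

  -- Differentiate (1 - aX) `geo a` = 1 and multiply by `geo a`.
  d-geo : ∀ a → d (geo a) ≋ S.ι a ⊛ (geo a ⊛ geo a)
  d-geo a = S.≈-from-- (S.+ʳ (S.sym (S.*-identityˡ (d g)) ⟫ S.*ʳ {d g} (S.sym (geo-inverse a) ⟫ S.*-comm m g)) ⟫ S.solve 4 (λ g m dg a → g S.:* m S.:* dg S.:- a S.:* (g S.:* g) S.:= g S.:* (S.:- a S.:* g S.:+ m S.:* dg)) S.refl g m (d g) (S.ι a) ⟫
      S.*-zeroʳ {g} (S.+ʳ (S.*ʳ {g} (S.sym (d-1-aX a))) ⟫ S.sym (d-leibniz m g) ⟫ d-cong (geo-inverse a) ⟫ d-𝟏))
    where
    g = geo a
    m = 𝟏 ⊕ ⊖ (S.ι a ⊛ X)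

-- Fractions with poles at 1/2 and 1/6, and their degrees

module Rational (K : CommutativeRing 0ℓ 0ℓ) where

  open Kit K
  open Series K
  open Polynomials K using (Poly; Poly-cong; Poly-0; Poly-+; Poly-·; Poly-⊖; Poly-≤; shift-conv)
  open Substitution K
  module SS = Series seriesRing
  open SS public using () renaming (_⊛_ to infixl 7 _⋆_; _⊕_ to infixl 6 _✚_)

  infix 8 1-_X
  1-_X : ℕ → Ser
  1- a X = 𝟏 ⊕ ⊖ (S.ι a ⊛ X)

  -- The top coefficient x may vanish; it is carried along because `Rat-ϑ` depends on a top
  -- coefficient that cancels.
  record Top (n : ℕ) (f : Ser) (x : Carrier) : Set where
    constructor top
    field
      poly : Poly (suc n) f
      lead : f n ≈ x
  open Top

  Poly-top : ∀ n f → Poly (suc n) f → f n ≈ 0# → Poly n f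
  Poly-top zero f p e zero = e
  Poly-top zero f p e (suc k) = p k
  Poly-top (suc n) f p e = Poly-top n (shift f) p e

  Poly-beyond : ∀ n f → Poly n f → ∀ k → f (n N.+ k) ≈ 0#
  Poly-beyond zero f p k = p k
  Poly-beyond (suc n) f p k = Poly-beyond n (shift f) p k

  Poly-⊛' : ∀ m n {f g} → Poly (suc m) f → Poly n g → Poly (m N.+ n) (f ⊛ g)
  Poly-⊛' zero n {f} {g} p q = Poly-cong n {f 0 · g} {f ⊛ g} (mk λ { zero → refl ; (suc k) → sym (+ˡ (⊛-zeroˡ k p) » +-identityʳ _) }) (Poly-· n (f 0) {g} q)
  Poly-⊛' (suc m) n {f} {g} p q = Poly-+ (m N.+ n) {f 0 · shift g} {shift f ⊛ g} (Poly-· (m N.+ n) (f 0) {shift g} (Poly-≤ {n} {suc (m N.+ n)} g (NP.m≤n⇒m≤1+n (NP.m≤n+m n m)) q)) (Poly-⊛' m n {shift f} {g} p q)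

  Poly-⊛″ : ∀ m n {f g} → Poly (suc m) f → Poly (suc n) g → Poly (suc (m N.+ n)) (f ⊛ g)
  Poly-⊛″ m n {f} {g} p q = subst (λ k → Poly k (f ⊛ g)) (NP.+-suc m n) (Poly-⊛' m (suc n) {f} {g} p q)

  Top-⊛ : ∀ {m n f g x y} → Top m f x → Top n g y → Top (m N.+ n) (f ⊛ g) (x * y)
  Top-⊛ {m} {n} {f} {g} (top p a) (top q b) = top (Poly-⊛″ m n {f} {g} p q) (go m f p » *-cong a b)
    where
    go : ∀ m f → Poly (suc m) f → (f ⊛ g) (m N.+ n) ≈ f m * g n
    go zero f p = constant n
      where
      constant : ∀ n → (f ⊛ g) n ≈ f 0 * g n
      constant zero = refl
      constant (suc n) = +ˡ (⊛-zeroˡ n p) » +-identityʳ _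
    go (suc m) f p = +-cong (*-zeroʳ (reflexive (cong (g ∘ suc) (NP.+-comm m n)) » Poly-beyond (suc n) g q m)) (go m (shift f) p) » +-identityˡ _

  Top-⊕ : ∀ {n f g x y} → Top n f x → Top n g y → Top n (f ⊕ g) (x + y)
  Top-⊕ {n} {f} {g} (top p a) (top q b) = top (Poly-+ (suc n) {f} {g} p q) (+-cong a b)

  Top-ι : ∀ n → Top 0 (S.ι n) (ι n)
  Top-ι n = top (λ k → at (ιs-C n) (suc k)) (at (ιs-C n) 0)

  Top-X : Top 1 X 1#
  Top-X = top (λ k → refl) refl

  Top-1-aX : ∀ a → Top 1 (1- a X) (- ι a)
  Top-1-aX a = top (λ k → +-zero refl (-‿cong (at (ιs⊛ a X) (suc (suc k)) » zeroʳ _) » -0#≈0#)) (+-identityˡ _ » -‿cong (at (ιs⊛ a X) 1 » *-identityʳ _))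

  Top-θ : ∀ {n f x} → Top n f x → Top n (θ f) (ι n * x)
  Top-θ {n} {f} (top p a) = top (go (suc n) f ι p) (*ˡ a)
    where
    go : ∀ n f (c : ℕ → Carrier) → Poly n f → Poly n (λ k → c k * f k)
    go zero f c p k = *-zeroʳ (p k)
    go (suc n) f c p = go n (shift f) (c ∘ suc) p

  f e : Ser
  f = geo 2
  e = geo 6

  pw : Ser → ℕ → Ser
  pw g zero = 𝟏
  pw g (suc n) = g ⊛ pw g n

  pw-+ : ∀ g m n → pw g (m N.+ n) ≋ pw g m ⊛ pw g n
  pw-+ g zero n = S.sym (S.*-identityˡ (pw g n))
  pw-+ g (suc m) n = S.*ˡ {g} (pw-+ g m n) ⟫ S.sym (S.*-assoc g (pw g m) (pw g n))

  -- F = P / ((1 - 2X)^a (1 - 6X)^b) with P of degree at most n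
  record Rat (a b n : ℕ) (F : Ser) : Set where
    constructor rat
    field
      num : Ser
      deg : Poly (suc n) num
      value : F ≋ num ⊛ (pw f a ⊛ pw e b)
  open Rat public

  Rat-cast : ∀ {a a' b b' n n' F} → a ≡ a' → b ≡ b' → n ≡ n' → Rat a b n F → Rat a' b' n' F
  Rat-cast E.refl E.refl E.refl r = r

  Rat-cong : ∀ {a b n F G} → F ≋ G → Rat a b n F → Rat a b n G
  Rat-cong E (rat P p v) = rat P p (S.sym E ⟫ v)

  Rat-0 : ∀ {a b n F} → F ≋ 𝟎 → Rat a b n F
  Rat-0 {a} {b} {n} E = rat 𝟎 (Poly-0 (suc n) (λ _ → refl)) (E ⟫ S.sym (S.zeroˡ (pw f a ⊛ pw e b)))

  Rat-⊕ : ∀ {a b n F G} → Rat a b n F → Rat a b n G → Rat a b n (F ⊕ G)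
  Rat-⊕ {a} {b} {n} (rat P p v) (rat Q q w) = rat (P ⊕ Q) (Poly-+ (suc n) {P} {Q} p q) (S.+-cong v w ⟫ S.sym (S.distribʳ (pw f a ⊛ pw e b) P Q))

  Rat-⊖ : ∀ {a b n F} → Rat a b n F → Rat a b n (⊖ F)
  Rat-⊖ {a} {b} {n} (rat P p v) = rat (⊖ P) (Poly-⊖ (suc n) {P} p) (S.-‿cong v ⟫ S.-‿distribˡ-* P (pw f a ⊛ pw e b))

  Rat-⊛ : ∀ {a b n a' b' n' F G} → Rat a b n F → Rat a' b' n' G → Rat (a N.+ a') (b N.+ b') (n N.+ n') (F ⊛ G)
  Rat-⊛ {a} {b} {n} {a'} {b'} {n'} (rat P p v) (rat Q q w) = rat (P ⊛ Q) (Poly-⊛″ n n' {P} {Q} p q)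
    (S.*-cong v w ⟫ S.solve 6 (λ P Q a b c d → P S.:* (a S.:* b) S.:* (Q S.:* (c S.:* d)) S.:= P S.:* Q S.:* (a S.:* c S.:* (b S.:* d))) S.refl P Q (pw f a) (pw e b) (pw f a') (pw e b') ⟫ S.*ˡ {P ⊛ Q} (S.sym (S.*-cong (pw-+ f a a') (pw-+ e b b'))))

  Rat-poly : ∀ {k a b n p F} → Poly (suc k) p → Rat a b n F → Rat a b (k N.+ n) (p ⊛ F)
  Rat-poly {k} {a} {b} {n} {p} h (rat P q v) = rat (p ⊛ P) (Poly-⊛″ k n {p} {P} h q) (S.*ˡ {p} v ⟫ S.sym (S.*-assoc p P (pw f a ⊛ pw e b)))

  Rat-f : ∀ {a b n F} → Rat a b n F → Rat (suc a) b n (f ⊛ F)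
  Rat-f {a} {b} (rat P p v) = rat P p (S.*ˡ {f} v ⟫ S.solve 4 (λ f P x y → f S.:* (P S.:* (x S.:* y)) S.:= P S.:* (f S.:* x S.:* y)) S.refl f P (pw f a) (pw e b))

  Rat-e : ∀ {a b n F} → Rat a b n F → Rat a (suc b) n (e ⊛ F)
  Rat-e {a} {b} (rat P p v) = rat P p (S.*ˡ {e} v ⟫ S.solve 4 (λ e P x y → e S.:* (P S.:* (x S.:* y)) S.:= P S.:* (x S.:* (e S.:* y))) S.refl e P (pw f a) (pw e b))

  cancel : ∀ {x y} z → x ⊛ y ≋ 𝟏 → y ⊛ (x ⊛ z) ≋ z
  cancel {x} {y} z E = S.solve 3 (λ x y z → y S.:* (x S.:* z) S.:= x S.:* y S.:* z) S.refl x y z ⟫ S.*ʳ {z} E ⟫ S.*-identityˡ z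

  Rat-raise-f : ∀ {a b n F} → Rat a b n F → Rat (suc a) b (suc n) F
  Rat-raise-f {F = F} r = Rat-cong (cancel F (geo-inverse 2)) (Rat-f (Rat-poly {1} {p = 1- 2 X} (poly (Top-1-aX 2)) r))

  Rat-raise-e : ∀ {a b n F} → Rat a b n F → Rat a (suc b) (suc n) F
  Rat-raise-e {F = F} r = Rat-cong (cancel F (geo-inverse 6)) (Rat-e (Rat-poly {1} {p = 1- 6 X} (poly (Top-1-aX 6)) r))

  Rat-suc : ∀ {a b n F} → Rat a b n F → Rat a b (suc n) F
  Rat-suc {n = n} (rat P p v) = rat P (Poly-≤ {suc n} {suc (suc n)} P (NP.n≤1+n (suc n)) p) v

  Rat-e⁻ : ∀ {a b n F} → Rat a (suc b) n F → Rat a b n (1- 6 X ⊛ F)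
  Rat-e⁻ {a} {b} (rat P p v) = rat P p (S.*ˡ {1- 6 X} v ⟫ S.solve 5 (λ m P x e y → m S.:* (P S.:* (x S.:* (e S.:* y))) S.:= m S.:* e S.:* (P S.:* (x S.:* y))) S.refl (1- 6 X) P (pw f a) e (pw e b) ⟫
    S.*ʳ {P ⊛ (pw f a ⊛ pw e b)} (geo-inverse 6) ⟫ S.*-identityˡ _)

  -- 2s d/ds = 2X(1 - 3X)/(1 - 6X) d/dX for s = X(1 - 3X)
  ϑ : Ser → Ser
  ϑ F = S.ι 2 ⊛ (1- 3 X ⊛ (e ⊛ θ F))

  private
    θ-𝟏 : θ 𝟏 ≋ 𝟎
    θ-𝟏 = mk λ { zero → zeroˡ _ ; (suc n) → zeroʳ _ }

    θ-pw : ∀ a n → θ (pw (geo a) n) ≋ S.ι n ⊛ (S.ι a ⊛ (X ⊛ (geo a ⊛ pw (geo a) n)))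
    θ-pw a zero = θ-𝟏 ⟫ S.sym (S.zeroˡ _)
    θ-pw a (suc n) = S.trans (θ-leibniz g (pw g n)) (S.+-cong (S.*ʳ {pw g n} (S.sym (X⊛d g) ⟫ S.*ˡ {X} (d-geo a))) (S.*ˡ {g} (θ-pw a n)) ⟫
      S.solve 5 (λ g p n a x → x S.:* (a S.:* (g S.:* g)) S.:* p S.:+ g S.:* (n S.:* (a S.:* (x S.:* (g S.:* p)))) S.:= (S.:1 S.:+ n) S.:* (a S.:* (x S.:* (g S.:* (g S.:* p))))) S.refl g (pw g n) (S.ι n) (S.ι a) X ⟫
        S.*ʳ {S.ι a ⊛ (X ⊛ (g ⊛ (g ⊛ pw g n)))} (S.sym (S.ι-suc n)))
      where g = geo a

    -- The numerator of m + `ϑ` applied to P/((1-2X)^a (1-6X)^b), over the denominator with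
    -- exponents a + 1 and b + 2.
    numerator : ℕ → ℕ → ℕ → Ser → Ser
    numerator m a b P = S.ι m ⊛ (1- 2 X ⊛ (1- 6 X ⊛ (1- 6 X ⊛ P))) ⊕ S.ι 2 ⊛ (1- 3 X ⊛ (1- 2 X ⊛ (1- 6 X ⊛ θ P))) ⊕ S.ι 2 ⊛ (1- 3 X ⊛ (S.ι 2 ⊛ (S.ι a ⊛ (X ⊛ (1- 6 X ⊛ P))))) ⊕ S.ι 2 ⊛ (1- 3 X ⊛ (S.ι 6 ⊛ (S.ι b ⊛ (X ⊛ (1- 2 X ⊛ P)))))

    -- At infinity 2(1-3X)/(1-6X) tends to 1, so `ϑ` acts like X d/dX and multiplies a leading term
    -- X^(-m) by -m, which m + `ϑ` cancels.
    numerator-top : ∀ m a b n P x → a N.+ b ≡ n N.+ m → Top n P x → Top (3 N.+ n) (numerator m a b P) 0#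
    numerator-top m a b n P x E t = vanishing (Top-⊕ (Top-⊕ (Top-⊕ (Top-⊛ (Top-ι m) (Top-⊛ (Top-1-aX 2) (Top-⊛ (Top-1-aX 6) (Top-⊛ (Top-1-aX 6) t)))) (Top-⊛ (Top-ι 2) (Top-⊛ (Top-1-aX 3) (Top-⊛ (Top-1-aX 2) (Top-⊛ (Top-1-aX 6) (Top-θ t))))))
        (Top-⊛ (Top-ι 2) (Top-⊛ (Top-1-aX 3) (Top-⊛ (Top-ι 2) (Top-⊛ (Top-ι a) (Top-⊛ Top-X (Top-⊛ (Top-1-aX 6) t)))))))
        (Top-⊛ (Top-ι 2) (Top-⊛ (Top-1-aX 3) (Top-⊛ (Top-ι 6) (Top-⊛ (Top-ι b) (Top-⊛ Top-X (Top-⊛ (Top-1-aX 2) t)))))))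
      where
      vanishing : ∀ {g} → Top (3 N.+ n) g _ → Top (3 N.+ n) g 0#
      vanishing (top p q) = top p (q » solve 5 (λ m a b n x → m :* (:- :2 :* (:- con (+ 6) :* (:- con (+ 6) :* x))) :+ :2 :* (:- :3 :* (:- :2 :* (:- con (+ 6) :* (n :* x))))
            :+ :2 :* (:- :3 :* (:2 :* (a :* (:1 :* (:- con (+ 6) :* x))))) :+ :2 :* (:- :3 :* (con (+ 6) :* (b :* (:1 :* (:- :2 :* x)))))
          := con (+ 72) :* x :* (a :+ b :- (n :+ m))) refl (ι m) (ι a) (ι b) (ι n) x »
        *-zeroʳ (+ʳ (sym (ι-+ a b) » reflexive (cong ι E) » ι-+ n m) » -‿inverseʳ _))

  -- The operator m + ϑ raises the order at infinity a + b - n of a fraction of order exactly m.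
  Rat-ϑ : ∀ m {a b n F} → a N.+ b ≡ n N.+ m → Rat a b n F → Rat (1 N.+ a) (2 N.+ b) (2 N.+ n) (S.ι m ⊛ F ⊕ ϑ F)
  Rat-ϑ m {a} {b} {n} {F} E (rat P p v) = rat Q (Poly-top (3 N.+ n) Q (poly tQ) (lead tQ)) (S.+-cong (S.*ˡ {S.ι m} v) (S.*ˡ {S.ι 2} (S.*ˡ {1- 3 X} (S.*ˡ {e} (θ-cong v ⟫ θw)))) ⟫
      S.sym (identity ⟫ S.+-cong (S.+ˡ {L₀} (S.*ʳ {A} (unit 2))) (S.*ʳ {B} (unit 6)) ⟫ S.solve 3 (λ l a b → l S.:+ S.con (+ 0) S.:* a S.:+ S.con (+ 0) S.:* b S.:= l) S.refl L₀ A B))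
    where
    Q = numerator m a b P
    tQ : Top (3 N.+ n) Q 0#
    tQ = numerator-top m a b n P (P n) E (top p refl)
    w = pw f a ⊛ pw e b
    T₀ = θ P ⊕ P ⊛ (S.ι a ⊛ (S.ι 2 ⊛ (X ⊛ f)) ⊕ S.ι b ⊛ (S.ι 6 ⊛ (X ⊛ e)))
    L₀ = S.ι m ⊛ (P ⊛ w) ⊕ S.ι 2 ⊛ (1- 3 X ⊛ (e ⊛ (T₀ ⊛ w)))
    -- A and B are the cofactors of the relations (1-2X) f = 1 and (1-6X) e = 1, so that the solver
    -- may treat f, e and the linear factors as independent.
    A = ⊖ (S.ι m ⊛ (P ⊛ w) ⊕ S.ι 2 ⊛ (1- 3 X ⊛ (e ⊛ ((θ P ⊕ P ⊛ (S.ι b ⊛ (S.ι 6 ⊛ (X ⊛ e)))) ⊛ w))))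
    B = ⊖ ((1- 2 X ⊛ f) ⊛ (S.ι m ⊛ (P ⊛ w)) ⊛ (𝟏 ⊕ 1- 6 X ⊛ e) ⊕ S.ι 2 ⊛ (1- 3 X ⊛ (e ⊛ ((θ P ⊛ (1- 2 X ⊛ f) ⊕ P ⊛ (S.ι a ⊛ (S.ι 2 ⊛ (X ⊛ f)))) ⊛ w))))
    unit : ∀ a → 𝟏 ⊕ ⊖ (1- a X ⊛ geo a) ≋ S.ι 0
    unit a = S.+ˡ (S.-‿cong (geo-inverse a)) ⟫ S.-‿inverseʳ 𝟏
    θw : θ (P ⊛ w) ≋ T₀ ⊛ w
    θw = θ-leibniz P w ⟫ S.+ˡ (S.*ˡ {P} (θ-leibniz (pw f a) (pw e b) ⟫ S.+-cong (S.*ʳ {pw e b} (θ-pw 2 a)) (S.*ˡ {pw f a} (θ-pw 6 b)))) ⟫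
      S.solve 11 (λ P θP u v a b x f e c₂ c₆ → θP S.:* (u S.:* v) S.:+ P S.:* (a S.:* (c₂ S.:* (x S.:* (f S.:* u))) S.:* v S.:+ u S.:* (b S.:* (c₆ S.:* (x S.:* (e S.:* v)))))
        S.:= (θP S.:+ P S.:* (a S.:* (c₂ S.:* (x S.:* f)) S.:+ b S.:* (c₆ S.:* (x S.:* e)))) S.:* (u S.:* v)) S.refl P (θ P) (pw f a) (pw e b) (S.ι a) (S.ι b) X f e (S.ι 2) (S.ι 6)
    identity : Q ⊛ (pw f (1 N.+ a) ⊛ pw e (2 N.+ b)) ≋ L₀ ⊕ (𝟏 ⊕ ⊖ (1- 2 X ⊛ f)) ⊛ A ⊕ (𝟏 ⊕ ⊖ (1- 6 X ⊛ e)) ⊛ B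
    identity = S.solve 13 (λ m a b P θP u v x f e α β γ →
      (m S.:* (α S.:* (β S.:* (β S.:* P))) S.:+ S.:2 S.:* (γ S.:* (α S.:* (β S.:* θP))) S.:+ S.:2 S.:* (γ S.:* (S.:2 S.:* (a S.:* (x S.:* (β S.:* P))))) S.:+ S.:2 S.:* (γ S.:* (S.con (+ 6) S.:* (b S.:* (x S.:* (α S.:* P))))))
        S.:* (f S.:* u S.:* (e S.:* (e S.:* v)))
      S.:= (m S.:* (P S.:* (u S.:* v)) S.:+ S.:2 S.:* (γ S.:* (e S.:* ((θP S.:+ P S.:* (a S.:* (S.:2 S.:* (x S.:* f)) S.:+ b S.:* (S.con (+ 6) S.:* (x S.:* e)))) S.:* (u S.:* v)))))
        S.:+ (S.:1 S.:- α S.:* f) S.:* (S.:- (m S.:* (P S.:* (u S.:* v)) S.:+ S.:2 S.:* (γ S.:* (e S.:* ((θP S.:+ P S.:* (b S.:* (S.con (+ 6) S.:* (x S.:* e)))) S.:* (u S.:* v))))))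
        S.:+ (S.:1 S.:- β S.:* e) S.:* (S.:- (α S.:* f S.:* (m S.:* (P S.:* (u S.:* v))) S.:* (S.:1 S.:+ β S.:* e) S.:+ S.:2 S.:* (γ S.:* (e S.:* ((θP S.:* (α S.:* f) S.:+ P S.:* (a S.:* (S.:2 S.:* (x S.:* f)))) S.:* (u S.:* v)))))))
      S.refl (S.ι m) (S.ι a) (S.ι b) P (θ P) (pw f a) (pw e b) X f e (1- 2 X) (1- 6 X) (1- 3 X)

  -- Each genus adds 3 and 5 to the pole orders and 8 to the degree, the slopes of 3g-2, 5g-3 and
  -- 8g-6. Only the first N terms are bounded, which suits the induction on the genus.
  record Graded (N a b n : ℕ) (F : ℕ → Ser) : Set where
    constructor graded
    field term : ∀ k → k N.< N → Rat (a N.+ k N.* 3) (b N.+ k N.* 5) (n N.+ k N.* 8) (F k)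
  open Graded public

  Graded-cong : ∀ {N a b n F G} → F SS.≋ G → Graded N a b n F → Graded N a b n G
  Graded-cong E (graded r) = graded (λ k h → Rat-cong (SS.at E k) (r k h))

  Graded-< : ∀ {N a b n F} → Graded (suc N) a b n F → Graded N a b n F
  Graded-< (graded r) = graded (λ k h → r k (NP.m≤n⇒m≤1+n h))

  Graded-⊕ : ∀ {N a b n F G} → Graded N a b n F → Graded N a b n G → Graded N a b n (F ✚ G)
  Graded-⊕ (graded r) (graded t) = graded (λ k h → Rat-⊕ (r k h) (t k h))

  Graded-⊖ : ∀ {N a b n F} → Graded N a b n F → Graded N a b n (SS.⊖ F)
  Graded-⊖ (graded r) = graded (λ k h → Rat-⊖ (r k h))

  Graded-X : ∀ {N a b n F} → Graded N (3 N.+ a) (5 N.+ b) (8 N.+ n) F → Graded (suc N) a b n (SS.X ⋆ F)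
  Graded-X {N} {a} {b} {n} {F} (graded r) = graded λ { zero _ → Rat-0 (SS.X⊛-zero F) ; (suc k) (s≤s h) → Rat-cong (S.sym (SS.X⊛-suc F k)) (Rat-cast (eq 3 a (k N.* 3)) (eq 5 b (k N.* 5)) (eq 8 n (k N.* 8)) (r k h)) }
    where
    eq : ∀ c a y → c N.+ a N.+ y ≡ a N.+ (c N.+ y)
    eq = ℕ-Solver.solve 3 (λ c a y → c ℕ-Solver.:+ a ℕ-Solver.:+ y ℕ-Solver.:= a ℕ-Solver.:+ (c ℕ-Solver.:+ y)) E.refl

  Graded-⊛ : ∀ {N a b n a' b' n' F G} → Graded N a b n F → Graded N a' b' n' G → Graded N (a N.+ a') (b N.+ b') (n N.+ n') (F ⋆ G)
  Graded-⊛ {N} {a} {b} {n} {a'} {b'} {n'} {F} {G} (graded r) (graded t) = graded (λ k h → go k a b n F (λ j i → r j (NP.≤-<-trans i h)) (λ j i → t j (NP.≤-<-trans i h)))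
    where
    eq₀ : ∀ a a' → a N.+ 0 N.+ (a' N.+ 0) ≡ a N.+ a' N.+ 0
    eq₀ = ℕ-Solver.solve 2 (λ a a' → a ℕ-Solver.:+ ℕ-Solver.con 0 ℕ-Solver.:+ (a' ℕ-Solver.:+ ℕ-Solver.con 0) ℕ-Solver.:= a ℕ-Solver.:+ a' ℕ-Solver.:+ ℕ-Solver.con 0) E.refl
    eq₁ : ∀ a a' y → a N.+ 0 N.+ (a' N.+ y) ≡ a N.+ a' N.+ y
    eq₁ = ℕ-Solver.solve 3 (λ a a' y → a ℕ-Solver.:+ ℕ-Solver.con 0 ℕ-Solver.:+ (a' ℕ-Solver.:+ y) ℕ-Solver.:= a ℕ-Solver.:+ a' ℕ-Solver.:+ y) E.refl
    eq₂ : ∀ c a a' y → c N.+ a N.+ a' N.+ y ≡ a N.+ a' N.+ (c N.+ y)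
    eq₂ = ℕ-Solver.solve 4 (λ c a a' y → c ℕ-Solver.:+ a ℕ-Solver.:+ a' ℕ-Solver.:+ y ℕ-Solver.:= a ℕ-Solver.:+ a' ℕ-Solver.:+ (c ℕ-Solver.:+ y)) E.refl
    eq₃ : ∀ c a y → a N.+ (c N.+ y) ≡ c N.+ a N.+ y
    eq₃ = ℕ-Solver.solve 3 (λ c a y → a ℕ-Solver.:+ (c ℕ-Solver.:+ y) ℕ-Solver.:= c ℕ-Solver.:+ a ℕ-Solver.:+ y) E.refl
    go : ∀ k a b n F → (∀ j → j N.≤ k → Rat (a N.+ j N.* 3) (b N.+ j N.* 5) (n N.+ j N.* 8) (F j)) → (∀ j → j N.≤ k → Rat (a' N.+ j N.* 3) (b' N.+ j N.* 5) (n' N.+ j N.* 8) (G j)) →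
         Rat (a N.+ a' N.+ k N.* 3) (b N.+ b' N.+ k N.* 5) (n N.+ n' N.+ k N.* 8) ((F ⋆ G) k)
    go zero a b n F r t = Rat-cast (eq₀ a a') (eq₀ b b') (eq₀ n n') (Rat-⊛ (r 0 z≤n) (t 0 z≤n))
    go (suc k) a b n F r t = Rat-⊕ (Rat-cast (eq₁ a a' _) (eq₁ b b' _) (eq₁ n n' _) (Rat-⊛ (r 0 z≤n) (t (suc k) NP.≤-refl))) (Rat-cast (eq₂ 3 a a' (k N.* 3)) (eq₂ 5 b b' (k N.* 5)) (eq₂ 8 n n' (k N.* 8)) (go k (3 N.+ a) (5 N.+ b) (8 N.+ n) (F ∘ suc)
        (λ j i → Rat-cast (eq₃ 3 a (j N.* 3)) (eq₃ 5 b (j N.* 5)) (eq₃ 8 n (j N.* 8)) (r (suc j) (s≤s i))) (λ j i → t j (NP.m≤n⇒m≤1+n i))))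

  Graded-map : ∀ i j l {x} → (∀ {a b n F} → Rat a b n F → Rat (i N.+ a) (j N.+ b) (l N.+ n) (x ⊛ F)) → ∀ {N a b n F} → Graded N a b n F → Graded N (i N.+ a) (j N.+ b) (l N.+ n) (SS.C x ⋆ F)
  Graded-map i j l {x} φ {F = F} (graded r) = graded (λ k h → Rat-cong (S.sym (SS.at (SS.C⊛ x F) k)) (Rat-cast (E.sym (NP.+-assoc i _ _)) (E.sym (NP.+-assoc j _ _)) (E.sym (NP.+-assoc l _ _)) (φ (r k h))))

  Graded-e⁻ : ∀ {N a b n F} → Graded N a (suc b) n F → Graded N a b n (SS.C (1- 6 X) ⋆ F)
  Graded-e⁻ {F = F} (graded r) = graded (λ k h → Rat-cong (S.sym (SS.at (SS.C⊛ (1- 6 X) F) k)) (Rat-e⁻ (r k h)))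

  Graded-raise : ∀ i {N a b n F} → Graded N a b n F → Graded N a (i N.+ b) (i N.+ n) F
  Graded-raise zero g = g
  Graded-raise (suc i) g = graded (λ k h → Rat-raise-e (term (Graded-raise i g) k h))

  Graded-raise-f : ∀ {N a b n F} → Graded N a b n F → Graded N (suc a) b (suc n) F
  Graded-raise-f (graded r) = graded (λ k h → Rat-raise-f (r k h))

  Graded-suc : ∀ {N a b n F} → Graded N a b n F → Graded N a b (suc n) F
  Graded-suc (graded r) = graded (λ k h → Rat-suc (r k h))

  Graded-ϑ : ∀ m {N a b n F} → a N.+ b ≡ n N.+ m → Graded N a b n F → Graded N (1 N.+ a) (2 N.+ b) (2 N.+ n) (λ k → S.ι m ⊛ F k ⊕ ϑ (F k))
  Graded-ϑ m {N} {a} {b} {n} E (graded r) = graded (λ k h → Rat-ϑ m (eq₁ a b k ∙ cong (N._+ k N.* 8) E ∙ eq₂ n m (k N.* 8)) (r k h))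
    where
    eq₁ : ∀ a b k → a N.+ k N.* 3 N.+ (b N.+ k N.* 5) ≡ a N.+ b N.+ k N.* 8
    eq₁ = ℕ-Solver.solve 3 (λ a b k → a ℕ-Solver.:+ k ℕ-Solver.:* ℕ-Solver.con 3 ℕ-Solver.:+ (b ℕ-Solver.:+ k ℕ-Solver.:* ℕ-Solver.con 5) ℕ-Solver.:= a ℕ-Solver.:+ b ℕ-Solver.:+ k ℕ-Solver.:* ℕ-Solver.con 8) E.refl
    eq₂ : ∀ n m y → n N.+ m N.+ y ≡ n N.+ y N.+ m
    eq₂ = ℕ-Solver.solve 3 (λ n m y → n ℕ-Solver.:+ m ℕ-Solver.:+ y ℕ-Solver.:= n ℕ-Solver.:+ y ℕ-Solver.:+ m) E.refl

-- The differential equation with a genus variable and its first integral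

module GenusSeries (K : CommutativeRing 0ℓ 0ℓ) (inv : ℕ → CommutativeRing.Carrier K) (inv-l : ∀ n → CommutativeRing._≈_ K (CommutativeRing._*_ K (Kit.ι K (suc n)) (inv n)) (CommutativeRing.1# K)) where

  open Kit K
  open Series K
  open Doubling K
  open Substitution K
  open Rational K
  private module P = SS.S
  open P using () renaming (_»_ to infixr 5 _⋙_)

  private
    regular : ∀ n {x} → ι (suc n) * x ≈ 0# → x ≈ 0#
    regular n {x} E = begin
      _ ≈⟨ sym (*-identityˡ x) » *ʳ (sym (inv-l n)) ⟩
      ι (suc n) * inv n * x ≈⟨ solve 3 (λ a b x → a :* b :* x := b :* (a :* x)) refl _ _ _ ⟩
      inv n * (ι (suc n) * x) ≈⟨ *-zeroʳ E ⟩
      _ ∎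

  S-regular : ∀ n {F G} → S.ι (suc n) ⊛ F ≋ S.ι (suc n) ⊛ G → F ≋ G
  S-regular n {F} {G} E = S.≈-from-- (mk λ k → regular n (sym (at (ιs⊛ (suc n) (F ⊕ ⊖ G)) k) » at (S.solve 3 (λ n f g → n S.:* (f S.:- g) S.:= n S.:* f S.:- n S.:* g) S.refl (S.ι (suc n)) F G ⟫ S.+ʳ E ⟫ S.-‿inverseʳ _) k))

  -- The recursion is a series in the edges with coefficients in the genus variable; the equations
  -- below are series in the genus variable over series in the edges.
  transpose-⊛ : ∀ (F G : ℕ → Ser) n g → (F ⋆ G) n g ≈ ((λ i j → F j i) ⋆ (λ i j → G j i)) g n
  transpose-⊛ F G zero g = head g (λ i j → F j i) (λ i j → G j i)
    where
    head : ∀ g (A B : ℕ → Ser) → ((λ i → A i 0) ⊛ (λ i → B i 0)) g ≈ (A ⋆ B) g 0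
    head zero A B = refl
    head (suc g) A B = +ˡ (head g (A ∘ suc) B)
  transpose-⊛ F G (suc n) g = trans (+ˡ (transpose-⊛ (F ∘ suc) G n g)) (sym (split g (λ i j → F j i) (λ i j → G j i)))
    where
    split : ∀ g (A B : ℕ → Ser) → (A ⋆ B) g (suc n) ≈ ((λ i → A i 0) ⊛ (λ i → B i (suc n))) g + ((shift ∘ A) ⋆ B) g n
    split zero A B = refl
    split (suc g) A B = +ˡ (split g (A ∘ suc) B) » solve 4 (λ a b c e → a :+ b :+ (c :+ e) := a :+ c :+ (b :+ e)) refl _ _ _ _

  P-ι⊛ : ∀ k F g → (P.ι k ⋆ F) g ≋ S.ι k ⊛ F g
  P-ι⊛ k F g = SS.at (SS.ιs⊛ k F) g

  -- h marks the genus, x is the constant series X.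
  h x : ℕ → Ser
  h = SS.X
  x = SS.C X

  Θ : (ℕ → Ser) → (ℕ → Ser)
  Θ F g = ι 2 · θ (F g)

  private
    Θ-⊕ : ∀ F G → Θ (F ✚ G) SS.≋ Θ F ✚ Θ G
    Θ-⊕ F G = SS.mk (λ g → mk (λ n → solve 4 (λ t n a b → t :* (n :* (a :+ b)) := t :* (n :* a) :+ t :* (n :* b)) refl _ _ _ _))

    Θ-⊖ : ∀ F → Θ (SS.⊖ F) SS.≋ SS.⊖ Θ F
    Θ-⊖ F = SS.mk (λ g → mk (λ n → solve 3 (λ t n a → t :* (n :* :- a) := :- (t :* (n :* a))) refl _ _ _))

    Θ-⊛ : ∀ F G → Θ (F ⋆ G) SS.≋ Θ F ⋆ G ✚ F ⋆ Θ G
    Θ-⊛ = LiftDerivation.lift-leibniz seriesRing (λ f → ι 2 · θ f) (λ f g → mk (λ n → solve 4 (λ t n a b → t :* (n :* (a :+ b)) := t :* (n :* a) :+ t :* (n :* b)) refl _ _ _ _))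
      (λ f g → mk (λ n → *ˡ (at (θ-leibniz f g) n)) ⟫ S.sym (C⊛ (ι 2) (θ f ⊛ g ⊕ f ⊛ θ g)) ⟫ S.solve 5 (λ c a b f g → c S.:* (a S.:* g S.:+ f S.:* b) S.:= c S.:* a S.:* g S.:+ f S.:* (c S.:* b)) S.refl (C (ι 2)) (θ f) (θ g) f g ⟫
          S.+-cong (S.*ʳ {g} (C⊛ (ι 2) (θ f))) (S.*ˡ {f} (C⊛ (ι 2) (θ g))))

    Θ-𝟏 : Θ SS.𝟏 SS.≋ SS.𝟎
    Θ-𝟏 = SS.mk λ { zero → mk (λ { zero → *-zeroʳ (zeroˡ _) ; (suc n) → *-zeroʳ (zeroʳ _) }) ; (suc g) → mk (λ n → *-zeroʳ (zeroʳ _)) }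

    Θ-h : Θ h SS.≋ SS.𝟎
    Θ-h = SS.mk λ { zero → mk (λ n → *-zeroʳ (zeroʳ _)) ; (suc g) → SS.at Θ-𝟏 g }

    Θ-x : Θ x SS.≋ P.ι 2 ⋆ x
    Θ-x = P.sym (SS.ιs⊛ 2 x ⋙ (SS.mk λ { zero → S.trans (ιs⊛ 2 X) (mk (λ { zero → *ˡ (sym (zeroˡ _)) ; (suc zero) → *ˡ (sym (*-identityˡ _)) ; (suc (suc n)) → *ˡ (sym (zeroʳ _)) })) ; (suc g) → S.zeroʳ _ ⟫ mk (λ n → sym (*-zeroʳ (zeroʳ _))) }))

  module Equations (ĉ : ℕ → Ser) (ĉ-0 : ĉ 0 ≋ 𝟏) (recursion₁ : ι 4 · ĉ 1 ≋ ι 8 · ι 1 · ĉ 0) (recursion : ∀ n → ι (dbl (3 N.+ n)) · ĉ (2 N.+ n) ≋ X ⊛ (ι (suc (suc (suc (dbl n)))) · ι (suc (suc (dbl n))) · ι (suc (dbl n)) · ĉ n)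
                   ⊕ ι 6 · ((λ k → ι (suc (dbl k)) · ĉ k) ⋆ (λ k → ι (suc (dbl k)) · ĉ k)) n ⊕ ι 8 · ι (suc (dbl (suc n))) · ĉ (suc n)) where

    G U V W : ℕ → Ser
    G g n = ĉ n g
    U = G ✚ Θ G
    V = P.ι 2 ⋆ U ✚ Θ U
    W = P.ι 3 ⋆ V ✚ Θ V

    private
      step-at : ∀ k F g n → (P.ι k ⋆ F ✚ Θ F) g n ≈ ι (k N.+ dbl n) * F g n
      step-at k F g n = +ʳ (at (P-ι⊛ k F g) n » at (ιs⊛ k (F g)) n) » solve 4 (λ k t n y → k :* y :+ t :* (n :* y) := (k :+ t :* n) :* y) refl _ _ _ _ » *ʳ (+ˡ (sym (ι-dbl n)) » sym (ι-+ k (dbl n)))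

      U-at : ∀ g n → U g n ≈ ι (suc (dbl n)) * ĉ n g
      U-at g n = +ʳ (sym (*-identityˡ _) » sym (at (P-ι⊛ 1 G g) n » at (ιs⊛ 1 (G g)) n)) » step-at 1 G g n

      W-at : ∀ g n → W g n ≈ ι (3 N.+ dbl n) * (ι (2 N.+ dbl n) * (ι (suc (dbl n)) * ĉ n g))
      W-at g n = step-at 3 V g n » *ˡ (step-at 2 U g n » *ˡ (U-at g n))

      Q : ℕ → Ser
      Q = h ⋆ W ✚ P.ι 6 ⋆ (U ⋆ U)

      x-zero : ∀ F g → (x ⋆ F) g 0 ≈ 0#
      x-zero F g = at (SS.at (SS.C⊛ X F) g) 0 » X⊛-zero (F g)

      x-suc : ∀ F g n → (x ⋆ F) g (suc n) ≈ F g n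
      x-suc F g n = at (SS.at (SS.C⊛ X F) g) (suc n) » X⊛-suc (F g) n

      LHS-at : ∀ g n → (U ✚ G) g n ≈ ι (suc (suc (dbl n))) * ĉ n g
      LHS-at g n = +ʳ (U-at g n) » solve 2 (λ k y → k :* y :+ y := (:1 :+ k) :* y) refl _ _ » *ʳ (sym (ι-suc (suc (dbl n))))

      P-ι-at : ∀ k g n → P.ι k g n ≈ ι k * 𝟏 n * 𝟏 g
      P-ι-at k zero n = trans (at (SS.at (SS.ιs-C k) 0) n) (at (ιs-C k) n » constant n » sym (*-identityʳ _))
        where
        constant : ∀ n → C (ι k) n ≈ ι k * 𝟏 n
        constant zero = sym (*-identityʳ _)
        constant (suc n) = sym (zeroʳ _)
      P-ι-at k (suc g) n = at (SS.at (SS.ιs-C k) (suc g)) n » sym (zeroʳ _)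

    -- The recursion for two or more edges as a differential equation; the constant 2 and
    -- `recursion₁` account for the coefficients of zero and one edge.
    quadratic : U ✚ G SS.≋ x ⋆ (x ⋆ Q ✚ P.ι 8 ⋆ U) ✚ P.ι 2
    quadratic = SS.mk (λ g → mk (λ n → LHS-at g n » go g n))
      where
      eight : ∀ g n → (P.ι 8 ⋆ U) g n ≈ ι 8 * (ι (suc (dbl n)) * ĉ n g)
      eight g n = at (P-ι⊛ 8 U g) n » at (ιs⊛ 8 (U g)) n » *ˡ (U-at g n)
      six : ∀ g n → (P.ι 6 ⋆ (U ⋆ U)) g n ≈ ι 6 * ((λ k → ι (suc (dbl k)) · ĉ k) ⋆ (λ k → ι (suc (dbl k)) · ĉ k)) n g
      six g n = at (P-ι⊛ 6 (U ⋆ U) g) n » at (ιs⊛ 6 ((U ⋆ U) g)) n » *ˡ (sym (transpose-⊛ _ _ n g » at (SS.⊛-at g (λ i → mk (λ j → sym (U-at i j))) (λ i → mk (λ j → sym (U-at i j)))) n))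
      genus : ∀ g n → (h ⋆ W) g n ≈ (X ⊛ (ι (3 N.+ dbl n) · ι (2 N.+ dbl n) · ι (suc (dbl n)) · ĉ n)) g
      genus zero n = at (SS.X⊛-zero W) n » sym (X⊛-zero (ι (3 N.+ dbl n) · ι (2 N.+ dbl n) · ι (suc (dbl n)) · ĉ n))
      genus (suc g) n = at (SS.X⊛-suc W g) n » W-at g n » sym (X⊛-suc (ι (3 N.+ dbl n) · ι (2 N.+ dbl n) · ι (suc (dbl n)) · ĉ n) g)
      two : ∀ g n → P.ι 2 g (suc n) ≈ 0#
      two g n = P-ι-at 2 g (suc n) » *-zeroˡ (zeroʳ _)
      go : ∀ g n → ι (suc (suc (dbl n))) * ĉ n g ≈ (x ⋆ (x ⋆ Q ✚ P.ι 8 ⋆ U) ✚ P.ι 2) g n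
      go g zero = sym (+-cong (x-zero _ g) (P-ι-at 2 g 0) » +-identityˡ _ » *-cong (*-identityʳ _) (sym (at ĉ-0 g)))
      go g (suc zero) = at recursion₁ g » sym (+-cong (x-suc _ g 0) (two g 0) » +-identityʳ _ » +-cong (x-zero Q g) (eight g 0) » +-identityˡ _)
      go g (suc (suc n)) = at (recursion n) g » sym (+-cong (x-suc _ g (suc n)) (two g (suc n)) » +-identityʳ _ » +-cong (x-suc Q g n » +-cong (genus g n) (six g n)) (eight g (suc n)))

    private
      a b y J E : ℕ → Ser
      a = SS.𝟏 ✚ x ⋆ U
      b = a ✚ a
      y = x ⋆ V
      J = (U ✚ G) ⋆ (U ✚ G) ✚ SS.⊖ (U ⋆ (b ⋆ b)) ✚ SS.⊖ (h ⋆ (y ⋆ y))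
      E = x ⋆ (x ⋆ Q ✚ P.ι 8 ⋆ U) ✚ P.ι 2 ✚ SS.⊖ (U ✚ G)

      ΘU : Θ U SS.≋ V ✚ SS.⊖ (P.ι 2 ⋆ U)
      ΘU = P.solve 2 (λ u t → t P.:= P.:2 P.:* u P.:+ t P.:- P.:2 P.:* u) P.refl U (Θ U)

      ΘG : Θ G SS.≋ U ✚ SS.⊖ G
      ΘG = P.solve 2 (λ g t → t P.:= g P.:+ t P.:- g) P.refl G (Θ G)

      ΘUG : Θ (U ✚ G) SS.≋ V ✚ SS.⊖ (U ✚ G)
      ΘUG = Θ-⊕ U G ⋙ P.+-cong ΘU ΘG ⋙ P.solve 3 (λ u v g → v P.:- P.:2 P.:* u P.:+ (u P.:- g) P.:= v P.:- (u P.:+ g)) P.refl U V G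

      Θa : Θ a SS.≋ y
      Θa = Θ-⊕ SS.𝟏 (x ⋆ U) ⋙ P.+-cong Θ-𝟏 (Θ-⊛ x U ⋙ P.+-cong (P.*ʳ {U} Θ-x) (P.*ˡ {x} ΘU)) ⋙ P.solve 3 (λ x u v → P.con (+ 0) P.:+ (P.:2 P.:* x P.:* u P.:+ x P.:* (v P.:- P.:2 P.:* u)) P.:= x P.:* v) P.refl x U V

      Θy : Θ y SS.≋ x ⋆ (W ✚ SS.⊖ V)
      Θy = Θ-⊛ x V ⋙ P.+ʳ (P.*ʳ {V} Θ-x) ⋙ P.solve 3 (λ x v t → P.:2 P.:* x P.:* v P.:+ x P.:* t P.:= x P.:* (P.:3 P.:* v P.:+ t P.:- v)) P.refl x V (Θ V)

      ΘJ : Θ J SS.≋ (V ✚ SS.⊖ (U ✚ G)) ⋆ (U ✚ G) ✚ (U ✚ G) ⋆ (V ✚ SS.⊖ (U ✚ G)) ✚ SS.⊖ ((V ✚ SS.⊖ (P.ι 2 ⋆ U)) ⋆ (b ⋆ b) ✚ U ⋆ ((y ✚ y) ⋆ b ✚ b ⋆ (y ✚ y))) ✚ SS.⊖ (SS.𝟎 ⋆ (y ⋆ y) ✚ h ⋆ ((x ⋆ (W ✚ SS.⊖ V)) ⋆ y ✚ y ⋆ (x ⋆ (W ✚ SS.⊖ V))))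
      ΘJ = P.trans (Θ-⊕ (A ✚ B) D) (P.+-cong (Θ-⊕ A B ⋙ P.+-cong (Θ-⊛ (U ✚ G) (U ✚ G) ⋙ P.+-cong (P.*ʳ {U ✚ G} ΘUG) (P.*ˡ {U ✚ G} ΘUG))
          (Θ-⊖ (U ⋆ (b ⋆ b)) ⋙ P.-‿cong (Θ-⊛ U (b ⋆ b) ⋙ P.+-cong (P.*ʳ {b ⋆ b} ΘU) (P.*ˡ {U} (Θ-⊛ b b ⋙ P.+-cong (P.*ʳ {b} Θb) (P.*ˡ {b} Θb))))))
          (Θ-⊖ (h ⋆ (y ⋆ y)) ⋙ P.-‿cong (Θ-⊛ h (y ⋆ y) ⋙ P.+-cong (P.*ʳ {y ⋆ y} Θ-h) (P.*ˡ {h} (Θ-⊛ y y ⋙ P.+-cong (P.*ʳ {y} Θy) (P.*ˡ {y} Θy))))))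
        where
        A = (U ✚ G) ⋆ (U ✚ G)
        B = SS.⊖ (U ⋆ (b ⋆ b))
        D = SS.⊖ (h ⋆ (y ⋆ y))
        Θb : Θ b SS.≋ y ✚ y
        Θb = Θ-⊕ a a ⋙ P.+-cong Θa Θa

      E≋𝟎 : E SS.≋ SS.𝟎
      E≋𝟎 = P.+ʳ (P.sym quadratic) ⋙ P.-‿inverseʳ _

      -- (2 + Θ) J = -2 V E
      2J+ΘJ : P.ι 2 ⋆ J ✚ Θ J SS.≋ SS.𝟎
      2J+ΘJ = P.+ˡ ΘJ ⋙ P.solve 6 (λ x h u g v w →
          let a = P.:1 P.:+ x P.:* u ; b = a P.:+ a ; y = x P.:* v ; q = h P.:* w P.:+ P.con (+ 6) P.:* (u P.:* u) in
          P.:2 P.:* ((u P.:+ g) P.:* (u P.:+ g) P.:- u P.:* (b P.:* b) P.:- h P.:* (y P.:* y)) P.:+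
            ((v P.:- (u P.:+ g)) P.:* (u P.:+ g) P.:+ (u P.:+ g) P.:* (v P.:- (u P.:+ g)) P.:- ((v P.:- P.:2 P.:* u) P.:* (b P.:* b) P.:+ u P.:* ((y P.:+ y) P.:* b P.:+ b P.:* (y P.:+ y)))
              P.:- (P.con (+ 0) P.:* (y P.:* y) P.:+ h P.:* (x P.:* (w P.:- v) P.:* y P.:+ y P.:* (x P.:* (w P.:- v)))))
          P.:= P.:- P.:2 P.:* v P.:* (x P.:* (x P.:* q P.:+ P.con (+ 8) P.:* u) P.:+ P.:2 P.:- (u P.:+ g))) P.refl x h U G V W ⋙
        P.*-zeroʳ {SS.⊖ P.ι 2 ⋆ V} E≋𝟎

    -- 2 + `Θ` multiplies the coefficient of degree n by 2n + 2, hence is injective: the constant of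
    -- integration is 0.
    discriminant : J SS.≋ SS.𝟎
    discriminant = SS.mk (λ g → mk (λ n → regular (suc (dbl n)) (sym (step-at 2 J g n) » at (SS.at 2J+ΘJ g) n)))

    -- The same equations after the substitution s = X(1 - 3X).

    sub* : (ℕ → Ser) → (ℕ → Ser)
    sub* F g = sub (F g)

    𝐆 𝐔 𝐕 𝐖 σ : ℕ → Ser
    𝐆 = sub* G
    𝐔 = sub* U
    𝐕 = sub* V
    𝐖 = sub* W
    σ = SS.C s

    private
      sub*-⊛ : ∀ F G → sub* (F ⋆ G) SS.≋ sub* F ⋆ sub* G
      sub*-⊛ F G = SS.mk (λ g → Lift.lift-hom seriesRing seriesRing sub sub-cong sub-⊕ sub-⊛ g F G)

      sub*-⊕ : ∀ F G → sub* (F ✚ G) SS.≋ sub* F ✚ sub* G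
      sub*-⊕ F G = SS.mk (λ g → sub-⊕ (F g) (G g))

      sub*-𝟎 : sub* SS.𝟎 SS.≋ SS.𝟎
      sub*-𝟎 = SS.mk (λ g → sub-𝟎)

      sub-𝟏 : sub 𝟏 ≋ 𝟏
      sub-𝟏 = S.trans (sub-cong 𝟏≋C) (sub-C 1# ⟫ S.sym 𝟏≋C)
        where
        𝟏≋C : 𝟏 ≋ C 1#
        𝟏≋C = mk λ { zero → refl ; (suc n) → refl }

      sub*-𝟏 : sub* SS.𝟏 SS.≋ SS.𝟏
      sub*-𝟏 = SS.mk λ { zero → sub-𝟏 ; (suc g) → sub-𝟎 }

      sub*-h : sub* h SS.≋ h
      sub*-h = SS.mk λ { zero → sub-𝟎 ; (suc g) → SS.at sub*-𝟏 g }

      sub*-x : sub* x SS.≋ σ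
      sub*-x = SS.mk λ { zero → sub-X ; (suc g) → sub-𝟎 }

      sub*-ι : ∀ n → sub* (P.ι n) SS.≋ P.ι n
      sub*-ι zero = sub*-𝟎
      sub*-ι (suc zero) = sub*-𝟏
      sub*-ι (suc (suc n)) = sub*-⊕ SS.𝟏 (P.ι (suc n)) ⋙ P.+-cong sub*-𝟏 (sub*-ι (suc n))

      sub-⊖ : ∀ f → sub (⊖ f) ≋ ⊖ sub f
      sub-⊖ f = S.solve 2 (λ a b → a S.:= b S.:+ a S.:- b) S.refl (sub (⊖ f)) (sub f) ⟫ S.+ʳ (S.sym (sub-⊕ f (⊖ f)) ⟫ sub-cong (S.-‿inverseʳ f) ⟫ sub-𝟎) ⟫ S.+-identityˡ _

      sub*-⊖ : ∀ F → sub* (SS.⊖ F) SS.≋ SS.⊖ sub* F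
      sub*-⊖ F = SS.mk (λ g → sub-⊖ (F g))

      sub*-cong : ∀ {F G} → F SS.≋ G → sub* F SS.≋ sub* G
      sub*-cong E = SS.mk (λ g → sub-cong (SS.at E g))

      _⟪⊛⟫_ : ∀ {F G F' G'} → sub* F SS.≋ F' → sub* G SS.≋ G' → sub* (F ⋆ G) SS.≋ F' ⋆ G'
      _⟪⊛⟫_ {F} {G} p q = sub*-⊛ F G ⋙ P.*-cong p q

      _⟪⊕⟫_ : ∀ {F G F' G'} → sub* F SS.≋ F' → sub* G SS.≋ G' → sub* (F ✚ G) SS.≋ F' ✚ G'
      _⟪⊕⟫_ {F} {G} p q = sub*-⊕ F G ⋙ P.+-cong p q

      ⟪⊖⟫_ : ∀ {F F'} → sub* F SS.≋ F' → sub* (SS.⊖ F) SS.≋ SS.⊖ F'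
      ⟪⊖⟫_ {F} p = sub*-⊖ F ⋙ P.-‿cong p

      var : ∀ F → sub* F SS.≋ sub* F
      var F = P.refl

    quadratic-t : 𝐔 ✚ 𝐆 SS.≋ σ ⋆ (σ ⋆ (h ⋆ 𝐖 ✚ P.ι 6 ⋆ (𝐔 ⋆ 𝐔)) ✚ P.ι 8 ⋆ 𝐔) ✚ P.ι 2
    quadratic-t = P.sym (sub*-⊕ U G) ⋙ sub*-cong quadratic ⋙ ((sub*-x ⟪⊛⟫ ((sub*-x ⟪⊛⟫ ((sub*-h ⟪⊛⟫ var W) ⟪⊕⟫ (sub*-ι 6 ⟪⊛⟫ (var U ⟪⊛⟫ var U)))) ⟪⊕⟫ (sub*-ι 8 ⟪⊛⟫ var U))) ⟪⊕⟫ sub*-ι 2)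

    discriminant-t : (𝐔 ✚ 𝐆) ⋆ (𝐔 ✚ 𝐆) ✚ SS.⊖ (𝐔 ⋆ (((SS.𝟏 ✚ σ ⋆ 𝐔) ✚ (SS.𝟏 ✚ σ ⋆ 𝐔)) ⋆ ((SS.𝟏 ✚ σ ⋆ 𝐔) ✚ (SS.𝟏 ✚ σ ⋆ 𝐔)))) ✚ SS.⊖ (h ⋆ ((σ ⋆ 𝐕) ⋆ (σ ⋆ 𝐕))) SS.≋ SS.𝟎
    discriminant-t = P.sym ((((var U ⟪⊕⟫ var G) ⟪⊛⟫ (var U ⟪⊕⟫ var G)) ⟪⊕⟫ (⟪⊖⟫ (var U ⟪⊛⟫ (sub-b ⟪⊛⟫ sub-b)))) ⟪⊕⟫ (⟪⊖⟫ (sub*-h ⟪⊛⟫ (sub-y ⟪⊛⟫ sub-y)))) ⋙ sub*-cong discriminant ⋙ sub*-𝟎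
      where
      sub-a : sub* a SS.≋ SS.𝟏 ✚ σ ⋆ 𝐔
      sub-a = sub*-𝟏 ⟪⊕⟫ (sub*-x ⟪⊛⟫ var U)
      sub-b : sub* b SS.≋ (SS.𝟏 ✚ σ ⋆ 𝐔) ✚ (SS.𝟏 ✚ σ ⋆ 𝐔)
      sub-b = sub-a ⟪⊕⟫ sub-a
      sub-y : sub* y SS.≋ σ ⋆ 𝐕
      sub-y = sub*-x ⟪⊛⟫ var V

    private
      -- The chain rule: 2s d/ds becomes 2s/(1-6t) d/dt because ds/dt = 1 - 6t.
      sub-θ : ∀ f → sub (ι 2 · θ f) ≋ ϑ (sub f)
      sub-θ f = sub-· (ι 2) (θ f) ⟫ S.sym (ιs⊛ 2 (sub (θ f))) ⟫ S.*ˡ {S.ι 2} (sub-cong (S.sym (X⊛d f)) ⟫ sub-⊛ X (d f) ⟫ S.*ʳ {sub (d f)} sub-X ⟫ S.sym (S.*ˡ {1- 3 X} (S.*ˡ {e} (S.sym (X⊛d (sub f)) ⟫ S.*ˡ {X} (sub-d f))) ⟫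
          S.solve 5 (λ γ e x β y → γ S.:* (e S.:* (x S.:* (β S.:* y))) S.:= β S.:* e S.:* (x S.:* γ S.:* y)) S.refl (1- 3 X) e X (1- 6 X) (sub (d f)) ⟫ S.*ʳ {s ⊛ sub (d f)} (geo-inverse 6) ⟫ S.*-identityˡ (s ⊛ sub (d f))))

    𝐔-step : ∀ g → 𝐔 g ≋ 𝐆 g ⊕ ϑ (𝐆 g)
    𝐔-step g = sub-⊕ (G g) (Θ G g) ⟫ S.+ˡ (sub-θ (G g))

    private
      next-step : ∀ m F g → sub ((P.ι m ⋆ F ✚ Θ F) g) ≋ S.ι m ⊛ sub (F g) ⊕ ϑ (sub (F g))
      next-step m F g = sub-⊕ ((P.ι m ⋆ F) g) (Θ F g) ⟫ S.+-cong (sub-cong (P-ι⊛ m F g) ⟫ sub-⊛ (S.ι m) (F g) ⟫ S.*ʳ {sub (F g)} (sub-cong (ιs-C m) ⟫ sub-C (ι m) ⟫ S.sym (ιs-C m))) (sub-θ (F g))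

    𝐕-step : ∀ g → 𝐕 g ≋ S.ι 2 ⊛ 𝐔 g ⊕ ϑ (𝐔 g)
    𝐕-step = next-step 2 U

    𝐖-step : ∀ g → 𝐖 g ≋ S.ι 3 ⊛ 𝐕 g ⊕ ϑ (𝐕 g)
    𝐖-step = next-step 3 V

-- Genus 0 in closed form and higher genus by algebraic recursion

module FixedGenus (K : CommutativeRing 0ℓ 0ℓ) (inv : ℕ → CommutativeRing.Carrier K) (inv-l : ∀ n → CommutativeRing._≈_ K (CommutativeRing._*_ K (Kit.ι K (suc n)) (inv n)) (CommutativeRing.1# K)) where

  open Kit K
  open Series K
  open Substitution K
  open Rational K
  open GenusSeries K inv inv-l
  private module P = SS.S
  open P using () renaming (_»_ to infixr 5 _⋙_)

  q : Ser
  q = geo 3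

  private
    C-cong : ∀ {F G} → F ≋ G → SS.C F SS.≋ SS.C G
    C-cong E = SS.mk λ { zero → E ; (suc n) → S.refl }

    C-⊛ : ∀ F G → SS.C (F ⊛ G) SS.≋ SS.C F ⋆ SS.C G
    C-⊛ F G = P.sym (SS.C⊛ F (SS.C G) ⋙ (SS.mk λ { zero → S.refl ; (suc n) → S.zeroʳ F }))

    C-𝟏 : SS.C 𝟏 SS.≋ SS.𝟏
    C-𝟏 = SS.mk λ { zero → S.refl ; (suc n) → S.refl }

    C-1-aX : ∀ a → SS.C (1- a X) SS.≋ SS.𝟏 ✚ SS.⊖ (P.ι a ⋆ x)
    C-1-aX a = (SS.mk λ { zero → S.refl ; (suc n) → S.sym (S.+-identityˡ _ ⟫ S.-‿cong (S.zeroʳ (S.ι a)) ⟫ S.-0#≈0#) }) ⋙ P.+ˡ (P.-‿cong (P.sym (SS.ιs⊛ a x)))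

    C-inverse : ∀ a → SS.C (1- a X) ⋆ SS.C (geo a) SS.≋ SS.𝟏
    C-inverse a = P.sym (C-⊛ (1- a X) (geo a)) ⋙ C-cong (geo-inverse a) ⋙ C-𝟏

  module Fixed (ĉ : ℕ → Ser) (ĉ-0 : ĉ 0 ≋ 𝟏) (recursion₁ : ι 4 · ĉ 1 ≋ ι 8 · ι 1 · ĉ 0) (recursion : ∀ n → ι (dbl (3 N.+ n)) · ĉ (2 N.+ n) ≋ X ⊛ (ι (suc (suc (suc (dbl n)))) · ι (suc (suc (dbl n))) · ι (suc (dbl n)) · ĉ n)
                   ⊕ ι 6 · ((λ k → ι (suc (dbl k)) · ĉ k) ⋆ (λ k → ι (suc (dbl k)) · ĉ k)) n ⊕ ι 8 · ι (suc (dbl (suc n))) · ĉ (suc n)) where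

    open Equations ĉ ĉ-0 recursion₁ recursion public

    private
      a b : Ser
      a = 𝟏 ⊕ s ⊛ 𝐔 0
      b = 𝟏 ⊕ S.ι 3 ⊛ (s ⊛ 𝐔 0)

      1+s⊛ : ∀ c F → (𝟏 ⊕ c ⊛ (s ⊛ F)) 0 ≈ 1#
      1+s⊛ c F = +ˡ (*-zeroʳ (*-zeroˡ (zeroˡ _))) » +-identityʳ _

      U+C : 𝐔 0 ⊕ 𝐆 0 ≋ S.ι 2 ⊛ (a ⊛ b)
      U+C = SS.at quadratic-t 0 ⟫ S.solve 3 (λ s u w → s S.:* (s S.:* (S.con (+ 0) S.:* w S.:+ S.con (+ 6) S.:* (u S.:* u)) S.:+ S.con (+ 8) S.:* u) S.:+ S.:2
        S.:= S.:2 S.:* ((S.:1 S.:+ s S.:* u) S.:* (S.:1 S.:+ S.:3 S.:* (s S.:* u)))) S.refl s (𝐔 0) (𝐖 0)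

      -- In genus 0 the differential equation factors as U + G = 2ab, and the first integral reads
      -- (U + G)² = 4 a² U; the series a has constant term 1 and cancels.
      U≋bb : 𝐔 0 ≋ b ⊛ b
      U≋bb = S.sym (S.≈-from-- (unit-cancel a0 (unit-cancel {a} {a ⊛ (b ⊛ b ⊕ ⊖ 𝐔 0)} a0 (S-regular 3 {a ⊛ (a ⊛ (b ⊛ b ⊕ ⊖ 𝐔 0))} {𝟎} (
          S.solve 4 (λ a b u y → S.:4 S.:* (a S.:* (a S.:* (b S.:* b S.:- u))) S.:= S.:2 S.:* (a S.:* b) S.:* (S.:2 S.:* (a S.:* b)) S.:- u S.:* ((a S.:+ a) S.:* (a S.:+ a)) S.:- S.con (+ 0) S.:* y) S.refl a b (𝐔 0) ((s ⊛ 𝐕 0) ⊛ (s ⊛ 𝐕 0)) ⟫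
          S.+ʳ (S.+ʳ (S.sym (S.*-cong U+C U+C))) ⟫
          SS.at discriminant-t 0 ⟫ S.sym (S.zeroʳ (S.ι 4)))))))
        where
        a0 : a 0 ≈ 1#
        a0 = +ˡ (*-zeroˡ (zeroˡ _)) » +-identityʳ _

      γq : 1- 3 X ⊛ q ≋ 𝟏
      γq = geo-inverse 3

      sq : s ⊛ q ≋ X
      sq = S.*-assoc X (1- 3 X) q ⟫ S.*ˡ {X} γq ⟫ S.*-identityʳ X

      -- Both series solve b = 1 + 3 s b², the second because s q = t. The difference of the two
      -- equations has the factor 1 - 3s(b + q), whose constant term is 1.
      b≋q : b ≋ q
      b≋q = S.≈-from-- (unit-cancel {𝟏 ⊕ ⊖ S.ι 3 ⊛ (s ⊛ (b ⊕ q))} (1+s⊛ (⊖ S.ι 3) (b ⊕ q)) (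
        S.solve 4 (λ s b q u → (S.:1 S.:+ (S.:- S.:3) S.:* (s S.:* (b S.:+ q))) S.:* (b S.:- q) S.:= (b S.:- S.:3 S.:* (s S.:* (b S.:* b))) S.:- (q S.:- S.:3 S.:* (s S.:* q S.:* q))) S.refl s b q (𝐔 0) ⟫
        S.+-cong (S.+ˡ (S.-‿cong (S.*ˡ {S.ι 3} (S.*ˡ {s} (S.sym U≋bb)))) ⟫ S.solve 1 (λ t → S.:1 S.:+ S.:3 S.:* t S.:- S.:3 S.:* t S.:= S.:1) S.refl (s ⊛ 𝐔 0))
          (S.-‿cong (S.+ˡ (S.-‿cong (S.*ˡ {S.ι 3} (S.*ʳ {q} sq))) ⟫ S.solve 2 (λ x q → q S.:- S.:3 S.:* (x S.:* q) S.:= (S.:1 S.:- S.:3 S.:* x) S.:* q) S.refl X q ⟫ γq)) ⟫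
          S.-‿inverseʳ 𝟏))

    𝐔-0 : 𝐔 0 ≋ q ⊛ q
    𝐔-0 = U≋bb ⟫ S.*-cong b≋q b≋q

    𝐆-0 : 𝐆 0 ≋ 1- 4 X ⊛ (q ⊛ q)
    𝐆-0 = S.trans (S.solve 2 (λ g u → g S.:= u S.:+ g S.:- u) S.refl (𝐆 0) (𝐔 0)) (S.+-cong (U+C ⟫ S.*ˡ {S.ι 2} (S.*-cong (S.+-cong (S.sym γq) sU) b≋q)) (S.-‿cong 𝐔-0) ⟫
      S.solve 2 (λ x q → S.:2 S.:* (((S.:1 S.:- S.:3 S.:* x) S.:* q S.:+ x S.:* q) S.:* q) S.:- q S.:* q S.:= (S.:1 S.:- S.:4 S.:* x) S.:* (q S.:* q)) S.refl X q)
      where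
      sU : s ⊛ 𝐔 0 ≋ X ⊛ q
      sU = S.*ˡ {s} 𝐔-0 ⟫ S.sym (S.*-assoc s q q) ⟫ S.*ʳ {q} sq

    private
      θq : θ q ≋ X ⊛ (S.ι 3 ⊛ (q ⊛ q))
      θq = S.sym (X⊛d q) ⟫ S.*ˡ {X} (d-geo 3)

    𝐕-0 : 𝐕 0 ≋ S.ι 2 ⊛ (q ⊛ (q ⊛ e))
    𝐕-0 = 𝐕-step 0 ⟫ S.+-cong (S.*ˡ {S.ι 2} 𝐔-0) (S.*ˡ {S.ι 2} (S.*ˡ {1- 3 X} (S.*ˡ {e} (θ-cong 𝐔-0 ⟫ θ-leibniz q q ⟫ S.+-cong (S.*ʳ {q} θq) (S.*ˡ {q} θq))))) ⟫
      S.solve 4 (λ x q e g → S.:2 S.:* (q S.:* q) S.:+ S.:2 S.:* (g S.:* (e S.:* (x S.:* (S.:3 S.:* (q S.:* q)) S.:* q S.:+ q S.:* (x S.:* (S.:3 S.:* (q S.:* q))))))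
        S.:= S.:2 S.:* (q S.:* q) S.:+ S.con (+ 12) S.:* (x S.:* e S.:* (q S.:* q)) S.:* (g S.:* q)) S.refl X q e (1- 3 X) ⟫
      S.+-cong (S.*ˡ {S.ι 2} (S.sym (S.*-identityˡ (q ⊛ q)) ⟫ S.*ʳ {q ⊛ q} (S.sym (geo-inverse 6)))) (S.*ˡ {S.ι 12 ⊛ (X ⊛ e ⊛ (q ⊛ q))} γq ⟫ S.*-identityʳ _) ⟫
        S.solve 3 (λ x q e → S.:2 S.:* ((S.:1 S.:- S.con (+ 6) S.:* x) S.:* e S.:* (q S.:* q)) S.:+ S.con (+ 12) S.:* (x S.:* e S.:* (q S.:* q)) S.:= S.:2 S.:* (q S.:* (q S.:* e))) S.refl X q e

    G⁺ U⁺ V⁺ : ℕ → Ser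
    G⁺ = 𝐆 ∘ suc
    U⁺ = 𝐔 ∘ suc
    V⁺ = 𝐕 ∘ suc

    private
      q̂ f̂ ê α β γ : ℕ → Ser
      q̂ = SS.C q
      f̂ = SS.C f
      ê = SS.C e
      α = SS.C (1- 2 X)
      β = SS.C (1- 6 X)
      γ = SS.C (1- 3 X)

      infix 8 1-_x
      1-_x : ℕ → ℕ → Ser
      1- n x = SS.𝟏 ✚ SS.⊖ (P.ι n ⋆ x)

      σ≋ : σ SS.≋ x ⋆ γ
      σ≋ = C-⊛ X (1- 3 X)

      σq : σ ⋆ q̂ SS.≋ x
      σq = P.sym (C-⊛ s q) ⋙ C-cong sq

      γq̂ : γ ⋆ q̂ SS.≋ SS.𝟏
      γq̂ = C-inverse 3

      U-split : 𝐔 SS.≋ q̂ ⋆ q̂ ✚ h ⋆ U⁺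
      U-split = SS.split-head 𝐔 ⋙ P.+ʳ (C-cong 𝐔-0 ⋙ C-⊛ q q)

      G-split : 𝐆 SS.≋ 1- 4 x ⋆ (q̂ ⋆ q̂) ✚ h ⋆ G⁺
      G-split = SS.split-head 𝐆 ⋙ P.+ʳ (C-cong 𝐆-0 ⋙ C-⊛ (1- 4 X) (q ⊛ q) ⋙ P.*-cong (C-1-aX 4) (C-⊛ q q))

      V-split : 𝐕 SS.≋ P.ι 2 ⋆ (q̂ ⋆ (q̂ ⋆ ê)) ✚ h ⋆ V⁺
      V-split = SS.split-head 𝐕 ⋙ P.+ʳ (C-cong 𝐕-0 ⋙ C-⊛ (S.ι 2) (q ⊛ (q ⊛ e)) ⋙ P.*-cong (P.sym (SS.ιs-C 2)) (C-⊛ q (q ⊛ e) ⋙ P.*ˡ {q̂} (C-⊛ q e)))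

      a-split : SS.𝟏 ✚ σ ⋆ 𝐔 SS.≋ 1- 2 x ⋆ q̂ ✚ h ⋆ (σ ⋆ U⁺)
      a-split = P.+-cong (P.sym γq̂ ⋙ P.*ʳ {q̂} (C-1-aX 3)) (P.*ˡ {σ} U-split ⋙ P.solve 4 (λ s q h u → s P.:* (q P.:* q P.:+ h P.:* u) P.:= s P.:* q P.:* q P.:+ h P.:* (s P.:* u)) P.refl σ q̂ h U⁺ ⋙ P.+ʳ (P.*ʳ {q̂} σq)) ⋙
        P.solve 3 (λ x q t → (P.:1 P.:- P.:3 P.:* x) P.:* q P.:+ (x P.:* q P.:+ t) P.:= (P.:1 P.:- P.:2 P.:* x) P.:* q P.:+ t) P.refl x q̂ (h ⋆ (σ ⋆ U⁺))

      y Z : ℕ → Ser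
      y = σ ⋆ 𝐕
      Z = P.ι 4 ⋆ (1- 2 x ⋆ (q̂ ⋆ q̂) ⋆ G⁺) ✚ h ⋆ (1- 2 x ⋆ 1- 6 x ⋆ (U⁺ ⋆ U⁺) ✚ P.ι 2 ⋆ (U⁺ ⋆ G⁺) ✚ G⁺ ⋆ G⁺) ✚ SS.⊖ (P.ι 4 ⋆ (h ⋆ (h ⋆ (σ ⋆ σ ⋆ (U⁺ ⋆ (U⁺ ⋆ U⁺)))))) ✚ SS.⊖ (y ⋆ y)

      J≋ : ∀ {u u' g g' a a'} → u SS.≋ u' → g SS.≋ g' → a SS.≋ a' → (u ✚ g) ⋆ (u ✚ g) ✚ SS.⊖ (u ⋆ ((a ✚ a) ⋆ (a ✚ a))) ✚ SS.⊖ (h ⋆ (y ⋆ y)) SS.≋ (u' ✚ g') ⋆ (u' ✚ g') ✚ SS.⊖ (u' ⋆ ((a' ✚ a') ⋆ (a' ✚ a'))) ✚ SS.⊖ (h ⋆ (y ⋆ y))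
      J≋ p r t = P.+ʳ (P.+-cong (P.*-cong (P.+-cong p r) (P.+-cong p r)) (P.-‿cong (P.*-cong p (P.*-cong (P.+-cong t t) (P.+-cong t t)))))

      -- J expanded around genus 0. The coefficient of the linear term in `U⁺` would be 2(U + G) -
      -- 4(1 + sU)(1 + 3sU) at genus 0, which vanishes by the genus-0 equation; thus `U⁺` enters Z
      -- only with a further factor h.
      hZ : h ⋆ Z SS.≋ SS.𝟎
      hZ = P.trans (P.sym (P.+-identityʳ _) ⋙ P.+ˡ (P.sym (P.*-zeroˡ (P.+ʳ σq ⋙ P.-‿inverseʳ x)))) (P.sym identity ⋙ P.sym (J≋ U-split G-split a-split) ⋙ discriminant-t)
        where
        -- The relation σ q = x cannot be given to the solver, so its multiple is split off
        -- explicitly.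
        identity : _ SS.≋ h ⋆ Z ✚ (σ ⋆ q̂ ✚ SS.⊖ x) ⋆ (SS.⊖ P.ι 4 ⋆ (h ⋆ U⁺) ⋆ (P.ι 2 ⋆ (q̂ ⋆ q̂) ⋆ 1- 2 x ✚ (σ ⋆ q̂ ✚ x) ⋆ (h ⋆ U⁺) ✚ P.ι 2 ⋆ 1- 2 x ⋆ (h ⋆ U⁺)))
        identity = P.solve 7 (λ x q h u c y s →
          let 𝑢 = q P.:* q P.:+ h P.:* u ; g = (P.:1 P.:- P.:4 P.:* x) P.:* (q P.:* q) P.:+ h P.:* c ; a = (P.:1 P.:- P.:2 P.:* x) P.:* q P.:+ h P.:* (s P.:* u)
              α = P.:1 P.:- P.:2 P.:* x in
          (𝑢 P.:+ g) P.:* (𝑢 P.:+ g) P.:- 𝑢 P.:* ((a P.:+ a) P.:* (a P.:+ a)) P.:- h P.:* (y P.:* y)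
          P.:= h P.:* (P.:4 P.:* (α P.:* (q P.:* q) P.:* c) P.:+ h P.:* (α P.:* (P.:1 P.:- P.con (+ 6) P.:* x) P.:* (u P.:* u) P.:+ P.:2 P.:* (u P.:* c) P.:+ c P.:* c)
              P.:- P.:4 P.:* (h P.:* (h P.:* (s P.:* s P.:* (u P.:* (u P.:* u))))) P.:- y P.:* y)
            P.:+ (s P.:* q P.:- x) P.:* (P.:- P.:4 P.:* (h P.:* u) P.:* (P.:2 P.:* (q P.:* q) P.:* α P.:+ (s P.:* q P.:+ x) P.:* (h P.:* u) P.:+ P.:2 P.:* α P.:* (h P.:* u)))) P.refl x q̂ h U⁺ G⁺ y σ

      Z≋𝟎 : Z SS.≋ SS.𝟎
      Z≋𝟎 = SS.X-cancel (hZ ⋙ P.sym (P.zeroʳ h))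

      γy : γ ⋆ y SS.≋ x ⋆ (P.ι 2 ⋆ ê ✚ h ⋆ (γ ⋆ (γ ⋆ V⁺)))
      γy = P.*ˡ {γ} (P.*-cong σ≋ V-split) ⋙
        P.solve 6 (λ g x q e h v → g P.:* (x P.:* g P.:* (P.:2 P.:* (q P.:* (q P.:* e)) P.:+ h P.:* v)) P.:= x P.:* (P.:2 P.:* (g P.:* q P.:* (g P.:* q) P.:* e) P.:+ h P.:* (g P.:* (g P.:* v)))) P.refl γ x q̂ ê h V⁺ ⋙
        P.*ˡ {x} (P.+ʳ (P.*ˡ {P.ι 2} (P.*ʳ {ê} (P.*-cong γq̂ γq̂) ⋙ P.solve 1 (λ e → P.:1 P.:* P.:1 P.:* e P.:= e) P.refl ê)))

      t₁ t₂ t₃ t₄ t₅ t₆ t₇ : ℕ → Ser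
      t₁ = P.ι 4 ⋆ (x ⋆ (x ⋆ (f̂ ⋆ (ê ⋆ (ê ⋆ SS.𝟏)))))
      t₂ = P.ι 4 ⋆ (x ⋆ (x ⋆ (γ ⋆ (γ ⋆ (f̂ ⋆ (ê ⋆ V⁺))))))
      t₃ = x ⋆ (x ⋆ (γ ⋆ (γ ⋆ (γ ⋆ (γ ⋆ (f̂ ⋆ (V⁺ ⋆ V⁺)))))))
      t₄ = γ ⋆ (γ ⋆ (β ⋆ (U⁺ ⋆ U⁺)))
      t₅ = P.ι 2 ⋆ (γ ⋆ (γ ⋆ (f̂ ⋆ (U⁺ ⋆ G⁺))))
      t₆ = γ ⋆ (γ ⋆ (f̂ ⋆ (G⁺ ⋆ G⁺)))
      t₇ = P.ι 4 ⋆ (x ⋆ (x ⋆ (γ ⋆ (γ ⋆ (γ ⋆ (γ ⋆ (f̂ ⋆ (U⁺ ⋆ (U⁺ ⋆ U⁺)))))))))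

      Φ : (y' s' w : ℕ → Ser) → ℕ → Ser
      Φ y' s' w = f̂ ⋆ (y' ⋆ y') ✚ P.ι 4 ⋆ (h ⋆ (h ⋆ (f̂ ⋆ (γ ⋆ γ) ⋆ (s' ⋆ s') ⋆ (U⁺ ⋆ (U⁺ ⋆ U⁺))))) ✚ SS.⊖ (h ⋆ (γ ⋆ γ ⋆ (w ⋆ (U⁺ ⋆ U⁺) ✚ f̂ ⋆ (P.ι 2 ⋆ (U⁺ ⋆ G⁺) ✚ G⁺ ⋆ G⁺))))

      -- Z = 0 multiplied by (1-3t)²/(1-2t), which leaves 4 G⁺ alone. Apart from the explicit term
      -- t₁, everything on the right carries a factor h and so involves lower genera only.
      genus-system : P.ι 4 ⋆ G⁺ SS.≋ t₁ ✚ h ⋆ t₂ ✚ h ⋆ (h ⋆ t₃) ✚ SS.⊖ (h ⋆ t₄) ✚ SS.⊖ (h ⋆ t₅) ✚ SS.⊖ (h ⋆ t₆) ✚ h ⋆ (h ⋆ t₇)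
      genus-system = P.trans (P.sym (P.*-identityˡ (P.ι 4 ⋆ G⁺)) ⋙ P.*ʳ {P.ι 4 ⋆ G⁺} (P.sym (P.*-cong unit (P.*-cong γq̂ γq̂) ⋙ P.solve 0 (P.:1 P.:* (P.:1 P.:* P.:1) P.:= P.:1) P.refl) ⋙ P.*ʳ {γ ⋆ q̂ ⋆ (γ ⋆ q̂)} (P.*ʳ {f̂} (C-1-aX 2))))
        (P.solve 9 (λ x f g q h u c y s →
            let α = P.:1 P.:- P.:2 P.:* x ; β = P.:1 P.:- P.con (+ 6) P.:* x ; φ = f P.:* (y P.:* (y P.:* (g P.:* g))) in
            α P.:* f P.:* (g P.:* q P.:* (g P.:* q)) P.:* (P.:4 P.:* c)
            P.:= f P.:* (g P.:* g) P.:* (P.:4 P.:* (α P.:* (q P.:* q) P.:* c) P.:+ h P.:* (α P.:* β P.:* (u P.:* u) P.:+ P.:2 P.:* (u P.:* c) P.:+ c P.:* c) P.:- P.:4 P.:* (h P.:* (h P.:* (s P.:* s P.:* (u P.:* (u P.:* u))))) P.:- y P.:* y)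
              P.:+ (f P.:* (g P.:* y P.:* (g P.:* y)) P.:+ P.:4 P.:* (h P.:* (h P.:* (f P.:* (g P.:* g) P.:* (s P.:* s) P.:* (u P.:* (u P.:* u)))))
                P.:- h P.:* (g P.:* g P.:* (α P.:* f P.:* β P.:* (u P.:* u) P.:+ f P.:* (P.:2 P.:* (u P.:* c) P.:+ c P.:* c))))) P.refl x f̂ γ q̂ h U⁺ G⁺ y σ ⋙
        P.+-cong (P.*-zeroʳ {f̂ ⋆ (γ ⋆ γ)} Z≋𝟎) (Φ-cong γy σ≋ (P.*ʳ {1- 6 x} (P.*ʳ {f̂} (P.sym (C-1-aX 2)) ⋙ unit) ⋙ P.*-identityˡ (1- 6 x) ⋙ P.sym (C-1-aX 6))) ⋙
          P.solve 9 (λ x f g h u c e v β → P.con (+ 0) P.:+ (f P.:* (x P.:* (P.:2 P.:* e P.:+ h P.:* (g P.:* (g P.:* v))) P.:* (x P.:* (P.:2 P.:* e P.:+ h P.:* (g P.:* (g P.:* v)))))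
                P.:+ P.:4 P.:* (h P.:* (h P.:* (f P.:* (g P.:* g) P.:* (x P.:* g P.:* (x P.:* g)) P.:* (u P.:* (u P.:* u)))))
                P.:- h P.:* (g P.:* g P.:* (β P.:* (u P.:* u) P.:+ f P.:* (P.:2 P.:* (u P.:* c) P.:+ c P.:* c))))
            P.:= P.:4 P.:* (x P.:* (x P.:* (f P.:* (e P.:* (e P.:* P.:1))))) P.:+ h P.:* (P.:4 P.:* (x P.:* (x P.:* (g P.:* (g P.:* (f P.:* (e P.:* v)))))))
              P.:+ h P.:* (h P.:* (x P.:* (x P.:* (g P.:* (g P.:* (g P.:* (g P.:* (f P.:* (v P.:* v))))))))) P.:- h P.:* (g P.:* (g P.:* (β P.:* (u P.:* u))))
              P.:- h P.:* (P.:2 P.:* (g P.:* (g P.:* (f P.:* (u P.:* c))))) P.:- h P.:* (g P.:* (g P.:* (f P.:* (c P.:* c))))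
              P.:+ h P.:* (h P.:* (P.:4 P.:* (x P.:* (x P.:* (g P.:* (g P.:* (g P.:* (g P.:* (f P.:* (u P.:* (u P.:* u))))))))))))
            P.refl x f̂ γ h U⁺ G⁺ ê V⁺ β)
        where
        unit : α ⋆ f̂ SS.≋ SS.𝟏
        unit = C-inverse 2
        Φ-cong : ∀ {y₁ y₂ s₁ s₂ w₁ w₂} → y₁ SS.≋ y₂ → s₁ SS.≋ s₂ → w₁ SS.≋ w₂ → Φ y₁ s₁ w₁ SS.≋ Φ y₂ s₂ w₂
        Φ-cong p r t = P.+-cong (P.+-cong (P.*ˡ {f̂} (P.*-cong p p)) (P.*ˡ {P.ι 4} (P.*ˡ {h} (P.*ˡ {h} (P.*ʳ {U⁺ ⋆ (U⁺ ⋆ U⁺)} (P.*ˡ {f̂ ⋆ (γ ⋆ γ)} (P.*-cong r r))))))) (P.-‿cong (P.*ˡ {h} (P.*ˡ {γ ⋆ γ} (P.+ʳ (P.*ʳ {U⁺ ⋆ U⁺} t)))))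

    𝐆-1 : 𝐆 1 ≋ X ⊛ (X ⊛ (f ⊛ (e ⊛ (e ⊛ 𝟏))))
    𝐆-1 = S-regular 3 (SS.at genus-system 0 ⟫ S.solve 7 (λ t a b c d e g → t S.:+ S.con (+ 0) S.:* a S.:+ S.con (+ 0) S.:* (S.con (+ 0) S.:* b) S.:- S.con (+ 0) S.:* c S.:- S.con (+ 0) S.:* d S.:- S.con (+ 0) S.:* e
      S.:+ S.con (+ 0) S.:* (S.con (+ 0) S.:* g) S.:= t) S.refl (t₁ 0) (t₂ 0) (t₃ 0) (t₄ 0) (t₅ 0) (t₆ 0) (t₇ 0))

    private
      g-X : ∀ {N a b n F} → Graded N a b n F → Graded N a b (suc n) (x ⋆ F)
      g-X = Graded-map 0 0 1 (Rat-poly {1} {p = X} (Top.poly Top-X))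

      g-γ : ∀ {N a b n F} → Graded N a b n F → Graded N a b (suc n) (γ ⋆ F)
      g-γ = Graded-map 0 0 1 (Rat-poly {1} {p = 1- 3 X} (Top.poly (Top-1-aX 3)))

      g-f : ∀ {N a b n F} → Graded N a b n F → Graded N (suc a) b n (f̂ ⋆ F)
      g-f = Graded-map 1 0 0 Rat-f

      g-e : ∀ {N a b n F} → Graded N a b n F → Graded N a (suc b) n (ê ⋆ F)
      g-e = Graded-map 0 1 0 Rat-e

      g-ι : ∀ m {N a b n F} → Graded N a b n F → Graded N a b n (P.ι m ⋆ F)
      g-ι m {F = F} g = Graded-cong (P.*ʳ {F} (P.sym (SS.ιs-C m))) (Graded-map 0 0 0 (Rat-poly {0} {p = S.ι m} (Top.poly (Top-ι m))) g)

      g-quarter : ∀ {N a b n F} → Graded N a b n (P.ι 4 ⋆ F) → Graded N a b n F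
      g-quarter {F = F} g = Graded-cong (SS.mk (λ k → SS.at (SS.C⊛ (C (inv 3)) (P.ι 4 ⋆ F)) k ⟫ mk (λ n → at (C⊛ (inv 3) ((P.ι 4 ⋆ F) k)) n »
          *ˡ (at (P-ι⊛ 4 F k) n » at (ιs⊛ 4 (F k)) n) » sym (*-assoc _ _ _) » *ʳ (*-comm _ _ » inv-l 3) » *-identityˡ _)))
        (Graded-map 0 0 0 (Rat-poly {0} {p = C (inv 3)} (λ k → refl)) g)

      g-𝟏 : ∀ {N} → Graded N 0 0 0 SS.𝟏
      g-𝟏 = graded λ { zero _ → rat 𝟏 (λ k → refl) (S.solve 0 (S.:1 S.:= S.:1 S.:* (S.:1 S.:* S.:1)) S.refl) ; (suc k) _ → Rat-0 S.refl }

      -- Every term fits the class (1, 2, 2) after a shift by (3, 5, 8) for each factor h, the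
      -- smaller ones once numerator and denominator are padded. In t₄ the factor 1-6t has to be
      -- spent on a pole, or the pole order and the degree would be too large by one.
      g-step : ∀ N → Graded N 1 2 2 G⁺ → Graded (suc N) 1 2 2 G⁺
      g-step N gG = g-quarter (Graded-cong (P.sym genus-system) (Graded-⊕ (Graded-⊕ (Graded-⊕ (Graded-⊕ (Graded-⊕ (Graded-⊕ (g-ι 4 (g-X (g-X (g-f (g-e (g-e g-𝟏)))))) (Graded-X (g-ι 4 (g-X (g-X (g-γ (g-γ (g-f (g-e gV)))))))))
          (Graded-< (Graded-X (Graded-X (g-X (g-X (g-γ (g-γ (g-γ (g-γ (g-f (Graded-⊛ gV gV))))))))))))
          (Graded-⊖ (Graded-X (g-γ (g-γ (Graded-e⁻ (Graded-⊛ gU gU)))))))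
          (Graded-⊖ (Graded-X (g-ι 2 (Graded-suc (Graded-raise 1 (g-γ (g-γ (g-f (Graded-⊛ gU gG))))))))))
          (Graded-⊖ (Graded-X (Graded-raise 3 (Graded-raise-f (g-γ (g-γ (g-f (Graded-⊛ gG gG)))))))))
          (Graded-< (Graded-X (Graded-X (g-ι 4 (g-X (g-X (g-γ (g-γ (g-γ (g-γ (g-f (Graded-⊛ gU (Graded-⊛ gU gU)))))))))))))))
        where
        gU : Graded N 2 4 4 U⁺
        gU = Graded-cong (SS.mk (λ k → S.+ʳ (S.*-identityˡ (G⁺ k)) ⟫ S.sym (𝐔-step (suc k)))) (Graded-ϑ 1 E.refl gG)
        gV : Graded N 3 6 6 V⁺
        gV = Graded-cong (SS.mk (λ k → S.sym (𝐕-step (suc k)))) (Graded-ϑ 2 E.refl gU)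

    rational : ∀ k → Rat (1 N.+ k N.* 3) (2 N.+ k N.* 5) (2 N.+ k N.* 8) (𝐆 (suc k))
    rational k = term (every (suc k)) k NP.≤-refl
      where
      every : ∀ N → Graded N 1 2 2 G⁺
      every zero = graded (λ k ())
      every (suc N) = g-step N (every N)

    -- The equation of genus g = k + 1 with the genus-0 series inserted.
    linear : ∀ k → 1- 2 X ⊛ 1- 6 X ⊛ 𝐔 (suc k) ⊕ 𝐆 (suc k) ≋ s ⊛ (s ⊛ (𝐖 k ⊕ S.ι 6 ⊛ (h ⋆ (U⁺ ⋆ U⁺)) k))
    linear k = S.trans (S.+ʳ (S.*ʳ {𝐔 (suc k)} (S.refl {1- 2 X ⊛ 1- 6 X}) ⟫ S.sym (SS.at (P.*ʳ {U⁺} (P.sym (C-⊛ (1- 2 X) (1- 6 X) ⋙ P.*-cong (C-1-aX 2) (C-1-aX 6)))) k ⟫ SS.at (SS.C⊛ (1- 2 X ⊛ 1- 6 X) U⁺) k)))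
        (SS.at main k ⟫ SS.at (SS.C⊛ s _) k ⟫ S.*ˡ {s} (SS.at (SS.C⊛ s _) k ⟫ S.*ˡ {s} (S.+ˡ (P-ι⊛ 6 (h ⋆ (U⁺ ⋆ U⁺)) k))))
      where
      R₀ : ℕ → Ser
      R₀ = 𝐖 ✚ P.ι 6 ⋆ (h ⋆ (U⁺ ⋆ U⁺))
      main : 1- 2 x ⋆ 1- 6 x ⋆ U⁺ ✚ G⁺ SS.≋ σ ⋆ (σ ⋆ R₀)
      main = SS.X-cancel (P.≈-from-- (P.solve 7 (λ x q h u c w s → h P.:* ((P.:1 P.:- P.:2 P.:* x) P.:* (P.:1 P.:- P.con (+ 6) P.:* x) P.:* u P.:+ c) P.:- h P.:* (s P.:* (s P.:* (w P.:+ P.con (+ 6) P.:* (h P.:* (u P.:* u)))))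
          P.:= (q P.:* q P.:+ h P.:* u P.:+ ((P.:1 P.:- P.:4 P.:* x) P.:* (q P.:* q) P.:+ h P.:* c) P.:- (s P.:* (s P.:* (h P.:* w P.:+ P.con (+ 6) P.:* ((q P.:* q P.:+ h P.:* u) P.:* (q P.:* q P.:+ h P.:* u))) P.:+ P.con (+ 8) P.:* (q P.:* q P.:+ h P.:* u)) P.:+ P.:2))
            P.:+ (s P.:* q P.:- x) P.:* (P.con (+ 6) P.:* (q P.:* q) P.:* (s P.:* q P.:+ x) P.:+ P.con (+ 12) P.:* (h P.:* u) P.:* (s P.:* q P.:+ x) P.:+ P.con (+ 8) P.:* q)
            P.:+ P.con (+ 8) P.:* (h P.:* u) P.:* (s P.:- x P.:* (P.:1 P.:- P.:3 P.:* x))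
            P.:- ((P.:1 P.:- P.:3 P.:* x) P.:* q P.:- P.:1) P.:* (P.:2 P.:* ((P.:1 P.:- P.:3 P.:* x) P.:* q P.:+ P.:1) P.:+ P.con (+ 8) P.:* (x P.:* q))) P.refl x q̂ h U⁺ G⁺ 𝐖 σ ⋙
        P.+-zero (P.+-zero (P.+-zero (P.+ʳ (P.+-cong (P.sym U-split) (P.sym G-split) ⋙ quadratic-t ⋙ P.+ʳ (P.*ˡ {σ} (P.+-cong (P.*ˡ {σ} (P.+ˡ (P.*ˡ {P.ι 6} (P.*-cong U-split U-split)))) (P.*ˡ {P.ι 8} U-split)))) ⋙ P.-‿inverseʳ _)
            (P.*-zeroˡ (P.+ʳ σq ⋙ P.-‿inverseʳ x)))
            (P.*-zeroʳ {P.ι 8 ⋆ (h ⋆ U⁺)} (P.+ʳ (σ≋ ⋙ P.*ˡ {x} (C-1-aX 3)) ⋙ P.-‿inverseʳ _)))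
            (P.-‿cong (P.*-zeroˡ (P.+ʳ (P.*ʳ {q̂} (P.sym (C-1-aX 3)) ⋙ γq̂) ⋙ P.-‿inverseʳ SS.𝟏)) ⋙ P.-0#≈0#)))

-- The third-order operator and the recursion with the integral

module Sums (K : CommutativeRing 0ℓ 0ℓ) where

  open Kit K
  open Series K

  below : (ℕ → Carrier) → ℕ → Carrier
  below a zero = 0#
  below a (suc n) = below a n + a n

  below-head : ∀ a n → below a (suc n) ≈ a 0 + below (a ∘ suc) n
  below-head a zero = +-comm _ _
  below-head a (suc n) = +ʳ (below-head a n) » +-assoc _ _ _

  below-cong : ∀ {a b} n → (∀ k → k N.< n → a k ≈ b k) → below a n ≈ below b n
  below-cong zero E = refl
  below-cong (suc n) E = +-cong (below-cong n (λ k h → E k (NP.m≤n⇒m≤1+n h))) (E n NP.≤-refl)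

  ⊛-below : ∀ n f g → (f ⊛ g) n ≈ below (λ k → f k * g (n N.∸ k)) (suc n)
  ⊛-below zero f g = sym (+-identityˡ _)
  ⊛-below (suc n) f g = +ˡ (⊛-below n (shift f) g) » sym (below-head _ (suc n))

module Operators (K : CommutativeRing 0ℓ 0ℓ) where

  open Kit K
  open Series K
  open Substitution K
  open Rational K

  int : ℤ → Ser
  int (+ n) = S.ι n
  int -[1+ n ] = ⊖ S.ι (suc n)

  horner : List ℤ → Ser
  horner [] = 𝟎
  horner (a ∷ as) = int a ⊕ X ⊛ horner as

  D̃ : Ser → Ser
  D̃ F = (horner (+ 0 ∷ + 0 ∷ + 0 ∷ + 4 ∷ []) ⊛ pw (horner (+ 1 ∷ ℤ.- + 3 ∷ [])) 3 ⊛ pw e 3 ⊛ d (d (d F))) ⊕ (horner (+ 0 ∷ + 0 ∷ + 24 ∷ []) ⊛ pw (horner (+ 1 ∷ ℤ.- + 3 ∷ [])) 2 ⊛ horner (+ 1 ∷ ℤ.- + 9 ∷ + 27 ∷ []) ⊛ pw e 4 ⊛ d (d F))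
    ⊕ (horner (+ 0 ∷ + 9 ∷ []) ⊛ horner (+ 1 ∷ ℤ.- + 3 ∷ []) ⊛ horner (+ 3 ∷ ℤ.- + 56 ∷ + 456 ∷ ℤ.- + 1728 ∷ + 2592 ∷ []) ⊛ pw e 5 ⊛ d F)
    ⊕ S.ι 3 ⊛ F

  private
    -- `ϑ` is 2A d/dX with A = s/(1-6X), and A₁, A₂ are the first two derivatives of A. The series ε
    -- is 1 in the form (1-6X) e, used to bring terms to a common power of e.
    A A₁ A₂ ε : Ser
    A = s ⊛ e
    A₁ = 1- 6 X ⊛ e ⊕ S.ι 6 ⊛ (s ⊛ (e ⊛ e))
    A₂ = S.ι 6 ⊛ (⊖ e ⊕ S.ι 2 ⊛ (1- 6 X ⊛ (e ⊛ e)) ⊕ S.ι 12 ⊛ (s ⊛ (e ⊛ (e ⊛ e))))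
    ε = 1- 6 X ⊛ e

    ε≋𝟏 : ε ≋ 𝟏
    ε≋𝟏 = geo-inverse 6

    infix 4 _↦_
    record _↦_ (F F' : Ser) : Set where
      constructor ↦-intro
      field elim : d F ≋ F'
    open _↦_

    _⊛ᵈ_ : ∀ {F G F' G'} → F ↦ F' → G ↦ G' → F ⊛ G ↦ F' ⊛ G ⊕ F ⊛ G'
    _⊛ᵈ_ {F} {G} p r = ↦-intro (d-leibniz F G ⟫ S.+-cong (S.*ʳ {G} (elim p)) (S.*ˡ {F} (elim r)))

    _⊕ᵈ_ : ∀ {F G F' G'} → F ↦ F' → G ↦ G' → F ⊕ G ↦ F' ⊕ G'
    _⊕ᵈ_ {F} {G} p r = ↦-intro (d-⊕ F G ⟫ S.+-cong (elim p) (elim r))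

    dι : ∀ n → S.ι n ↦ 𝟎
    dι n = ↦-intro (d-cong (ιs-C n) ⟫ d-C (ι n))

    dvar : ∀ F → F ↦ d F
    dvar F = ↦-intro S.refl

    ds : s ↦ 1- 6 X
    ds = ↦-intro d-s

    de : e ↦ S.ι 6 ⊛ (e ⊛ e)
    de = ↦-intro (d-geo 6)

    ι⊛ᵈ : ∀ n {G G'} → G ↦ G' → S.ι n ⊛ G ↦ S.ι n ⊛ G'
    ι⊛ᵈ n {G} p = ↦-intro (elim (dι n ⊛ᵈ p) ⟫ S.+ʳ (S.zeroˡ G) ⟫ S.+-identityˡ _)

    dA : A ↦ A₁
    dA = ↦-intro (elim (ds ⊛ᵈ de) ⟫ S.solve 3 (λ β s e → β S.:* e S.:+ s S.:* (S.con (+ 6) S.:* (e S.:* e)) S.:= β S.:* e S.:+ S.con (+ 6) S.:* (s S.:* (e S.:* e))) S.refl (1- 6 X) s e)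

    dA₁ : A₁ ↦ A₂
    dA₁ = ↦-intro (elim ((↦-intro (d-1-aX 6) ⊛ᵈ de) ⊕ᵈ ι⊛ᵈ 6 (ds ⊛ᵈ (de ⊛ᵈ de))) ⟫
      S.solve 3 (λ x s e → let β = S.:1 S.:- S.con (+ 6) S.:* x ; e' = S.con (+ 6) S.:* (e S.:* e) in
        (S.:- S.con (+ 6)) S.:* e S.:+ β S.:* e' S.:+ S.con (+ 6) S.:* (β S.:* (e S.:* e) S.:+ s S.:* (e' S.:* e S.:+ e S.:* e'))
        S.:= S.con (+ 6) S.:* (S.:- e S.:+ S.:2 S.:* (β S.:* (e S.:* e)) S.:+ S.con (+ 12) S.:* (s S.:* (e S.:* (e S.:* e))))) S.refl X s e)

    ϑ≋ : ∀ F → ϑ F ≋ S.ι 2 ⊛ (A ⊛ d F)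
    ϑ≋ F = S.*ˡ {S.ι 2} (S.*ˡ {1- 3 X} (S.*ˡ {e} (S.sym (X⊛d F))) ⟫ S.solve 4 (λ x γ e f → γ S.:* (e S.:* (x S.:* f)) S.:= x S.:* γ S.:* e S.:* f) S.refl X (1- 3 X) e (d F))

    κ₁ κ₂ : Ser
    κ₁ = 1- 6 X ⊛ 1- 6 X ⊕ S.ι 6 ⊛ s
    κ₂ = S.ι 6 ⊛ (1- 6 X ⊛ 1- 6 X ⊕ S.ι 12 ⊛ s)

    pad : ∀ F → F ≋ ε ⊛ F
    pad F = S.sym (S.*-identityˡ F) ⟫ S.*ʳ {F} (S.sym ε≋𝟏)

    A₁≋ : A₁ ≋ e ⊛ (e ⊛ κ₁)
    A₁≋ = S.+ʳ (pad ε) ⟫ S.solve 3 (λ β s e → β S.:* e S.:* (β S.:* e) S.:+ S.con (+ 6) S.:* (s S.:* (e S.:* e)) S.:= e S.:* (e S.:* (β S.:* β S.:+ S.con (+ 6) S.:* s))) S.refl (1- 6 X) s e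

    A₂≋ : A₂ ≋ e ⊛ (e ⊛ (e ⊛ κ₂))
    A₂≋ = S.*ˡ {S.ι 6} (S.+ʳ (S.+-cong (S.-‿cong (pad e ⟫ S.*ˡ {ε} (pad e))) (S.*ˡ {S.ι 2} (pad (1- 6 X ⊛ (e ⊛ e)))))) ⟫
      S.solve 3 (λ β s e → S.con (+ 6) S.:* (S.:- (β S.:* e S.:* (β S.:* e S.:* e)) S.:+ S.:2 S.:* (β S.:* e S.:* (β S.:* (e S.:* e))) S.:+ S.con (+ 12) S.:* (s S.:* (e S.:* (e S.:* e))))
        S.:= e S.:* (e S.:* (e S.:* (S.con (+ 6) S.:* (β S.:* β S.:+ S.con (+ 12) S.:* s))))) S.refl (1- 6 X) s e

  -- D̃ = (1 + ϑ)(2 + ϑ)(3 + ϑ)/2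
  D̃-factors : ∀ {F u v w} → u ≋ F ⊕ ϑ F → v ≋ S.ι 2 ⊛ u ⊕ ϑ u → w ≋ S.ι 3 ⊛ v ⊕ ϑ v → w ≋ S.ι 2 ⊛ D̃ F
  D̃-factors {F} {u} {v} {w} Eu Ev Ew = S.trans (expand 3 Ew Ev' dv) (S.solve 7 (λ a b c f p r t → S.:3 S.:* (S.:2 S.:* f S.:+ (S.con (+ 6) S.:* a S.:+ S.:4 S.:* (a S.:* b)) S.:* p S.:+ S.:4 S.:* (a S.:* a) S.:* r)
        S.:+ S.:2 S.:* (a S.:* (S.:2 S.:* p S.:+ ((S.con (+ 6) S.:* b S.:+ S.:4 S.:* (b S.:* b S.:+ a S.:* c)) S.:* p S.:+ (S.con (+ 6) S.:* a S.:+ S.:4 S.:* (a S.:* b)) S.:* r) S.:+ (S.:4 S.:* (b S.:* a S.:+ a S.:* b) S.:* r S.:+ S.:4 S.:* (a S.:* a) S.:* t)))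
        S.:= S.:2 S.:* (S.:4 S.:* (a S.:* (a S.:* a)) S.:* t S.:+ S.con (+ 12) S.:* (a S.:* a S.:+ a S.:* a S.:* b) S.:* r
          S.:+ (S.con (+ 11) S.:* a S.:+ S.con (+ 12) S.:* (a S.:* b) S.:+ S.:4 S.:* (a S.:* (b S.:* b)) S.:+ S.:4 S.:* (a S.:* (a S.:* c))) S.:* p S.:+ S.:3 S.:* f)) S.refl A A₁ A₂ F (d F) (d (d F)) (d (d (d F))) ⟫
      S.*ˡ {S.ι 2} (S.+ʳ (S.+-cong (S.+-cong (S.*ʳ {d (d (d F))} c₃) (S.*ʳ {d (d F)} c₂)) (S.*ʳ {d F} c₁))))
    where
    u' = F ⊕ S.ι 2 ⊛ (A ⊛ d F)
    v' = S.ι 2 ⊛ F ⊕ (S.ι 6 ⊛ A ⊕ S.ι 4 ⊛ (A ⊛ A₁)) ⊛ d F ⊕ S.ι 4 ⊛ (A ⊛ A) ⊛ d (d F)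
    Eu' : u ≋ u'
    Eu' = Eu ⟫ S.+ˡ (ϑ≋ F)
    expand : ∀ m {F G F' dF'} → G ≋ S.ι m ⊛ F ⊕ ϑ F → F ≋ F' → F' ↦ dF' → G ≋ S.ι m ⊛ F' ⊕ S.ι 2 ⊛ (A ⊛ dF')
    expand m {F} E p r = E ⟫ S.+-cong (S.*ˡ {S.ι m} p) (ϑ≋ F ⟫ S.*ˡ {S.ι 2} (S.*ˡ {A} (d-cong p ⟫ elim r)))
    Ev' : v ≋ v'
    Ev' = expand 2 Ev Eu' (dvar F ⊕ᵈ ι⊛ᵈ 2 (dA ⊛ᵈ dvar (d F))) ⟫ S.solve 5 (λ a b f p r → S.:2 S.:* (f S.:+ S.:2 S.:* (a S.:* p)) S.:+ S.:2 S.:* (a S.:* (p S.:+ S.:2 S.:* (b S.:* p S.:+ a S.:* r)))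
        S.:= S.:2 S.:* f S.:+ (S.con (+ 6) S.:* a S.:+ S.:4 S.:* (a S.:* b)) S.:* p S.:+ S.:4 S.:* (a S.:* a) S.:* r) S.refl A A₁ F (d F) (d (d F))
    dv : v' ↦ S.ι 2 ⊛ d F ⊕ ((S.ι 6 ⊛ A₁ ⊕ S.ι 4 ⊛ (A₁ ⊛ A₁ ⊕ A ⊛ A₂)) ⊛ d F ⊕ (S.ι 6 ⊛ A ⊕ S.ι 4 ⊛ (A ⊛ A₁)) ⊛ d (d F)) ⊕ (S.ι 4 ⊛ (A₁ ⊛ A ⊕ A ⊛ A₁) ⊛ d (d F) ⊕ S.ι 4 ⊛ (A ⊛ A) ⊛ d (d (d F)))
    dv = (ι⊛ᵈ 2 (dvar F) ⊕ᵈ ((ι⊛ᵈ 6 dA ⊕ᵈ ι⊛ᵈ 4 (dA ⊛ᵈ dA₁)) ⊛ᵈ dvar (d F))) ⊕ᵈ (ι⊛ᵈ 4 (dA ⊛ᵈ dA) ⊛ᵈ dvar (d (d F)))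
    c₃ : S.ι 4 ⊛ (A ⊛ (A ⊛ A)) ≋ horner (+ 0 ∷ + 0 ∷ + 0 ∷ + 4 ∷ []) ⊛ pw (horner (+ 1 ∷ ℤ.- + 3 ∷ [])) 3 ⊛ pw e 3
    c₃ = S.solve 2 (λ x e → let γ = S.:1 S.:+ x S.:* (S.con (ℤ.- + 3) S.:+ x S.:* S.con (+ 0)) ; a = x S.:* (S.:1 S.:- S.:3 S.:* x) S.:* e in
      S.:4 S.:* (a S.:* (a S.:* a)) S.:= (S.con (+ 0) S.:+ x S.:* (S.con (+ 0) S.:+ x S.:* (S.con (+ 0) S.:+ x S.:* (S.:4 S.:+ x S.:* S.con (+ 0))))) S.:* (γ S.:* (γ S.:* (γ S.:* S.:1))) S.:* (e S.:* (e S.:* (e S.:* S.:1)))) S.refl X e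
    c₂ : S.ι 12 ⊛ (A ⊛ A ⊕ A ⊛ A ⊛ A₁) ≋ horner (+ 0 ∷ + 0 ∷ + 24 ∷ []) ⊛ pw (horner (+ 1 ∷ ℤ.- + 3 ∷ [])) 2 ⊛ horner (+ 1 ∷ ℤ.- + 9 ∷ + 27 ∷ []) ⊛ pw e 4
    c₂ = S.*ˡ {S.ι 12} (S.+-cong (pad (A ⊛ A) ⟫ S.*ˡ {ε} (pad (A ⊛ A))) (S.*ˡ {A ⊛ A} A₁≋)) ⟫
      S.solve 2 (λ x e → let γ = S.:1 S.:+ x S.:* (S.con (ℤ.- + 3) S.:+ x S.:* S.con (+ 0)) ; s = x S.:* (S.:1 S.:- S.:3 S.:* x) ; β = S.:1 S.:- S.con (+ 6) S.:* x ; a = s S.:* e ; ε = β S.:* e in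
        S.con (+ 12) S.:* (ε S.:* (ε S.:* (a S.:* a)) S.:+ a S.:* a S.:* (e S.:* (e S.:* (β S.:* β S.:+ S.con (+ 6) S.:* s))))
        S.:= (S.con (+ 0) S.:+ x S.:* (S.con (+ 0) S.:+ x S.:* (S.con (+ 24) S.:+ x S.:* S.con (+ 0)))) S.:* (γ S.:* (γ S.:* S.:1)) S.:* (S.:1 S.:+ x S.:* (S.con (ℤ.- + 9) S.:+ x S.:* (S.con (+ 27) S.:+ x S.:* S.con (+ 0)))) S.:* (e S.:* (e S.:* (e S.:* (e S.:* S.:1))))) S.refl X e
    c₁ : S.ι 11 ⊛ A ⊕ S.ι 12 ⊛ (A ⊛ A₁) ⊕ S.ι 4 ⊛ (A ⊛ (A₁ ⊛ A₁)) ⊕ S.ι 4 ⊛ (A ⊛ (A ⊛ A₂)) ≋ horner (+ 0 ∷ + 9 ∷ []) ⊛ horner (+ 1 ∷ ℤ.- + 3 ∷ []) ⊛ horner (+ 3 ∷ ℤ.- + 56 ∷ + 456 ∷ ℤ.- + 1728 ∷ + 2592 ∷ []) ⊛ pw e 5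
    c₁ = S.+-cong (S.+-cong (S.+-cong (S.*ˡ {S.ι 11} (pad A ⟫ S.*ˡ {ε} (pad A ⟫ S.*ˡ {ε} (pad A ⟫ S.*ˡ {ε} (pad A))))) (S.*ˡ {S.ι 12} (S.*ˡ {A} (A₁≋ ⟫ pad _ ⟫ S.*ˡ {ε} (pad _))))) (S.*ˡ {S.ι 4} (S.*ˡ {A} (S.*-cong A₁≋ A₁≋))))
          (S.*ˡ {S.ι 4} (S.*ˡ {A} (S.*ˡ {A} A₂≋))) ⟫
      S.solve 2 (λ x e → let γ = S.:1 S.:+ x S.:* (S.con (ℤ.- + 3) S.:+ x S.:* S.con (+ 0)) ; s = x S.:* (S.:1 S.:- S.:3 S.:* x) ; β = S.:1 S.:- S.con (+ 6) S.:* x ; a = s S.:* e ; ε = β S.:* e ; k = β S.:* β S.:+ S.con (+ 6) S.:* s ; l = e S.:* (e S.:* k) in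
        S.con (+ 11) S.:* (ε S.:* (ε S.:* (ε S.:* (ε S.:* a)))) S.:+ S.con (+ 12) S.:* (a S.:* (ε S.:* (ε S.:* l))) S.:+ S.:4 S.:* (a S.:* (l S.:* l))
          S.:+ S.:4 S.:* (a S.:* (a S.:* (e S.:* (e S.:* (e S.:* (S.con (+ 6) S.:* (β S.:* β S.:+ S.con (+ 12) S.:* s)))))))
        S.:= (S.con (+ 0) S.:+ x S.:* (S.con (+ 9) S.:+ x S.:* S.con (+ 0))) S.:* γ S.:* (S.:3 S.:+ x S.:* (S.con (ℤ.- + 56) S.:+ x S.:* (S.con (+ 456) S.:+ x S.:* (S.con (ℤ.- + 1728) S.:+ x S.:* (S.con (+ 2592) S.:+ x S.:* S.con (+ 0))))))
          S.:* (e S.:* (e S.:* (e S.:* (e S.:* (e S.:* S.:1)))))) S.refl X e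

module GenusIntegral (K : CommutativeRing 0ℓ 0ℓ) (inv : ℕ → CommutativeRing.Carrier K) (inv-l : ∀ n → CommutativeRing._≈_ K (CommutativeRing._*_ K (Kit.ι K (suc n)) (inv n)) (CommutativeRing.1# K)) where

  open Kit K
  open Series K
  open Substitution K
  open Rational K
  open GenusSeries K inv inv-l
  open FixedGenus K inv inv-l using (q)
  open Operators K

  -- 1/(1-3t)² is an integrating factor of `linear`: it turns the left side into twice the
  -- derivative of t(1-2t) c/(1-3t). This explains the prefactor of the integral.
  potential : Ser → Ser
  potential c = X ⊛ (1- 2 X ⊛ (q ⊛ c))

  d-potential : ∀ {c u w D Σ} → u ≋ c ⊕ ϑ c → w ≋ S.ι 2 ⊛ D → 1- 2 X ⊛ 1- 6 X ⊛ u ⊕ c ≋ s ⊛ (s ⊛ (w ⊕ S.ι 6 ⊛ Σ)) → d (potential c) ≋ X ⊛ (X ⊛ (D ⊕ S.ι 3 ⊛ Σ))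
  d-potential {c} {u} {w} {D} {Σ} Eu Ew E = S-regular 1 (S.*ˡ {S.ι 2} derivative ⟫ S.sym (S.≈-from-- (
      S.solve 8 (λ x q e c p D Σ t → let α = S.:1 S.:- S.:2 S.:* x ; β = S.:1 S.:- S.con (+ 6) S.:* x ; γ = S.:1 S.:- S.:3 S.:* x in
        q S.:* q S.:* (α S.:* β S.:* (c S.:+ S.:2 S.:* (γ S.:* (e S.:* (x S.:* p)))) S.:+ c) S.:- S.:2 S.:* (S.:1 S.:* (α S.:* (q S.:* c)) S.:+ x S.:* ((S.:- S.:2) S.:* (q S.:* c) S.:+ α S.:* (S.:3 S.:* (q S.:* q) S.:* c S.:+ q S.:* p)))
        S.:= (γ S.:* q S.:- S.:1) S.:* (S.:2 S.:* (q S.:* c) S.:* (S.:1 S.:- S.:4 S.:* x) S.:+ S.:2 S.:* (α S.:* (x S.:* (q S.:* p))))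
          S.:+ (β S.:* e S.:- S.:1) S.:* (S.:2 S.:* (α S.:* (x S.:* (q S.:* p))) S.:* (γ S.:* q))) S.refl X q e c (d c) D Σ s ⟫
      S.+-zero (S.*-zeroˡ (S.+ʳ (geo-inverse 3) ⟫ S.-‿inverseʳ 𝟏)) (S.*-zeroˡ (S.+ʳ (geo-inverse 6) ⟫ S.-‿inverseʳ 𝟏)))) ⟫
    S.*ˡ {q ⊛ q} (S.+ʳ (S.*ˡ {1- 2 X ⊛ 1- 6 X} (S.sym Eu')) ⟫ E ⟫ S.*ˡ {s} (S.*ˡ {s} (S.+ʳ Ew))) ⟫
    S.solve 5 (λ x g q D Σ → q S.:* q S.:* (x S.:* g S.:* (x S.:* g S.:* (S.:2 S.:* D S.:+ S.con (+ 6) S.:* Σ))) S.:= g S.:* q S.:* (g S.:* q S.:* (S.:2 S.:* (x S.:* (x S.:* (D S.:+ S.:3 S.:* Σ)))))) S.refl X (1- 3 X) q D Σ ⟫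
      S.*ʳ {1- 3 X ⊛ q ⊛ Z} (geo-inverse 3) ⟫ S.*-identityˡ (1- 3 X ⊛ q ⊛ Z) ⟫ S.*ʳ {Z} (geo-inverse 3) ⟫ S.*-identityˡ Z)
    where
    Z = S.ι 2 ⊛ (X ⊛ (X ⊛ (D ⊕ S.ι 3 ⊛ Σ)))
    Eu' : u ≋ c ⊕ S.ι 2 ⊛ (1- 3 X ⊛ (e ⊛ (X ⊛ d c)))
    Eu' = Eu ⟫ S.+ˡ (S.*ˡ {S.ι 2} (S.*ˡ {1- 3 X} (S.*ˡ {e} (S.sym (X⊛d c)))))
    derivative : d (potential c) ≋ 𝟏 ⊛ (1- 2 X ⊛ (q ⊛ c)) ⊕ X ⊛ ((⊖ S.ι 2) ⊛ (q ⊛ c) ⊕ 1- 2 X ⊛ (S.ι 3 ⊛ (q ⊛ q) ⊛ c ⊕ q ⊛ d c))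
    derivative = d-leibniz X (1- 2 X ⊛ (q ⊛ c)) ⟫ S.+-cong (S.*ʳ {1- 2 X ⊛ (q ⊛ c)} d-X) (S.*ˡ {X} (d-leibniz (1- 2 X) (q ⊛ c) ⟫ S.+-cong (S.*ʳ {q ⊛ c} (d-1-aX 2)) (S.*ˡ {1- 2 X} (d-leibniz q c ⟫ S.+ʳ (S.*ʳ {c} (d-geo 3))))))

  -- F n/(n+1) is the coefficient of t^n in the antiderivative of F divided by t; the potential has
  -- no constant term, so none is lost.
  integrate : ∀ {F} c → d (potential c) ≋ F → c ≋ 1- 3 X ⊛ geo 2 ⊛ (λ n → F n * inv n)
  integrate {F} c E = S.sym (S.*ˡ {1- 3 X ⊛ geo 2} (mk λ n → *ʳ (sym (at E n)) » solve 3 (λ a y i → a :* y :* i := a :* i :* y) refl _ _ _ » *ʳ (inv-l n) » *-identityˡ _ » X⊛-suc (1- 2 X ⊛ (q ⊛ c)) n) ⟫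
    S.solve 5 (λ g f a q c → g S.:* f S.:* (a S.:* (q S.:* c)) S.:= g S.:* q S.:* (a S.:* f S.:* c)) S.refl (1- 3 X) (geo 2) (1- 2 X) q c ⟫ S.*-cong (geo-inverse 3) (S.*ʳ {c} (geo-inverse 2)) ⟫ S.*-identityˡ (𝟏 ⊛ c) ⟫ S.*-identityˡ c)

module Composition (K : CommutativeRing 0ℓ 0ℓ) where

  open Kit K
  open Series K
  open Substitution K
  open Rational K using (pw; 1-_X)
  open Sums K

  private
    below-0 : ∀ {a} n → (∀ k → a k ≈ 0#) → below a n ≈ 0#
    below-0 zero E = refl
    below-0 (suc n) E = +-zero (below-0 n E) (E n)

    below-linear : ∀ (x y z : ℕ → Carrier) c n → below (λ k → x k * (y k - c * z k)) n ≈ below (λ k → x k * y k) n - c * below (λ k → x k * z k) n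
    below-linear x y z c zero = solve 1 (λ c → con (+ 0) := con (+ 0) :- c :* con (+ 0)) refl c
    below-linear x y z c (suc n) = +ʳ (below-linear x y z c n) » solve 6 (λ c x y z u v → u :- c :* v :+ x :* (y :- c :* z) := u :+ x :* y :- c :* (v :+ x :* z)) refl _ _ _ _ _ _

  -- The truncation M may exceed the degree m: a step of `sub` lowers the degree by one or two, but
  -- the truncation only by one.
  below-sub : ∀ M f m → m N.≤ M → below (λ n → f n * pw s n m) (suc M) ≈ sub f m
  below-sub M f zero h = below-head _ M » +-cong (*-identityʳ _) (below-0 M (λ n → *-zeroʳ (*-zeroˡ (zeroˡ _)))) » +-identityʳ _
  below-sub (suc M) f (suc zero) (s≤s h) = below-head _ (suc M) » +-cong (zeroʳ _) (below-cong (suc M) (λ n _ → *ˡ (sym (at (s*-⊛ (pw s n)) 1))) » below-sub M (shift f) 0 h) » +-identityˡ _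
  below-sub (suc M) f (suc (suc m)) (s≤s h) = below-head _ (suc M) » +-cong (zeroʳ _) (below-cong (suc M) (λ n _ → *ˡ (sym (at (s*-⊛ (pw s n)) (suc (suc m))))) » below-linear (f ∘ suc) (λ n → pw s n (suc m)) (λ n → pw s n m) (ι 3) (suc M) »
      +-cong (below-sub M (shift f) (suc m) h) (-‿cong (*ˡ (below-sub M (shift f) m (NP.≤-trans (NP.n≤1+n m) h))))) » +-identityˡ _

  pw-inverse : ∀ a n → pw (1- a X) n ⊛ pw (geo a) n ≋ 𝟏
  pw-inverse a zero = S.*-identityˡ 𝟏
  pw-inverse a (suc n) = S.solve 4 (λ m p g r → m S.:* p S.:* (g S.:* r) S.:= m S.:* g S.:* (p S.:* r)) S.refl (1- a X) (pw (1- a X) n) (geo a) (pw (geo a) n) ⟫ S.*-cong (geo-inverse a) (pw-inverse a n) ⟫ S.*-identityˡ 𝟏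

  pw-head : ∀ a n → pw (1- a X) n 0 ≈ 1#
  pw-head a zero = refl
  pw-head a (suc n) = *-cong (+ˡ (-‿cong (at (ιs⊛ a X) 0 » zeroʳ _) » -0#≈0#) » +-identityʳ _) (pw-head a n) » *-identityˡ _

-- Translation into the series of the statement

module Assembly where

  open Counting
  open Kit ℚring
  open Series ℚring
  open Substitution ℚring
  open Rational ℚring
  open Sums ℚring
  open Composition ℚring
  open Operators ℚring
  open GenusSeries ℚring inv inv-l using (S-regular; h)
  open FixedGenus ℚring inv inv-l using (q; module Fixed)
  open GenusIntegral ℚring inv inv-l
  open Fixed ĉ count-0 count-recursion₁ count-recursion

  sumBelow≡ : ∀ a n → Defs.sumBelow a n ≡ below a n
  sumBelow≡ a zero = E.refl
  sumBelow≡ a (suc n) = cong (λ x → x + a n) (sumBelow≡ a n)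

  infixl 7 _⟦⊛⟧_
  infixl 6 _⟦⊕⟧_

  _⟦⊛⟧_ : ∀ {f g F G} → f ≋ F → g ≋ G → (f Defs.⊛ g) ≋ F ⊛ G
  _⟦⊛⟧_ {f} {g} p r = mk (λ n → sumBelow≡ (λ k → f k * g (n N.∸ k)) (suc n) » sym (⊛-below n f g)) ⟫ S.*-cong p r

  _⟦⊕⟧_ : ∀ {f g F G} → f ≋ F → g ≋ G → (f Defs.⊕ g) ≋ F ⊕ G
  p ⟦⊕⟧ r = mk (λ n → +-cong (at p n) (at r n))

  ⟦3·⟧ : ∀ {f F} → f ≋ F → ((+ 3 / 1) Defs.· f) ≋ S.ι 3 ⊛ F
  ⟦3·⟧ {f} {F} p = mk (λ n → *ˡ {+ 3 / 1} (at p n)) ⟫ S.sym (ιs⊛ 3 F)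

  ⟦const⟧ : Defs.const 1ℚ ≋ 𝟏
  ⟦const⟧ = mk λ { zero → refl ; (suc n) → refl }

  ⟦pow⟧ : ∀ {f F} k → f ≋ F → Defs.pow f k ≋ pw F k
  ⟦pow⟧ zero p = ⟦const⟧
  ⟦pow⟧ (suc k) p = p ⟦⊛⟧ ⟦pow⟧ k p

  int-C : ∀ a → int a ≋ C (a / 1)
  int-C (+ n) = ιs-C n ⟫ (mk λ { zero → ι≡/ n ; (suc k) → refl })
  int-C -[1+ n ] = S.-‿cong (ιs-C (suc n)) ⟫ (mk λ { zero → cong ℚ.-_ (ι≡/ (suc n)) ; (suc k) → refl })

  ⟦poly⟧ : ∀ as → Defs.poly as ≋ horner as
  ⟦poly⟧ [] = mk (λ n → refl)
  ⟦poly⟧ (a ∷ as) = mk λ { zero → sym (+-cong (at (int-C a) 0) (X⊛-zero (horner as)) » +-identityʳ _) ; (suc n) → sym (+-cong (at (int-C a) (suc n)) (X⊛-suc (horner as) n) » +-identityˡ _ » sym (at (⟦poly⟧ as) n)) }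

  ⟦geom⟧ : ∀ a → Defs.geom a ≋ geo a
  ⟦geom⟧ a = mk (λ n → sym (ι≡/ (a N.^ n)))

  ⟦deriv⟧ : ∀ {f F} → f ≋ F → Defs.deriv f ≋ d F
  ⟦deriv⟧ p = mk (λ n → *-cong (sym (ι≡/ (suc n))) (at p (suc n)))

  ⟦Ct⟧ : ∀ g → Defs.Ct g ≋ 𝐆 g
  ⟦Ct⟧ g = mk (λ m → sumBelow≡ (λ n → Defs.c̃ g n * Defs.pow t n m) (suc m) » below-cong (suc m) (λ n _ → *ˡ {Defs.c̃ g n} (at (⟦pow⟧ n ⟦t⟧) m)) » below-sub m (Defs.c̃ g) m NP.≤-refl)
    where
    t = Defs.poly (+ 0 ∷ + 1 ∷ ℤ.- + 3 ∷ [])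
    ⟦t⟧ : t ≋ s
    ⟦t⟧ = ⟦poly⟧ (+ 0 ∷ + 1 ∷ ℤ.- + 3 ∷ []) ⟫ S.solve 1 (λ x → S.con (+ 0) S.:+ x S.:* (S.:1 S.:+ x S.:* (S.:- S.:3 S.:+ x S.:* S.con (+ 0))) S.:= x S.:* (S.:1 S.:- S.:3 S.:* x)) S.refl X

  ⟦D̃⟧ : ∀ {f F} → f ≋ F → Defs.D̃ f ≋ D̃ F
  ⟦D̃⟧ p = (⟦poly⟧ (+ 0 ∷ + 0 ∷ + 0 ∷ + 4 ∷ []) ⟦⊛⟧ ⟦pow⟧ 3 γ ⟦⊛⟧ ⟦pow⟧ 3 (⟦geom⟧ 6) ⟦⊛⟧ ⟦deriv⟧ (⟦deriv⟧ (⟦deriv⟧ p)))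
    ⟦⊕⟧ (⟦poly⟧ (+ 0 ∷ + 0 ∷ + 24 ∷ []) ⟦⊛⟧ ⟦pow⟧ 2 γ ⟦⊛⟧ ⟦poly⟧ (+ 1 ∷ ℤ.- + 9 ∷ + 27 ∷ []) ⟦⊛⟧ ⟦pow⟧ 4 (⟦geom⟧ 6) ⟦⊛⟧ ⟦deriv⟧ (⟦deriv⟧ p))
    ⟦⊕⟧ (⟦poly⟧ (+ 0 ∷ + 9 ∷ []) ⟦⊛⟧ γ ⟦⊛⟧ ⟦poly⟧ (+ 3 ∷ ℤ.- + 56 ∷ + 456 ∷ ℤ.- + 1728 ∷ + 2592 ∷ []) ⟦⊛⟧ ⟦pow⟧ 5 (⟦geom⟧ 6) ⟦⊛⟧ ⟦deriv⟧ p)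
    ⟦⊕⟧ ⟦3·⟧ p
    where
    γ = ⟦poly⟧ (+ 1 ∷ ℤ.- + 3 ∷ [])

  ⟦Ã⟧ : ∀ i → Defs.Ã i ≋ 𝐔 i
  ⟦Ã⟧ i = (⟦Ct⟧ i ⟦⊕⟧ (⟦poly⟧ (+ 0 ∷ + 2 ∷ ℤ.- + 6 ∷ []) ⟦⊛⟧ ⟦geom⟧ 6 ⟦⊛⟧ ⟦deriv⟧ (⟦Ct⟧ i))) ⟫ S.+ˡ {𝐆 i} (
      S.solve 3 (λ x e f → (S.con (+ 0) S.:+ x S.:* (S.:2 S.:+ x S.:* (S.:- S.con (+ 6) S.:+ x S.:* S.con (+ 0)))) S.:* e S.:* f S.:= S.:2 S.:* ((S.:1 S.:- S.:3 S.:* x) S.:* (e S.:* (x S.:* f)))) S.refl X e (d (𝐆 i)) ⟫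
      S.*ˡ {S.ι 2} (S.*ˡ {1- 3 X} (S.*ˡ {e} (X⊛d (𝐆 i))))) ⟫ S.sym (𝐔-step i)

  -- Summands i from 1 to k become a convolution of the series without their genus-0 terms, of index
  -- k - 1, and the factor `h` accounts for that shift.
  ⟦quadSum⟧ : ∀ k → Defs.quadSum (suc k) k ≋ (h ⋆ (U⁺ ⋆ U⁺)) k
  ⟦quadSum⟧ zero = mk (λ { zero → refl ; (suc n) → refl }) ⟫ S.sym (SS.X⊛-zero (U⁺ ⋆ U⁺))
  ⟦quadSum⟧ (suc j) = S.trans (partial (suc j) NP.≤-refl ⟫ S.sym (Sums.⊛-below seriesRing j U⁺ U⁺)) (S.sym (SS.X⊛-suc (U⁺ ⋆ U⁺) j))
    where
    partial : ∀ m → m N.≤ suc j → Defs.quadSum (suc (suc j)) m ≋ Sums.below seriesRing (λ a → U⁺ a ⊛ U⁺ (j N.∸ a)) m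
    partial zero _ = mk (λ { zero → refl ; (suc n) → refl })
    partial (suc m) (s≤s i) = partial m (NP.m≤n⇒m≤1+n i) ⟦⊕⟧ (⟦Ã⟧ (suc m) ⟦⊛⟧ S.trans (⟦Ã⟧ (suc j N.∸ m)) (S.reflexive (cong 𝐔 (NP.+-∸-assoc 1 i))))

  recursive : ∀ k → Defs.Ct (suc k) ≋ Defs.recursionRHS (suc k)
  recursive k = S.trans (⟦Ct⟧ (suc k)) (integrate (𝐆 (suc k)) (d-potential (𝐔-step (suc k)) (D̃-factors (𝐔-step k) (𝐕-step k) (𝐖-step k)) (linear k)) ⟫ S.sym ((⟦poly⟧ (+ 1 ∷ ℤ.- + 3 ∷ []) ⟦⊛⟧ ⟦geom⟧ 2 ⟦⊛⟧ mk (λ n → *ʳ {inv n} (at integrand n))) ⟫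
        S.*ʳ {λ n → F n * inv n} (S.*ʳ {geo 2} (S.solve 1 (λ x → S.:1 S.:+ x S.:* (S.:- S.:3 S.:+ x S.:* S.con (+ 0)) S.:= S.:1 S.:- S.:3 S.:* x) S.refl X))))
    where
    F : Ser
    F = X ⊛ (X ⊛ (D̃ (𝐆 k) ⊕ S.ι 3 ⊛ (h ⋆ (U⁺ ⋆ U⁺)) k))
    integrand : Defs.poly (+ 0 ∷ + 0 ∷ + 1 ∷ []) Defs.⊛ (Defs.D̃ (Defs.Ct k) Defs.⊕ ((+ 3 / 1) Defs.· Defs.quadSum (suc k) k)) ≋ F
    integrand = (⟦poly⟧ (+ 0 ∷ + 0 ∷ + 1 ∷ []) ⟦⊛⟧ (⟦D̃⟧ (⟦Ct⟧ k) ⟦⊕⟧ ⟦3·⟧ (⟦quadSum⟧ k))) ⟫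
      S.solve 2 (λ x y → (S.con (+ 0) S.:+ x S.:* (S.con (+ 0) S.:+ x S.:* (S.:1 S.:+ x S.:* S.con (+ 0)))) S.:* y S.:= x S.:* (x S.:* y)) S.refl X (D̃ (𝐆 k) ⊕ S.ι 3 ⊛ (h ⋆ (U⁺ ⋆ U⁺)) k)

  genus-0 : Defs.Ct 0 ≋ Defs.poly (+ 1 ∷ ℤ.- + 4 ∷ []) Defs.⊛ Defs.pow (Defs.geom 3) 2
  genus-0 = ⟦Ct⟧ 0 ⟫ 𝐆-0 ⟫ S.sym ((⟦poly⟧ (+ 1 ∷ ℤ.- + 4 ∷ []) ⟦⊛⟧ ⟦pow⟧ 2 (⟦geom⟧ 3)) ⟫ S.solve 2 (λ x q → (S.:1 S.:+ x S.:* (S.:- S.:4 S.:+ x S.:* S.con (+ 0))) S.:* (q S.:* (q S.:* S.:1)) S.:= (S.:1 S.:- S.:4 S.:* x) S.:* (q S.:* q)) S.refl X q)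

  genus-1 : Defs.Ct 1 ≋ Defs.poly (+ 0 ∷ + 0 ∷ + 1 ∷ []) Defs.⊛ Defs.geom 2 Defs.⊛ Defs.pow (Defs.geom 6) 2
  genus-1 = ⟦Ct⟧ 1 ⟫ 𝐆-1 ⟫ S.sym ((⟦poly⟧ (+ 0 ∷ + 0 ∷ + 1 ∷ []) ⟦⊛⟧ ⟦geom⟧ 2 ⟦⊛⟧ ⟦pow⟧ 2 (⟦geom⟧ 6)) ⟫
    S.solve 3 (λ x f e → (S.con (+ 0) S.:+ x S.:* (S.con (+ 0) S.:+ x S.:* (S.:1 S.:+ x S.:* S.con (+ 0)))) S.:* f S.:* (e S.:* (e S.:* S.:1)) S.:= x S.:* (x S.:* (f S.:* (e S.:* (e S.:* S.:1))))) S.refl X f e)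

  twice : ∀ n → 2 N.* n ≡ dbl n
  twice zero = E.refl
  twice (suc n) = cong suc (NP.+-suc n (n N.+ 0) ∙ cong suc (twice n))

  dbl-self : ∀ n → dbl n ≡ n N.+ n
  dbl-self n = E.sym (twice n) ∙ cong (n N.+_) (NP.+-identityʳ n)

  odd-!! : ∀ n → suc (dbl n) Defs.!! ≡ oddfact (suc n)
  odd-!! zero = E.refl
  odd-!! (suc n) = cong (suc (dbl (suc n)) N.*_) (odd-!! n)

  leading-!! : ∀ k → (4 N.* suc k N.∸ 1) Defs.!! ≡ oddfact (dbl (suc k))
  leading-!! k = E.trans (cong (λ n → (n N.∸ 1) Defs.!!) (NP.*-comm 4 (suc k) ∙ cong (4 N.+_) (four k))) (odd-!! (suc (dbl k)))
    where
    four : ∀ k → k N.* 4 ≡ dbl (dbl k)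
    four zero = E.refl
    four (suc k) = cong (4 N.+_) (four k)

  lead : ∀ n (U F : Ser) → U 0 ≡ 1# → Low n F → (U ⊛ F) n ≡ F n
  lead n U F E l = ⊛-lead n U F l » *ʳ {F n} E » *-identityˡ (F n)

  /-unique : ∀ b D m → ι (suc m) * b ≡ ι D → b ≡ + D / suc m
  /-unique b D m E = trans (unit b) (*ˡ {inv m} (E » sym (ι*/ D m)) » sym (unit (+ D / suc m)))
    where
    unit : ∀ y → y ≡ inv m * (ι (suc m) * y)
    unit y = sym (*-identityˡ y) » *ʳ {y} (sym (inv-l m) » *-comm (ι (suc m)) (inv m)) » *-assoc (inv m) (ι (suc m)) y

  low : ∀ g → Low (dbl g) (Defs.c̃ g)
  low g n h = count-vanish n g (NP.<-≤-trans h (NP.≤-reflexive (dbl-self g)))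

  -- The cleared denominators have constant term 1 and s = t - 3t², so the lowest coefficient of the
  -- numerator is the number of rooted maps with 2g edges itself.
  numerator-lead : ∀ g (P units : Ser) → units 0 ≡ 1# → P ≋ units ⊛ sub (Defs.c̃ g) → (4 N.* g N.∸ 1) Defs.!! ≡ oddfact (dbl g) → P (2 N.* g) ≡ + ((4 N.* g N.∸ 1) Defs.!!) / suc (2 N.* g)
  numerator-lead g P units head P≋ E = cong P (twice g) ∙ at P≋ (dbl g) ∙ lead (dbl g) units (sub (Defs.c̃ g)) head (sub-low (dbl g) (Defs.c̃ g) (low g)) ∙
    sub-lead (dbl g) (Defs.c̃ g) (low g) ∙ /-unique (ĉ (dbl g) g) (oddfact (dbl g)) (dbl g) (count-leading g) ∙ E.sym (cong₂ (λ x n → + x / suc n) E (twice g))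

  module Numerator (k : ℕ) where
    g = suc k
    r = rational k
    P = num r

    P≋ : P ≋ pw (1- 2 X) (1 N.+ k N.* 3) ⊛ pw (1- 6 X) (2 N.+ k N.* 5) ⊛ 𝐆 g
    P≋ = S.sym (S.*ˡ {pw (1- 2 X) a ⊛ pw (1- 6 X) b} (value r) ⟫ S.solve 5 (λ m n p f e → m S.:* n S.:* (p S.:* (f S.:* e)) S.:= m S.:* f S.:* (n S.:* e) S.:* p) S.refl (pw (1- 2 X) a) (pw (1- 6 X) b) P (pw f a) (pw e b) ⟫
      S.*ʳ {P} (S.*-cong (pw-inverse 2 a) (pw-inverse 6 b)) ⟫ S.*ʳ {P} (S.*-identityˡ 𝟏) ⟫ S.*-identityˡ P)
      where
      a = 1 N.+ k N.* 3
      b = 2 N.+ k N.* 5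

    low-coefficients : ∀ i → i N.< 2 N.* g → P i ≡ 0ℚ
    low-coefficients i h = at P≋ i » Low-⊛ʳ (dbl g) _ (𝐆 g) (sub-low (dbl g) (Defs.c̃ g) (low g)) i (NP.<-≤-trans h (NP.≤-reflexive (twice g)))

    high-coefficients : ∀ i → 8 N.* g N.∸ 6 N.< i → P i ≡ 0ℚ
    high-coefficients i h = trans (reflexive (cong P (E.sym (NP.m+[n∸m]≡n bound)))) (Poly-beyond (3 N.+ k N.* 8) P (deg r) (i N.∸ (3 N.+ k N.* 8)))
      where
      -- For g = k + 1 the bound 8g - 6 computes to 2 + 8k, the degree in `rational`.
      bound : 3 N.+ k N.* 8 N.≤ i
      bound = subst (λ n → suc (n N.∸ 6) N.≤ i) (NP.*-comm 8 g) h

    leading-coefficient : P (2 N.* g) ≡ + ((4 N.* g N.∸ 1) Defs.!!) / suc (2 N.* g)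
    leading-coefficient = numerator-lead g P (pw (1- 2 X) (1 N.+ k N.* 3) ⊛ pw (1- 6 X) (2 N.+ k N.* 5)) head P≋ (leading-!! k)
      where
      head : pw (1- 2 X) (1 N.+ k N.* 3) 0 * pw (1- 6 X) (2 N.+ k N.* 5) 0 ≡ 1#
      head = *-cong (pw-head 2 (1 N.+ k N.* 3)) (pw-head 6 (2 N.+ k N.* 5)) » *-identityˡ 1#

    fraction : Defs.Ct g ≋ P Defs.⊛ Defs.pow (Defs.geom 2) (3 N.* g N.∸ 2) Defs.⊛ Defs.pow (Defs.geom 6) (5 N.* g N.∸ 3)
    fraction = ⟦Ct⟧ g ⟫ value r ⟫ S.sym (S.*-assoc P (pw f (1 N.+ k N.* 3)) (pw e (2 N.+ k N.* 5))) ⟫ S.sym (S.refl {P} ⟦⊛⟧ S.trans (⟦pow⟧ (3 N.* g N.∸ 2) (⟦geom⟧ 2)) (S.reflexive (cong (λ n → pw f (n N.∸ 2)) (NP.*-comm 3 g)))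
        ⟦⊛⟧ S.trans (⟦pow⟧ (5 N.* g N.∸ 3) (⟦geom⟧ 6)) (S.reflexive (cong (λ n → pw e (n N.∸ 3)) (NP.*-comm 5 g))))

open import Defs
open import Data.Nat using (ℕ; suc; _≤_; _<_; _+_; _*_; _∸_)
open import Data.Integer using (+_; -_)

theorem2 : (Ct 0 ≋ poly (+ 1 ∷ - (+ 4) ∷ []) ⊛ pow (geom 3) 2)
    × (Ct 1 ≋ poly (+ 0 ∷ + 0 ∷ + 1 ∷ []) ⊛ geom 2 ⊛ pow (geom 6) 2)
    × ((g : ℕ) → 2 ≤ g →
    Σ (ℕ → ℚ) (λ P →
    ((i : ℕ) → i < 2 * g → P i ≡ 0ℚ)
    × ((i : ℕ) → 8 * g ∸ 6 < i → P i ≡ 0ℚ)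
    × (P (2 * g) ≡ + ((4 * g ∸ 1) !!) / (suc (2 * g)))
    × (Ct g ≋ P ⊛ pow (geom 2) (3 * g ∸ 2) ⊛ pow (geom 6) (5 * g ∸ 3))))
    × ((g : ℕ) → 1 ≤ g → Ct g ≋ recursionRHS g)
theorem2 = Series.at genus-0 , Series.at genus-1 ,
  (λ { (suc k) _ → Numerator.P k , Numerator.low-coefficients k , Numerator.high-coefficients k , Numerator.leading-coefficient k , Series.at (Numerator.fraction k) }) ,
  (λ { (suc k) _ → Series.at (recursive k) })
  where open Assembly
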